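{- Let $x,y,z$ be non-negative integers and $\mathbf{a}=(a_1,\dots,a_n)$ a sequence of positive integers with $y+2\operatorname{O}(\mathbf{a})\ge a_1+1$. Write $s=\mathbf{s}_n(\mathbf{a})$, $E=\operatorname{E}(\mathbf{a})$, $O=\operatorname{O}(\mathbf{a})$, and set $a_k:=0$ for $k>n$. If $y$ is odd, then \[ \operatorname{M}(\mathcal{R}'_{x,y,z}(\mathbf{a}))=\prod_{i=1}^{\frac{y-1}{2}}(2x+2i-1)_{2s+2y+2z-4i+1}\cdot\frac{1}{2^{y-1}}\frac{\operatorname{H}(s+y+z-1)\operatorname{H}_2(y)\operatorname{H}_2(2E+2z+1)\operatorname{H}_2(2O+1)\operatorname{H}_2(2s+y+2z)}{\operatorname{H}(s+z)\operatorname{H}_2(2E+y+2z)\operatorname{H}_2(2O+y)\operatorname{H}_2(2s+2y+2z-1)} \] \[ \times\operatorname{Q}'\Big(x+\tfrac{y-1}{2}+a_{2\lfloor\frac{n+1}{2}\rfloor},a_{2\lfloor\frac{n+1}{2}\rfloor-1},\dots,a_1\Big)\operatorname{Q}'\Big(x+\tfrac{y-1}{2}+a_{2\lfloor\frac{n}{2}\rfloor+1},a_{2\lfloor\frac{n}{2}\rfloor},\dots,a_1,z\Big), \] and if $y$ is even, then \[ \operatorname{M}(\mathcal{R}'_{x,y,z}(\mathbf{a}))=\prod_{i=1}^{\frac{y}{2}}(2x+2i-1)_{2s+2y+2z-4i+1}\cdot\frac{\operatorname{H}(s+y+z)\operatorname{H}_2(y)\operatorname{H}_2(2E+2z)\operatorname{H}_2(2O)\operatorname{H}_2(2s+y+2z)}{\operatorname{H}(s+z)\operatorname{H}_2(2E+y+2z)\operatorname{H}_2(2O+y)\operatorname{H}_2(2s+2y+2z)}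 \] \[ \times\operatorname{K}'\Big(x+\tfrac{y}{2}+a_{2\lfloor\frac{n+1}{2}\rfloor},a_{2\lfloor\frac{n+1}{2}\rfloor-1},\dots,a_1\Big)\operatorname{K}'\Big(x+\tfrac{y}{2}+a_{2\lfloor\frac{n}{2}\rfloor+1},a_{2\lfloor\frac{n}{2}\rfloor},\dots,a_1,z\Big). \] Empty products are $1$.
   Context: Work on the triangular lattice drawn with horizontal lattice lines; unit triangles are up- or down-pointing. A lozenge is the union of two unit triangles sharing an edge; a tiling of a region is a covering by lozenges without gaps or overlaps; for weighted lozenges, $\operatorname{M}(R)$ is the sum over all tilings of $R$ of the product of the weights of their lozenges (the number of tilings if unweighted). A vertical lozenge is the union of an up- and a down-pointing unit triangle sharing a horizontal edge. A "vertical zigzag western side with $N$ unit segments": from the north-west corner, the western boundary consists of $N$ unit segments alternately in the south-west and south-east directions, the first going south-west. "Weighting the western vertical lozenges by $\frac12$": for each $i$, the vertical lozenge formed by the leftmost unit triangle of row $2i-1$ and that of row $2i$ (rows counted from the top) gets weight $\frac12$, all other lozenges weight $1$. For a sequence $\mathbf{b}=(b_1,\dots,b_m)$: $\operatorname{E}(\mathbf{b})=\sum_{i\text{ even}}b_i$, $\operatorname{O}(\mathbf{b})=\sum_{i\text{ odd}}b_i$, $\mathbf{s}_k(\mathbf{b})=\sum_{i\le k}b_i$. $\operatorname{H}(n)=0!\,1!\cdots(n-1)!$; $\operatorname{H}_2(n)=0!\,2!\cdots(n-2)!$ for even $n$ and $1!\,3!\cdots(n-2)!$ for odd $n$ (empty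 products $=1$). Pochhammer symbol: $(u)_m=u(u+1)\cdots(u+m-1)$ for $m>0$, $(u)_0=1$, $(u)_m=1/((u-1)(u-2)\cdots(u+m))$ for $m<0$. $\mathcal{Q}(\mathbf{t})$, for $\mathbf{t}=(t_1,\dots,t_{2l})$ non-negative: region with northern side $\operatorname{O}(\mathbf{t})$, straight northeastern side $2\operatorname{E}(\mathbf{t})$, southern side $\operatorname{E}(\mathbf{t})+\operatorname{O}(\mathbf{t})$, vertical zigzag western side with $2\operatorname{E}(\mathbf{t})$ unit segments; along the southern side from left to right, leave a segment $t_1$, remove the up-pointing triangle of side $t_2$ resting on the southern side, leave $t_3$, remove an up-pointing triangle of side $t_4$, etc. $\mathcal{K}(\mathbf{t})$: same but with northeastern side $2\operatorname{E}(\mathbf{t})-1$ and zigzag western side with $2\operatorname{E}(\mathbf{t})-1$ unit segments. $\mathcal{Q}'(\mathbf{t})$, $\mathcal{K}'(\mathbf{t})$: these regions with the western vertical lozenges weighted $\frac12$; $\operatorname{Q}'(\mathbf{t})=\operatorname{M}(\mathcal{Q}'(\mathbf{t}))$, $\operatorname{K}'(\mathbf{t})=\operatorname{M}(\mathcal{K}'(\mathbf{t}))$. $\mathcal{R}_{x,y,z}(\mathbf{a})$: start from the region with northern side $x+\operatorname{E}(\mathbf{a})$, northeastern side $y+z+2\operatorname{O}(\mathbf{a})-1$, southeastern side $y+z+2\operatorname{E}(\mathbf{a})-1$, southern side $x+\operatorname{O}(\mathbf{a})$, and vertical zigzag western side with $2(y+z+\mathbf{s}_n(\mathbf{a})-1)$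 unit segments. Let $V$ be its eastern vertex, $\ell$ the horizontal lattice line $z$ units above $V$, and $P$ the point where $\ell$ meets the northeastern side. Going left from $P$ along $\ell$, mark consecutive segments of lengths $a_1,\dots,a_n$; remove the up-pointing triangle with the $i$-th segment as base for odd $i$ and the down-pointing triangle with the $i$-th segment as top side for even $i$. $\mathcal{R}'_{x,y,z}(\mathbf{a})$ is $\mathcal{R}_{x,y,z}(\mathbf{a})$ with the western vertical lozenges weighted $\frac12$. -}

module Defs where

open import Data.Bool.Base using (Bool; true; false; _∧_; _∨_; not; if_then_else_)
open import Data.Nat.Base as ℕ using (ℕ; zero; suc; _∸_; _≡ᵇ_; _/_; _%_; _!; _^_)
open import Data.Integer.Base as ℤ using (ℤ; +_; -[1+_]; ∣_∣; _≤ᵇ_)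
open import Data.Rational.Base as ℚ using (ℚ; 0ℚ; 1ℚ; ½)
open import Data.Product.Base using (_×_; _,_; proj₁; proj₂)
open import Data.List.Base using (List; []; _∷_; _++_; [_]; map; concatMap; filterᵇ; upTo; foldr; reverse; length)
open import Data.Bool.ListAction using (any)
open import Function.Base using (_∘_)

mutual
  oddSum : List ℕ → ℕ
  oddSum []       = 0
  oddSum (x ∷ xs) = x ℕ.+ evenSum xs

  evenSum : List ℕ → ℕ
  evenSum []       = 0
  evenSum (x ∷ xs) = oddSum xs

nth : List ℕ → ℕ → ℕ
nth []       _       = 0
nth (x ∷ xs) zero    = x
nth (x ∷ xs) (suc k) = nth xs k

-- a_k, 1-indexed, with the convention a_k = 0 for k > n (and for k = 0)
aAt : List ℕ → ℕ → ℕ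
aAt a zero    = 0
aAt a (suc k) = nth a k

desc : ℕ → List ℕ
desc m = reverse (map suc (upTo (m ∸ 1)))

H : ℕ → ℕ
H zero    = 1
H (suc n) = H n ℕ.* (n !)

H₂ : ℕ → ℕ
H₂ zero          = 1
H₂ (suc zero)    = 1
H₂ (suc (suc n)) = H₂ n ℕ.* (n !)

-- Pochhammer symbol (u)_m for m ≥ 0 (only non-negative m occur in the theorem)
poch : ℕ → ℕ → ℕ
poch u zero    = 1
poch u (suc m) = u ℕ.* poch (suc u) m

prod1 : ℕ → (ℕ → ℕ) → ℕ
prod1 zero    f = 1
prod1 (suc N) f = prod1 N f ℕ.* f (suc N)

-- the rational number n / d (d is always positive where used; d = 0 ↦ 0)
frac : ℕ → ℕ → ℚ
frac n zero    = 0ℚ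
frac n (suc d) = (+ n) ℚ./ suc d

toℚ : ℕ → ℚ
toℚ n = (+ n) ℚ./ 1

-- Triangular lattice, unit triangles, lozenges, tilings
-- Coordinates: horizontal lattice lines are indexed by their height b ∈ ℤ
-- (increasing northwards). A lattice point on line b has doubled
-- horizontal coordinate X ≡ b (mod 2) (unit lattice length = 2 in X).
-- The unit triangles in the strip between lines b and b+1 are indexed
-- by (k , b), k ∈ ℤ: (k , b) is up-pointing iff k + b is odd; an
-- up-pointing triangle (k , b) has base from X = k-1 to k+1 on line b
-- and apex X = k on line b+1; a down-pointing one has top side from
-- X = k-1 to k+1 on line b+1 and bottom vertex X = k on line b.

Cell : Set
Cell = ℤ × ℤ

Lozenge : Set
Lozenge = Cell × Cell

eqℤ : ℤ → ℤ → Bool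
eqℤ p q = (p ≤ᵇ q) ∧ (q ≤ᵇ p)

eqCell : Cell → Cell → Bool
eqCell (k , b) (k' , b') = eqℤ k k' ∧ eqℤ b b'

isUp : Cell → Bool
isUp (k , b) = ∣ k ℤ.+ b ∣ % 2 ≡ᵇ 1

neighbours : Cell → List Cell
neighbours (k , b) =
  (k ℤ.- + 1 , b) ∷ (k ℤ.+ + 1 , b) ∷
  (if isUp (k , b) then (k , b ℤ.- + 1) else (k , b ℤ.+ + 1)) ∷ []

member : Cell → List Cell → Bool
member c S = any (eqCell c) S

remove : Cell → List Cell → List Cell
remove c S = filterᵇ (not ∘ eqCell c) S

-- All lozenge tilings of a (duplicate-free) finite set of unit triangles:
-- the first triangle c of the list is covered by exactly one lozenge
-- {c , d} with d a neighbour of c in the region; recurse on the rest.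
-- Each tiling is produced exactly once (as a list of lozenges).
-- The first argument is fuel (the number of triangles suffices).
tilingsF : ℕ → List Cell → List (List Lozenge)
tilingsF _       []      = [] ∷ []
tilingsF zero    (_ ∷ _) = []
tilingsF (suc f) (c ∷ S) =
  concatMap (λ d → map ((c , d) ∷_) (tilingsF f (remove d S)))
            (filterᵇ (λ d → member d S) (neighbours c))

tilings : List Cell → List (List Lozenge)
tilings S = tilingsF (length S) S

sumℚ : List ℚ → ℚ
sumℚ = foldr ℚ._+_ 0ℚ

prodℚ : List ℚ → ℚ
prodℚ = foldr ℚ._*_ 1ℚ

M : (Lozenge → ℚ) → List Cell → ℚ
M w S = sumℚ (map (λ T → prodℚ (map w T)) (tilings S))

-- Regions with a vertical zigzag western side
-- A region of height h (strips 0 .. h-1, counted from the bottom) whose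
-- western side is a vertical zigzag with h unit segments starting at the
-- north-west corner going south-west: then the leftmost unit triangle of
-- every strip has the same index k = c; we take c = h (which has the
-- right parity: the top strip starts with an up-pointing triangle).
-- The strip b contains the triangles c ≤ k ≤ right b, minus the holes.

clamp : ℤ → ℕ
clamp (+ n)    = n
clamp -[1+ _ ] = 0

interval : ℤ → ℤ → List ℤ
interval lo hi = map (λ i → lo ℤ.+ + i) (upTo (clamp (hi ℤ.- lo ℤ.+ + 1)))

zigRegion : (h : ℕ) → (right : ℤ → ℤ) → (hole : Cell → Bool) → List Cell
zigRegion h right hole =
  filterᵇ (not ∘ hole)
    (concatMap (λ i → map (λ k → (k , + i)) (interval (+ h) (right (+ i)))) (upTo h))

-- Weights: the vertical lozenge formed by the leftmost triangles of rows
-- 2i-1 and 2i (rows counted from the top, i.e. strips h-2i+1 and h-2i)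
-- gets weight 1/2, for 1 ≤ i ≤ ⌊h/2⌋; all other lozenges weight 1.
westernLozenge : ℕ → ℕ → Lozenge
westernLozenge h i = ((+ h , + (h ∸ (2 ℕ.* i ∸ 1))) , (+ h , + (h ∸ 2 ℕ.* i)))

sameLozenge : Lozenge → Lozenge → Bool
sameLozenge (c , d) (c' , d') =
  (eqCell c c' ∧ eqCell d d') ∨ (eqCell c d' ∧ eqCell d c')

westernWeight : ℕ → Lozenge → ℚ
westernWeight h l =
  if any (λ i → sameLozenge l (westernLozenge h i)) (map suc (upTo (h / 2)))
  then ½ else 1ℚ

M' : ℕ → List Cell → ℚ
M' h S = M (westernWeight h) S

-- the up-pointing triangle of side a with base [q , q + 2a] on line bl
inUpTriangle : ℤ → ℕ → ℤ → Cell → Bool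
inUpTriangle q a bl (k , b) =
  (bl ≤ᵇ b) ∧ (b ℤ.+ + 1 ≤ᵇ bl ℤ.+ + a) ∧
  (q ℤ.+ + 1 ℤ.+ (b ℤ.- bl) ≤ᵇ k) ∧ (k ≤ᵇ q ℤ.+ + (2 ℕ.* a) ℤ.- + 1 ℤ.- (b ℤ.- bl))

-- the down-pointing triangle of side a with top side [q , q + 2a] on line bl
inDownTriangle : ℤ → ℕ → ℤ → Cell → Bool
inDownTriangle q a bl (k , b) =
  (b ℤ.+ + 1 ≤ᵇ bl) ∧ (bl ≤ᵇ b ℤ.+ + a) ∧
  (q ℤ.+ + 1 ℤ.+ (bl ℤ.- + 1 ℤ.- b) ≤ᵇ k) ∧
  (k ≤ᵇ q ℤ.+ + (2 ℕ.* a) ℤ.- + 1 ℤ.- (bl ℤ.- + 1 ℤ.- b))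

-- holes along the southern side (line 0), starting at X = p:
-- leave t₁, remove an up-pointing triangle of side t₂, leave t₃, ...
southHoles : ℤ → List ℕ → Cell → Bool
southHoles p []                 c = false
southHoles p (t₁ ∷ [])          c = false
southHoles p (t₁ ∷ t₂ ∷ ts)     c =
  inUpTriangle (p ℤ.+ + (2 ℕ.* t₁)) t₂ (+ 0) c ∨
  southHoles (p ℤ.+ + (2 ℕ.* (t₁ ℕ.+ t₂))) ts c

-- the region of height h (= 2E(t) for Q, 2E(t)-1 for K), northern side
-- O(t), straight northeastern side h, zigzag western side with h segments,
-- southern side E(t)+O(t) with the holes.
QKregion : ℕ → List ℕ → List Cell
QKregion h t =
  zigRegion h
    (λ b → + h ℤ.+ + (2 ℕ.* oddSum t) ℤ.+ + h ℤ.- b ℤ.- + 1)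
    (southHoles (+ (h ∸ h % 2)) t)

Q' : List ℕ → ℚ
Q' t = M' (2 ℕ.* evenSum t) (QKregion (2 ℕ.* evenSum t) t)

K' : List ℕ → ℚ
K' t = M' (2 ℕ.* evenSum t ∸ 1) (QKregion (2 ℕ.* evenSum t ∸ 1) t)

-- holes along ℓ (line bl), going left from X = XP:
-- i-th segment [XP - 2 s_i , XP - 2 s_{i-1}]; up-triangle above ℓ for odd i,
-- down-triangle below ℓ for even i.
lineHoles : ℤ → ℤ → Bool → List ℕ → Cell → Bool
lineHoles XP bl odd []       c = false
lineHoles XP bl odd (a ∷ as) c =
  (if odd then inUpTriangle (XP ℤ.- + (2 ℕ.* a)) a bl c
          else inDownTriangle (XP ℤ.- + (2 ℕ.* a)) a bl c) ∨
  lineHoles (XP ℤ.- + (2 ℕ.* a)) bl (not odd) as c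

Rheight : ℕ → ℕ → List ℕ → ℕ
Rheight y z a = 2 ℕ.* (y ℕ.+ z ℕ.+ (oddSum a ℕ.+ evenSum a) ∸ 1)

Rregion : ℕ → ℕ → ℕ → List ℕ → List Cell
Rregion x y z a = zigRegion h right (lineHoles XP bl true a)
  where
  E = evenSum a
  O = oddSum a
  h = Rheight y z a
  c : ℤ
  c = + h
  -- north-east corner and eastern vertex V (on line bV)
  cNE : ℤ
  cNE = c ℤ.+ + (2 ℕ.* x ℕ.+ 2 ℕ.* E)
  bV : ℤ
  bV = + (y ℕ.+ z ℕ.+ 2 ℕ.* E) ℤ.- + 1
  -- X-coordinate of the eastern boundary on line b
  Y : ℤ → ℤ
  Y b = if bV ≤ᵇ b then cNE ℤ.+ + h ℤ.- b
        else c ℤ.+ + (2 ℕ.* x ℕ.+ 2 ℕ.* O) ℤ.+ b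
  right : ℤ → ℤ
  right b = Y b ℤ.⊓ Y (b ℤ.+ + 1)
  -- the line ℓ, z units above V, and its intersection P with the NE side
  bl : ℤ
  bl = bV ℤ.+ + z
  XP : ℤ
  XP = cNE ℤ.+ + h ℤ.- bl

R' : ℕ → ℕ → ℕ → List ℕ → ℚ
R' x y z a = M' (Rheight y z a) (Rregion x y z a)

firstArg : ℕ → List ℕ → List ℕ
firstArg k a = (k ℕ.+ aAt a m) ∷ map (aAt a) (desc m)
  where m = 2 ℕ.* ((length a ℕ.+ 1) / 2)

secondArg : ℕ → List ℕ → ℕ → List ℕ
secondArg k a z = (k ℕ.+ aAt a m) ∷ (map (aAt a) (desc m) ++ [ z ])
  where m = 2 ℕ.* (length a / 2) ℕ.+ 1

rhsOdd : ℕ → ℕ → ℕ → List ℕ → ℚ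
rhsOdd x y z a =
  toℚ (prod1 ((y ∸ 1) / 2) (λ i → poch (2 ℕ.* x ℕ.+ 2 ℕ.* i ∸ 1) (2 ℕ.* s ℕ.+ 2 ℕ.* y ℕ.+ 2 ℕ.* z ℕ.+ 1 ∸ 4 ℕ.* i)))
  ℚ.* frac (H (s ℕ.+ y ℕ.+ z ∸ 1) ℕ.* H₂ y ℕ.* H₂ (2 ℕ.* E ℕ.+ 2 ℕ.* z ℕ.+ 1) ℕ.* H₂ (2 ℕ.* O ℕ.+ 1) ℕ.* H₂ (2 ℕ.* s ℕ.+ y ℕ.+ 2 ℕ.* z))
           (2 ^ (y ∸ 1) ℕ.* (H (s ℕ.+ z) ℕ.* H₂ (2 ℕ.* E ℕ.+ y ℕ.+ 2 ℕ.* z) ℕ.* H₂ (2 ℕ.* O ℕ.+ y) ℕ.* H₂ (2 ℕ.* s ℕ.+ 2 ℕ.* y ℕ.+ 2 ℕ.* z ∸ 1)))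
  ℚ.* Q' (firstArg (x ℕ.+ (y ∸ 1) / 2) a)
  ℚ.* Q' (secondArg (x ℕ.+ (y ∸ 1) / 2) a z)
  where
  E = evenSum a
  O = oddSum a
  s = O ℕ.+ E

rhsEven : ℕ → ℕ → ℕ → List ℕ → ℚ
rhsEven x y z a =
  toℚ (prod1 (y / 2) (λ i → poch (2 ℕ.* x ℕ.+ 2 ℕ.* i ∸ 1) (2 ℕ.* s ℕ.+ 2 ℕ.* y ℕ.+ 2 ℕ.* z ℕ.+ 1 ∸ 4 ℕ.* i)))
  ℚ.* frac (H (s ℕ.+ y ℕ.+ z) ℕ.* H₂ y ℕ.* H₂ (2 ℕ.* E ℕ.+ 2 ℕ.* z) ℕ.* H₂ (2 ℕ.* O) ℕ.* H₂ (2 ℕ.* s ℕ.+ y ℕ.+ 2 ℕ.* z))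
           (H (s ℕ.+ z) ℕ.* H₂ (2 ℕ.* E ℕ.+ y ℕ.+ 2 ℕ.* z) ℕ.* H₂ (2 ℕ.* O ℕ.+ y) ℕ.* H₂ (2 ℕ.* s ℕ.+ 2 ℕ.* y ℕ.+ 2 ℕ.* z))
  ℚ.* K' (firstArg (x ℕ.+ y / 2) a)
  ℚ.* K' (secondArg (x ℕ.+ y / 2) a z)
  where
  E = evenSum a
  O = oddSum a
  s = O ℕ.+ E

{-# OPTIONS --safe #-}

-- Cut the region along ℓ, and let S be the set of unit segments of ℓ, left of
-- the marked ones, that are crossed by vertical lozenges. The part above ℓ
-- is a region of the type of Q′ and K′ whose southern side ℓ has the removed
-- segments S ∪ U; the part below ℓ is, upside down, such a region with
-- removed segments S ∪ D, where D consists of the marked segments not in U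
-- and of z segments beyond P that come from a forced triangle of side z.
--
-- Building up such a region strip by strip, one sums determinants
-- (f_j(p)) over sets interlacing with a given set of positions; the sum
-- telescopes to the determinant of the antidifferences of the f_j. Taking
-- f_j = ∏_{l<j} (x² − l²) and (2x+1) ∏_{l<j} (x(x+1) − l(l+1)) alternately,
-- the weighted number of tilings is, up to a constant, a Vandermonde product
-- V(S ∪ U) over the removed segments.
--
-- As U and D are complementary in the set A of the last segments of ℓ,
-- V(S ∪ U) V(S ∪ D) V(A) = V(U) V(D) V(S) V(S ∪ A). Hence the holes enter
-- the sum over S only through the factor V(U) V(D), that is, through the two
-- regions on the right hand side. The remaining sum of V(S) V(S ∪ A) counts
-- the tilings of a region without holes; moving ℓ to the northern side of that
-- region turns it into a single Vandermonde product over an interval.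

module Submission where

open import Defs
open import Algebra.Bundles using (CommutativeRing)
open import Algebra.Structures using (IsCommutativeRing)
open import Data.Bool.Base using (Bool; true; false; _∧_; _∨_; not; if_then_else_; T)
open import Data.Bool.ListAction using (any)
open import Data.Bool.Properties using (∨-comm; ∨-assoc; ∨-identityʳ; ∨-zeroʳ; ∧-zeroʳ; ∧-identityʳ; not-involutive; T-≡; T-∧; T-∨)
open import Data.Empty using (⊥; ⊥-elim)
open import Data.Integer.Base as ℤ using (ℤ; +_; -[1+_])
import Data.Integer.Properties as ℤₚ
open import Data.List.Base using (List; []; _∷_; _++_; [_]; map; concatMap; filterᵇ; upTo; reverse; length; replicate; applyUpTo)
open import Data.List.Properties using (++-assoc; ++-identityʳ; length-++; length-replicate; length-applyUpTo; map-++; map-∘; map-replicate; map-upTo; map-applyUpTo; upTo-∷ʳ; filter-++; reverse-++; unfold-reverse; reverse-map; length-reverse)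
open import Data.List.Relation.Unary.All as All using (All; []; _∷_)
open import Data.List.Relation.Unary.All.Properties using () renaming (++⁺ to All-++⁺)
open import Data.Maybe.Base using (Maybe; just; nothing)
open import Data.Nat.Base as ℕ using (ℕ; zero; suc; _+_; _*_; _∸_; _≤_; _<_; z≤n; s≤s; _^_; _!; _/_; _%_; NonZero)
import Data.Nat.Properties as ℕₚ
import Data.Nat.DivMod as DM
import Data.Nat.Tactic.RingSolver as ℕ-Ring
import Data.Integer.Tactic.RingSolver as ℤ-Ring
open import Data.Product.Base using (_×_; _,_; proj₁; proj₂; ∃)
open import Data.Rational.Base as ℚ using (ℚ; 0ℚ; 1ℚ; ½)
import Data.Rational.Properties as ℚₚ
import Data.Rational.Unnormalised.Base as ℚᵘ
import Data.Rational.Unnormalised.Properties as ℚᵘₚ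
open import Data.Sum.Base using (_⊎_; inj₁; inj₂)
open import Data.Unit.Base using (tt)
open import Function.Bundles using (Equivalence)
open import Function.Base using (_∘_; id; _$_)
open import Level using (0ℓ)
open import Relation.Nullary using (¬_; yes; no)
open import Relation.Nullary.Decidable using (T?)
open import Relation.Binary.PropositionalEquality using (_≡_; _≢_; refl; sym; trans; cong; cong₂; subst; module ≡-Reasoning)
open import Tactic.RingSolver using (solve-∀)
import Tactic.RingSolver.Core.AlmostCommutativeRing as ACR

-- The two systems of functions come from reflections: e_j is even in x, o_j is odd in x + 1/2, and
-- each is, up to a constant, an antidifference of the other. A strip starting with an up-pointing
-- triangle leads from o to e and enlarges the determinant by a column for the constant e_0 = 1; a
-- strip starting with a down-pointing triangle leads from e to o and keeps the size. In the latter
-- the antidifference has to vanish at the western end, and since o_j(0) = -o_j(-1), this is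
-- achieved by counting e_j(0) with the weight 1/2 of the western lozenges. Removed triangles are
-- handled by forced lozenges. Between two adjacent removed segments interlacing leaves a single
-- place for a crossing, so removing a triangle has the same effect as removing only the unit
-- triangles along its base. Both parts of the region thereby follow one recursion over the lines,
-- in which whatever lies beyond the eastern boundary counts as removed too. The sum of V(S) V(S ∪
-- A) is not attacked directly: the identity obtained by cutting is applied to a region without
-- holes and read backwards.

-- Arithmetic of rational numbers.

infixl 6 _⊕_
infixl 7 _⊗_
infix  8 ⊖_

-- The operations of ℚ are opaque because unfolding its normalising
-- arithmetic during conversion checking is prohibitively expensive.
opaque
  _⊕_ _⊗_ : ℚ → ℚ → ℚ
  _⊕_ = ℚ._+_
  _⊗_ = ℚ._*_

  ⊖_ : ℚ → ℚ
  ⊖_ = ℚ.-_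

  ι : ℕ → ℚ
  ι = toℚ

  inv : ℕ → ℚ
  inv = frac 1

  isZero : (q : ℚ) → Maybe (0ℚ ≡ q)
  isZero q with 0ℚ ℚₚ.≟ q
  ... | yes e = just e
  ... | no  _ = nothing

  ⊕-⊗-isCommutativeRing : IsCommutativeRing _≡_ _⊕_ _⊗_ ⊖_ 0ℚ 1ℚ
  ⊕-⊗-isCommutativeRing = CommutativeRing.isCommutativeRing ℚₚ.+-*-commutativeRing

⊕-⊗-commutativeRing : CommutativeRing 0ℓ 0ℓ
⊕-⊗-commutativeRing = record { isCommutativeRing = ⊕-⊗-isCommutativeRing }

ℚ-ring : ACR.AlmostCommutativeRing 0ℓ 0ℓ
ℚ-ring = ACR.fromCommutativeRing ⊕-⊗-commutativeRing isZero

open CommutativeRing ⊕-⊗-commutativeRing public using ()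
  renaming ( +-comm to ⊕-comm; +-assoc to ⊕-assoc; +-identityˡ to ⊕-identityˡ; +-identityʳ to ⊕-identityʳ
           ; *-comm to ⊗-comm; *-assoc to ⊗-assoc; *-identityˡ to ⊗-identityˡ; *-identityʳ to ⊗-identityʳ
           ; distribˡ to ⊗-distribˡ-⊕; distribʳ to ⊗-distribʳ-⊕; zeroˡ to ⊗-zeroˡ; zeroʳ to ⊗-zeroʳ )

opaque
  unfolding _⊕_ isZero

  ⊕-interchange : ∀ a b c d → (a ⊕ b) ⊕ (c ⊕ d) ≡ (a ⊕ c) ⊕ (b ⊕ d)
  ⊕-interchange = solve-∀ ℚ-ring

  ⊗-swap : ∀ a b c → a ⊗ (b ⊗ c) ≡ b ⊗ (a ⊗ c)
  ⊗-swap = solve-∀ ℚ-ring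

opaque
  unfolding _⊕_

  ⊕-unfold : ∀ p q → p ℚ.+ q ≡ p ⊕ q
  ⊕-unfold p q = refl

  ⊗-unfold : ∀ p q → p ℚ.* q ≡ p ⊗ q
  ⊗-unfold p q = refl

  ι-unfold : ∀ n → toℚ n ≡ ι n
  ι-unfold n = refl

  ι-0 : ι 0 ≡ 0ℚ
  ι-0 = refl

  ι-1 : ι 1 ≡ 1ℚ
  ι-1 = refl

  ι-+ : ∀ m n → ι (m + n) ≡ ι m ⊕ ι n
  ι-+ m n = ℚₚ.toℚᵘ-injective (begin
    ℚ.toℚᵘ (toℚ (m + n))              ≈⟨ ℚₚ.toℚᵘ-fromℚᵘ (ℚᵘ.mkℚᵘ (+ (m + n)) 0) ⟩
    ℚᵘ.mkℚᵘ (+ (m + n)) 0             ≈⟨ ℚᵘ.*≡* (cong (ℤ._* + 1) (sym (cong₂ ℤ._+_ (ℤₚ.*-identityʳ (+ m)) (ℤₚ.*-identityʳ (+ n))))) ⟩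
    ℚᵘ.mkℚᵘ (+ m) 0 ℚᵘ.+ ℚᵘ.mkℚᵘ (+ n) 0 ≈⟨ ℚᵘₚ.+-cong (ℚᵘₚ.≃-sym (ℚₚ.toℚᵘ-fromℚᵘ (ℚᵘ.mkℚᵘ (+ m) 0))) (ℚᵘₚ.≃-sym (ℚₚ.toℚᵘ-fromℚᵘ (ℚᵘ.mkℚᵘ (+ n) 0))) ⟩
    ℚ.toℚᵘ (toℚ m) ℚᵘ.+ ℚ.toℚᵘ (toℚ n) ≈⟨ ℚᵘₚ.≃-sym (ℚₚ.toℚᵘ-homo-+ (toℚ m) (toℚ n)) ⟩
    ℚ.toℚᵘ (toℚ m ℚ.+ toℚ n)          ∎)
    where open ℚᵘₚ.≃-Reasoning

  frac-* : ∀ m n k l → frac m k ⊗ frac n l ≡ frac (m * n) (k * l)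
  -- `frac` takes the value 0 at the denominator 0, so that the rule holds for all arguments.
  frac-* m n zero    l       = ℚₚ.*-zeroˡ (frac n l)
  frac-* m n (suc k) zero    rewrite ℕₚ.*-zeroʳ k = ℚₚ.*-zeroʳ (frac m (suc k))
  frac-* m n (suc k) (suc l) = ℚₚ.toℚᵘ-injective (begin
    ℚ.toℚᵘ (frac m (suc k) ℚ.* frac n (suc l))         ≈⟨ ℚₚ.toℚᵘ-homo-* (frac m (suc k)) (frac n (suc l)) ⟩
    ℚ.toℚᵘ (frac m (suc k)) ℚᵘ.* ℚ.toℚᵘ (frac n (suc l)) ≈⟨ ℚᵘₚ.*-cong (ℚₚ.toℚᵘ-fromℚᵘ (ℚᵘ.mkℚᵘ (+ m) k)) (ℚₚ.toℚᵘ-fromℚᵘ (ℚᵘ.mkℚᵘ (+ n) l)) ⟩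
    ℚᵘ.mkℚᵘ (+ m) k ℚᵘ.* ℚᵘ.mkℚᵘ (+ n) l               ≈⟨ ℚᵘ.*≡* (cong (ℤ._* + suc (l + k * suc l)) (sym (ℤₚ.pos-* m n))) ⟩
    ℚᵘ.mkℚᵘ (+ (m * n)) (l + k * suc l)                ≈⟨ ℚᵘₚ.≃-sym (ℚₚ.toℚᵘ-fromℚᵘ (ℚᵘ.mkℚᵘ (+ (m * n)) (l + k * suc l))) ⟩
    ℚ.toℚᵘ (frac (m * n) (suc k * suc l))              ∎)
    where open ℚᵘₚ.≃-Reasoning

  frac-self : ∀ n → .{{NonZero n}} → frac n n ≡ 1ℚ
  frac-self (suc n) = ℚₚ.toℚᵘ-injective (ℚᵘₚ.≃-trans (ℚₚ.toℚᵘ-fromℚᵘ (ℚᵘ.mkℚᵘ (+ suc n) n)) (ℚᵘ.*≡* (ℤₚ.*-comm (+ suc n) (+ 1))))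

  ι-* : ∀ m n → ι (m * n) ≡ ι m ⊗ ι n
  ι-* m n = sym (frac-* m n 1 1)

  inv-* : ∀ m n → inv (m * n) ≡ inv m ⊗ inv n
  inv-* m n = sym (frac-* 1 1 m n)

  frac-ι-inv : ∀ m n → frac m n ≡ ι m ⊗ inv n
  frac-ι-inv m n = trans (sym (cong₂ frac (ℕₚ.*-identityʳ m) (ℕₚ.*-identityˡ n))) (sym (frac-* m 1 1 n))

  ι-inv : ∀ n → .{{NonZero n}} → ι n ⊗ inv n ≡ 1ℚ
  ι-inv n = trans (sym (frac-ι-inv n n)) (frac-self n)

  inv-1 : inv 1 ≡ 1ℚ
  inv-1 = refl

-- Interlacing sums of minors

sumB : ℕ → (List Bool → ℚ) → ℚ
sumB zero    f = f []
sumB (suc n) f = sumB n (f ∘ (false ∷_)) ⊕ sumB n (f ∘ (true ∷_))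

ind : Bool → ℚ → ℚ
ind b q = if b then q else 0ℚ

ind-false : ∀ {b} q → b ≡ false → ind b q ≡ 0ℚ
ind-false q refl = refl

ind-0 : ∀ b → ind b 0ℚ ≡ 0ℚ
ind-0 false = refl
ind-0 true  = refl

ind-⊗ : ∀ b p q → p ⊗ ind b q ≡ ind b (p ⊗ q)
ind-⊗ false p q = ⊗-zeroʳ p
ind-⊗ true  p q = refl

0⊕0 : 0ℚ ⊕ 0ℚ ≡ 0ℚ
0⊕0 = ⊕-identityˡ 0ℚ

sumB-cong : ∀ n {f g} → (∀ Q → length Q ≡ n → f Q ≡ g Q) → sumB n f ≡ sumB n g
sumB-cong zero    h = h [] refl
sumB-cong (suc n) h = cong₂ _⊕_ (sumB-cong n (λ Q e → h _ (cong suc e))) (sumB-cong n (λ Q e → h _ (cong suc e)))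

sumB-0 : ∀ n {f} → (∀ Q → length Q ≡ n → f Q ≡ 0ℚ) → sumB n f ≡ 0ℚ
sumB-0 zero    h = h [] refl
sumB-0 (suc n) h = trans (cong₂ _⊕_ (sumB-0 n (λ Q e → h _ (cong suc e))) (sumB-0 n (λ Q e → h _ (cong suc e)))) 0⊕0

sumB-⊕ : ∀ n f g → sumB n (λ Q → f Q ⊕ g Q) ≡ sumB n f ⊕ sumB n g
sumB-⊕ zero    f g = refl
sumB-⊕ (suc n) f g = trans (cong₂ _⊕_ (sumB-⊕ n _ _) (sumB-⊕ n _ _)) (⊕-interchange _ _ _ _)

sumB-⊗ : ∀ n c f → sumB n (λ Q → c ⊗ f Q) ≡ c ⊗ sumB n f
sumB-⊗ zero    c f = refl
sumB-⊗ (suc n) c f = trans (cong₂ _⊕_ (sumB-⊗ n c _) (sumB-⊗ n c _)) (sym (⊗-distribˡ-⊕ c _ _))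

sumB-swap : ∀ m n (f : List Bool → List Bool → ℚ) → sumB m (λ P → sumB n (λ Q → f P Q)) ≡ sumB n (λ Q → sumB m (λ P → f P Q))
sumB-swap zero    n f = refl
sumB-swap (suc m) n f = trans (cong₂ _⊕_ (sumB-swap m n (f ∘ (false ∷_))) (sumB-swap m n (f ∘ (true ∷_)))) (sym (sumB-⊕ n _ _))

-- A strip of unit triangles starting with an up-pointing one, whose missing
-- up-pointing (down-pointing) triangles are marked true in P (in Q), has a
-- tiling, necessarily unique, iff fits P Q. If it starts with a
-- down-pointing triangle, the condition is fits Q P.
fits : List Bool → List Bool → Bool
fits []          []          = true
fits []          (_ ∷ _)     = false
fits (true ∷ P)  Q           = fits Q P
fits (false ∷ P) (false ∷ Q) = fits P Q
fits (false ∷ P) _           = false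

module _ {G : Set} where

  -- The Laplace expansion of an alternating form along a linear functional.
  contract : (G → ℚ) → (List G → ℚ) → List G → ℚ
  contract φ K []       = 0ℚ
  contract φ K (g ∷ gs) = φ g ⊗ K gs ⊕ ⊖ contract φ (K ∘ (g ∷_)) gs

  -- The determinant without rows. The value 0 on leftover columns, and that of `contract` on
  -- leftover rows, make minors of non-square matrices vanish.
  unit : List G → ℚ
  unit []      = 1ℚ
  unit (_ ∷ _) = 0ℚ

  -- minor φ x P gs is the determinant of the matrix φ p g with g in gs and
  -- p in the set of positions marked in P, the first of which is x.
  minor : (ℕ → G → ℚ) → ℕ → List Bool → List G → ℚ
  minor φ x []          gs = unit gs
  minor φ x (false ∷ P) gs = minor φ (suc x) P gs
  minor φ x (true ∷ P)  gs = contract (φ x) (minor φ (suc x) P) gs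

  contract-cong : ∀ {φ ψ : G → ℚ} {K L : List G → ℚ} → (∀ g → φ g ≡ ψ g) → (∀ l → K l ≡ L l) → ∀ gs → contract φ K gs ≡ contract ψ L gs
  contract-cong p q []       = refl
  contract-cong p q (g ∷ gs) = cong₂ (λ a b → a ⊕ ⊖ b) (cong₂ _⊗_ (p g) (q gs)) (contract-cong p (λ l → q (g ∷ l)) gs)

  minor-cong : ∀ {φ ψ : ℕ → G → ℚ} x P → (∀ y g → x ≤ y → φ y g ≡ ψ y g) → ∀ gs → minor φ x P gs ≡ minor ψ x P gs
  minor-cong x []          p gs = refl
  minor-cong x (false ∷ P) p gs = minor-cong (suc x) P (λ y g l → p y g (ℕₚ.<⇒≤ l)) gs
  minor-cong x (true ∷ P)  p gs = contract-cong (λ g → p x g ℕₚ.≤-refl) (minor-cong (suc x) P (λ y g l → p y g (ℕₚ.<⇒≤ l))) gs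

  private opaque
    unfolding _⊕_ isZero
    ⊖0 : ⊖ 0ℚ ≡ 0ℚ
    ⊖0 = refl
    l1 : ∀ a b k r s → (a ⊕ b) ⊗ k ⊕ ⊖ (r ⊕ s) ≡ (a ⊗ k ⊕ ⊖ r) ⊕ (b ⊗ k ⊕ ⊖ s)
    l1 = solve-∀ ℚ-ring
    l2 : ∀ a k l r s → a ⊗ (k ⊕ l) ⊕ ⊖ (r ⊕ s) ≡ (a ⊗ k ⊕ ⊖ r) ⊕ (a ⊗ l ⊕ ⊖ s)
    l2 = solve-∀ ℚ-ring
    l3 : ∀ c a k r → (c ⊗ a) ⊗ k ⊕ ⊖ (c ⊗ r) ≡ c ⊗ (a ⊗ k ⊕ ⊖ r)
    l3 = solve-∀ ℚ-ring
    l4 : ∀ c a k r → a ⊗ (c ⊗ k) ⊕ ⊖ (c ⊗ r) ≡ c ⊗ (a ⊗ k ⊕ ⊖ r)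
    l4 = solve-∀ ℚ-ring
    l6 : ∀ a b → a ⊗ b ⊕ ⊖ (a ⊗ b) ≡ 0ℚ
    l6 = solve-∀ ℚ-ring
    l7 : ∀ a → 0ℚ ⊗ a ⊕ ⊖ 0ℚ ≡ 0ℚ
    l7 = solve-∀ ℚ-ring

  contract-⊕ˡ : ∀ φ ψ K gs → contract (λ g → φ g ⊕ ψ g) K gs ≡ contract φ K gs ⊕ contract ψ K gs
  contract-⊕ˡ φ ψ K []       = sym 0⊕0
  contract-⊕ˡ φ ψ K (g ∷ gs) = trans (cong (λ z → (φ g ⊕ ψ g) ⊗ K gs ⊕ ⊖ z) (contract-⊕ˡ φ ψ (K ∘ (g ∷_)) gs)) (l1 _ _ _ _ _)

  contract-⊕ʳ : ∀ φ K L gs → contract φ (λ l → K l ⊕ L l) gs ≡ contract φ K gs ⊕ contract φ L gs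
  contract-⊕ʳ φ K L []       = sym 0⊕0
  contract-⊕ʳ φ K L (g ∷ gs) = trans (cong (λ z → φ g ⊗ (K gs ⊕ L gs) ⊕ ⊖ z) (contract-⊕ʳ φ (K ∘ (g ∷_)) (L ∘ (g ∷_)) gs)) (l2 _ _ _ _ _)

  contract-⊗ˡ : ∀ c φ K gs → contract (λ g → c ⊗ φ g) K gs ≡ c ⊗ contract φ K gs
  contract-⊗ˡ c φ K []       = sym (⊗-zeroʳ c)
  contract-⊗ˡ c φ K (g ∷ gs) = trans (cong (λ z → (c ⊗ φ g) ⊗ K gs ⊕ ⊖ z) (contract-⊗ˡ c φ (K ∘ (g ∷_)) gs)) (l3 _ _ _ _)

  contract-⊗ʳ : ∀ c φ K gs → contract φ (λ l → c ⊗ K l) gs ≡ c ⊗ contract φ K gs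
  contract-⊗ʳ c φ K []       = sym (⊗-zeroʳ c)
  contract-⊗ʳ c φ K (g ∷ gs) = trans (cong (λ z → φ g ⊗ (c ⊗ K gs) ⊕ ⊖ z) (contract-⊗ʳ c φ (K ∘ (g ∷_)) gs)) (l4 _ _ _ _)

  contract-0ʳ : ∀ φ gs → contract φ (λ _ → 0ℚ) gs ≡ 0ℚ
  contract-0ʳ φ []       = refl
  contract-0ʳ φ (g ∷ gs) = trans (cong₂ (λ a b → a ⊕ ⊖ b) (⊗-zeroʳ (φ g)) (contract-0ʳ φ gs)) (trans (cong (0ℚ ⊕_) ⊖0) 0⊕0)

  contract-0ˡ : ∀ K gs → contract (λ _ → 0ℚ) K gs ≡ 0ℚ
  contract-0ˡ K []       = refl
  contract-0ˡ K (g ∷ gs) = trans (cong (λ z → 0ℚ ⊗ K gs ⊕ ⊖ z) (contract-0ˡ (K ∘ (g ∷_)) gs)) (l7 _)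

  -- A determinant with two equal rows: the terms in which one or the other copy takes the first
  -- element cancel, and the rest vanishes by induction.
  contract² : ∀ φ K gs → contract φ (contract φ K) gs ≡ 0ℚ
  contract² φ K []       = refl
  contract² φ K (g ∷ gs) = trans (cong (λ z → φ g ⊗ contract φ K gs ⊕ ⊖ z) (begin
    contract φ (λ l → φ g ⊗ K l ⊕ ⊖ contract φ (K ∘ (g ∷_)) l) gs
      ≡⟨ contract-cong (λ _ → refl) (λ l → cong (φ g ⊗ K l ⊕_) (neg _)) gs ⟩
    contract φ (λ l → φ g ⊗ K l ⊕ (⊖ 1ℚ) ⊗ contract φ (K ∘ (g ∷_)) l) gs
      ≡⟨ contract-⊕ʳ φ _ _ gs ⟩
    contract φ (λ l → φ g ⊗ K l) gs ⊕ contract φ (λ l → (⊖ 1ℚ) ⊗ contract φ (K ∘ (g ∷_)) l) gs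
      ≡⟨ cong₂ _⊕_ (contract-⊗ʳ (φ g) φ K gs) (trans (contract-⊗ʳ (⊖ 1ℚ) φ _ gs) (trans (cong ((⊖ 1ℚ) ⊗_) (contract² φ (K ∘ (g ∷_)) gs)) (⊗-zeroʳ _))) ⟩
    φ g ⊗ contract φ K gs ⊕ 0ℚ
      ≡⟨ ⊕-identityʳ _ ⟩
    φ g ⊗ contract φ K gs ∎)) (l6 (φ g) (contract φ K gs))
    where
    open ≡-Reasoning
    opaque
      unfolding _⊕_ isZero
      neg : ∀ a → ⊖ a ≡ (⊖ 1ℚ) ⊗ a
      neg = solve-∀ ℚ-ring

  contract-sumB : ∀ n φ (K : List Bool → List G → ℚ) gs → contract φ (λ l → sumB n (λ Q → K Q l)) gs ≡ sumB n (λ Q → contract φ (K Q) gs)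
  contract-sumB zero    φ K gs = refl
  contract-sumB (suc n) φ K gs = trans (contract-⊕ʳ φ _ _ gs) (cong₂ _⊕_ (contract-sumB n φ _ gs) (contract-sumB n φ _ gs))

  contract-ind : ∀ b φ K gs → ind b (contract φ K gs) ≡ contract φ (λ l → ind b (K l)) gs
  contract-ind false φ K gs = sym (contract-0ʳ φ gs)
  contract-ind true  φ K gs = refl

  -- The sums of minors over the sets Q interlacing with P, where Q starts at
  -- x; interˡ is for a strip starting on the side of P, interʳ for
  -- one starting on the side of Q.
  module _ (X : ℕ → G → ℚ) where
    interˡ interʳ : List Bool → ℕ → List G → ℚ
    interˡ []          x gs = 0ℚ
    interˡ (false ∷ P) x gs = interˡ P (suc x) gs
    interˡ (true ∷ P)  x gs = interʳ P x gs
    interʳ []          x gs = unit gs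
    interʳ (false ∷ P) x gs = contract (X x) (interˡ P (suc (suc x))) gs ⊕ interʳ P (suc x) gs
    interʳ (true ∷ P)  x gs = contract (X x) (interʳ P (suc x)) gs

    private
      term : Bool → ℕ → List Bool → List G → ℚ
      term b x Q gs = ind b (minor X x Q gs)

    -- The strip is read from left to right; each step decides on which of the two lines the rest of
    -- the strip starts, which makes the two sums mutually recursive.
    sum-interˡ : ∀ m P x gs → length P ≡ suc m → sumB m (λ Q → term (fits P Q) x Q gs) ≡ interˡ P x gs
    sum-interʳ : ∀ m P x gs → length P ≡ m → sumB m (λ Q → term (fits Q P) x Q gs) ≡ interʳ P x gs

    sum-interˡ m       (true ∷ P)  x gs e = sum-interʳ m P x gs (ℕₚ.suc-injective e)
    sum-interˡ zero    (false ∷ []) x gs e = refl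
    sum-interˡ (suc m) (false ∷ P) x gs e =
      trans (cong₂ _⊕_ (sum-interˡ m P (suc x) gs (ℕₚ.suc-injective e)) (sumB-0 m (λ _ _ → refl))) (⊕-identityʳ _)

    private
      first : ∀ m P x gs → length P ≡ suc m →
        sumB m (λ Q → term (fits P Q) x (true ∷ Q) gs) ≡ contract (X x) (interˡ P (suc x)) gs
      first m P x gs e = trans
        (trans (sumB-cong m (λ Q _ → contract-ind (fits P Q) (X x) (minor X (suc x) Q) gs))
               (sym (contract-sumB m (X x) (λ Q l → term (fits P Q) (suc x) Q l) gs)))
        (contract-cong (λ _ → refl) (λ l → sum-interˡ m P (suc x) l e) gs)

    sum-interʳ zero    []          x gs e = refl
    sum-interʳ (suc m) (false ∷ P) x gs e = trans (⊕-comm _ _)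
      (cong₂ _⊕_ (first m (false ∷ P) x gs e) (sum-interʳ m P (suc x) gs (ℕₚ.suc-injective e)))
    sum-interʳ (suc m) (true ∷ P)  x gs e =
      trans (cong₂ _⊕_ (sumB-0 m (λ _ _ → refl)) (first m (true ∷ P) x gs e)) (⊕-identityˡ _)

    module _ (Y : ℕ → G → ℚ) (step : ∀ x g → X x g ⊕ Y x g ≡ Y (suc x) g) where

      -- The interlacing sums telescope when X is the discrete derivative of Y.
      telescope : ∀ P x gs → interʳ P x gs ⊕ contract (Y x) (interˡ P (suc x)) gs ≡ minor Y (suc x) P gs
      telescope []          x gs = trans (cong (unit gs ⊕_) (contract-0ʳ (Y x) gs)) (⊕-identityʳ _)
      telescope (false ∷ P) x gs = begin
        (a ⊕ b) ⊕ contract (Y x) (interˡ P (2 + x)) gs ≡⟨ shuffle a b _ ⟩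
        b ⊕ (a ⊕ contract (Y x) (interˡ P (2 + x)) gs) ≡⟨ cong (b ⊕_) (sym (contract-⊕ˡ (X x) (Y x) (interˡ P (2 + x)) gs)) ⟩
        -- A crossing at x joins those further left in the same gap, already collected in `Y x`, to
        -- `Y (suc x)`.
        b ⊕ contract (λ g → X x g ⊕ Y x g) (interˡ P (2 + x)) gs ≡⟨ cong (b ⊕_) (contract-cong (step x) (λ _ → refl) gs) ⟩
        b ⊕ contract (Y (suc x)) (interˡ P (2 + x)) gs ≡⟨ telescope P (suc x) gs ⟩
        minor Y (2 + x) P gs ∎
        where
        open ≡-Reasoning
        a = contract (X x) (interˡ P (2 + x)) gs
        b = interʳ P (suc x) gs
        opaque
          unfolding _⊕_ isZero
          shuffle : ∀ a b c → (a ⊕ b) ⊕ c ≡ b ⊕ (a ⊕ c)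
          shuffle = solve-∀ ℚ-ring
      telescope (true ∷ P)  x gs = begin
        contract (X x) V gs ⊕ contract (Y x) V gs      ≡⟨ sym (contract-⊕ˡ (X x) (Y x) V gs) ⟩
        contract (λ g → X x g ⊕ Y x g) V gs            ≡⟨ contract-cong (step x) (λ _ → refl) gs ⟩
        contract Y′ V gs                               ≡⟨ sym (⊕-identityʳ _) ⟩
        -- A second row equal to `Y′` can be added for free; this restores the form of the induction
        -- hypothesis for the next gap.
        contract Y′ V gs ⊕ 0ℚ                          ≡⟨ cong (contract Y′ V gs ⊕_) (sym (contract² Y′ (interˡ P (2 + x)) gs)) ⟩
        contract Y′ V gs ⊕ contract Y′ (contract Y′ (interˡ P (2 + x))) gs ≡⟨ sym (contract-⊕ʳ Y′ V _ gs) ⟩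
        contract Y′ (λ l → V l ⊕ contract Y′ (interˡ P (2 + x)) l) gs ≡⟨ contract-cong (λ _ → refl) (telescope P (suc x)) gs ⟩
        contract Y′ (minor Y (2 + x) P) gs ∎
        where
        open ≡-Reasoning
        V = interʳ P (suc x)
        Y′ = Y (suc x)

      -- If Y vanishes at the western end, the extra row `Y x` of `telescope` disappears.
      interʳ-0 : (∀ g → Y 0 g ≡ 0ℚ) → ∀ P gs → interʳ P 0 gs ≡ minor Y 1 P gs
      interʳ-0 Y0 P gs = trans (sym (trans (cong (interʳ P 0 gs ⊕_)
        (trans (contract-cong Y0 (λ _ → refl) gs) (contract-0ˡ _ gs))) (⊕-identityʳ _))) (telescope P 0 gs)

      -- An element on which every Y x is 1 is annihilated by every X x.
      module _ (u : G) (Yu : ∀ x → Y x u ≡ 1ℚ) (Xu : ∀ x → X x u ≡ 0ℚ) where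
        interˡ-u : ∀ P x gs → interˡ P x (u ∷ gs) ≡ 0ℚ
        interʳ-u : ∀ P x gs → interʳ P x (u ∷ gs) ≡ 0ℚ

        private
          kill : ∀ x K gs → (∀ l → K (u ∷ l) ≡ 0ℚ) → contract (X x) K (u ∷ gs) ≡ 0ℚ
          kill x K gs h = trans (cong₂ (λ a b → a ⊗ K gs ⊕ ⊖ b) (Xu x) (trans (contract-cong (λ _ → refl) h gs) (contract-0ʳ (X x) gs))) (l7 _)

        interˡ-u []          x gs = refl
        interˡ-u (false ∷ P) x gs = interˡ-u P (suc x) gs
        interˡ-u (true ∷ P)  x gs = interʳ-u P x gs
        interʳ-u []          x gs = refl
        interʳ-u (false ∷ P) x gs = trans (cong₂ _⊕_ (kill x (interˡ P (2 + x)) gs (interˡ-u P (2 + x))) (interʳ-u P (suc x) gs)) 0⊕0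
        interʳ-u (true ∷ P)  x gs = kill x (interʳ P (suc x)) gs (interʳ-u P (suc x))

        -- With the column `u` in front, the first term of `telescope` vanishes because X does on
        -- `u`, and in the second one only the extra row can take `u`.
        interˡ-minor-suc : ∀ P x gs → interˡ P (suc x) gs ≡ minor Y (suc x) P (u ∷ gs)
        interˡ-minor-suc P x gs = sym (begin
          minor Y (suc x) P (u ∷ gs) ≡⟨ sym (telescope P x (u ∷ gs)) ⟩
          interʳ P x (u ∷ gs) ⊕ contract (Y x) (interˡ P (suc x)) (u ∷ gs) ≡⟨ cong₂ _⊕_ (interʳ-u P x gs) refl ⟩
          0ℚ ⊕ contract (Y x) (interˡ P (suc x)) (u ∷ gs) ≡⟨ ⊕-identityˡ _ ⟩
          Y x u ⊗ W gs ⊕ ⊖ contract (Y x) (W ∘ (u ∷_)) gs ≡⟨ cong₂ (λ a b → a ⊗ W gs ⊕ ⊖ b) (Yu x) (trans (contract-cong (λ _ → refl) (interˡ-u P (suc x)) gs) (contract-0ʳ (Y x) gs)) ⟩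
          1ℚ ⊗ W gs ⊕ ⊖ 0ℚ ≡⟨ cong₂ _⊕_ (⊗-identityˡ _) ⊖0 ⟩
          W gs ⊕ 0ℚ ≡⟨ ⊕-identityʳ _ ⟩
          W gs ∎)
          where
          open ≡-Reasoning
          W = interˡ P (suc x)

        -- Here Q has one element fewer than P, and summation yields differences of consecutive rows
        -- of Y. Bordering by a column of ones turns them back into a determinant of the rows
        -- themselves.
        interˡ-minor : ∀ P x gs → interˡ P x gs ≡ minor Y x P (u ∷ gs)
        interˡ-minor []          x gs = refl
        interˡ-minor (false ∷ P) x gs = interˡ-minor-suc P x gs
        interˡ-minor (true ∷ P)  x gs = sym (begin
          Y x u ⊗ minor Y (suc x) P gs ⊕ ⊖ contract (Y x) (minor Y (suc x) P ∘ (u ∷_)) gs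
            ≡⟨ cong₂ (λ a b → a ⊗ minor Y (suc x) P gs ⊕ ⊖ b) (Yu x) (contract-cong (λ _ → refl) (λ l → sym (interˡ-minor-suc P x l)) gs) ⟩
          1ℚ ⊗ minor Y (suc x) P gs ⊕ ⊖ W
            ≡⟨ cong (λ a → 1ℚ ⊗ a ⊕ ⊖ W) (sym (telescope P x gs)) ⟩
          1ℚ ⊗ (interʳ P x gs ⊕ W) ⊕ ⊖ W
            ≡⟨ cancel _ _ ⟩
          interʳ P x gs ∎)
          where
          open ≡-Reasoning
          W = contract (Y x) (interˡ P (suc x)) gs
          opaque
            unfolding _⊕_ isZero
            cancel : ∀ a b → 1ℚ ⊗ (a ⊕ b) ⊕ ⊖ b ≡ a
            cancel = solve-∀ ℚ-ring

-- Vandermonde determinants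

ev : ℕ → (ℕ → ℚ) → ℚ
ev x g = g x

Combination : (h′ h g : ℕ → ℚ) → ℚ → Set
Combination h′ h g c = ∀ x → h′ x ≡ h x ⊕ c ⊗ g x

-- What the Vandermonde evaluation uses of a determinant as a function of its columns. `column` adds
-- a multiple of a column to its right neighbour only; in this form the property passes through the
-- Laplace expansion.
record Alternating (K : List (ℕ → ℚ) → ℚ) : Set where
  field
    linear : ∀ pre rest {h′ h g c} → Combination h′ h g c →
             K (pre ++ h′ ∷ rest) ≡ K (pre ++ h ∷ rest) ⊕ c ⊗ K (pre ++ g ∷ rest)
    column : ∀ pre rest {h′ h g c} → Combination h′ h g c →
             K (pre ++ g ∷ h′ ∷ rest) ≡ K (pre ++ g ∷ h ∷ rest)

open Alternating

alternating-∷ : ∀ {K} g → Alternating K → Alternating (K ∘ (g ∷_))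
alternating-∷ g A = record
  { linear = λ pre rest r → linear A (g ∷ pre) rest r
  ; column = λ pre rest r → column A (g ∷ pre) rest r }

private opaque
  unfolding _⊕_ isZero
  lin-head : ∀ h c g k r s → (h ⊕ c ⊗ g) ⊗ k ⊕ ⊖ (r ⊕ c ⊗ s) ≡ (h ⊗ k ⊕ ⊖ r) ⊕ c ⊗ (g ⊗ k ⊕ ⊖ s)
  lin-head = solve-∀ ℚ-ring
  lin-tail : ∀ a k c l r s → a ⊗ (k ⊕ c ⊗ l) ⊕ ⊖ (r ⊕ c ⊗ s) ≡ (a ⊗ k ⊕ ⊖ r) ⊕ c ⊗ (a ⊗ l ⊕ ⊖ s)
  lin-tail = solve-∀ ℚ-ring
  col-head : ∀ g k c l h r → g ⊗ (k ⊕ c ⊗ l) ⊕ ⊖ ((h ⊕ c ⊗ g) ⊗ l ⊕ ⊖ r) ≡ g ⊗ k ⊕ ⊖ (h ⊗ l ⊕ ⊖ r)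
  col-head = solve-∀ ℚ-ring
  split-shift : ∀ u a c f → (u ⊕ ⊖ c) ⊗ f ≡ (u ⊕ ⊖ a) ⊗ f ⊕ (a ⊕ ⊖ c) ⊗ f
  split-shift = solve-∀ ℚ-ring
  self-zero : ∀ u f → (u ⊕ ⊖ u) ⊗ f ≡ 0ℚ
  self-zero = solve-∀ ℚ-ring
  drop-zero : ∀ a k → 0ℚ ⊗ a ⊕ ⊖ 0ℚ ≡ 0ℚ ⊗ k
  drop-zero = solve-∀ ℚ-ring
  minus-zero : ∀ a → a ⊕ ⊖ 0ℚ ≡ a
  minus-zero = solve-∀ ℚ-ring

contract-linear : ∀ x {K} → Alternating K → ∀ pre rest {h′ h g c} → Combination h′ h g c →
  contract (ev x) K (pre ++ h′ ∷ rest) ≡ contract (ev x) K (pre ++ h ∷ rest) ⊕ c ⊗ contract (ev x) K (pre ++ g ∷ rest)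
contract-linear x {K} A [] rest {h′} {h} {g} {c} r = begin
  h′ x ⊗ K rest ⊕ ⊖ contract (ev x) (K ∘ (h′ ∷_)) rest
    ≡⟨ cong₂ (λ a b → a ⊗ K rest ⊕ ⊖ b) (r x) (contract-cong (λ _ → refl) (λ l → linear A [] l r) rest) ⟩
  (h x ⊕ c ⊗ g x) ⊗ K rest ⊕ ⊖ contract (ev x) (λ l → K (h ∷ l) ⊕ c ⊗ K (g ∷ l)) rest
    ≡⟨ cong (λ b → (h x ⊕ c ⊗ g x) ⊗ K rest ⊕ ⊖ b) (trans (contract-⊕ʳ (ev x) _ _ rest) (cong (_ ⊕_) (contract-⊗ʳ c (ev x) _ rest))) ⟩
  (h x ⊕ c ⊗ g x) ⊗ K rest ⊕ ⊖ (contract (ev x) (K ∘ (h ∷_)) rest ⊕ c ⊗ contract (ev x) (K ∘ (g ∷_)) rest)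
    ≡⟨ lin-head _ _ _ _ _ _ ⟩
  _ ∎
  where open ≡-Reasoning
contract-linear x A (p ∷ pre) rest r =
  trans (cong₂ (λ a b → p x ⊗ a ⊕ ⊖ b) (linear A pre rest r) (contract-linear x (alternating-∷ p A) pre rest r)) (lin-tail _ _ _ _ _ _)

contract-column : ∀ x {K} → Alternating K → ∀ pre rest {h′ h g c} → Combination h′ h g c →
  contract (ev x) K (pre ++ g ∷ h′ ∷ rest) ≡ contract (ev x) K (pre ++ g ∷ h ∷ rest)
contract-column x {K} A [] rest {h′} {h} {g} {c} r = trans
  -- Two terms with the factor c arise, one from the smaller determinant and one from the entry in
  -- the row x; they cancel.
  (cong₂ (λ a b → g x ⊗ a ⊕ ⊖ b) (linear A [] rest r)
    (cong₂ (λ a b → a ⊗ K (g ∷ rest) ⊕ ⊖ b) (r x) (contract-cong (λ _ → refl) (λ l → column A [] l r) rest)))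
  (col-head _ _ _ _ _ _)
contract-column x A (p ∷ pre) rest r =
  cong₂ (λ a b → p x ⊗ a ⊕ ⊖ b) (column A pre rest r) (contract-column x (alternating-∷ p A) pre rest r)

contract-alternating : ∀ x {K} → Alternating K → Alternating (contract (ev x) K)
contract-alternating x A = record { linear = contract-linear x A ; column = contract-column x A }

unit-alternating : Alternating unit
unit-alternating = record
  { linear = λ where
      []        rest {c = c} r → sym (trans (⊕-identityˡ _) (⊗-zeroʳ c))
      (_ ∷ pre) rest {c = c} r → sym (trans (⊕-identityˡ _) (⊗-zeroʳ c))
  ; column = λ where
      []        rest r → refl
      (_ ∷ pre) rest r → refl }

minor-alternating : ∀ x P → Alternating (minor ev x P)
minor-alternating x []          = unit-alternating
minor-alternating x (false ∷ P) = minor-alternating (suc x) P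
minor-alternating x (true ∷ P)  = contract-alternating x (minor-alternating (suc x) P)

contract-map : ∀ {G G′ : Set} (t : G → G′) φ K gs → contract φ K (map t gs) ≡ contract (φ ∘ t) (K ∘ map t) gs
contract-map t φ K []       = refl
contract-map t φ K (g ∷ gs) = cong (λ z → φ (t g) ⊗ K (map t gs) ⊕ ⊖ z) (contract-map t φ (K ∘ (t g ∷_)) gs)

minor-map : ∀ {G G′ : Set} (t : G → G′) φ x P gs → minor φ x P (map t gs) ≡ minor (λ y g → φ y (t g)) x P gs
minor-map t φ x []          []       = refl
minor-map t φ x []          (_ ∷ gs) = refl
minor-map t φ x (false ∷ P) gs       = minor-map t φ (suc x) P gs
minor-map t φ x (true ∷ P)  gs       = trans (contract-map t (φ x) _ gs) (contract-cong (λ _ → refl) (minor-map t φ (suc x) P) gs)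

prodOver : (ℕ → ℚ) → ℕ → List Bool → ℚ
prodOver s x []          = 1ℚ
prodOver s x (false ∷ P) = prodOver s (suc x) P
prodOver s x (true ∷ P)  = s x ⊗ prodOver s (suc x) P

module _ {G : Set} where
  minor-rows : ∀ s (φ : ℕ → G → ℚ) x P gs → minor (λ y g → s y ⊗ φ y g) x P gs ≡ prodOver s x P ⊗ minor φ x P gs
  minor-rows s φ x []          gs = sym (⊗-identityˡ _)
  minor-rows s φ x (false ∷ P) gs = minor-rows s φ (suc x) P gs
  minor-rows s φ x (true ∷ P)  gs = begin
    contract (λ g → s x ⊗ φ x g) (minor _ (suc x) P) gs
      ≡⟨ contract-⊗ˡ (s x) (φ x) _ gs ⟩
    s x ⊗ contract (φ x) (minor _ (suc x) P) gs
      ≡⟨ cong (s x ⊗_) (trans (contract-cong (λ _ → refl) (minor-rows s φ (suc x) P) gs) (contract-⊗ʳ _ (φ x) _ gs)) ⟩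
    s x ⊗ (prodOver s (suc x) P ⊗ contract (φ x) (minor φ (suc x) P) gs)
      ≡⟨ sym (⊗-assoc _ _ _) ⟩
    _ ∎
    where open ≡-Reasoning

  prodList : (G → ℚ) → List G → ℚ
  prodList s []       = 1ℚ
  prodList s (g ∷ gs) = s g ⊗ prodList s gs

  private opaque
    unfolding _⊕_ isZero
    cols : ∀ a b p k c → (a ⊗ b) ⊗ (p ⊗ k) ⊕ ⊖ (p ⊗ (a ⊗ c)) ≡ (a ⊗ p) ⊗ (b ⊗ k ⊕ ⊖ c)
    cols = solve-∀ ℚ-ring

  contract-columns : ∀ s (φ : G → ℚ) (K L : List G → ℚ) → (∀ l → K l ≡ prodList s l ⊗ L l) →
    ∀ gs → contract (λ g → s g ⊗ φ g) K gs ≡ prodList s gs ⊗ contract φ L gs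
  contract-columns s φ K L h []       = sym (⊗-zeroʳ _)
  contract-columns s φ K L h (g ∷ gs) = trans
    (cong₂ (λ a b → (s g ⊗ φ g) ⊗ a ⊕ ⊖ b) (h gs)
      (trans (contract-columns s φ (K ∘ (g ∷_)) (λ l → s g ⊗ L (g ∷ l)) (λ l → trans (h (g ∷ l)) (swap _ _ _)) gs)
             (cong (prodList s gs ⊗_) (contract-⊗ʳ (s g) φ _ gs))))
    (cols _ _ _ _ _)
    where
    opaque
      unfolding _⊕_ isZero
      swap : ∀ a b c → (a ⊗ b) ⊗ c ≡ b ⊗ (a ⊗ c)
      swap = solve-∀ ℚ-ring

  minor-columns : ∀ s (φ : ℕ → G → ℚ) x P gs → minor (λ y g → s g ⊗ φ y g) x P gs ≡ prodList s gs ⊗ minor φ x P gs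
  minor-columns s φ x []          []       = sym (⊗-identityˡ _)
  minor-columns s φ x []          (_ ∷ gs) = sym (⊗-zeroʳ _)
  minor-columns s φ x (false ∷ P) gs       = minor-columns s φ (suc x) P gs
  minor-columns s φ x (true ∷ P)  gs       = contract-columns s (φ x) _ _ (minor-columns s φ (suc x) P) gs

tower : {A : Set} → (ℕ → A) → ℕ → List A
tower F zero    = []
tower F (suc n) = F 0 ∷ tower (F ∘ suc) n

map-tower : ∀ {A B : Set} (t : A → B) F n → map t (tower F n) ≡ tower (t ∘ F) n
map-tower t F zero    = refl
map-tower t F (suc n) = cong (_ ∷_) (map-tower t (F ∘ suc) n)

module _ (u : ℕ → ℚ) where

  vandermonde : (ℕ → ℚ) → ℕ → List Bool → ℕ → ℚ
  vandermonde w x []          zero    = 1ℚ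
  vandermonde w x []          (suc _) = 0ℚ
  vandermonde w x (false ∷ P) n       = vandermonde w (suc x) P n
  vandermonde w x (true ∷ P)  zero    = 0ℚ
  vandermonde w x (true ∷ P)  (suc n) = w x ⊗ (prodOver (λ y → u y ⊕ ⊖ u x) (suc x) P ⊗ vandermonde w (suc x) P n)

  times : ℚ → (ℕ → ℚ) → ℕ → ℚ
  times a g y = (u y ⊕ ⊖ a) ⊗ g y

  -- As u - c_j = (u - a) + (a - c_j), the columns f_{j+1} and (u - a) f_j differ by a multiple of
  -- f_j, their left neighbour. The choice a = u x makes all columns but the first vanish in the row
  -- x.
  column-operations : ∀ a {K} → Alternating K → ∀ pre (f : ℕ → ℕ → ℚ) c → (∀ j x → f (suc j) x ≡ (u x ⊕ ⊖ c j) ⊗ f j x) → ∀ n →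
    K (pre ++ f 0 ∷ tower (times a ∘ f) n) ≡ K (pre ++ f 0 ∷ tower (f ∘ suc) n)
  column-operations a {K} A pre f c fs zero    = refl
  column-operations a {K} A pre f c fs (suc n) = begin
    K (pre ++ f 0 ∷ times a (f 0) ∷ tower (times a ∘ f ∘ suc) n)
      ≡⟨ sym (column A pre _ (λ x → trans (fs 0 x) (split-shift (u x) a (c 0) (f 0 x)))) ⟩
    K (pre ++ f 0 ∷ f 1 ∷ tower (times a ∘ f ∘ suc) n)
      ≡⟨ cong K (sym (++-assoc pre [ f 0 ] _)) ⟩
    K ((pre ++ [ f 0 ]) ++ f 1 ∷ tower (times a ∘ f ∘ suc) n)
      ≡⟨ column-operations a A (pre ++ [ f 0 ]) (f ∘ suc) (c ∘ suc) (λ j → fs (suc j)) n ⟩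
    K ((pre ++ [ f 0 ]) ++ f 1 ∷ tower (f ∘ suc ∘ suc) n)
      ≡⟨ cong K (++-assoc pre [ f 0 ] _) ⟩
    K (pre ++ f 0 ∷ f 1 ∷ tower (f ∘ suc ∘ suc) n) ∎
    where open ≡-Reasoning

  contract-vanishing : ∀ x K (f : ℕ → ℕ → ℚ) n → contract (ev x) K (tower (times (u x) ∘ f) n) ≡ 0ℚ
  contract-vanishing x K f zero    = refl
  contract-vanishing x K f (suc n) = trans
    (cong₂ (λ a b → a ⊗ K (tower (times (u x) ∘ f ∘ suc) n) ⊕ ⊖ b) (self-zero (u x) (f 0 x)) (contract-vanishing x _ (f ∘ suc) n))
    (trans (drop-zero _ 0ℚ) (⊗-zeroˡ _))

  -- After the column operations the row x is (f_0(x), 0, ..., 0) and every other row y contains the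
  -- factor u y - u x; the columns left over are again f_0, f_1, ...
  minor-vandermonde : ∀ (f : ℕ → ℕ → ℚ) c → (∀ j x → f (suc j) x ≡ (u x ⊕ ⊖ c j) ⊗ f j x) → ∀ x P n →
    minor ev x P (tower f n) ≡ vandermonde (f 0) x P n
  minor-vandermonde f c fs x []          zero    = refl
  minor-vandermonde f c fs x []          (suc n) = refl
  minor-vandermonde f c fs x (false ∷ P) n       = minor-vandermonde f c fs (suc x) P n
  minor-vandermonde f c fs x (true ∷ P)  zero    = refl
  minor-vandermonde f c fs x (true ∷ P)  (suc n) = begin
    contract (ev x) K (f 0 ∷ tower (f ∘ suc) n)
      ≡⟨ sym (column-operations (u x) (contract-alternating x (minor-alternating (suc x) P)) [] f c fs n) ⟩
    f 0 x ⊗ K (tower (times (u x) ∘ f) n) ⊕ ⊖ contract (ev x) (K ∘ (f 0 ∷_)) (tower (times (u x) ∘ f) n)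
      ≡⟨ cong (λ z → f 0 x ⊗ K (tower (times (u x) ∘ f) n) ⊕ ⊖ z) (contract-vanishing x _ f n) ⟩
    f 0 x ⊗ K (tower (times (u x) ∘ f) n) ⊕ ⊖ 0ℚ
      ≡⟨ minus-zero _ ⟩
    f 0 x ⊗ K (tower (times (u x) ∘ f) n)
      ≡⟨ cong (λ l → f 0 x ⊗ K l) (sym (map-tower (times (u x)) f n)) ⟩
    f 0 x ⊗ K (map (times (u x)) (tower f n))
      ≡⟨ cong (f 0 x ⊗_) (trans (minor-map (times (u x)) ev (suc x) P (tower f n)) (minor-rows _ ev (suc x) P (tower f n))) ⟩
    f 0 x ⊗ (prodOver (λ y → u y ⊕ ⊖ u x) (suc x) P ⊗ minor ev (suc x) P (tower f n))
      ≡⟨ cong (λ z → f 0 x ⊗ (_ ⊗ z)) (minor-vandermonde f c fs (suc x) P n) ⟩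
    _ ∎
    where
    open ≡-Reasoning
    K = minor ev (suc x) P

-- Closed form of the row-by-row recursion

par : ℕ → Bool
par zero    = false
par (suc n) = not (par n)

-- ⌈n/2⌉. Since the zigzag makes every other row longer, the line n rows below a northern side of
-- length L has L + ⌈n/2⌉ unit segments; ⌈n/2⌉ is also the number of marks on it.
rk : ℕ → ℕ
rk zero    = 0
rk (suc n) = if par n then rk n else suc (rk n)

kern : Bool → List Bool → List Bool → Bool
kern s P Q = if s then fits Q P else fits P Q

-- The rows that start with a down-pointing triangle are those with an even number, counted from the
-- top; a crossing of their leftmost upper segment is a western vertical lozenge.
wt : Bool → List Bool → ℚ
wt true (true ∷ _) = ½
wt _    _          = 1ℚ

none : List Bool → Bool
none []       = true
none (b ∷ bs) = not b ∧ none bs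

-- The weighted number of tilings of the top n rows of a region with a
-- vertical zigzag western side, northern side L and straight northeastern
-- side, where the up-pointing triangles along the bottom marked in P are
-- removed.
Tr : ℕ → ℕ → List Bool → ℚ
Tr L zero    P = ind (none P) 1ℚ
Tr L (suc n) P = sumB (L + rk n) (λ Q → wt (par n) Q ⊗ ind (kern (par n) P Q) (Tr L n Q))

ι-suc : ∀ n → ι (suc n) ≡ 1ℚ ⊕ ι n
ι-suc n = trans (ι-+ 1 n) (cong (_⊕ ι n) ι-1)

-- eᵤ j x = ∏_{l<j} (x² − l²) and oᵤ j x = (2x+1) ∏_{l<j} (x(x+1) − l(l+1)).
sq sqo : ℕ → ℚ
sq x = ι x ⊗ ι x
sqo x = ι x ⊗ (1ℚ ⊕ ι x)

eᵤ rᵤ oᵤ : ℕ → ℕ → ℚ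
eᵤ zero    x = 1ℚ
eᵤ (suc j) x = (sq x ⊕ ⊖ sq j) ⊗ eᵤ j x
rᵤ zero    x = 1ℚ
rᵤ (suc j) x = (sqo x ⊕ ⊖ sqo j) ⊗ rᵤ j x
oᵤ j x = (ι x ⊕ (1ℚ ⊕ ι x)) ⊗ rᵤ j x

private opaque
  unfolding _⊕_ isZero
  a0 : ∀ X → ((1ℚ ⊕ X) ⊗ (1ℚ ⊕ X) ⊕ ⊖ (0ℚ ⊗ 0ℚ)) ⊗ 1ℚ ≡ (1ℚ ⊕ X) ⊗ (1ℚ ⊕ X ⊕ 0ℚ) ⊗ 1ℚ
  a0 = solve-∀ ℚ-ring
  a1 : ∀ X J r → ((1ℚ ⊕ X) ⊗ (1ℚ ⊕ X) ⊕ ⊖ ((1ℚ ⊕ J) ⊗ (1ℚ ⊕ J))) ⊗ ((1ℚ ⊕ X) ⊗ (1ℚ ⊕ X ⊕ J) ⊗ r)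
    ≡ (1ℚ ⊕ X) ⊗ (1ℚ ⊕ X ⊕ (1ℚ ⊕ J)) ⊗ ((X ⊗ (1ℚ ⊕ X) ⊕ ⊖ (J ⊗ (1ℚ ⊕ J))) ⊗ r)
  a1 = solve-∀ ℚ-ring
  b0 : ∀ X → (X ⊗ X ⊕ ⊖ (0ℚ ⊗ 0ℚ)) ⊗ 1ℚ ≡ X ⊗ (X ⊕ ⊖ 0ℚ) ⊗ 1ℚ
  b0 = solve-∀ ℚ-ring
  b1 : ∀ X J r → (X ⊗ X ⊕ ⊖ ((1ℚ ⊕ J) ⊗ (1ℚ ⊕ J))) ⊗ (X ⊗ (X ⊕ ⊖ J) ⊗ r)
    ≡ X ⊗ (X ⊕ ⊖ (1ℚ ⊕ J)) ⊗ ((X ⊗ (1ℚ ⊕ X) ⊕ ⊖ (J ⊗ (1ℚ ⊕ J))) ⊗ r)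
  b1 = solve-∀ ℚ-ring
  c0 : ∀ X → (X ⊗ (1ℚ ⊕ X) ⊕ ⊖ (0ℚ ⊗ (1ℚ ⊕ 0ℚ))) ⊗ 1ℚ ≡ (X ⊕ ⊖ 0ℚ) ⊗ (1ℚ ⊕ X ⊕ ⊖ 0ℚ) ⊗ 1ℚ
  c0 = solve-∀ ℚ-ring
  c1 : ∀ X J r → (X ⊗ (1ℚ ⊕ X) ⊕ ⊖ ((1ℚ ⊕ J) ⊗ (1ℚ ⊕ (1ℚ ⊕ J)))) ⊗ ((X ⊕ ⊖ J) ⊗ (1ℚ ⊕ X ⊕ ⊖ J) ⊗ r)
    ≡ (X ⊕ ⊖ (1ℚ ⊕ J)) ⊗ (1ℚ ⊕ X ⊕ ⊖ (1ℚ ⊕ J)) ⊗ (((1ℚ ⊕ X) ⊗ (1ℚ ⊕ (1ℚ ⊕ X)) ⊕ ⊖ (J ⊗ (1ℚ ⊕ J))) ⊗ r)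
  c1 = solve-∀ ℚ-ring
  d1 : ∀ X J r → (1ℚ ⊕ J) ⊗ ((X ⊕ (1ℚ ⊕ X)) ⊗ r) ⊕ X ⊗ (X ⊕ ⊖ J) ⊗ r ≡ (1ℚ ⊕ X) ⊗ (1ℚ ⊕ X ⊕ J) ⊗ r
  d1 = solve-∀ ℚ-ring
  f0 : ∀ X → (1ℚ ⊕ 1ℚ) ⊗ (0ℚ ⊕ (1ℚ ⊕ 0ℚ)) ⊗ 1ℚ ⊕ (X ⊕ (1ℚ ⊕ X)) ⊗ 1ℚ ≡ ((1ℚ ⊕ X) ⊕ (1ℚ ⊕ (1ℚ ⊕ X))) ⊗ 1ℚ
  f0 = solve-∀ ℚ-ring
  f1 : ∀ X J r → (1ℚ ⊕ 1ℚ) ⊗ ((1ℚ ⊕ J) ⊕ (1ℚ ⊕ (1ℚ ⊕ J))) ⊗ ((1ℚ ⊕ X) ⊗ (1ℚ ⊕ X ⊕ ⊖ J) ⊗ r) ⊕ (X ⊕ (1ℚ ⊕ X)) ⊗ ((X ⊕ ⊖ J) ⊗ (1ℚ ⊕ X ⊕ ⊖ J) ⊗ r)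
    ≡ ((1ℚ ⊕ X) ⊕ (1ℚ ⊕ (1ℚ ⊕ X))) ⊗ (((1ℚ ⊕ X) ⊗ (1ℚ ⊕ (1ℚ ⊕ X)) ⊕ ⊖ (J ⊗ (1ℚ ⊕ J))) ⊗ r)
  f1 = solve-∀ ℚ-ring
  g1 : ∀ z → z ⊗ 0ℚ ≡ 0ℚ
  g1 = solve-∀ ℚ-ring
  g2 : (0ℚ ⊗ 0ℚ ⊕ ⊖ (0ℚ ⊗ 0ℚ)) ⊗ 1ℚ ≡ 0ℚ
  g2 = refl
  g3 : (0ℚ ⊗ (1ℚ ⊕ 0ℚ) ⊕ ⊖ (0ℚ ⊗ (1ℚ ⊕ 0ℚ))) ⊗ 1ℚ ≡ 0ℚ
  g3 = refl
  g4 : (0ℚ ⊕ (1ℚ ⊕ 0ℚ)) ⊗ 1ℚ ≡ 1ℚ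
  g4 = refl
  g5 : ½ ⊗ 1ℚ ≡ inv 2
  g5 = refl

-- By x² - l² = (x - l)(x + l) and x(x + 1) - l(l + 1) = (x - l)(x + l + 1) the products in question
-- share all but the outermost linear factors, which this and the next two identities single out.
e-suc : ∀ j x → eᵤ (suc j) (suc x) ≡ (1ℚ ⊕ ι x) ⊗ (1ℚ ⊕ ι x ⊕ ι j) ⊗ rᵤ j x
e-suc zero    x rewrite ι-suc x | ι-0 = a0 (ι x)
e-suc (suc j) x = trans (cong₂ _⊗_ (cong₂ (λ a b → a ⊗ a ⊕ ⊖ (b ⊗ b)) (ι-suc x) (ι-suc j)) (e-suc j x))
  (trans (a1 (ι x) (ι j) (rᵤ j x)) (cong (λ a → (1ℚ ⊕ ι x) ⊗ (1ℚ ⊕ ι x ⊕ a) ⊗ rᵤ (suc j) x) (sym (ι-suc j))))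

e-r : ∀ j x → eᵤ (suc j) x ≡ ι x ⊗ (ι x ⊕ ⊖ ι j) ⊗ rᵤ j x
e-r zero    x rewrite ι-0 = b0 (ι x)
e-r (suc j) x = trans (cong₂ _⊗_ (cong (λ b → sq x ⊕ ⊖ (b ⊗ b)) (ι-suc j)) (e-r j x))
  (trans (b1 (ι x) (ι j) (rᵤ j x)) (cong (λ a → ι x ⊗ (ι x ⊕ ⊖ a) ⊗ rᵤ (suc j) x) (sym (ι-suc j))))

r-suc : ∀ j x → rᵤ (suc j) x ≡ (ι x ⊕ ⊖ ι j) ⊗ (1ℚ ⊕ ι x ⊕ ⊖ ι j) ⊗ rᵤ j (suc x)
r-suc zero    x rewrite ι-0 = c0 (ι x)
r-suc (suc j) x = trans (cong₂ _⊗_ (cong (λ b → sqo x ⊕ ⊖ (b ⊗ (1ℚ ⊕ b))) (ι-suc j)) (r-suc j x))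
  (trans (c1 (ι x) (ι j) (rᵤ j (suc x)))
    (cong₂ (λ a b → (ι x ⊕ ⊖ a) ⊗ (1ℚ ⊕ ι x ⊕ ⊖ a) ⊗ ((b ⊗ (1ℚ ⊕ b) ⊕ ⊖ sqo j) ⊗ rᵤ j (suc x))) (sym (ι-suc j)) (sym (ι-suc x))))

-- Both values of e_{j+1} are multiples of r_j(x), and their cofactors differ by (j + 1)(2x + 1).
e-step : ∀ j x → ι (suc j) ⊗ oᵤ j x ⊕ eᵤ (suc j) x ≡ eᵤ (suc j) (suc x)
e-step j x = trans (cong₂ (λ a b → a ⊗ oᵤ j x ⊕ b) (ι-suc j) (e-r j x)) (trans (d1 (ι x) (ι j) (rᵤ j x)) (sym (e-suc j x)))

o-step : ∀ j x → (1ℚ ⊕ 1ℚ) ⊗ (ι j ⊕ (1ℚ ⊕ ι j)) ⊗ eᵤ j (suc x) ⊕ oᵤ j x ≡ oᵤ j (suc x)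
o-step zero x rewrite ι-0 | ι-suc x = f0 (ι x)
o-step (suc j) x = trans
  (cong₂ _⊕_ (cong₂ (λ a b → (1ℚ ⊕ 1ℚ) ⊗ (a ⊕ (1ℚ ⊕ a)) ⊗ b) (ι-suc j)
               (trans (e-r j (suc x)) (cong (λ a → a ⊗ (a ⊕ ⊖ ι j) ⊗ rᵤ j (suc x)) (ι-suc x))))
             (cong ((ι x ⊕ (1ℚ ⊕ ι x)) ⊗_) (r-suc j x)))
  (trans (f1 (ι x) (ι j) (rᵤ j (suc x)))
         (cong (λ a → (a ⊕ (1ℚ ⊕ a)) ⊗ ((a ⊗ (1ℚ ⊕ a) ⊕ ⊖ sqo j) ⊗ rᵤ j (suc x))) (sym (ι-suc x))))

e-0 : ∀ j → eᵤ (suc j) 0 ≡ 0ℚ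
e-0 zero    rewrite ι-0 = g2
e-0 (suc j) = trans (cong ((sq 0 ⊕ ⊖ sq (suc j)) ⊗_) (e-0 j)) (g1 _)

r-0 : ∀ j → rᵤ (suc j) 0 ≡ 0ℚ
r-0 zero    rewrite ι-0 = g3
r-0 (suc j) = trans (cong ((sqo 0 ⊕ ⊖ sqo (suc j)) ⊗_) (r-0 j)) (g1 _)

-- The reciprocal of the factor 2(2j + 1) that `o-step` produces in front of e_j.
κ : ℕ → ℚ
κ j = inv (2 * (j + suc j))

κ-inverse : ∀ j a → κ j ⊗ ((1ℚ ⊕ 1ℚ) ⊗ (ι j ⊕ (1ℚ ⊕ ι j)) ⊗ a) ≡ a
κ-inverse j a = begin
  κ j ⊗ ((1ℚ ⊕ 1ℚ) ⊗ (ι j ⊕ (1ℚ ⊕ ι j)) ⊗ a) ≡⟨ cong (λ z → κ j ⊗ (z ⊗ a)) (sym two) ⟩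
  κ j ⊗ (ι m ⊗ a)                             ≡⟨ sym (⊗-assoc _ _ _) ⟩
  κ j ⊗ ι m ⊗ a                               ≡⟨ cong (_⊗ a) (trans (⊗-comm _ _) (ι-inv m {{nz}})) ⟩
  1ℚ ⊗ a                                      ≡⟨ ⊗-identityˡ a ⟩
  a ∎
  where
  open ≡-Reasoning
  m = 2 * (j + suc j)
  nz : NonZero (2 * (j + suc j))
  nz rewrite ℕₚ.+-suc j j = _
  two : ι m ≡ (1ℚ ⊕ 1ℚ) ⊗ (ι j ⊕ (1ℚ ⊕ ι j))
  two = trans (ι-* 2 (j + suc j)) (cong₂ _⊗_ (trans (ι-+ 1 1) (cong₂ _⊕_ ι-1 ι-1)) (trans (ι-+ j (suc j)) (cong (ι j ⊕_) (ι-suc j))))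

minor-suc : ∀ {G : Set} (φ : ℕ → G → ℚ) x P gs → minor φ (suc x) P gs ≡ minor (φ ∘ suc) x P gs
minor-suc φ x []          gs = refl
minor-suc φ x (false ∷ P) gs = minor-suc φ (suc x) P gs
minor-suc φ x (true ∷ P)  gs = contract-cong (λ _ → refl) (minor-suc φ (suc x) P) gs

φe φo : ℕ → ℕ → ℚ
φe x j = eᵤ j x
φo x j = oᵤ j x

φ : Bool → ℕ → ℕ → ℚ
φ s = if s then φe else φo

module EvenToOdd where
  X Y : ℕ → ℕ → ℚ
  X x k = ι k ⊗ oᵤ (ℕ.pred k) x
  Y = φe

  X0 : ∀ x → X x 0 ≡ 0ℚ
  X0 x = trans (cong (_⊗ oᵤ 0 x) ι-0) (⊗-zeroˡ _)

  step : ∀ x k → X x k ⊕ Y x k ≡ Y (suc x) k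
  step x zero    = trans (cong (_⊕ 1ℚ) (X0 x)) (⊕-identityˡ _)
  step x (suc k) = e-step k x

  -- The index 0 stands for e_0 = 1, the additional column, on which the difference X vanishes. The
  -- other columns e_k have the differences k o_{k-1}, whence the product of 1, ..., r.
  sum-minor : ∀ m r P → length P ≡ suc m →
    prodList ι (tower suc r) ⊗ sumB m (λ Q → ind (fits P Q) (minor φo 0 Q (tower id r))) ≡ minor φe 0 P (tower id (suc r))
  sum-minor m r P e = begin
    prodList ι ts ⊗ sumB m (λ Q → ind (fits P Q) (minor φo 0 Q (tower id r)))
      ≡⟨ sym (sumB-⊗ m _ _) ⟩
    sumB m (λ Q → prodList ι ts ⊗ ind (fits P Q) (minor φo 0 Q (tower id r)))
      ≡⟨ sumB-cong m (λ Q _ → trans (ind-⊗ (fits P Q) _ _) (cong (ind (fits P Q)) (rescale Q))) ⟩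
    sumB m (λ Q → ind (fits P Q) (minor X 0 Q ts))
      ≡⟨ sum-interˡ X m P 0 ts e ⟩
    interˡ X P 0 ts
      ≡⟨ interˡ-minor X Y step 0 (λ _ → refl) X0 P 0 ts ⟩
    minor φe 0 P (0 ∷ ts) ∎
    where
    open ≡-Reasoning
    ts = tower suc r
    rescale : ∀ Q → prodList ι ts ⊗ minor φo 0 Q (tower id r) ≡ minor X 0 Q ts
    rescale Q = sym (trans (minor-columns ι (λ x k → oᵤ (ℕ.pred k) x) 0 Q ts)
      (cong (prodList ι ts ⊗_) (trans (sym (minor-map ℕ.pred φo 0 Q ts)) (cong (minor φo 0 Q) (map-tower ℕ.pred suc r)))))

module OddToEven where
  X Y : ℕ → ℕ → ℚ
  X zero    j = ½ ⊗ eᵤ j 0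
  X (suc x) j = eᵤ j (suc x)
  Y zero    j = 0ℚ
  Y (suc x) j = κ j ⊗ oᵤ j x

  -- At x = 0 this asks for κ_j o_j(0) = e_j(0)/2: both sides are 1/2 for j = 0 and 0 otherwise. It
  -- is here that the weight 1/2 of the western lozenges enters.
  step : ∀ x j → X x j ⊕ Y x j ≡ Y (suc x) j
  step zero    zero    = trans (⊕-identityʳ _) (trans g5 (sym (trans (cong (κ 0 ⊗_) (trans (cong (λ a → (a ⊕ (1ℚ ⊕ a)) ⊗ 1ℚ) ι-0) g4)) (⊗-identityʳ _))))
  step zero    (suc j) = trans (⊕-identityʳ _) (trans (cong (½ ⊗_) (e-0 j)) (trans (⊗-zeroʳ ½) (sym (trans (cong (λ a → κ (suc j) ⊗ (_ ⊗ a)) (r-0 j)) (trans (cong (κ (suc j) ⊗_) (⊗-zeroʳ _)) (⊗-zeroʳ _))))))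
  step (suc x) j       = trans (cong (_⊕ κ j ⊗ oᵤ j x) (sym (κ-inverse j _))) (trans (sym (⊗-distribˡ-⊕ (κ j) _ _)) (cong (κ j ⊗_) (o-step j x)))

  weighted : ∀ Q gs → wt true Q ⊗ minor φe 0 Q gs ≡ minor X 0 Q gs
  weighted []          gs = ⊗-identityˡ _
  weighted (false ∷ Q) gs = trans (⊗-identityˡ _) (minor-cong 1 Q (λ { (suc y) j _ → refl }) gs)
  weighted (true ∷ Q)  gs = trans (sym (contract-⊗ˡ ½ (φe 0) _ gs)) (contract-cong (λ _ → refl) (minor-cong 1 Q (λ { (suc y) j _ → refl })) gs)

  sum-minor : ∀ m r P → length P ≡ m →
    sumB m (λ Q → wt true Q ⊗ ind (fits Q P) (minor φe 0 Q (tower id r))) ≡ prodList κ (tower id r) ⊗ minor φo 0 P (tower id r)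
  sum-minor m r P e = begin
    sumB m (λ Q → wt true Q ⊗ ind (fits Q P) (minor φe 0 Q js))
      ≡⟨ sumB-cong m (λ Q _ → trans (ind-⊗ (fits Q P) _ _) (cong (ind (fits Q P)) (weighted Q js))) ⟩
    sumB m (λ Q → ind (fits Q P) (minor X 0 Q js))
      ≡⟨ sum-interʳ X m P 0 js e ⟩
    interʳ X P 0 js
      ≡⟨ interʳ-0 X Y step (λ _ → refl) P js ⟩
    minor Y 1 P js
      ≡⟨ minor-suc Y 0 P js ⟩
    minor (λ x j → κ j ⊗ oᵤ j x) 0 P js
      ≡⟨ minor-columns κ φo 0 P js ⟩
    prodList κ js ⊗ minor φo 0 P js ∎
    where
    open ≡-Reasoning
    js = tower id r

count : List Bool → ℕ
count []          = 0
count (false ∷ P) = count P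
count (true ∷ P)  = suc (count P)

bit : Bool → ℕ
bit s = if s then 0 else 1

-- The factored form of y² - x², respectively y(y + 1) - x(x + 1), for y = x + d + 1. It involves no
-- subtraction, so the Vandermonde products live in ℕ.
gap : Bool → ℕ → ℕ → ℕ
gap s x d = suc d * (x + x + suc d + bit s)

-- cross s x d P pairs the position x with the positions marked in P, the
-- first of which is x + suc d.
cross : Bool → ℕ → ℕ → List Bool → ℕ
cross s x d []          = 1
cross s x d (false ∷ P) = cross s x (suc d) P
cross s x d (true ∷ P)  = gap s x d * cross s x (suc d) P

weight : Bool → ℕ → ℕ
weight s x = if s then 1 else x + suc x

Vdm : Bool → ℕ → List Bool → ℕ
Vdm s x []          = 1
Vdm s x (false ∷ P) = Vdm s (suc x) P
Vdm s x (true ∷ P)  = weight s x * (cross s x 0 P * Vdm s (suc x) P)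

node : Bool → ℕ → ℚ
node s = if s then sq else sqo

private opaque
  unfolding _⊕_ isZero
  gap-e : ∀ X D → (X ⊕ D) ⊗ (X ⊕ D) ⊕ ⊖ (X ⊗ X) ≡ D ⊗ (X ⊕ X ⊕ D ⊕ 0ℚ)
  gap-e = solve-∀ ℚ-ring
  gap-o : ∀ X D → (X ⊕ D) ⊗ (1ℚ ⊕ (X ⊕ D)) ⊕ ⊖ (X ⊗ (1ℚ ⊕ X)) ≡ D ⊗ (X ⊕ X ⊕ D ⊕ 1ℚ)
  gap-o = solve-∀ ℚ-ring

node-gap : ∀ s x d → node s (x + suc d) ⊕ ⊖ node s x ≡ ι (gap s x d)
node-gap s x d = trans (lem s) (sym (trans (ι-* (suc d) _) (cong (ι (suc d) ⊗_)
  (trans (ι-+ (x + x + suc d) (bit s)) (cong (_⊕ ι (bit s)) (trans (ι-+ (x + x) (suc d)) (cong (_⊕ ι (suc d)) (ι-+ x x))))))))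
  where
  lem : ∀ s → node s (x + suc d) ⊕ ⊖ node s x ≡ ι (suc d) ⊗ (ι x ⊕ ι x ⊕ ι (suc d) ⊕ ι (bit s))
  lem true  rewrite ι-+ x (suc d) | ι-0 = gap-e (ι x) (ι (suc d))
  lem false rewrite ι-+ x (suc d) | ι-1 = gap-o (ι x) (ι (suc d))

prodOver-cross : ∀ s x d P → prodOver (λ y → node s y ⊕ ⊖ node s x) (x + suc d) P ≡ ι (cross s x d P)
prodOver-cross s x d []          = sym ι-1
prodOver-cross s x d (false ∷ P) = trans (cong (λ z → prodOver (λ y → node s y ⊕ ⊖ node s x) z P) (sym (ℕₚ.+-suc x (suc d)))) (prodOver-cross s x (suc d) P)
prodOver-cross s x d (true ∷ P)  = trans
  (cong₂ _⊗_ (node-gap s x d) (trans (cong (λ z → prodOver (λ y → node s y ⊕ ⊖ node s x) z P) (sym (ℕₚ.+-suc x (suc d)))) (prodOver-cross s x (suc d) P)))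
  (sym (ι-* (gap s x d) _))

weight-φ : ∀ s x → φ s x 0 ≡ ι (weight s x)
weight-φ true  x = sym ι-1
weight-φ false x = trans (⊗-identityʳ _) (sym (trans (ι-+ x (suc x)) (cong (ι x ⊕_) (ι-suc x))))

vandermonde-Vdm : ∀ s x P n → vandermonde (node s) (λ y → φ s y 0) x P n ≡ ind (count P ℕ.≡ᵇ n) (ι (Vdm s x P))
vandermonde-Vdm s x []          zero    = sym ι-1
vandermonde-Vdm s x []          (suc n) = refl
vandermonde-Vdm s x (false ∷ P) n       = vandermonde-Vdm s (suc x) P n
vandermonde-Vdm s x (true ∷ P)  zero    = refl
vandermonde-Vdm s x (true ∷ P)  (suc n) = begin
  φ s x 0 ⊗ (prodOver (λ y → node s y ⊕ ⊖ node s x) (suc x) P ⊗ vandermonde (node s) (λ y → φ s y 0) (suc x) P n)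
    ≡⟨ cong₂ _⊗_ (weight-φ s x) (cong₂ _⊗_ (trans (cong (λ z → prodOver (λ y → node s y ⊕ ⊖ node s x) z P) (ℕₚ.+-comm 1 x)) (prodOver-cross s x 0 P)) (vandermonde-Vdm s (suc x) P n)) ⟩
  ι (weight s x) ⊗ (ι (cross s x 0 P) ⊗ ind t (ι (Vdm s (suc x) P)))
    ≡⟨ cong (ι (weight s x) ⊗_) (ind-⊗ t _ _) ⟩
  ι (weight s x) ⊗ ind t (ι (cross s x 0 P) ⊗ ι (Vdm s (suc x) P))
    ≡⟨ ind-⊗ t _ _ ⟩
  ind t (ι (weight s x) ⊗ (ι (cross s x 0 P) ⊗ ι (Vdm s (suc x) P)))
    ≡⟨ cong (ind t) (sym (trans (ι-* (weight s x) _) (cong (ι (weight s x) ⊗_) (ι-* (cross s x 0 P) _)))) ⟩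
  ind t (ι (Vdm s x (true ∷ P))) ∎
  where
  open ≡-Reasoning
  t = count P ℕ.≡ᵇ n

minor-Vdm : ∀ s P r → minor (φ s) 0 P (tower id r) ≡ ind (count P ℕ.≡ᵇ r) (ι (Vdm s 0 P))
minor-Vdm true P r = trans (trans (sym (minor-map eᵤ ev 0 P (tower id r))) (cong (minor ev 0 P) (map-tower eᵤ id r)))
  (trans (minor-vandermonde sq eᵤ sq (λ _ _ → refl) 0 P r) (vandermonde-Vdm true 0 P r))
minor-Vdm false P r = trans (trans (sym (minor-map oᵤ ev 0 P (tower id r))) (cong (minor ev 0 P) (map-tower oᵤ id r)))
  (trans (minor-vandermonde sqo oᵤ sqo (λ j x → ⊗-swap _ _ _) 0 P r) (vandermonde-Vdm false 0 P r))

-- The constants of the first n rows multiplied together: with r = rk of the row, r! for a row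
-- starting with an up-pointing triangle and 2^r · 1 · 3 ··· (2r - 1) for the others.
den : ℕ → ℕ
den n = (if par n then 1 else 2 ^ rk n) * H₂ (suc n)

rk-even : ∀ n → par n ≡ false → n ≡ rk n + rk n
rk-odd  : ∀ n → par n ≡ true → suc n ≡ rk n + rk n
rk-even zero    e = refl
rk-even (suc n) e with par n in p
... | true = rk-odd n p
rk-odd (suc n) e with par n in p
... | false = cong suc (trans (cong suc (rk-even n p)) (sym (ℕₚ.+-suc (rk n) (rk n))))

-- The quotient H₂(2q + 2) / H₂(2q + 1) is the product of (2i)! / (2i - 1)! = 2i over 1 ≤ i ≤ q.
H₂-ratio : ∀ q → H₂ (2 + (q + q)) ≡ 2 ^ q * H₂ (1 + (q + q)) * q !
H₂-ratio zero    = refl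
H₂-ratio (suc q) rewrite ℕₚ.+-suc q q = trans (cong (_* ((2 + (q + q)) !)) (H₂-ratio q))
  (shuffle (2 ^ q) (H₂ (1 + (q + q))) (q !) ((1 + (q + q)) !) q)
  where
  shuffle : ∀ a b c d q → a * b * c * ((2 + (q + q)) * d) ≡ (2 * a) * (b * d) * ((1 + q) * c)
  shuffle = ℕ-Ring.solve-∀

oddProduct : ℕ → ℕ
oddProduct zero    = 1
oddProduct (suc q) = oddProduct q * (2 * (q + suc q))

-- The quotient H₂(2q + 1) / H₂(2q) is the product of (2i + 1)! / (2i)! = 2i + 1 over i < q.
H₂-ratio′ : ∀ q → 2 ^ q * H₂ (1 + (q + q)) ≡ H₂ (q + q) * oddProduct q
H₂-ratio′ zero    = refl
H₂-ratio′ (suc q) rewrite ℕₚ.+-suc q q = begin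
  (2 * a) * (b * ((1 + (q + q)) * f)) ≡⟨ s₁ a b f q ⟩
  (a * b) * (f * (2 * (1 + (q + q)))) ≡⟨ cong (_* (f * (2 * (1 + (q + q))))) (H₂-ratio′ q) ⟩
  (H₂ (q + q) * o) * (f * (2 * (1 + (q + q)))) ≡⟨ ℕ⊗ (H₂ (q + q)) o f (2 * (1 + (q + q))) ⟩
  H₂ (q + q) * f * (o * (2 * (1 + (q + q)))) ∎
  where
  open ≡-Reasoning
  a = 2 ^ q
  b = H₂ (1 + (q + q))
  f = (q + q) !
  o = oddProduct q
  s₁ : ∀ a b f q → (2 * a) * (b * ((1 + (q + q)) * f)) ≡ (a * b) * (f * (2 * (1 + (q + q))))
  s₁ = ℕ-Ring.solve-∀
  ℕ⊗ : ∀ a b c d → a * b * (c * d) ≡ a * c * (b * d)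
  ℕ⊗ = ℕ-Ring.solve-∀

den-even : ∀ n → par n ≡ false → den (suc n) ≡ den n * (rk n) !
den-even n p rewrite p = trans (ℕₚ.*-identityˡ _) (subst (λ m → H₂ (2 + m) ≡ 2 ^ rk n * H₂ (1 + m) * (rk n) !) (sym (rk-even n p)) (H₂-ratio (rk n)))

den-odd : ∀ n → par n ≡ true → den (suc n) ≡ den n * oddProduct (rk n)
den-odd n p rewrite p = subst (λ m → 2 ^ rk n * H₂ (1 + m) ≡ 1 * H₂ m * oddProduct (rk n)) (sym (rk-odd n p))
  (trans (H₂-ratio′ (rk n)) (cong (_* oddProduct (rk n)) (sym (ℕₚ.*-identityˡ (H₂ (rk n + rk n))))))

prodList-snoc : ∀ {G : Set} (s : G → ℚ) F n → prodList s (tower F (suc n)) ≡ prodList s (tower F n) ⊗ s (F n)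
prodList-snoc s F zero    = trans (⊗-identityʳ _) (sym (⊗-identityˡ _))
prodList-snoc s F (suc n) = trans (cong (s (F 0) ⊗_) (prodList-snoc s (F ∘ suc) n)) (sym (⊗-assoc _ _ _))

prodList-! : ∀ r → prodList ι (tower suc r) ≡ ι (r !)
prodList-! zero    = sym ι-1
prodList-! (suc r) = trans (prodList-snoc ι suc r) (trans (cong (_⊗ ι (suc r)) (prodList-! r)) (trans (⊗-comm _ _) (sym (ι-* (suc r) (r !)))))

prodList-κ : ∀ r → prodList κ (tower id r) ≡ inv (oddProduct r)
prodList-κ zero    = sym inv-1
prodList-κ (suc r) = trans (prodList-snoc κ id r) (trans (cong (_⊗ κ r) (prodList-κ r)) (sym (inv-* (oddProduct r) _)))

factorial-nonZero : ∀ n → NonZero (n !)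
factorial-nonZero n = ℕ.>-nonZero (ℕₚ.1≤n! n)

H₂-nonZero : ∀ n → NonZero (H₂ n)
H₂-nonZero zero          = _
H₂-nonZero (suc zero)    = _
H₂-nonZero (suc (suc n)) = ℕₚ.m*n≢0 (H₂ n) (n !) {{H₂-nonZero n}} {{factorial-nonZero n}}

divide : ∀ n → .{{NonZero n}} → ∀ a {b} → ι n ⊗ a ≡ b → a ≡ inv n ⊗ b
divide n a e = trans (sym (trans (cong (_⊗ a) (trans (⊗-comm _ _) (ι-inv n))) (⊗-identityˡ a))) (trans (⊗-assoc _ _ _) (cong (inv n ⊗_) e))

-- The induction runs over determinants rather than over their Vandermonde values, because it is the
-- multilinearity of the former that makes the sum over Q tractable.
Tr-minor : ∀ L n P → length P ≡ L + rk n → Tr L n P ≡ inv (den n) ⊗ minor (φ (par n)) 0 P (tower id (rk n))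
Tr-minor L zero    P e = trans (base 0 P) (sym (trans (cong (_⊗ minor φo 0 P []) inv-1) (⊗-identityˡ _)))
  where
  base : ∀ x P → ind (none P) 1ℚ ≡ minor φo x P []
  base x []          = refl
  base x (false ∷ P) = base (suc x) P
  base x (true ∷ P)  = refl
Tr-minor L (suc n) P e with par n in p
... | false = begin
  sumB m (λ Q → 1ℚ ⊗ ind (fits P Q) (Tr L n Q))
    ≡⟨ sumB-cong m (λ Q l → trans (⊗-identityˡ _) (trans (cong (ind (fits P Q)) (trans (Tr-minor L n Q l) (cong (λ s → inv (den n) ⊗ minor (φ s) 0 Q (tower id r)) p))) (sym (ind-⊗ (fits P Q) _ _)))) ⟩
  sumB m (λ Q → inv (den n) ⊗ ind (fits P Q) (minor φo 0 Q (tower id r)))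
    ≡⟨ sumB-⊗ m _ _ ⟩
  inv (den n) ⊗ sumB m (λ Q → ind (fits P Q) (minor φo 0 Q (tower id r)))
    ≡⟨ cong (inv (den n) ⊗_) (divide (r !) {{factorial-nonZero r}} _ (trans (cong (_⊗ sumB m (λ Q → ind (fits P Q) (minor φo 0 Q (tower id r)))) (sym (prodList-! r))) (EvenToOdd.sum-minor m r P (trans e (ℕₚ.+-suc L r))))) ⟩
  inv (den n) ⊗ (inv (r !) ⊗ M′)
    ≡⟨ trans (sym (⊗-assoc _ _ _)) (cong (_⊗ M′) (trans (sym (inv-* (den n) (r !))) (cong inv (trans (sym (den-even n p)) (den-suc p))))) ⟩
  inv (1 * H₂ (2 + n)) ⊗ M′ ∎
  where
  open ≡-Reasoning
  r = rk n
  m = L + r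
  M′ = minor φe 0 P (tower id (suc r))
  den-suc : par n ≡ false → den (suc n) ≡ 1 * H₂ (2 + n)
  den-suc p rewrite p = refl
... | true = begin
  sumB m (λ Q → wt true Q ⊗ ind (fits Q P) (Tr L n Q))
    ≡⟨ sumB-cong m (λ Q l → trans (cong (λ z → wt true Q ⊗ ind (fits Q P) z) (trans (Tr-minor L n Q l) (cong (λ s → inv (den n) ⊗ minor (φ s) 0 Q (tower id r)) p))) (trans (cong (wt true Q ⊗_) (sym (ind-⊗ (fits Q P) _ _))) (⊗-swap _ _ _))) ⟩
  sumB m (λ Q → inv (den n) ⊗ (wt true Q ⊗ ind (fits Q P) (minor φe 0 Q (tower id r))))
    ≡⟨ sumB-⊗ m _ _ ⟩
  inv (den n) ⊗ sumB m (λ Q → wt true Q ⊗ ind (fits Q P) (minor φe 0 Q (tower id r)))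
    ≡⟨ cong (inv (den n) ⊗_) (trans (OddToEven.sum-minor m r P e) (cong (_⊗ M′) (prodList-κ r))) ⟩
  inv (den n) ⊗ (inv (oddProduct r) ⊗ M′)
    ≡⟨ trans (sym (⊗-assoc _ _ _)) (cong (_⊗ M′) (trans (sym (inv-* (den n) (oddProduct r))) (cong inv (trans (sym (den-odd n p)) (den-suc p))))) ⟩
  inv (2 ^ r * H₂ (2 + n)) ⊗ M′ ∎
  where
  open ≡-Reasoning
  r = rk n
  m = L + r
  M′ = minor φo 0 P (tower id r)
  den-suc : par n ≡ true → den (suc n) ≡ 2 ^ rk n * H₂ (2 + n)
  den-suc p rewrite p = refl

Tr-formula : ∀ L n P → length P ≡ L + rk n → Tr L n P ≡ inv (den n) ⊗ ind (count P ℕ.≡ᵇ rk n) (ι (Vdm (par n) 0 P))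
Tr-formula L n P e = trans (Tr-minor L n P e) (cong (inv (den n) ⊗_) (minor-Vdm (par n) P (rk n)))

-- Tilings, strip by strip

sumOver : {A : Set} → (A → ℚ) → List A → ℚ
sumOver f []       = 0ℚ
sumOver f (x ∷ xs) = f x ⊕ sumOver f xs

weightOf : (Lozenge → ℚ) → List Lozenge → ℚ
weightOf w T = prodℚ (map w T)

Mᶠ : (Lozenge → ℚ) → ℕ → List Cell → ℚ
Mᶠ w f S = sumOver (weightOf w) (tilingsF f S)

sumOver-unfold : ∀ {A : Set} (f : A → ℚ) xs → sumℚ (map f xs) ≡ sumOver f xs
sumOver-unfold f []       = refl
sumOver-unfold f (x ∷ xs) = trans (⊕-unfold _ _) (cong (f x ⊕_) (sumOver-unfold f xs))

M-unfold : ∀ w S → M w S ≡ Mᶠ w (length S) S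
M-unfold w S = sumOver-unfold _ (tilings S)

sumOver-++ : ∀ {A : Set} (f : A → ℚ) xs ys → sumOver f (xs ++ ys) ≡ sumOver f xs ⊕ sumOver f ys
sumOver-++ f []       ys = sym (⊕-identityˡ _)
sumOver-++ f (x ∷ xs) ys = trans (cong (f x ⊕_) (sumOver-++ f xs ys)) (sym (⊕-assoc _ _ _))

sumOver-cong : ∀ {A : Set} {f g : A → ℚ} → (∀ x → f x ≡ g x) → ∀ xs → sumOver f xs ≡ sumOver g xs
sumOver-cong h []       = refl
sumOver-cong h (x ∷ xs) = cong₂ _⊕_ (h x) (sumOver-cong h xs)

sumOver-concatMap : ∀ {A B : Set} (f : B → ℚ) (t : A → List B) xs → sumOver f (concatMap t xs) ≡ sumOver (λ x → sumOver f (t x)) xs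
sumOver-concatMap f t []       = refl
sumOver-concatMap f t (x ∷ xs) = trans (sumOver-++ f (t x) _) (cong (_ ⊕_) (sumOver-concatMap f t xs))

sumOver-∷ : ∀ w l Ts → sumOver (weightOf w) (map (l ∷_) Ts) ≡ w l ⊗ sumOver (weightOf w) Ts
sumOver-∷ w l []       = sym (⊗-zeroʳ _)
sumOver-∷ w l (T ∷ Ts) = trans (cong₂ _⊕_ (⊗-unfold _ _) (sumOver-∷ w l Ts)) (sym (⊗-distribˡ-⊕ _ _ _))

sumOver-filter : ∀ {A : Set} (f : A → ℚ) p xs → sumOver f (filterᵇ p xs) ≡ sumOver (λ x → ind (p x) (f x)) xs
sumOver-filter f p []       = refl
sumOver-filter f p (x ∷ xs) with p x
... | true  = cong (f x ⊕_) (sumOver-filter f p xs)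
... | false = trans (sumOver-filter f p xs) (sym (⊕-identityˡ _))

length-remove : ∀ d S → length (remove d S) ≤ length S
length-remove d []      = z≤n
length-remove d (c ∷ S) with not (eqCell d c)
... | true  = s≤s (length-remove d S)
... | false = ℕₚ.m≤n⇒m≤1+n (length-remove d S)

private
  Mᶠ-suc : ∀ w f c S → Mᶠ w (suc f) (c ∷ S) ≡ sumOver (λ d → ind (member d S) (w (c , d) ⊗ Mᶠ w f (remove d S))) (neighbours c)
  Mᶠ-suc w f c S = trans (sumOver-concatMap (weightOf w) _ (filterᵇ (λ d → member d S) (neighbours c)))
    (trans (sumOver-cong (λ d → sumOver-∷ w (c , d) (tilingsF f (remove d S))) (filterᵇ (λ d → member d S) (neighbours c)))
           (sumOver-filter _ (λ d → member d S) (neighbours c)))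

Mᶠ-fuel : ∀ w f g S → length S ≤ f → length S ≤ g → Mᶠ w f S ≡ Mᶠ w g S
Mᶠ-fuel w zero    zero    []      p q = refl
Mᶠ-fuel w zero    (suc g) []      p q = refl
Mᶠ-fuel w (suc f) zero    []      p q = refl
Mᶠ-fuel w (suc f) (suc g) []      p q = refl
Mᶠ-fuel w (suc f) (suc g) (c ∷ S) (s≤s p) (s≤s q) = trans (Mᶠ-suc w f c S) (trans
  (sumOver-cong (λ d → cong (λ z → ind (member d S) (w (c , d) ⊗ z))
    (Mᶠ-fuel w f g (remove d S) (ℕₚ.≤-trans (length-remove d S) p) (ℕₚ.≤-trans (length-remove d S) q))) (neighbours c))
  (sym (Mᶠ-suc w g c S)))

M-∷ : ∀ w c S → M w (c ∷ S) ≡ sumOver (λ d → ind (member d S) (w (c , d) ⊗ M w (remove d S))) (neighbours c)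
M-∷ w c S = trans (M-unfold w (c ∷ S)) (trans (Mᶠ-suc w (length S) c S)
  (sumOver-cong (λ d → cong (λ z → ind (member d S) (w (c , d) ⊗ z))
    (trans (Mᶠ-fuel w (length S) (length (remove d S)) (remove d S) (length-remove d S) ℕₚ.≤-refl) (sym (M-unfold w (remove d S))))) (neighbours c)))

M-[] : ∀ w → M w [] ≡ 1ℚ
M-[] w = trans (M-unfold w []) (⊕-identityʳ 1ℚ)

eqℤ-refl : ∀ p → eqℤ p p ≡ true
eqℤ-refl p with p ℤ.≤ᵇ p in e
... | true  = refl
... | false = ⊥-elim (subst T e (ℤₚ.≤⇒≤ᵇ (ℤₚ.≤-refl {p})))

eqℤ-≢ : ∀ {p q} → p ≢ q → eqℤ p q ≡ false
eqℤ-≢ {p} {q} ne with p ℤ.≤ᵇ q in e | q ℤ.≤ᵇ p in f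
... | true  | true  = ⊥-elim (ne (ℤₚ.≤-antisym (ℤₚ.≤ᵇ⇒≤ (subst T (sym e) tt)) (ℤₚ.≤ᵇ⇒≤ (subst T (sym f) tt))))
... | true  | false = refl
... | false | _     = refl

eqCell-refl : ∀ c → eqCell c c ≡ true
eqCell-refl (k , b) rewrite eqℤ-refl k = eqℤ-refl b

record Differ (d c : Cell) : Set where
  constructor differ
  field unequal : eqCell d c ≡ false

Fresh : Cell → List Cell → Set
Fresh d S = All (Differ d) S

eqCell-≢₁ : ∀ {k k′ b b′} → k ≢ k′ → Differ (k , b) (k′ , b′)
eqCell-≢₁ {b = b} {b′} ne = differ (cong (_∧ eqℤ b b′) (eqℤ-≢ ne))

eqCell-≢₂ : ∀ {k k′ b b′} → b ≢ b′ → Differ (k , b) (k′ , b′)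
eqCell-≢₂ {k} {k′} ne = differ (trans (cong (eqℤ k k′ ∧_) (eqℤ-≢ ne)) (∧-zeroʳ _))

fresh-member : ∀ {d S} → Fresh d S → member d S ≡ false
fresh-member []       = refl
fresh-member (differ e ∷ es) rewrite e = fresh-member es

fresh-remove : ∀ {d S} → Fresh d S → remove d S ≡ S
fresh-remove []       = refl
fresh-remove (differ e ∷ es) rewrite e = cong (_ ∷_) (fresh-remove es)

member-middle : ∀ {d} A {B} → Fresh d A → member d (A ++ d ∷ B) ≡ true
member-middle {d} []      []       rewrite eqCell-refl d = refl
member-middle     (_ ∷ A) (differ e ∷ es) rewrite e = member-middle A es

remove-middle : ∀ {d} A {B} → Fresh d A → Fresh d B → remove d (A ++ d ∷ B) ≡ A ++ B
remove-middle {d} []      []       q rewrite eqCell-refl d = fresh-remove q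
remove-middle     (_ ∷ A) (differ e ∷ es) q rewrite e = cong (_ ∷_) (remove-middle A es q)

-- The unit triangles of the strip b with indices k, k+1, ... that are not
-- marked in the list.
cells : ℕ → ℕ → List Bool → List Cell
cells k b []          = []
cells k b (false ∷ r) = (+ k , + b) ∷ cells (suc k) b r
cells k b (true ∷ r)  = cells (suc k) b r

cells-All : ∀ {Pr : Cell → Set} k b r → (∀ j → k ≤ j → Pr (+ j , + b)) → All Pr (cells k b r)
cells-All k b []          h = []
cells-All k b (false ∷ r) h = h k ℕₚ.≤-refl ∷ cells-All (suc k) b r (λ j l → h j (ℕₚ.<⇒≤ l))
cells-All k b (true ∷ r)  h = cells-All (suc k) b r (λ j l → h j (ℕₚ.<⇒≤ l))

module _ (w : Lozenge → ℚ) where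

  horizontal vertical : ℕ → ℕ → ℚ
  horizontal k b = w ((+ k , + b) , (+ suc k , + b))
  vertical k b   = w ((+ k , + b) , (+ k , + suc b))

  -- The strip b is tiled from left to right, starting with the triangle k;
  -- f is applied to the marking of the next strip after the triangles used
  -- by vertical lozenges have been marked too.
  rowSum : ℕ → ℕ → List Bool → List Bool → (List Bool → ℚ) → ℚ
  rowSum k b (true ∷ r)          (n ∷ r′)      f = rowSum (suc k) b r r′ (f ∘ (n ∷_))
  rowSum k b (false ∷ false ∷ r) (n ∷ n′ ∷ r′) f =
    horizontal k b ⊗ rowSum (2 + k) b r r′ (λ o → f (n ∷ n′ ∷ o)) ⊕
    -- An up-pointing triangle would need its lower neighbour, which belongs to a strip already
    -- covered; a down-pointing one needs its upper neighbour, which must not be missing.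
    ind (not (isUp (+ k , + b)) ∧ not n) (vertical k b ⊗ rowSum (suc k) b (false ∷ r) (n′ ∷ r′) (f ∘ (true ∷_)))
  rowSum k b (false ∷ r)         (n ∷ r′)      f =
    ind (not (isUp (+ k , + b)) ∧ not n) (vertical k b ⊗ rowSum (suc k) b r r′ (f ∘ (true ∷_)))
  rowSum k b _                   r′            f = f r′

  rowSum-cong : ∀ k b r r′ {f g} → (∀ o → f o ≡ g o) → rowSum k b r r′ f ≡ rowSum k b r r′ g
  rowSum-cong k b []                  r′           e = e r′
  rowSum-cong k b (true ∷ r)          []           e = e []
  rowSum-cong k b (true ∷ r)          (n ∷ r′)     e = rowSum-cong (suc k) b r r′ (λ o → e (n ∷ o))
  rowSum-cong k b (false ∷ r)         []           e = lem r
    where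
    lem : ∀ r → rowSum k b (false ∷ r) [] _ ≡ rowSum k b (false ∷ r) [] _
    lem []          = e []
    lem (false ∷ r) = e []
    lem (true ∷ r)  = e []
  rowSum-cong k b (false ∷ [])        (n ∷ r′)     e = cong (λ z → ind (not (isUp (+ k , + b)) ∧ not n) (vertical k b ⊗ z)) (rowSum-cong (suc k) b [] r′ (λ o → e (true ∷ o)))
  rowSum-cong k b (false ∷ true ∷ r)  (n ∷ r′)     e = cong (λ z → ind (not (isUp (+ k , + b)) ∧ not n) (vertical k b ⊗ z)) (rowSum-cong (suc k) b (true ∷ r) r′ (λ o → e (true ∷ o)))
  rowSum-cong k b (false ∷ false ∷ r) (n ∷ [])     e = cong (λ z → ind (not (isUp (+ k , + b)) ∧ not n) (vertical k b ⊗ z)) (rowSum-cong (suc k) b (false ∷ r) [] (λ o → e (true ∷ o)))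
  rowSum-cong k b (false ∷ false ∷ r) (n ∷ n′ ∷ r′) e = cong₂ _⊕_
    (cong (horizontal k b ⊗_) (rowSum-cong (2 + k) b r r′ (λ o → e (n ∷ n′ ∷ o))))
    (cong (λ z → ind (not (isUp (+ k , + b)) ∧ not n) (vertical k b ⊗ z)) (rowSum-cong (suc k) b (false ∷ r) (n′ ∷ r′) (λ o → e (true ∷ o))))

  -- The list consists of the triangles of the strip b from the column k on, the part `A` of the
  -- strip b + 1 left of k, the part from k on, and the higher strips. In this order the next
  -- triangle to be covered is at the head.
  module Strip (b : ℕ) (rest : List Cell) (above : All (λ c → ∃ λ m → proj₂ c ≡ + m × 2 + b ≤ m) rest) where

    Left : ℕ → List Cell → Set
    Left k A = All (λ c → ∃ λ j → j < k × c ≡ (+ j , + suc b)) A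

    add : ℕ → Bool → List Cell → List Cell
    add k n A = A ++ cells k (suc b) [ n ]

    left-add : ∀ k n {A} → Left k A → Left (suc k) (add k n A)
    left-add k false []                 = (k , ℕₚ.≤-refl , refl) ∷ []
    left-add k true  []                 = []
    left-add k n     ((j , l , e) ∷ ls) = (j , ℕₚ.m<n⇒m<1+n l , e) ∷ left-add k n ls

    add-cells : ∀ k n A o → A ++ (cells k (suc b) (n ∷ o) ++ rest) ≡ add k n A ++ (cells (suc k) (suc b) o ++ rest)
    add-cells k false A o = sym (++-assoc A _ _)
    add-cells k true  A o = sym (++-assoc A [] _)

    next : ℕ → List Cell → List Bool → List Cell
    next k A o = A ++ (cells k (suc b) o ++ rest)

    low-rest : ∀ {x y} → (∀ m → 2 + b ≤ m → y ≢ + m) → Fresh (x , y) rest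
    low-rest h = go above
      where
      go : ∀ {S} → All (λ c → ∃ λ m → proj₂ c ≡ + m × 2 + b ≤ m) S → Fresh _ S
      go []                  = []
      go ((m , refl , l) ∷ p) = eqCell-≢₂ (h m l) ∷ go p

    low-next : ∀ {x y} k A o → Left k A → (∀ m → suc b ≤ m → y ≢ + m) → Fresh (x , y) (next k A o)
    low-next k A o l h = All-++⁺ (go l) (All-++⁺ (cells-All k (suc b) o (λ _ _ → eqCell-≢₂ (h (suc b) ℕₚ.≤-refl))) (low-rest (λ m p → h m (ℕₚ.<⇒≤ p))))
      where
      go : ∀ {A k} → Left k A → Fresh _ A
      go []                  = []
      go ((j , _ , refl) ∷ p) = eqCell-≢₂ (h (suc b) ℕₚ.≤-refl) ∷ go p

    row-fresh : ∀ {x y} k r → (∀ j → k ≤ j → x ≢ + j) → Fresh (x , y) (cells k b r)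
    row-fresh k r h = cells-All k b r (λ j l → eqCell-≢₁ (h j l))

    private
      pred-≢ : ∀ k j → k ≤ j → + k ℤ.- + 1 ≢ + j
      pred-≢ k j l e = ℕₚ.<-irrefl refl (subst (_≤ j) (ℤₚ.+-injective (begin
        + k                    ≡⟨ sym (ℤₚ.+-identityʳ (+ k)) ⟩
        + k ℤ.+ (ℤ.- + 1 ℤ.+ + 1) ≡⟨ sym (ℤₚ.+-assoc (+ k) (ℤ.- + 1) (+ 1)) ⟩
        (+ k ℤ.- + 1) ℤ.+ + 1  ≡⟨ cong (ℤ._+ + 1) e ⟩
        + (j + 1)              ≡⟨ cong +_ (ℕₚ.+-comm j 1) ⟩
        + suc j ∎)) l)
        where open ≡-Reasoning

      +-≢ : ∀ {m n} → m < n → + m ≢ + n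
      +-≢ l refl = ℕₚ.<-irrefl refl l

      term : Cell → Cell → List Cell → ℚ
      term c d S = ind (member d S) (w (c , d) ⊗ M w (remove d S))

      term-fresh : ∀ c {d S} → Fresh d S → term c d S ≡ 0ℚ
      term-fresh c fr = ind-false _ (fresh-member fr)

      term-middle : ∀ c {d} A {B} → Fresh d A → Fresh d B → term c d (A ++ d ∷ B) ≡ w (c , d) ⊗ M w (A ++ B)
      term-middle c {d} A {B} p q = trans (cong (λ z → ind z (w (c , d) ⊗ M w (remove d (A ++ d ∷ B)))) (member-middle A p))
        (cong (λ z → w (c , d) ⊗ M w z) (remove-middle A p q))

      left-term : ∀ k A r o → Left k A → term (+ k , + b) (+ k ℤ.- + 1 , + b) (cells (suc k) b r ++ next k A o) ≡ 0ℚ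
      left-term k A r o l = term-fresh _ (All-++⁺ (row-fresh (suc k) r (λ j p → pred-≢ k j (ℕₚ.<⇒≤ p))) (low-next k A o l (λ m p → +-≢ p)))

      right-cell : ∀ k → _≡_ {A = Cell} (+ k ℤ.+ + 1 , + b) (+ suc k , + b)
      right-cell k = cong {B = Cell} (λ z → (+ z , + b)) (ℕₚ.+-comm k 1)

      right-term-true : ∀ k A r o → Left k A → term (+ k , + b) (+ k ℤ.+ + 1 , + b) (cells (2 + k) b r ++ next k A o) ≡ 0ℚ
      right-term-true k A r o l = subst (λ d → term (+ k , + b) d (cells (2 + k) b r ++ next k A o) ≡ 0ℚ) (sym (right-cell k)) $ term-fresh _ (All-++⁺ (row-fresh (2 + k) r (λ j p → +-≢ p)) (low-next k A o l (λ m p → +-≢ p)))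

      right-term-false : ∀ k A r o → Left k A → term (+ k , + b) (+ k ℤ.+ + 1 , + b) (cells (suc k) b (false ∷ r) ++ next k A o) ≡ horizontal k b ⊗ M w (cells (2 + k) b r ++ next k A o)
      right-term-false k A r o l = subst (λ d → term (+ k , + b) d (cells (suc k) b (false ∷ r) ++ next k A o) ≡ horizontal k b ⊗ M w (cells (2 + k) b r ++ next k A o)) (sym (right-cell k)) $ term-middle _ [] [] (All-++⁺ (row-fresh (2 + k) r (λ j p → +-≢ p)) (low-next k A o l (λ m p → +-≢ p)))

      third : ℕ → Cell
      third k = if isUp (+ k , + b) then (+ k , + b ℤ.- + 1) else (+ k , + b ℤ.+ + 1)

      vertical-term : ∀ k A r n o → Left k A → term (+ k , + b) (third k) (cells (suc k) b r ++ next k A (n ∷ o)) ≡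
        ind (not (isUp (+ k , + b)) ∧ not n) (vertical k b ⊗ M w (cells (suc k) b r ++ next k A (true ∷ o)))
      vertical-term k A r n o l with isUp (+ k , + b)
      ... | true = term-fresh _ (All-++⁺ (row-fresh (suc k) r (λ j p → +-≢ p)) (low-next k A (n ∷ o) l (λ m p → pred-≢ b m (ℕₚ.<⇒≤ p))))
      vertical-term k A r n o l | false rewrite ℕₚ.+-comm b 1 = lem n
        where
        d = (+ k , + suc b)
        left-fresh : ∀ {A} → Left k A → Fresh d A
        left-fresh []                  = []
        left-fresh ((j , p , refl) ∷ q) = eqCell-≢₁ (λ e → +-≢ p (sym e)) ∷ left-fresh q
        before : Fresh d (cells (suc k) b r ++ A)
        before = All-++⁺ (row-fresh (suc k) r (λ j p → +-≢ p)) (left-fresh l)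
        after : Fresh d (cells (suc k) (suc b) o ++ rest)
        after = All-++⁺ (cells-All (suc k) (suc b) o (λ j p → eqCell-≢₁ (+-≢ p))) (low-rest (λ m p → +-≢ p))
        lem : ∀ n → term (+ k , + b) d (cells (suc k) b r ++ next k A (n ∷ o)) ≡ ind (not n) (vertical k b ⊗ M w (cells (suc k) b r ++ next k A (true ∷ o)))
        lem true  = term-fresh _ (subst (Fresh d) (++-assoc (cells (suc k) b r) A _) (All-++⁺ before after))
        lem false = begin
          term (+ k , + b) d (cells (suc k) b r ++ (A ++ d ∷ S))
            ≡⟨ cong (term (+ k , + b) d) (sym (++-assoc (cells (suc k) b r) A _)) ⟩
          term (+ k , + b) d ((cells (suc k) b r ++ A) ++ d ∷ S)
            ≡⟨ term-middle _ _ before after ⟩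
          vertical k b ⊗ M w ((cells (suc k) b r ++ A) ++ S)
            ≡⟨ cong (λ z → vertical k b ⊗ M w z) (++-assoc (cells (suc k) b r) A _) ⟩
          vertical k b ⊗ M w (cells (suc k) b r ++ (A ++ S)) ∎
          where
          open ≡-Reasoning
          S = cells (suc k) (suc b) o ++ rest

      expand : ∀ k A r n o → Left k A → M w ((+ k , + b) ∷ (cells (suc k) b r ++ next k A (n ∷ o))) ≡
        term (+ k , + b) (+ k ℤ.+ + 1 , + b) (cells (suc k) b r ++ next k A (n ∷ o)) ⊕
        ind (not (isUp (+ k , + b)) ∧ not n) (vertical k b ⊗ M w (cells (suc k) b r ++ next k A (true ∷ o)))
      expand k A r n o l = trans (M-∷ w (+ k , + b) (cells (suc k) b r ++ next k A (n ∷ o))) (trans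
        (cong₂ _⊕_ (left-term k A r (n ∷ o) l) (cong (term (+ k , + b) (+ k ℤ.+ + 1 , + b) (cells (suc k) b r ++ next k A (n ∷ o)) ⊕_)
          (trans (⊕-identityʳ _) (vertical-term k A r n o l))))
        (⊕-identityˡ _))

    -- The left neighbour of the head is never in the list, so that the expansion `M-∷` has just the
    -- terms of `rowSum`.
    M-strip : ∀ k A r o → Left k A → length r ≡ length o →
      M w (cells k b r ++ next k A o) ≡ rowSum k b r o (λ o′ → M w (next k A o′))

    private
      M-strip-suc : ∀ k A r n o → Left k A → length r ≡ length o →
        M w (cells (suc k) b r ++ next k A (n ∷ o)) ≡ rowSum (suc k) b r o (λ o′ → M w (next k A (n ∷ o′)))
      M-strip-suc k A r n o l e = trans (cong (λ z → M w (cells (suc k) b r ++ z)) (add-cells k n A o))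
        (trans (M-strip (suc k) (add k n A) r o (left-add k n l) e)
               (rowSum-cong (suc k) b r o (λ o′ → cong (M w) (sym (add-cells k n A o′)))))

      M-strip-suc² : ∀ k A r n n′ o → Left k A → length r ≡ length o →
        M w (cells (2 + k) b r ++ next k A (n ∷ n′ ∷ o)) ≡ rowSum (2 + k) b r o (λ o′ → M w (next k A (n ∷ n′ ∷ o′)))
      M-strip-suc² k A r n n′ o l e = trans (cong (λ z → M w (cells (2 + k) b r ++ z)) (add-cells k n A (n′ ∷ o)))
        (trans (M-strip-suc (suc k) (add k n A) r n′ o (left-add k n l) e)
               (rowSum-cong (2 + k) b r o (λ o′ → cong (M w) (sym (add-cells k n A (n′ ∷ o′))))))

      no-right : ∀ {p q z} → p ≡ 0ℚ → q ≡ z → p ⊕ q ≡ z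
      no-right refl refl = ⊕-identityˡ _

    M-strip k A []                  []           l e = refl
    M-strip k A (true ∷ r)          (n ∷ o)      l e = M-strip-suc k A r n o l (ℕₚ.suc-injective e)
    M-strip k A (false ∷ [])        (n ∷ o)      l e = trans (expand k A [] n o l) (no-right (term-fresh (+ k , + b) {d = + k ℤ.+ + 1 , + b} {S = next k A (n ∷ o)} (low-next {x = + k ℤ.+ + 1} {y = + b} k A (n ∷ o) l (λ m p → +-≢ p)))
      (cong (λ z → ind (not (isUp (+ k , + b)) ∧ not n) (vertical k b ⊗ z)) (M-strip-suc k A [] true o l (ℕₚ.suc-injective e))))
    M-strip k A (false ∷ true ∷ r)  (n ∷ o)      l e = trans (expand k A (true ∷ r) n o l) (no-right (right-term-true k A r (n ∷ o) l)
      (cong (λ z → ind (not (isUp (+ k , + b)) ∧ not n) (vertical k b ⊗ z)) (M-strip-suc k A (true ∷ r) true o l (ℕₚ.suc-injective e))))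
    M-strip k A (false ∷ false ∷ r) (n ∷ n′ ∷ o) l e = trans (expand k A (false ∷ r) n (n′ ∷ o) l) (cong₂ _⊕_
      (trans (right-term-false k A r (n ∷ n′ ∷ o) l) (cong (horizontal k b ⊗_) (M-strip-suc² k A r n n′ o l (ℕₚ.suc-injective (ℕₚ.suc-injective e)))))
      (cong (λ z → ind (not (isUp (+ k , + b)) ∧ not n) (vertical k b ⊗ z)) (M-strip-suc k A (false ∷ r) true (n′ ∷ o) l (ℕₚ.suc-injective e))))

-- From tilings of a strip to interlacing sets of crossings.

il : List Bool → List Bool → List Bool
il []      _ = []
il (p ∷ P) B = p ∷ il B P

orl : List Bool → List Bool → List Bool
orl (q ∷ Q) (b ∷ B) = (q ∨ b) ∷ orl Q B
orl _       _       = []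

-- A vertical lozenge across a line consists of the down-pointing triangle below it, possibly
-- missing according to B, and the up-pointing one above it, possibly missing according to A.
free : List Bool → List Bool → List Bool → Bool
free (true ∷ Q)  (b ∷ B) (a ∷ A) = (not b ∧ not a) ∧ free Q B A
free (false ∷ Q) (b ∷ B) (a ∷ A) = free Q B A
free _           _       _       = true

%2-par : ∀ n → (n % 2 ℕ.≡ᵇ 1) ≡ par n
%2-par zero          = refl
%2-par (suc zero)    = refl
%2-par (suc (suc n)) = trans (%2-par n) (sym (not-involutive (par n)))

isUp-par : ∀ k b → isUp (+ k , + b) ≡ par (k + b)
isUp-par k b = %2-par (k + b)

-- Keeps the marks of two neighbouring strips in step with the alternation of `il`; the mutual
-- induction of `rowSum-up` and `rowSum-down` runs over it.
data Balanced : (X Y X′ Y′ : List Bool) → Set where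
  []  : Balanced [] [] [] []
  _∷_ : ∀ {X Y X′ Y′} (p : Bool × Bool) → Balanced Y X Y′ X′ → Balanced (proj₁ p ∷ X) Y (proj₂ p ∷ X′) Y′

balanced : ∀ {n} X Y X′ Y′ → length X ≡ n → length Y ≡ n → length X′ ≡ n → length Y′ ≡ n → Balanced X Y X′ Y′
balanced []      []      []        []        refl _ _ _ = []
balanced (x ∷ X) (y ∷ Y) (x′ ∷ X′) (y′ ∷ Y′) refl p q r =
  (x , x′) ∷ ((y , y′) ∷ balanced X Y X′ Y′ refl (ℕₚ.suc-injective p) (ℕₚ.suc-injective q) (ℕₚ.suc-injective r))

columnWeight : (ℕ → ℚ) → ℕ → List Bool → ℚ
columnWeight v k []          = 1ℚ
columnWeight v k (false ∷ Q) = columnWeight v (2 + k) Q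
columnWeight v k (true ∷ Q)  = v k ⊗ columnWeight v (2 + k) Q

module _ (w : Lozenge → ℚ) (b : ℕ) (flat : ∀ k → horizontal w k b ≡ 1ℚ) where

  private
    v : ℕ → ℚ
    v k = vertical w k b

    summand : ℕ → (B A : List Bool) → (List Bool → Bool) → (List Bool → ℚ) → List Bool → ℚ
    summand k B A t g Q = ind (free Q B A) (columnWeight v k Q ⊗ ind (t (orl Q B)) (g (orl Q A)))

    ⊕-dropˡ : ∀ {p q} → p ≡ 0ℚ → p ⊕ q ≡ q
    ⊕-dropˡ refl = ⊕-identityˡ _

    ⊕-dropʳ : ∀ {p q} → q ≡ 0ℚ → p ⊕ q ≡ p
    ⊕-dropʳ refl = ⊕-identityʳ _

    vanish : ∀ x c → ind x (c ⊗ 0ℚ) ≡ 0ℚ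
    vanish x c = trans (cong (ind x) (⊗-zeroʳ c)) (ind-0 x)

    no-fit : ∀ n k (B A : List Bool) → sumB n (λ Q → ind (free Q B A) (columnWeight v k Q ⊗ 0ℚ)) ≡ 0ℚ
    no-fit n k B A = sumB-0 n (λ Q _ → vanish (free Q B A) (columnWeight v k Q))

    sumB-zero : ∀ n → sumB n (λ _ → 0ℚ) ≡ 0ℚ
    sumB-zero n = sumB-0 n (λ _ _ → refl)

    drop-vertical : ∀ u z n q → isUp (+ u , + b) ≡ true → z ⊕ ind (not (isUp (+ u , + b)) ∧ n) q ≡ z
    drop-vertical u z n q e rewrite e = ⊕-identityʳ z

    take-vertical : ∀ u a q → isUp (+ u , + b) ≡ false → ind (not (isUp (+ u , + b)) ∧ a) q ≡ ind a q
    take-vertical u a q e rewrite e = refl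

    pass : ∀ k q → horizontal w k b ⊗ q ≡ q
    pass k q = trans (cong (_⊗ q) (flat k)) (⊗-identityˡ q)

    next-up : ∀ k → isUp (+ k , + b) ≡ false → isUp (+ suc k , + b) ≡ true
    next-up k e = trans (isUp-par (suc k) b) (cong not (trans (sym (isUp-par k b)) e))

    next-down : ∀ k → isUp (+ k , + b) ≡ true → isUp (+ suc k , + b) ≡ false
    next-down k e = trans (isUp-par (suc k) b) (cong not (trans (sym (isUp-par k b)) e))

    through : ∀ k n a (B A : List Bool) (t : List Bool → Bool) (g : List Bool → ℚ) →
      ind (not a) (v k ⊗ sumB n (summand (2 + k) B A t (λ o → g (true ∷ o)))) ≡
      sumB n (λ Q → ind (free (true ∷ Q) (false ∷ B) (a ∷ A)) (columnWeight v k (true ∷ Q) ⊗ ind (t (orl Q B)) (g (true ∷ orl Q A))))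
    through k n true  B A t g = sym (sumB-0 n (λ _ _ → refl))
    through k n false B A t g = trans (sym (sumB-⊗ n (v k) _)) (sumB-cong n (λ Q _ →
      trans (ind-⊗ (free Q B A) _ _) (cong (ind (free Q B A)) (sym (⊗-assoc _ _ _)))))

    through-0 : ∀ k a (B A : List Bool) →
      sumB (length B) (λ Q → ind (free (true ∷ Q) (false ∷ B) (a ∷ A)) (columnWeight v k (true ∷ Q) ⊗ 0ℚ)) ≡ 0ℚ
    through-0 k a B A = sumB-0 (length B) (λ Q _ → vanish (free (true ∷ Q) (false ∷ B) (a ∷ A)) (columnWeight v k (true ∷ Q)))

  -- Once the set Q of vertical lozenges is chosen, horizontal lozenges cover the rest of the strip
  -- in at most one way and have weight 1, so a sum over Q remains.
  rowSum-up : ∀ k {P B B′ A} f → isUp (+ k , + b) ≡ true → Balanced P B B′ A →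
    rowSum w k b (il P B) (il B′ A) f ≡ sumB (length B) (summand (suc k) B A (fits P) (λ X → f (il B′ X)))
  rowSum-down : ∀ k {B P A B′} f → isUp (+ k , + b) ≡ false → Balanced B P A B′ →
    rowSum w k b (il B P) (il A B′) f ≡ sumB (length B) (summand k B A (λ X → fits X P) (λ X → f (il X B′)))

  rowSum-up k f u [] = sym (⊗-identityˡ _)
  rowSum-up k f u ((true , b′) ∷ s) = rowSum-down (suc k) (f ∘ (b′ ∷_)) (next-down k u) s
  rowSum-up k f u ((false , b′) ∷ []) rewrite u = sym (⊗-zeroʳ 1ℚ)
  rowSum-up k {B = _ ∷ B} {A = _ ∷ A} f u ((false , b′) ∷ ((true , a) ∷ s)) rewrite u = sym (trans
    (cong₂ _⊕_ (sumB-0 (length B) (λ Q _ → vanish (free Q B A) (columnWeight v (3 + k) Q))) (sumB-zero (length B))) 0⊕0)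
  rowSum-up k {B = _ ∷ B} {A = _ ∷ A} f u ((false , b′) ∷ ((false , a) ∷ s)) = trans (drop-vertical k _ (not b′) _ u) (trans (pass k _)
    (trans (rowSum-up (2 + k) (λ o → f (b′ ∷ a ∷ o)) (next-up (suc k) (next-down k u)) s)
      (sym (⊕-dropʳ (through-0 (suc k) a B A)))))

  rowSum-down k f u [] = sym (⊗-identityˡ _)
  rowSum-down k {B = _ ∷ B} f u ((true , a) ∷ s) = trans (rowSum-up (suc k) (f ∘ (a ∷_)) (next-up k u) s)
    (sym (⊕-dropʳ (sumB-zero (length B))))
  rowSum-down k f u ((false , a) ∷ []) = trans (take-vertical k (not a) _ u) (trans (lem a) (sym (⊕-dropˡ (⊗-zeroʳ 1ℚ))))
    where
    lem : ∀ a → ind (not a) (v k ⊗ f (true ∷ [])) ≡ ind ((true ∧ not a) ∧ true) ((v k ⊗ 1ℚ) ⊗ f (true ∷ []))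
    lem true  = refl
    lem false = cong (_⊗ f (true ∷ [])) (sym (⊗-identityʳ (v k)))
  rowSum-down k {B = _ ∷ B} {P} {_ ∷ A} {B′} f u ((false , a) ∷ s@((true , b′) ∷ _)) = trans (take-vertical k (not a) _ u) (trans
    (cong (λ z → ind (not a) (v k ⊗ z)) (rowSum-up (suc k) (f ∘ (true ∷_)) (next-up k u) s))
    (trans (through k (length B) a B A (fits P) (λ X → f (il X B′)))
      (sym (⊕-dropˡ (no-fit (length B) (2 + k) B A)))))
  rowSum-down k {B = _ ∷ B} {P} {_ ∷ A} {B′} f u ((false , a) ∷ s@((false , b′) ∷ s′)) = cong₂ _⊕_
    (trans (pass k _) (rowSum-down (2 + k) (λ o → f (a ∷ b′ ∷ o)) (next-down (suc k) (next-up k u)) s′))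
    (trans (take-vertical k (not a) _ u) (trans
      (cong (λ z → ind (not a) (v k ⊗ z)) (rowSum-up (suc k) (f ∘ (true ∷_)) (next-up k u) s))
      (through k (length B) a B A (fits P) (λ X → f (il X B′)))))

eqCell-sound : ∀ {k k′ b b′} → eqCell (k , b) (k′ , b′) ≡ true → k ≡ k′
eqCell-sound {k} {k′} e with k ℤ.≤ᵇ k′ in p | k′ ℤ.≤ᵇ k in q
... | true | true = ℤₚ.≤-antisym (ℤₚ.≤ᵇ⇒≤ (subst T (sym p) tt)) (ℤₚ.≤ᵇ⇒≤ (subst T (sym q) tt))

any-applyUpTo : ∀ {A : Set} (p : A → Bool) t (g : ℕ → ℕ) n m → m < n → p (t (g m)) ≡ true → any p (map t (applyUpTo g n)) ≡ true
any-applyUpTo p t g (suc n) zero    l       e rewrite e = refl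
any-applyUpTo p t g (suc n) (suc m) (s≤s l) e rewrite any-applyUpTo p t (g ∘ suc) n m l e = ∨-zeroʳ _

any-false : ∀ {A : Set} (p : A → Bool) xs → (∀ x → p x ≡ false) → any p xs ≡ false
any-false p []       h = refl
any-false p (x ∷ xs) h rewrite h x = any-false p xs h

private
  not-true : ∀ {b} → (b ≡ true → ⊥) → b ≡ false
  not-true {true}  h = ⊥-elim (h refl)
  not-true {false} h = refl

  ∧-true : ∀ {a b} → a ∧ b ≡ true → a ≡ true × b ≡ true
  ∧-true {true} {true} e = refl , refl

sameLozenge-columns : ∀ {k k′ b b′ h i} → ¬ (k ≡ + h × k′ ≡ + h) → sameLozenge ((k , b) , (k′ , b′)) (westernLozenge h i) ≡ false
sameLozenge-columns {k} {k′} {b} {b′} {h} {i} ne = lem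
  (not-true λ e → ne (eqCell-sound {k} {+ h} {b} {+ (h ∸ (2 * i ∸ 1))} (proj₁ (∧-true e)) , eqCell-sound {k′} {+ h} {b′} {+ (h ∸ 2 * i)} (proj₂ (∧-true {eqCell (k , b) (+ h , + (h ∸ (2 * i ∸ 1)))} e))))
  (not-true λ e → ne (eqCell-sound {k} {+ h} {b} {+ (h ∸ 2 * i)} (proj₁ (∧-true e)) , eqCell-sound {k′} {+ h} {b′} {+ (h ∸ (2 * i ∸ 1))} (proj₂ (∧-true {eqCell (k , b) (+ h , + (h ∸ 2 * i))} e))))
  where
  lem : ∀ {a b} → a ≡ false → b ≡ false → a ∨ b ≡ false
  lem refl refl = refl

westernWeight-1 : ∀ {k k′ b b′} h → ¬ (k ≡ + h × k′ ≡ + h) → westernWeight h ((k , b) , (k′ , b′)) ≡ 1ℚ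
westernWeight-1 {k} {k′} {b} {b′} h ne = cong (λ z → if z then ½ else 1ℚ)
  (any-false (λ i → sameLozenge ((k , b) , (k′ , b′)) (westernLozenge h i)) (map suc (upTo (h / 2))) (λ i → sameLozenge-columns {k} {k′} {b} {b′} {h} {i} ne))

western-horizontal : ∀ h k b → horizontal (westernWeight h) k b ≡ 1ℚ
western-horizontal h k b = westernWeight-1 {+ k} {+ suc k} {+ b} {+ b} h λ (p , q) → ℕₚ.1+n≢n (trans (ℤₚ.+-injective q) (sym (ℤₚ.+-injective p)))

western-vertical : ∀ h k b → h < k → vertical (westernWeight h) k b ≡ 1ℚ
western-vertical h k b l = westernWeight-1 {+ k} {+ k} {+ b} {+ suc b} h λ (p , q) → ℕₚ.<-irrefl (sym (ℤₚ.+-injective p)) l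

-- The strip b is the row 2(m + 1) from the top, so i = m + 1 shows that the lozenge is a western
-- one.
western-½ : ∀ b m → vertical (westernWeight (b + 2 * suc m)) (b + 2 * suc m) b ≡ ½
western-½ b m = cong (λ z → if z then ½ else 1ℚ)
  (any-applyUpTo (λ i → sameLozenge ((+ h , + b) , (+ h , + suc b)) (westernLozenge h i)) suc id (h / 2) m bound same)
  where
  h = b + 2 * suc m
  bound : m < h / 2
  bound = ℕₚ.≤-trans (ℕₚ.≤-reflexive (sym (trans (cong (_/ 2) (ℕₚ.*-comm 2 (suc m))) (DM.m*n/n≡m (suc m) 2)))) (DM./-monoˡ-≤ 2 (ℕₚ.m≤n+m (2 * suc m) b))
  low : h ∸ 2 * suc m ≡ b
  low = ℕₚ.m+n∸n≡m b (2 * suc m)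
  high : h ∸ (2 * suc m ∸ 1) ≡ suc b
  high = trans (cong (_∸ (m + suc (m + 0))) (ℕₚ.+-suc b (m + suc (m + 0)))) (ℕₚ.m+n∸n≡m (suc b) (m + suc (m + 0)))
  same : sameLozenge ((+ h , + b) , (+ h , + suc b)) (westernLozenge h (suc m)) ≡ true
  same = trans (cong₂ (λ x y → sameLozenge ((+ h , + b) , (+ h , + suc b)) ((+ h , + x) , (+ h , + y))) high low) (both (eqCell-refl (+ h , + b)) (eqCell-refl (+ h , + suc b)))
    where
    both : ∀ {x y z} → x ≡ true → y ≡ true → z ∨ (x ∧ y) ≡ true
    both refl refl = ∨-zeroʳ _

columnWeight-1 : ∀ v k Q → (∀ j → k ≤ j → v j ≡ 1ℚ) → columnWeight v k Q ≡ 1ℚ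
columnWeight-1 v k []          h = refl
columnWeight-1 v k (false ∷ Q) h = columnWeight-1 v (2 + k) Q (λ j l → h j (ℕₚ.m+n≤o⇒n≤o 2 l))
columnWeight-1 v k (true ∷ Q)  h = trans (cong₂ _⊗_ (h k ℕₚ.≤-refl) (columnWeight-1 v (2 + k) Q (λ j l → h j (ℕₚ.m+n≤o⇒n≤o 2 l)))) (⊗-identityˡ 1ℚ)

columnWeight-wt : ∀ v k Q → v k ≡ ½ → (∀ j → k < j → v j ≡ 1ℚ) → columnWeight v k Q ≡ wt true Q
columnWeight-wt v k []          e h = refl
columnWeight-wt v k (false ∷ Q) e h = columnWeight-1 v (2 + k) Q (λ j l → h j (ℕₚ.m+n≤o⇒n≤o 1 l))
columnWeight-wt v k (true ∷ Q)  e h = trans (cong₂ _⊗_ e (columnWeight-1 v (2 + k) Q (λ j l → h j (ℕₚ.m+n≤o⇒n≤o 1 l)))) (⊗-identityʳ ½)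

rowOf : Bool → List Bool → List Bool → List Bool
rowOf s P B = if s then il B P else il P B

par-+ : ∀ m n → par n ≡ false → par (m + n) ≡ par m
par-+ zero    n e = e
par-+ (suc m) n e = cong not (par-+ m n e)

sumB-length : ∀ {m n f g} → m ≡ n → (∀ Q → length Q ≡ n → f Q ≡ g Q) → sumB m f ≡ sumB n g
sumB-length refl h = sumB-cong _ h

par-double : ∀ b → par (b + b) ≡ false
par-double zero    = refl
par-double (suc b) = trans (cong not (cong par (ℕₚ.+-suc b b))) (trans (not-involutive _) (par-double b))

-- Strips of height 1 between the lines b and b+1, where the missing
-- up-pointing triangles above the line b are marked in A b, and the missing
-- down-pointing ones below it in B b; all lines have wd marks.
module Strips (h wd : ℕ) (A B : ℕ → List Bool) (lengthA : ∀ b → length (A b) ≡ wd) (lengthB : ∀ b → length (B b) ≡ wd) where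

  down : ℕ → Bool
  down b = not (par (h + b))

  strips : ℕ → ℕ → List Cell
  strips b zero    = []
  strips b (suc n) = cells h b (rowOf (down b) (A b) (B (suc b))) ++ strips (suc b) n

  -- The weighted number of tilings of the n strips above the line b, with
  -- missing up-pointing triangles P in the lowest one.
  upward : ℕ → ℕ → List Bool → ℚ
  upward zero    b P = 1ℚ
  upward (suc n) b P = sumB wd (λ Q → ind (free Q (B (suc b)) (A (suc b)))
    (wt (down b) Q ⊗ ind (kern (down b) P (orl Q (B (suc b)))) (upward n (suc b) (orl Q (A (suc b))))))

  cells-full : ∀ k b r → none (map not r) ≡ true → cells k b r ≡ []
  cells-full k b []         e = refl
  cells-full k b (true ∷ r) e = cells-full (suc k) b r e

  Full : List Bool → Set
  Full r = none (map not r) ≡ true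

  full-il : ∀ P Q → Full P → Full Q → Full (il P Q)
  full-il []         Q p q = refl
  full-il (true ∷ P) Q p q = full-il Q P q p

  full-orl : ∀ Q A → Full A → Full (orl Q A)
  full-orl []      A          p = refl
  full-orl (q ∷ Q) []         p = refl
  full-orl (q ∷ Q) (true ∷ A) p rewrite ∨-zeroʳ q = full-orl Q A p

  full-rowOf : ∀ s P Q → Full P → Full Q → Full (rowOf s P Q)
  full-rowOf false P Q p q = full-il P Q p q
  full-rowOf true  P Q p q = full-il Q P q p

  strips-above : ∀ b n {c} → c ≤ b → All (λ d → ∃ λ m → proj₂ d ≡ + m × c ≤ m) (strips b n)
  strips-above b zero    l = []
  strips-above b (suc n) l = All-++⁺ (cells-All h b (rowOf (down b) (A b) (B (suc b))) (λ _ _ → b , refl , l)) (strips-above (suc b) n (ℕₚ.m≤n⇒m≤1+n l))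

  length-il : ∀ {n} P Q → length P ≡ n → length Q ≡ n → length (il P Q) ≡ n + n
  length-il []      []      refl q = refl
  length-il (p ∷ P) (x ∷ Q) refl q = cong suc (trans (cong suc (length-il P Q refl (ℕₚ.suc-injective q))) (sym (ℕₚ.+-suc _ _)))

  length-rowOf : ∀ {n} s P Q → length P ≡ n → length Q ≡ n → length (rowOf s P Q) ≡ n + n
  length-rowOf false P Q p q = length-il P Q p q
  length-rowOf true  P Q p q = length-il Q P q p

  length-orl : ∀ {n} Q A → length Q ≡ n → length A ≡ n → length (orl Q A) ≡ n
  length-orl []      A       refl q = refl
  length-orl (x ∷ Q) (a ∷ A) refl q = cong suc (length-orl Q A refl (ℕₚ.suc-injective q))

  even-gap : ∀ b n → b + suc n ≡ h → down b ≡ true → ∃ λ m → h ≡ b + 2 * suc m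
  even-gap b n refl d with rk (suc n) in r | rk-even (suc n) even
    where
    even : par (suc n) ≡ false
    even = begin
      par (suc n)             ≡⟨ sym (par-+ (suc n) (b + b) (par-double b)) ⟩
      par (suc n + (b + b))   ≡⟨ cong par (trans (sym (ℕₚ.+-assoc (suc n) b b)) (cong (_+ b) (ℕₚ.+-comm (suc n) b))) ⟩
      par (b + suc n + b)     ≡⟨ trans (sym (not-involutive _)) (cong not d) ⟩
      false ∎
      where open ≡-Reasoning
  ... | suc m | e = m , cong (λ z → b + z) (trans e (cong (ℕ._+_ (suc m)) (sym (ℕₚ.+-identityʳ (suc m)))))

  W : Lozenge → ℚ
  W = westernWeight h

  module _ (topA : Full (A h)) (topB : Full (B (suc h))) where

    -- The induction ends at an artificial strip on top of the region whose triangles are all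
    -- missing; it keeps vertical lozenges from crossing the northern side.
    M-upward : ∀ n b P → b + n ≡ h → length P ≡ wd → (n ≡ 0 → Full P) →
      M W (cells h b (rowOf (down b) P (B (suc b))) ++ strips (suc b) n) ≡ upward n b P
    M-upward zero b P e l f = trans (cong (M W) (trans (++-identityʳ _) (cells-full h b (rowOf (down b) P (B (suc b))) (full-rowOf (down b) P (B (suc b)) (f refl)
      (subst (λ z → Full (B (suc z))) (trans (sym e) (ℕₚ.+-identityʳ b)) topB))))) (M-[] W)
    M-upward (suc n) b P e l f = trans
      (Strip.M-strip W b (strips (2 + b) n) (strips-above (2 + b) n ℕₚ.≤-refl) h [] (rowOf (down b) P (B (suc b))) (rowOf (down (suc b)) (A (suc b)) (B (2 + b))) []
        (trans (length-rowOf (down b) P (B (suc b)) l (lengthB (suc b))) (sym (length-rowOf (down (suc b)) (A (suc b)) (B (2 + b)) (lengthA (suc b)) (lengthB (2 + b))))))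
      (lem (down b) refl (down (suc b)) (cong not (cong par (ℕₚ.+-suc h b))))
      where
      b+1 = suc b
      tail : List Bool → ℚ
      tail o = M W (cells h b+1 o ++ strips (2 + b) n)
      IH : ∀ s → down b+1 ≡ s → ∀ Q → length Q ≡ wd → tail (rowOf s (orl Q (A b+1)) (B (2 + b))) ≡ upward n b+1 (orl Q (A b+1))
      IH s refl Q m = M-upward n b+1 (orl Q (A b+1)) (trans (sym (ℕₚ.+-suc b n)) e) (length-orl Q (A b+1) m (lengthA b+1))
        λ { refl → full-orl Q (A b+1) (subst (Full ∘ A) (trans (sym e) (ℕₚ.+-comm b 1)) topA) }
      finish : ∀ {t : Bool} {c c′ : ℚ} {p q} Q → c ≡ c′ → p ≡ q →
        ind (free Q (B b+1) (A b+1)) (c ⊗ ind t p) ≡ ind (free Q (B b+1) (A b+1)) (c′ ⊗ ind t q)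
      finish {t} Q e e′ = cong₂ (λ x y → ind (free Q (B b+1) (A b+1)) (x ⊗ ind t y)) e e′
      up : ∀ s → down b ≡ s → isUp (+ h , + b) ≡ not s
      up s d = trans (isUp-par h b) (trans (sym (not-involutive _)) (cong not d))
      right : ∀ j → h < j → vertical W j b ≡ 1ℚ
      right j = western-vertical h j b
      lem : ∀ s → down b ≡ s → ∀ t → down b+1 ≡ not (not (par (h + b))) →
        rowSum W h b (rowOf s P (B b+1)) (rowOf (down b+1) (A b+1) (B (2 + b))) tail ≡
        sumB wd (λ Q → ind (free Q (B b+1) (A b+1)) (wt s Q ⊗ ind (kern s P (orl Q (B b+1))) (upward n b+1 (orl Q (A b+1)))))
      lem false d _ d′ rewrite trans d′ (cong not d) = trans
        (rowSum-up W b (λ k → western-horizontal h k b) h tail (up false d) (balanced P (B b+1) (B (2 + b)) (A b+1) l (lengthB b+1) (lengthB (2 + b)) (lengthA b+1)))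
        (sumB-length (lengthB b+1) (λ Q m → finish {fits P (orl Q (B b+1))} Q (columnWeight-1 (λ k → vertical W k b) (suc h) Q right) (IH true (trans d′ (cong not d)) Q m)))
      lem true d _ d′ rewrite trans d′ (cong not d) = trans
        (rowSum-down W b (λ k → western-horizontal h k b) h tail (up true d) (balanced (B b+1) P (A b+1) (B (2 + b)) (lengthB b+1) l (lengthA b+1) (lengthB (2 + b))))
        (sumB-length (lengthB b+1) (λ Q m → finish {fits (orl Q (B b+1)) P} Q (columnWeight-wt (λ k → vertical W k b) h Q half right) (IH false (trans d′ (cong not d)) Q m)))
        where
        half : vertical W h b ≡ ½
        half with even-gap b n e d
        ... | m , g = subst (λ z → vertical (westernWeight z) z b ≡ ½) (sym g) (western-½ b m)

-- Forced lozenges around holes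

ones zeros : ℕ → List Bool
ones j  = replicate j true
zeros j = replicate j false

Near : ℕ → ℕ → Set
Near m n = m ≡ n ⊎ m ≡ suc n

near-pred : ∀ {m n} → Near (suc m) n → Near n m
near-pred (inj₁ refl) = inj₂ refl
near-pred (inj₂ refl) = inj₁ refl

near-suc : ∀ {m n} → Near (suc m) (suc n) → Near m n
near-suc (inj₁ refl) = inj₁ refl
near-suc (inj₂ refl) = inj₂ refl

fits-ones : ∀ a b → Near a b → fits (ones a) (ones b) ≡ true
fits-ones zero    zero    n = refl
fits-ones zero    (suc b) (inj₁ ())
fits-ones zero    (suc b) (inj₂ ())
fits-ones (suc a) b       n = fits-ones b a (near-pred n)

-- Missing triangles behind the right end of a strip impose nothing, provided that up- and
-- down-pointing triangles alternate both with and without them; this is what the two conditions on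
-- lengths say.
fits-pad : ∀ X Y a b → Near (length X) (length Y) → Near (length X + a) (length Y + b) → fits (X ++ ones a) (Y ++ ones b) ≡ fits X Y
fits-pad []          []          a b n n′ = fits-ones a b n′
fits-pad []          (_ ∷ Y)     a b (inj₁ ()) n′
fits-pad []          (_ ∷ Y)     a b (inj₂ ()) n′
fits-pad (true ∷ X)  Y           a b n n′ = fits-pad Y X b a (near-pred n) (near-pred n′)
fits-pad (false ∷ X) (false ∷ Y) a b n n′ = fits-pad X Y a b (near-suc n) (near-suc n′)
fits-pad (false ∷ X) (true ∷ Y)  a b n n′ = refl
fits-pad (false ∷ X) []          a zero    n n′ = refl
fits-pad (false ∷ X) []          a (suc b) n n′ = refl

sup : List Bool → List Bool → Bool
sup (r ∷ R) (h ∷ H) = (not h ∨ r) ∧ sup R H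
sup _       _       = true

-- The profile of a triangular hole from line to line: each removed segment of H lies between two
-- adjacent removed segments of P, the neighbouring line closer to the base, which is one segment
-- longer.
data Erodes : List Bool → List Bool → Set where
  stop : ∀ {p} → Erodes [] [ p ]
  _◂_  : ∀ {h H p p′ P} → (h ≡ true → p ≡ true × p′ ≡ true) → Erodes H (p′ ∷ P) → Erodes (h ∷ H) (p ∷ p′ ∷ P)

-- Interlacing puts an element of R between consecutive elements of P. For two adjacent ones there
-- is only one place, so the crossings inside a hole are forced.
fits-sup₁ : ∀ {H P} R → Erodes H P → fits P R ≡ true → sup R H ≡ true
fits-sup₂ : ∀ {H q P} R → Erodes H (q ∷ P) → fits R P ≡ true → sup R H ≡ true

fits-sup₁ {P = true ∷ _}  R           E       e = fits-sup₂ R E e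
fits-sup₁ {P = false ∷ _} []          E       e = refl
fits-sup₁ {P = false ∷ _} (false ∷ R) stop    e = refl
fits-sup₁ {H = true ∷ _}  {false ∷ _} (false ∷ R) (k ◂ E) e with k refl
... | () , _
fits-sup₁ {H = false ∷ _} {false ∷ _} (false ∷ R) (k ◂ E) e = fits-sup₁ R E e

fits-sup₂ []          E       e = refl
fits-sup₂ (_ ∷ R)     stop    e = refl
fits-sup₂ {H = h ∷ _} (true ∷ R)  (k ◂ E) e rewrite ∨-zeroʳ (not h) = fits-sup₁ R E e
fits-sup₂ {H = true ∷ _}  {P = false ∷ P} (false ∷ R) (k ◂ E) e with k refl
... | _ , ()
fits-sup₂ {H = false ∷ _} {P = false ∷ P} (false ∷ R) (k ◂ E) e = fits-sup₂ R E e

-- A strip starting with a down-pointing triangle has as many segments above as below; the leftmost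
-- upper one meets a single lower segment and is required to lie outside the holes.
ErodesAt : Bool → List Bool → List Bool → Set
ErodesAt false H P = Erodes H P
ErodesAt true  H P = ∃ λ H′ → H ≡ false ∷ H′ × Erodes H′ P

kern-sup : ∀ s {H P} R → ErodesAt s H P → kern s P R ≡ true → sup R H ≡ true
kern-sup false R           E               e = fits-sup₁ R E e
kern-sup true  []          E               e = refl
kern-sup true  (true ∷ R)  (_ , refl , E)  e = fits-sup₁ R E e
kern-sup true  {P = false ∷ P} (false ∷ R) (_ , refl , E) e = fits-sup₂ R E e

erodes-mono : ∀ {H H′ P} → Erodes H H′ → length P ≡ length H′ → sup P H′ ≡ true → Erodes H P
erodes-mono {P = p ∷ []} stop l e = stop
erodes-mono {H′ = h ∷ h′ ∷ H′} {p ∷ p′ ∷ P} (k ◂ E) l e =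
  (λ t → use p h (proj₁ (k t)) (∧₁ e) , use p′ h′ (proj₂ (k t)) (∧₁ (∧₂ (not h ∨ p) e))) ◂ erodes-mono E (ℕₚ.suc-injective l) (∧₂ (not h ∨ p) e)
  where
  ∧₁ : ∀ {a b} → a ∧ b ≡ true → a ≡ true
  ∧₁ {true} _ = refl
  ∧₂ : ∀ a {b} → a ∧ b ≡ true → b ≡ true
  ∧₂ true e = e
  use : ∀ p h → h ≡ true → not h ∨ p ≡ true → p ≡ true
  use p true refl e = e

erodesAt-mono : ∀ s {H H′ P} → ErodesAt s H H′ → length P ≡ length H′ → sup P H′ ≡ true → ErodesAt s H P
erodesAt-mono false E              l e = erodes-mono E l e
erodesAt-mono true  (H , refl , E) l e = H , refl , erodes-mono E l e

sup-orl : ∀ Q H → sup (orl Q H) H ≡ true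
sup-orl []      H       = refl
sup-orl (q ∷ Q) []      = refl
sup-orl (q ∷ Q) (true ∷ H)  rewrite ∨-zeroʳ q = sup-orl Q H
sup-orl (q ∷ Q) (false ∷ H) = sup-orl Q H

-- Taking the union with H is a bijection from the sets disjoint from H to the sets containing H.
sumB-free : ∀ H (f : List Bool → ℚ) → sumB (length H) (λ Q → ind (free Q H H) (f (orl Q H))) ≡ sumB (length H) (λ R → ind (sup R H) (f R))
sumB-free []          f = refl
sumB-free (true ∷ H)  f = trans (cong₂ _⊕_ (sumB-free H (f ∘ (true ∷_))) (sumB-0 (length H) (λ _ _ → refl)))
  (trans (⊕-comm _ _) (cong (_⊕ sumB (length H) (λ R → ind (sup R H) (f (true ∷ R)))) (sym (sumB-0 (length H) (λ _ _ → refl)))))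
sumB-free (false ∷ H) f = cong₂ _⊕_ (sumB-free H (f ∘ (false ∷_))) (sumB-free H (f ∘ (true ∷_)))

sumB-full : ∀ j (F : List Bool → ℚ) → sumB j (λ Q → ind (free Q (ones j) (ones j)) (F Q)) ≡ F (zeros j)
sumB-full zero    F = refl
sumB-full (suc j) F = trans (cong₂ _⊕_ (sumB-full j (F ∘ (false ∷_))) (sumB-0 j (λ _ _ → refl))) (⊕-identityʳ _)

sumB-pad : ∀ X Y j (F : List Bool → ℚ) → length X ≡ length Y →
  sumB (length X + j) (λ Q → ind (free Q (X ++ ones j) (Y ++ ones j)) (F Q)) ≡ sumB (length X) (λ Q → ind (free Q X Y) (F (Q ++ zeros j)))
sumB-pad []      []      j F e = sumB-full j F
sumB-pad (x ∷ X) (y ∷ Y) j F e = cong₂ _⊕_ (sumB-pad X Y j (F ∘ (false ∷_)) (ℕₚ.suc-injective e)) (lem (not x ∧ not y))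
  where
  lem : ∀ c → sumB (length X + j) (λ Q → ind (c ∧ free Q (X ++ ones j) (Y ++ ones j)) (F (true ∷ Q))) ≡ sumB (length X) (λ Q → ind (c ∧ free Q X Y) (F (true ∷ Q ++ zeros j)))
  lem true  = sumB-pad X Y j (F ∘ (true ∷_)) (ℕₚ.suc-injective e)
  lem false = trans (sumB-0 (length X + j) (λ _ _ → refl)) (sym (sumB-0 (length X) (λ _ _ → refl)))

orl-pad : ∀ Q H j → length Q ≡ length H → orl (Q ++ zeros j) (H ++ ones j) ≡ orl Q H ++ ones j
orl-pad []      []      zero    e = refl
orl-pad []      []      (suc j) e = cong (true ∷_) (orl-pad [] [] j refl)
orl-pad (q ∷ Q) (h ∷ H) j       e = cong (_ ∷_) (orl-pad Q H j (ℕₚ.suc-injective e))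

orl-length : ∀ Q H → length Q ≡ length H → length (orl Q H) ≡ length H
orl-length []      []      e = refl
orl-length (q ∷ Q) (h ∷ H) e = cong suc (orl-length Q H (ℕₚ.suc-injective e))

LengthAt : Bool → ℕ → ℕ → Set
LengthAt s m p = if s then p ≡ m else p ≡ suc m

kern-pad : ∀ s P R a b → LengthAt s (length R) (length P) → length P + a ≡ length R + b → kern s (P ++ ones a) (R ++ ones b) ≡ kern s P R
kern-pad false P R a b l e = fits-pad P R a b (inj₂ l) (inj₁ e)
kern-pad true  P R a b l e = fits-pad R P b a (inj₁ (sym l)) (inj₁ (sym e))

wt-pad : ∀ s Q j → wt s (Q ++ zeros j) ≡ wt s Q
wt-pad false Q           j       = refl
wt-pad true  []          zero    = refl
wt-pad true  []          (suc j) = refl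
wt-pad true  (false ∷ Q) j       = refl
wt-pad true  (true ∷ Q)  j       = refl

wt-orl : ∀ s {H P} Q → ErodesAt s H P → length Q ≡ length H → wt s Q ≡ wt s (orl Q H)
wt-orl false Q           E              l = refl
wt-orl true  (false ∷ Q) (_ , refl , E) l = refl
wt-orl true  (true ∷ Q)  (_ , refl , E) l = refl

-- A set R of crossings avoiding the holes H is replaced by the union of R
-- and H, since the crossings in H are forced when H erodes P.
fill-holes : ∀ s H P a b wd (F T : List Bool → ℚ) → ErodesAt s H P → LengthAt s (length H) (length P) → length H + a ≡ wd → length P + b ≡ wd →
  (∀ Q → length Q ≡ length H → F (Q ++ zeros a) ≡ T (orl Q H)) →
  sumB wd (λ R → ind (free R (H ++ ones a) (H ++ ones a)) (wt s R ⊗ ind (kern s (P ++ ones b) (orl R (H ++ ones a))) (F R)))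
  ≡ sumB (length H) (λ Q → wt s Q ⊗ ind (kern s P Q) (T Q))
fill-holes s H P a b wd F T E l refl e h = begin
  sumB (length H + a) (λ R → ind (free R (H ++ ones a) (H ++ ones a)) (wt s R ⊗ ind (kern s (P ++ ones b) (orl R (H ++ ones a))) (F R)))
    ≡⟨ sumB-pad H H a (λ R → wt s R ⊗ ind (kern s (P ++ ones b) (orl R (H ++ ones a))) (F R)) refl ⟩
  sumB (length H) (λ Q → ind (free Q H H) (wt s (Q ++ zeros a) ⊗ ind (kern s (P ++ ones b) (orl (Q ++ zeros a) (H ++ ones a))) (F (Q ++ zeros a))))
    ≡⟨ sumB-cong (length H) (λ Q m → cong (ind (free Q H H)) (cong₂ _⊗_ (trans (wt-pad s Q a) (wt-orl s Q E m))
         (cong₂ ind (trans (cong (kern s (P ++ ones b)) (orl-pad Q H a m)) (kern-pad s P (orl Q H) b a (len Q m) (trans e (cong (_+ a) (sym (orl-length Q H m)))))) (h Q m)))) ⟩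
  sumB (length H) (λ Q → ind (free Q H H) (wt s (orl Q H) ⊗ ind (kern s P (orl Q H)) (T (orl Q H))))
    ≡⟨ sumB-free H (λ R → wt s R ⊗ ind (kern s P R) (T R)) ⟩
  sumB (length H) (λ R → ind (sup R H) (wt s R ⊗ ind (kern s P R) (T R)))
    ≡⟨ sumB-cong (length H) (λ R _ → absorb R) ⟩
  sumB (length H) (λ R → wt s R ⊗ ind (kern s P R) (T R)) ∎
  where
  open ≡-Reasoning
  len : ∀ Q → length Q ≡ length H → LengthAt s (length (orl Q H)) (length P)
  len Q m = subst (λ z → LengthAt s z (length P)) (sym (orl-length Q H m)) l
  absorb : ∀ R → ind (sup R H) (wt s R ⊗ ind (kern s P R) (T R)) ≡ wt s R ⊗ ind (kern s P R) (T R)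
  absorb R with kern s P R in k
  ... | true  = cong (λ z → ind z (wt s R ⊗ T R)) (kern-sup s R E k)
  ... | false = trans (cong (ind (sup R H)) (⊗-zeroʳ _)) (trans (ind-0 (sup R H)) (sym (⊗-zeroʳ _)))

sumB-single : ∀ n (F : List Bool → ℚ) → (∀ Q → none Q ≡ false → F Q ≡ 0ℚ) → sumB n F ≡ F (zeros n)
sumB-single zero    F h = refl
sumB-single (suc n) F h = trans (cong₂ _⊕_ (sumB-single n (F ∘ (false ∷_)) (λ Q → h (false ∷ Q))) (sumB-0 n (λ Q _ → h (true ∷ Q) refl))) (⊕-identityʳ _)

none-zeros : ∀ n → none (zeros n) ≡ true
none-zeros zero    = refl
none-zeros (suc n) = none-zeros n

free-zeros : ∀ n X Y → free (zeros n) X Y ≡ true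
free-zeros zero    X       Y       = refl
free-zeros (suc n) []      Y       = refl
free-zeros (suc n) (x ∷ X) []      = refl
free-zeros (suc n) (x ∷ X) (y ∷ Y) = free-zeros n X Y

wt-zeros : ∀ s n → wt s (zeros n) ≡ 1ℚ
wt-zeros false n       = refl
wt-zeros true  zero    = refl
wt-zeros true  (suc n) = refl

free-ones : ∀ Q X → length X ≡ length Q → none Q ≡ false → free Q X (ones (length Q)) ≡ false
free-ones (true ∷ Q)  (x ∷ X) e h rewrite ∧-zeroʳ (not x) = refl
free-ones (false ∷ Q) (x ∷ X) e h = free-ones Q X (ℕₚ.suc-injective e) h

sumB-ones : ∀ n X (F : List Bool → ℚ) → length X ≡ n → sumB n (λ Q → ind (free Q X (ones n)) (F Q)) ≡ F (zeros n)
sumB-ones n X F e = trans (sumB-single′ n (λ Q l h → cong (λ z → ind z (F Q)) (subst (λ m → free Q X (ones m) ≡ false) l (free-ones Q X (trans e (sym l)) h))))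
  (cong (λ z → ind z (F (zeros n))) (free-zeros n X (ones n)))
  where
  sumB-single′ : ∀ n {F : List Bool → ℚ} → (∀ Q → length Q ≡ n → none Q ≡ false → F Q ≡ 0ℚ) → sumB n F ≡ F (zeros n)
  sumB-single′ zero    h = refl
  sumB-single′ (suc n) h = trans (cong₂ _⊕_ (sumB-single′ n (λ Q l → h (false ∷ Q) (cong suc l))) (sumB-0 n (λ Q l → h (true ∷ Q) (cong suc l) refl))) (⊕-identityʳ _)

ind-none : ∀ Q q → none Q ≡ false → ind (none Q) q ≡ 0ℚ
ind-none Q q e = ind-false q e

≡ᵇ-refl : ∀ n → (n ℕ.≡ᵇ n) ≡ true
≡ᵇ-refl zero    = refl
≡ᵇ-refl (suc n) = ≡ᵇ-refl n

≡ᵇ-< : ∀ {m n} → m < n → (m ℕ.≡ᵇ n) ≡ false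
≡ᵇ-< {zero}  (s≤s l) = refl
≡ᵇ-< {suc m} (s≤s l) = ≡ᵇ-< l

length-zeros-orl : ∀ n A → length A ≡ n → orl (zeros n) A ≡ A
length-zeros-orl zero    []      e = refl
length-zeros-orl (suc n) (a ∷ A) e = cong (a ∷_) (length-zeros-orl n A (ℕₚ.suc-injective e))

full-ones : ∀ n → none (map not (ones n)) ≡ true
full-ones zero    = refl
full-ones (suc n) = full-ones n

-- Cutting a region along a horizontal line.

module Lines (h wd : ℕ) (A B : ℕ → List Bool) (lengthA : ∀ b → length (A b) ≡ wd) (lengthB : ∀ b → length (B b) ≡ wd) where

  open Strips h wd A B lengthA lengthB using (down; strips; W)

  -- The n strips above the line b, given the crossings Q of this line, which here are kept apart
  -- from the holes. The weights of Q itself are left out, in `forward` as well, so that a cut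
  -- counts them once.
  crossing : ℕ → ℕ → List Bool → ℚ
  crossing zero    b Q = ind (none Q) 1ℚ
  crossing (suc n) b Q = sumB wd (λ R → ind (free R (B (suc b)) (A (suc b)))
    (wt (down b) R ⊗ ind (kern (down b) (orl Q (A b)) (orl R (B (suc b)))) (crossing n (suc b) R)))

  forward : ℕ → List Bool → ℚ
  forward zero    Q = ind (none Q) 1ℚ
  forward (suc b) Q = sumB wd (λ R → ind (free R (B b) (A b))
    (wt (par (h + b)) R ⊗ ind (kern (down b) (orl R (A b)) (orl Q (B (suc b)))) (forward b R)))

  -- Adds the artificial strip of missing triangles on top that `M-upward` asks for.
  A⁺ B⁺ : ℕ → List Bool
  A⁺ b = if b ℕ.≡ᵇ h then ones wd else A b
  B⁺ b = if b ℕ.≡ᵇ suc h then ones wd else B b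

  A⁺-< : ∀ {b} → b < h → A⁺ b ≡ A b
  A⁺-< l rewrite ≡ᵇ-< l = refl

  B⁺-≤ : ∀ {b} → b ≤ h → B⁺ b ≡ B b
  B⁺-≤ l rewrite ≡ᵇ-< (s≤s l) = refl

  length-if : ∀ (c : Bool) X → length X ≡ wd → length (if c then ones wd else X) ≡ wd
  length-if true  X e = length-replicate wd
  length-if false X e = e

  module S⁺ = Strips h wd A⁺ B⁺ (λ b → length-if (b ℕ.≡ᵇ h) (A b) (lengthA b)) (λ b → length-if (b ℕ.≡ᵇ suc h) (B b) (lengthB b))

  topA : S⁺.Full (A⁺ h)
  topA rewrite ≡ᵇ-refl h = full-ones wd

  topB : S⁺.Full (B⁺ (suc h))
  topB rewrite ≡ᵇ-refl h = full-ones wd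

  strips⁺ : ∀ n b → b + n ≡ h → S⁺.strips b (suc n) ≡ strips b n
  strips⁺ zero    b e = trans (++-identityʳ _) (S⁺.cells-full h b (rowOf (down b) (A⁺ b) (B⁺ (suc b)))
    (S⁺.full-rowOf (down b) (A⁺ b) (B⁺ (suc b)) (subst (S⁺.Full ∘ A⁺) (sym b≡h) topA) (subst (λ z → S⁺.Full (B⁺ (suc z))) (sym b≡h) topB)))
    where b≡h = trans (sym (ℕₚ.+-identityʳ b)) e
  strips⁺ (suc n) b e = cong₂ _++_ (cong₂ (λ X Y → cells h b (rowOf (down b) X Y)) (A⁺-< b<h) (B⁺-≤ b<h)) (strips⁺ n (suc b) (trans (sym (ℕₚ.+-suc b n)) e))
    where
    b<h : b < h
    b<h = subst (b <_) e (ℕₚ.m<m+n b (s≤s z≤n))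

  upward-crossing : ∀ n b Q → b + suc n ≡ h → S⁺.upward (suc n) b (orl Q (A b)) ≡ crossing (suc n) b Q
  upward-crossing zero b Q e = begin
    sumB wd (λ R → ind (free R (B⁺ (suc b)) (A⁺ (suc b))) (wt (down b) R ⊗ ind (kern (down b) (orl Q (A b)) (orl R (B⁺ (suc b)))) 1ℚ))
      ≡⟨ sumB-cong wd (λ R _ → cong₂ (λ X Y → ind (free R X Y) (wt (down b) R ⊗ ind (kern (down b) (orl Q (A b)) (orl R X)) 1ℚ))
           (B⁺-≤ (ℕₚ.≤-reflexive 1+b≡h)) (trans (cong A⁺ 1+b≡h) (cong (λ z → if z then ones wd else A h) (≡ᵇ-refl h)))) ⟩
    sumB wd (λ R → ind (free R (B (suc b)) (ones wd)) (wt (down b) R ⊗ ind (kern (down b) (orl Q (A b)) (orl R (B (suc b)))) 1ℚ))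
      ≡⟨ sumB-ones wd (B (suc b)) _ (lengthB (suc b)) ⟩
    F (zeros wd) 1ℚ
      ≡⟨ sym (cong₂ ind (free-zeros wd (B (suc b)) (A (suc b))) (cong (F (zeros wd)) (cong (λ z → ind z 1ℚ) (none-zeros wd)))) ⟩
    ind (free (zeros wd) (B (suc b)) (A (suc b))) (F (zeros wd) (ind (none (zeros wd)) 1ℚ))
      ≡⟨ sym (sumB-single wd (λ R → ind (free R (B (suc b)) (A (suc b))) (F R (ind (none R) 1ℚ))) (λ R m → vanish R m)) ⟩
    sumB wd (λ R → ind (free R (B (suc b)) (A (suc b))) (F R (ind (none R) 1ℚ))) ∎
    where
    open ≡-Reasoning
    1+b≡h : suc b ≡ h
    1+b≡h = trans (ℕₚ.+-comm 1 b) e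
    F : List Bool → ℚ → ℚ
    F R q = wt (down b) R ⊗ ind (kern (down b) (orl Q (A b)) (orl R (B (suc b)))) q
    vanish : ∀ R → none R ≡ false → ind (free R (B (suc b)) (A (suc b))) (F R (ind (none R) 1ℚ)) ≡ 0ℚ
    vanish R m = trans (cong (ind (free R (B (suc b)) (A (suc b)))) (trans (cong (wt (down b) R ⊗_) (trans (cong (ind (kern (down b) (orl Q (A b)) (orl R (B (suc b))))) (ind-none R 1ℚ m)) (ind-0 (kern (down b) (orl Q (A b)) (orl R (B (suc b))))))) (⊗-zeroʳ _))) (ind-0 (free R (B (suc b)) (A (suc b))))
  upward-crossing (suc n) b Q e = sumB-cong wd λ R _ → trans
    (cong₂ (λ X Y → ind (free R X Y) (wt (down b) R ⊗ ind (kern (down b) (orl Q (A b)) (orl R X)) (S⁺.upward (suc n) (suc b) (orl R Y))))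
      (B⁺-≤ (ℕₚ.<⇒≤ b<h)) (A⁺-< b<h))
    (cong (λ z → ind (free R (B (suc b)) (A (suc b))) (wt (down b) R ⊗ ind (kern (down b) (orl Q (A b)) (orl R (B (suc b)))) z))
      (upward-crossing n (suc b) R e′))
    where
    e′ : suc b + suc n ≡ h
    e′ = trans (sym (ℕₚ.+-suc b (suc n))) e
    b<h : suc b < h
    b<h = subst (suc b <_) e′ (ℕₚ.m<m+n (suc b) (s≤s z≤n))

  M-crossing : M W (strips 0 h) ≡ crossing h 0 (zeros wd)
  M-crossing = trans (cong (M W) (sym (strips⁺ h 0 refl))) (lem h refl)
    where
    lem : ∀ n → n ≡ h → M W (S⁺.strips 0 (suc h)) ≡ crossing n 0 (zeros wd)
    lem zero    refl = trans (trans (cong (M W) (strips⁺ h 0 refl)) (M-[] W)) (cong (λ z → ind z 1ℚ) (sym (none-zeros wd)))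
    lem (suc n) refl = trans (S⁺.M-upward topA topB h 0 (A⁺ 0) refl (length-if false (A 0) (lengthA 0)) (λ ()))
      (trans (cong (S⁺.upward h 0) (sym (length-zeros-orl wd (A 0) (lengthA 0)))) (upward-crossing n 0 (zeros wd) refl))

  total : ℕ → ℕ → ℚ
  total n b = sumB wd (λ R → ind (free R (B b) (A b)) (wt (par (h + b)) R ⊗ (forward b R ⊗ crossing n b R)))

  private
    exchange : ∀ x y k w w′ f c → ind x (w ⊗ (f ⊗ ind y (w′ ⊗ ind k c))) ≡ ind y (w′ ⊗ (ind x (w ⊗ ind k f) ⊗ c))
    exchange false false k     w w′ f c = refl
    exchange false true  k     w w′ f c = sym (trans (cong (w′ ⊗_) (⊗-zeroˡ c)) (⊗-zeroʳ w′))
    exchange true  false k     w w′ f c = trans (cong (w ⊗_) (⊗-zeroʳ f)) (⊗-zeroʳ w)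
    exchange true  true  false w w′ f c = trans (cong (λ z → w ⊗ (f ⊗ z)) (⊗-zeroʳ w′)) (trans (cong (w ⊗_) (⊗-zeroʳ f)) (trans (⊗-zeroʳ w)
      (sym (trans (cong (λ z → w′ ⊗ (z ⊗ c)) (⊗-zeroʳ w)) (trans (cong (w′ ⊗_) (⊗-zeroˡ c)) (⊗-zeroʳ w′))))))
    exchange true  true  true  w w′ f c = reorder w w′ f c
      where
      opaque
        unfolding _⊕_ isZero
        reorder : ∀ w w′ f c → w ⊗ (f ⊗ (w′ ⊗ c)) ≡ w′ ⊗ ((w ⊗ f) ⊗ c)
        reorder = solve-∀ ℚ-ring

    pullʳ : ∀ n x w f (g : List Bool → ℚ) → ind x (w ⊗ (f ⊗ sumB n g)) ≡ sumB n (λ Q → ind x (w ⊗ (f ⊗ g Q)))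
    pullʳ n false w f g = sym (sumB-0 n (λ _ _ → refl))
    pullʳ n true  w f g = sym (trans (sumB-⊗ n w _) (cong (w ⊗_) (sumB-⊗ n f g)))

    pullˡ : ∀ n x w c (g : List Bool → ℚ) → ind x (w ⊗ (sumB n g ⊗ c)) ≡ sumB n (λ Q → ind x (w ⊗ (g Q ⊗ c)))
    pullˡ n x w c g = trans (cong (λ z → ind x (w ⊗ z)) (⊗-comm _ c)) (trans (pullʳ n x w c g) (sumB-cong n (λ Q _ → cong (λ z → ind x (w ⊗ z)) (⊗-comm c (g Q)))))

  total-0 : total h 0 ≡ crossing h 0 (zeros wd)
  total-0 = trans (sumB-single wd _ vanish) (trans (cong₂ ind (free-zeros wd (B 0) (A 0))
      (cong₂ (λ a b → a ⊗ (ind b 1ℚ ⊗ crossing h 0 (zeros wd))) (wt-zeros (par (h + 0)) wd) (none-zeros wd)))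
    (trans (⊗-identityˡ _) (⊗-identityˡ _)))
    where
    vanish : ∀ R → none R ≡ false → ind (free R (B 0) (A 0)) (wt (par (h + 0)) R ⊗ (ind (none R) 1ℚ ⊗ crossing h 0 R)) ≡ 0ℚ
    vanish R m = trans (cong (ind (free R (B 0) (A 0))) (trans (cong (wt (par (h + 0)) R ⊗_) (trans (cong (_⊗ crossing h 0 R) (ind-none R 1ℚ m)) (⊗-zeroˡ _))) (⊗-zeroʳ _))) (ind-0 (free R (B 0) (A 0)))

  -- Exchanging the sums over the crossings of two neighbouring lines moves the strip between them
  -- from `crossing` to `forward`.
  total-suc : ∀ n b → total (suc n) b ≡ total n (suc b)
  total-suc n b = begin
    sumB wd (λ R → ind (fr R) (v R ⊗ (forward b R ⊗ sumB wd (λ Q → ind (fr′ Q) (wt (down b) Q ⊗ ind (k R Q) (crossing n (suc b) Q))))))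
      ≡⟨ sumB-cong wd (λ R _ → pullʳ wd (fr R) (v R) (forward b R) _) ⟩
    sumB wd (λ R → sumB wd (λ Q → ind (fr R) (v R ⊗ (forward b R ⊗ ind (fr′ Q) (wt (down b) Q ⊗ ind (k R Q) (crossing n (suc b) Q))))))
      ≡⟨ sumB-swap wd wd (λ R Q → ind (fr R) (v R ⊗ (forward b R ⊗ ind (fr′ Q) (wt (down b) Q ⊗ ind (k R Q) (crossing n (suc b) Q))))) ⟩
    sumB wd (λ Q → sumB wd (λ R → ind (fr R) (v R ⊗ (forward b R ⊗ ind (fr′ Q) (wt (down b) Q ⊗ ind (k R Q) (crossing n (suc b) Q))))))
      ≡⟨ sumB-cong wd (λ Q _ → sumB-cong wd (λ R _ → exchange (fr R) (fr′ Q) (k R Q) (v R) (wt (down b) Q) (forward b R) (crossing n (suc b) Q))) ⟩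
    sumB wd (λ Q → sumB wd (λ R → ind (fr′ Q) (wt (down b) Q ⊗ (ind (fr R) (v R ⊗ ind (k R Q) (forward b R)) ⊗ crossing n (suc b) Q))))
      ≡⟨ sumB-cong wd (λ Q _ → sym (pullˡ wd (fr′ Q) (wt (down b) Q) (crossing n (suc b) Q) _)) ⟩
    sumB wd (λ Q → ind (fr′ Q) (wt (down b) Q ⊗ (forward (suc b) Q ⊗ crossing n (suc b) Q)))
      ≡⟨ sumB-cong wd (λ Q _ → cong (λ z → ind (fr′ Q) (wt z Q ⊗ (forward (suc b) Q ⊗ crossing n (suc b) Q))) (cong par (sym (ℕₚ.+-suc h b)))) ⟩
    total n (suc b) ∎
    where
    open ≡-Reasoning
    fr fr′ : List Bool → Bool
    fr R = free R (B b) (A b)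
    fr′ Q = free Q (B (suc b)) (A (suc b))
    v : List Bool → ℚ
    v R = wt (par (h + b)) R
    k : List Bool → List Bool → Bool
    k R Q = kern (down b) (orl R (A b)) (orl Q (B (suc b)))

  M-split : ∀ n b → b + n ≡ h → M W (strips 0 h) ≡ total n b
  M-split n b e = trans (trans M-crossing (sym total-0)) (trans (cong (λ z → total z 0) (trans (sym e) (ℕₚ.+-comm b n))) (move b n))
    where
    move : ∀ b n → total (n + b) 0 ≡ total n b
    move zero    n = cong (λ z → total z 0) (ℕₚ.+-identityʳ n)
    move (suc b) n = trans (cong (λ z → total z 0) (ℕₚ.+-suc n b)) (trans (move b (suc n)) (total-suc n b))

  length-step : ∀ n L → LengthAt (par n) (L + rk n) (L + rk (suc n))
  length-step n L with par n
  ... | true  = refl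
  ... | false = ℕₚ.+-suc L (rk n)

  -- One side of the cut, its lines numbered from the horizontal side of the region towards the cut.
  -- H n marks the holes on the line n; `pad n` further marks stand for what lies beyond the eastern
  -- boundary.
  module Halves (L N : ℕ) (H : ℕ → List Bool) (pad : ℕ → ℕ)
    (lengthH : ∀ n → n ≤ N → length (H n) ≡ L + rk n) (padded : ∀ n → n ≤ N → length (H n) + pad n ≡ wd)
    (start : none (H 0) ≡ true) (erosion : ∀ n → n < N → ErodesAt (par n) (H n) (H (suc n))) where

    private
      Tr-0 : ∀ Q H → length Q ≡ length H → none H ≡ true → ind (none (Q ++ zeros (pad 0))) 1ℚ ≡ ind (none (orl Q H)) 1ℚ
      Tr-0 Q H l e = cong (λ z → ind z 1ℚ) (lem Q H l e)
        where
        lem : ∀ Q H → length Q ≡ length H → none H ≡ true → none (Q ++ zeros (pad 0)) ≡ none (orl Q H)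
        lem []          []          l e = none-zeros (pad 0)
        lem (true ∷ Q)  (h ∷ H)     l e = refl
        lem (false ∷ Q) (false ∷ H) l e = lem Q H (ℕₚ.suc-injective l) e

      step : ∀ n → suc n ≤ N → ∀ Q → length Q ≡ length (H (suc n)) → (F : List Bool → ℚ) →
        (∀ R → length R ≡ length (H n) → F (R ++ zeros (pad n)) ≡ Tr L n (orl R (H n))) →
        sumB wd (λ R → ind (free R (H n ++ ones (pad n)) (H n ++ ones (pad n)))
          (wt (par n) R ⊗ ind (kern (par n) (orl (Q ++ zeros (pad (suc n))) (H (suc n) ++ ones (pad (suc n)))) (orl R (H n ++ ones (pad n)))) (F R)))
        ≡ Tr L (suc n) (orl Q (H (suc n)))
      step n l Q m F h = trans
        (cong (λ z → sumB wd (λ R → ind (free R Hₙ Hₙ) (wt (par n) R ⊗ ind (kern (par n) z (orl R Hₙ)) (F R)))) (orl-pad Q (H (suc n)) (pad (suc n)) m))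
        (trans (fill-holes (par n) (H n) (orl Q (H (suc n))) (pad n) (pad (suc n)) wd F (Tr L n)
            (erodesAt-mono (par n) (erosion n l) (orl-length Q (H (suc n)) m) (sup-orl Q (H (suc n))))
            (subst (LengthAt (par n) (length (H n))) (sym len) (subst (λ z → LengthAt (par n) z (L + rk (suc n))) (sym (lengthH n (ℕₚ.<⇒≤ l))) (length-step n L)))
            (padded n (ℕₚ.<⇒≤ l)) (trans (cong (_+ pad (suc n)) (orl-length Q (H (suc n)) m)) (padded (suc n) l)) h)
          (sumB-length (lengthH n (ℕₚ.<⇒≤ l)) (λ _ _ → refl)))
        where
        Hₙ = H n ++ ones (pad n)
        len : length (orl Q (H (suc n))) ≡ L + rk (suc n)
        len = trans (orl-length Q (H (suc n)) m) (lengthH (suc n) l)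

    down-par : ∀ n b → b + suc n ≡ h → down b ≡ par n
    down-par n b e = trans (cong (λ z → not (par (z + b))) (trans (sym e) (ℕₚ.+-comm b (suc n))))
      (trans (cong (not ∘ par) (ℕₚ.+-assoc (suc n) b b)) (trans (cong not (par-+ (suc n) (b + b) (par-double b))) (not-involutive _)))

    crossing-Tr : (∀ n b → n ≤ N → b + n ≡ h → A b ≡ H n ++ ones (pad n)) → (∀ n b → n < N → b + n ≡ h → B b ≡ H n ++ ones (pad n)) →
      ∀ n b → n ≤ N → b + n ≡ h → ∀ Q → length Q ≡ length (H n) → crossing n b (Q ++ zeros (pad n)) ≡ Tr L n (orl Q (H n))
    crossing-Tr HA HB zero    b l e Q m = Tr-0 Q (H 0) m start
    crossing-Tr HA HB (suc n) b l e Q m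
      rewrite HA (suc n) b l e | HA n (suc b) (ℕₚ.<⇒≤ l) (trans (sym (ℕₚ.+-suc b n)) e) | HB n (suc b) l (trans (sym (ℕₚ.+-suc b n)) e) | down-par n b e
      = step n l Q m (crossing n (suc b)) (crossing-Tr HA HB n (suc b) (ℕₚ.<⇒≤ l) (trans (sym (ℕₚ.+-suc b n)) e))

    -- Upside down, the lower part is of the same kind with A and B exchanged. As h is even, its
    -- lowest strip starts with a down-pointing triangle, which turns into the up-pointing start of
    -- a top row, and the pairs of rows with weighted lozenges are the same.
    forward-Tr : par h ≡ false → (∀ b → b ≤ N → B b ≡ H b ++ ones (pad b)) → (∀ b → b < N → A b ≡ H b ++ ones (pad b)) →
      ∀ b → b ≤ N → ∀ Q → length Q ≡ length (H b) → forward b (Q ++ zeros (pad b)) ≡ Tr L b (orl Q (H b))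
    forward-Tr hev HB HA zero    l Q m = Tr-0 Q (H 0) m start
    forward-Tr hev HB HA (suc b) l Q m rewrite HB (suc b) l | HB b (ℕₚ.<⇒≤ l) | HA b l = trans
      (sumB-cong wd (λ R _ → cong₂ (λ x y → ind (free R (H b ++ ones (pad b)) (H b ++ ones (pad b))) (wt x R ⊗ ind y (forward b R)))
        parity (flip (orl R (H b ++ ones (pad b))) (orl (Q ++ zeros (pad (suc b))) (H (suc b) ++ ones (pad (suc b)))))))
      (step b l Q m (forward b) (forward-Tr hev HB HA b (ℕₚ.<⇒≤ l)))
      where
      parity : par (h + b) ≡ par b
      parity = trans (cong par (ℕₚ.+-comm h b)) (par-+ b h hev)
      flip : ∀ X Y → kern (down b) X Y ≡ kern (par b) Y X
      flip X Y rewrite parity with par b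
      ... | true  = refl
      ... | false = refl

-- Coordinates of unit triangles

-- ⌊n/2⌋; the leftmost segment of the line b will have the number ⌊(h + b)/2⌋.
fl : ℕ → ℕ
fl zero    = 0
fl (suc n) = if par n then suc (fl n) else fl n

fl-even : ∀ n → par n ≡ false → n ≡ fl n + fl n
fl-odd  : ∀ n → par n ≡ true → n ≡ suc (fl n + fl n)
fl-even zero    e = refl
fl-even (suc n) e with par n in p
... | true = cong suc (trans (fl-odd n p) (sym (ℕₚ.+-suc (fl n) (fl n))))
fl-odd (suc n) e with par n in p
... | false = cong suc (fl-even n p)

T-true : ∀ {b} → T b → b ≡ true
T-true = Equivalence.to T-≡

T-ext : ∀ {a b} → (T a → T b) → (T b → T a) → a ≡ b
T-ext {true}  {true}  f g = refl
T-ext {true}  {false} f g = ⊥-elim (f tt)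
T-ext {false} {true}  f g = ⊥-elim (g tt)
T-ext {false} {false} f g = refl

applyUpTo-cong : ∀ {f g : ℕ → Bool} n → (∀ i → i < n → f i ≡ g i) → applyUpTo f n ≡ applyUpTo g n
applyUpTo-cong zero    h = refl
applyUpTo-cong (suc n) h = cong₂ _∷_ (h 0 (s≤s z≤n)) (applyUpTo-cong n (λ i l → h (suc i) (s≤s l)))

il-applyUpTo : ∀ (f g ρ : ℕ → Bool) n → (∀ i → f i ≡ ρ (i + i)) → (∀ i → g i ≡ ρ (suc (i + i))) →
  il (applyUpTo f n) (applyUpTo g n) ≡ applyUpTo ρ (n + n)
il-applyUpTo f g ρ zero    p q = refl
il-applyUpTo f g ρ (suc n) p q rewrite ℕₚ.+-suc n n = cong₂ _∷_ (p 0) (cong₂ _∷_ (q 0)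
  (il-applyUpTo (f ∘ suc) (g ∘ suc) (ρ ∘ suc ∘ suc) n
    (λ i → trans (p (suc i)) (cong (ρ ∘ suc) (ℕₚ.+-suc i i))) (λ i → trans (q (suc i)) (cong (ρ ∘ suc ∘ suc) (ℕₚ.+-suc i i)))))

cells-filter : ∀ (hole : Cell → Bool) b k c m (ρ : ℕ → Bool) → c ≤ m → (∀ i → ρ i ≡ ((k + c) ℕ.≤ᵇ (k + i)) ∨ hole (+ (k + i) , + b)) →
  filterᵇ (not ∘ hole) (applyUpTo (λ i → (+ (k + i) , + b)) c) ≡ cells k b (applyUpTo ρ m)
cells-filter hole b k zero    zero    ρ l h = refl
cells-filter hole b k zero    (suc m) ρ l h rewrite trans (h 0) (cong (_∨ hole (+ (k + 0) , + b)) (T-true (ℕₚ.≤⇒≤ᵇ (ℕₚ.≤-refl {k + 0})))) =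
  cells-filter hole b (suc k) zero m (ρ ∘ suc) z≤n (λ i → trans (h (suc i)) (cong₂ _∨_
    (trans (T-true (ℕₚ.≤⇒≤ᵇ (ℕₚ.+-monoʳ-≤ k (z≤n {suc i})))) (sym (T-true (ℕₚ.≤⇒≤ᵇ (ℕₚ.+-monoʳ-≤ (suc k) (z≤n {i}))))))
    (cong (λ z → hole (+ z , + b)) (ℕₚ.+-suc k i))))
cells-filter hole b k (suc c) (suc m) ρ (s≤s l) h = lem (ρ 0) refl
  where
  k+0 : k + 0 ≡ k
  k+0 = ℕₚ.+-identityʳ k
  beyond : ((k + suc c) ℕ.≤ᵇ (k + 0)) ≡ false
  beyond with (k + suc c) ℕ.≤ᵇ (k + 0) in e
  ... | false = refl
  ... | true  = ⊥-elim (ℕₚ.<⇒≱ (ℕₚ.m<m+n k {suc c} (s≤s z≤n)) (subst (k + suc c ≤_) k+0 (ℕₚ.≤ᵇ⇒≤ _ _ (subst T (sym e) tt))))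
  ρ0 : ρ 0 ≡ hole (+ (k + 0) , + b)
  ρ0 = trans (h 0) (cong (_∨ hole (+ (k + 0) , + b)) beyond)
  rest : filterᵇ (not ∘ hole) (applyUpTo (λ i → (+ (k + suc i) , + b)) c) ≡ cells (suc k) b (applyUpTo (ρ ∘ suc) m)
  rest = trans (cong (filterᵇ (not ∘ hole)) (shift c id))
    (cells-filter hole b (suc k) c m (ρ ∘ suc) l (λ i → trans (h (suc i)) (cong₂ (λ x y → (x ℕ.≤ᵇ y) ∨ hole (+ y , + b)) (ℕₚ.+-suc k c) (ℕₚ.+-suc k i))))
    where
    shift : ∀ c (t : ℕ → ℕ) → applyUpTo (λ i → _,_ {B = λ _ → ℤ} (+ (k + suc (t i))) (+ b)) c ≡ applyUpTo (λ i → (+ (suc k + t i) , + b)) c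
    shift zero    t = refl
    shift (suc c) t = cong₂ (λ x y → (+ x , + b) ∷ y) (ℕₚ.+-suc k (t 0)) (shift c (t ∘ suc))
  lem : ∀ r → ρ 0 ≡ r → filterᵇ (not ∘ hole) (applyUpTo (λ i → (+ (k + i) , + b)) (suc c)) ≡ cells k b (r ∷ applyUpTo (ρ ∘ suc) m)
  lem true  e rewrite trans (sym ρ0) e = rest
  lem false e rewrite trans (sym ρ0) e = cong₂ (λ x y → (+ x , + b) ∷ y) k+0 rest

-- α b u tells whether the up-pointing triangle on the segment u of the line b is missing, β b u
-- whether the down-pointing one below that segment is. Segments beyond the eastern boundary count
-- as missing.
module Columns (h wd : ℕ) (right : ℤ → ℤ) (hole : Cell → Bool) (α β : ℕ → ℕ → Bool) (c : ℕ → ℕ)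
  (ends : ∀ b → b < h → right (+ b) ℤ.+ + 1 ≡ + (h + c b)) (wide : ∀ b → b < h → c b ≤ wd + wd)
  (up-cells : ∀ b u k → b < h → h ≤ k → k + b ≡ suc (u + u) → α b u ≡ (h + c b ℕ.≤ᵇ k) ∨ hole (+ k , + b))
  (down-cells : ∀ b u k → b < h → h ≤ k → k + b ≡ u + u → β (suc b) u ≡ (h + c b ℕ.≤ᵇ k) ∨ hole (+ k , + b)) where

  A B : ℕ → List Bool
  A b = applyUpTo (λ i → α b (fl (h + b) + i)) wd
  B b = applyUpTo (λ i → β b (fl (h + b) + i)) wd

  lengthA : ∀ b → length (A b) ≡ wd
  lengthA b = length-applyUpTo _ wd

  lengthB : ∀ b → length (B b) ≡ wd
  lengthB b = length-applyUpTo _ wd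

  open Strips h wd A B lengthA lengthB using (strips; down)
  open Lines h wd A B lengthA lengthB public

  ρ : ℕ → ℕ → Bool
  ρ b j = (h + c b ℕ.≤ᵇ h + j) ∨ hole (+ (h + j) , + b)

  row : ∀ b → b < h → rowOf (down b) (A b) (B (suc b)) ≡ applyUpTo (ρ b) (wd + wd)
  row b l = lem (par (h + b)) refl
    where
    f = fl (h + b)
    next : fl (h + suc b) ≡ (if par (h + b) then suc f else f)
    next = cong fl (ℕₚ.+-suc h b)
    s₁ : ∀ h b i f → h + b ≡ suc (f + f) → (h + (i + i)) + b ≡ suc ((f + i) + (f + i))
    s₁ h b i f e = trans (perm h b i) (trans (cong (_+ (i + i)) e) (perm′ f i))
      where
      perm : ∀ h b i → (h + (i + i)) + b ≡ (h + b) + (i + i)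
      perm = ℕ-Ring.solve-∀
      perm′ : ∀ f i → suc (f + f) + (i + i) ≡ suc ((f + i) + (f + i))
      perm′ = ℕ-Ring.solve-∀
    s₂ : ∀ h b i f → h + b ≡ f + f → (h + (i + i)) + b ≡ (f + i) + (f + i)
    s₂ h b i f e = trans (perm h b i) (trans (cong (_+ (i + i)) e) (perm′ f i))
      where
      perm : ∀ h b i → (h + (i + i)) + b ≡ (h + b) + (i + i)
      perm = ℕ-Ring.solve-∀
      perm′ : ∀ f i → (f + f) + (i + i) ≡ (f + i) + (f + i)
      perm′ = ℕ-Ring.solve-∀
    shift : ∀ h b j → (h + suc j) + b ≡ suc (h + j + b)
    shift = ℕ-Ring.solve-∀
    dbl : ∀ f i → suc (suc ((f + i) + (f + i))) ≡ (suc f + i) + (suc f + i)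
    dbl = ℕ-Ring.solve-∀
    lem : ∀ s → par (h + b) ≡ s → rowOf (not s) (A b) (B (suc b)) ≡ applyUpTo (ρ b) (wd + wd)
    lem true  e = il-applyUpTo _ _ (ρ b) wd
      (λ i → up-cells b (f + i) (h + (i + i)) l (ℕₚ.m≤m+n h _) (s₁ h b i f (fl-odd (h + b) e)))
      (λ i → trans (cong (λ z → β (suc b) (z + i)) (trans next (cong (λ z → if z then suc f else f) e)))
        (down-cells b (suc f + i) (h + suc (i + i)) l (ℕₚ.m≤m+n h _) (trans (shift h b (i + i)) (trans (cong suc (s₁ h b i f (fl-odd (h + b) e))) (dbl f i)))))
    lem false e = il-applyUpTo _ _ (ρ b) wd
      (λ i → trans (cong (λ z → β (suc b) (z + i)) (trans next (cong (λ z → if z then suc f else f) e)))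
        (down-cells b (f + i) (h + (i + i)) l (ℕₚ.m≤m+n h _) (s₂ h b i f (fl-even (h + b) e))))
      (λ i → up-cells b (f + i) (h + suc (i + i)) l (ℕₚ.m≤m+n h _) (trans (shift h b (i + i)) (cong suc (s₂ h b i f (fl-even (h + b) e)))))

  region-strips : zigRegion h right hole ≡ strips 0 h
  region-strips = lem h id 0 (λ i → refl) (λ i l → l)
    where
    count-cells : ∀ b → b < h → clamp (right (+ b) ℤ.- + h ℤ.+ + 1) ≡ c b
    count-cells b l = cong clamp (trans (move (right (+ b)) (+ h)) (trans (cong (ℤ._- + h) (ends b l)) (cancel (+ h) (+ c b))))
      where
      move : ∀ r h → r ℤ.- h ℤ.+ + 1 ≡ r ℤ.+ + 1 ℤ.- h
      move = ℤ-Ring.solve-∀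
      cancel : ∀ h c → h ℤ.+ c ℤ.- h ≡ c
      cancel = ℤ-Ring.solve-∀
    oneRow : ∀ b → b < h → filterᵇ (not ∘ hole) (map (λ k → (k , + b)) (interval (+ h) (right (+ b)))) ≡ cells h b (rowOf (down b) (A b) (B (suc b)))
    oneRow b l = trans (cong (filterᵇ (not ∘ hole)) (trans (cong (λ z → map (λ k → (k , + b)) (map (λ i → + h ℤ.+ + i) (upTo z))) (count-cells b l))
        (trans (cong (map (λ k → (k , + b))) (map-upTo (λ i → + h ℤ.+ + i) (c b))) (map-applyUpTo (λ i → + h ℤ.+ + i) (λ k → (k , + b)) (c b)))))
      (trans (cells-filter hole b h (c b) (wd + wd) (ρ b) (wide b l) (λ i → refl)) (cong (cells h b) (sym (row b l))))
    lem : ∀ n (t : ℕ → ℕ) b → (∀ i → t i ≡ b + i) → (∀ i → i < n → b + i < h) →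
      filterᵇ (not ∘ hole) (concatMap (λ i → map (λ k → (k , + i)) (interval (+ h) (right (+ i)))) (applyUpTo t n)) ≡ strips b n
    lem zero    t b e l = refl
    lem (suc n) t b e l = trans (filter-++ (T? ∘ not ∘ hole) (map (λ k → (k , + t 0)) (interval (+ h) (right (+ t 0)))) _) (cong₂ _++_
      (trans (cong (λ z → filterᵇ (not ∘ hole) (map (λ k → (k , + z)) (interval (+ h) (right (+ z))))) t0)
        (oneRow b (subst (_< h) (ℕₚ.+-identityʳ b) (l 0 (s≤s z≤n)))))
      (lem n (t ∘ suc) (suc b) (λ i → trans (e (suc i)) (ℕₚ.+-suc b i)) (λ i l′ → subst (_< h) (ℕₚ.+-suc b i) (l (suc i) (s≤s l′)))))
      where
      t0 : t 0 ≡ b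
      t0 = trans (e 0) (ℕₚ.+-identityʳ b)

≤ᵇ-ℤ : ∀ p q m n → q ℤ.- p ≡ + n ℤ.- + m → (p ℤ.≤ᵇ q) ≡ (m ℕ.≤ᵇ n)
≤ᵇ-ℤ p q m n e = T-ext
  (λ t → ℕₚ.≤⇒≤ᵇ (ℤₚ.drop‿+≤+ {m} {n} (ℤₚ.0≤i-j⇒j≤i {+ n} {+ m} (subst (ℤ.0ℤ ℤ.≤_) e (ℤₚ.i≤j⇒0≤j-i {p} {q} (ℤₚ.≤ᵇ⇒≤ {p} {q} t))))))
  (λ t → ℤₚ.≤⇒≤ᵇ {p} {q} (ℤₚ.0≤i-j⇒j≤i {q} {p} (subst (ℤ.0ℤ ℤ.≤_) (sym e) (ℤₚ.i≤j⇒0≤j-i {+ m} {+ n} (ℤ.+≤+ (ℕₚ.≤ᵇ⇒≤ m n t))))))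

half-≤ : ∀ m n → m + m ≤ suc (n + n) → m ≤ n
half-≤ m n l with ℕₚ.≤-total m n
... | inj₁ p = p
... | inj₂ p with ℕₚ.m≤n⇒m<n∨m≡n p
...   | inj₁ q    = ⊥-elim (ℕₚ.<-irrefl refl (ℕₚ.≤-trans (subst (_≤ m + m) (cong suc (ℕₚ.+-suc n n)) (ℕₚ.+-mono-≤ q q)) l))
...   | inj₂ refl = ℕₚ.≤-refl

≤ᵇ-double : ∀ m n → (m + m ℕ.≤ᵇ n + n) ≡ (m ℕ.≤ᵇ n)
≤ᵇ-double m n = T-ext (λ t → ℕₚ.≤⇒≤ᵇ (half-≤ m n (ℕₚ.m≤n⇒m≤1+n (ℕₚ.≤ᵇ⇒≤ _ _ t)))) (λ t → ℕₚ.≤⇒≤ᵇ (ℕₚ.+-mono-≤ (ℕₚ.≤ᵇ⇒≤ m n t) (ℕₚ.≤ᵇ⇒≤ m n t)))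

≤ᵇ-double-suc : ∀ m n → (m + m ℕ.≤ᵇ suc (n + n)) ≡ (m ℕ.≤ᵇ n)
≤ᵇ-double-suc m n = T-ext (λ t → ℕₚ.≤⇒≤ᵇ (half-≤ m n (ℕₚ.≤ᵇ⇒≤ _ _ t))) (λ t → ℕₚ.≤⇒≤ᵇ (ℕₚ.m≤n⇒m≤1+n (ℕₚ.+-mono-≤ (ℕₚ.≤ᵇ⇒≤ m n t) (ℕₚ.≤ᵇ⇒≤ m n t))))

≤ᵇ-suc-double : ∀ m n → (suc (m + m) ℕ.≤ᵇ n + n) ≡ (suc m ℕ.≤ᵇ n)
≤ᵇ-suc-double m n = T-ext
  (λ t → ℕₚ.≤⇒≤ᵇ (half-≤ (suc m) n (subst (_≤ suc (n + n)) (cong suc (sym (ℕₚ.+-suc m m))) (s≤s (ℕₚ.≤ᵇ⇒≤ _ _ t)))))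
  (λ t → ℕₚ.≤⇒≤ᵇ (ℕₚ.<⇒≤ (subst (_≤ n + n) (cong suc (ℕₚ.+-suc m m)) (ℕₚ.+-mono-≤ (ℕₚ.≤ᵇ⇒≤ (suc m) n t) (ℕₚ.≤ᵇ⇒≤ (suc m) n t)))))

-- An up-pointing (down-pointing) triangle of side a with base (top side)
-- [q , q + 2a] on the line bl is given by v and a, where q + bl = 2v; it
-- removes the unit segments u of the line b, those with end points 2u - b
-- and 2u + 2 - b, such that holeUp (holeDown) is true.
holeUp holeDown : ℕ → ℕ → ℕ → ℕ → ℕ → Bool
holeUp v a bl b u = (bl ℕ.≤ᵇ b) ∧ (v + b ℕ.≤ᵇ u + bl) ∧ (suc u ℕ.≤ᵇ v + a)
holeDown v a bl b u = (v ℕ.≤ᵇ u) ∧ (suc (u + bl) ℕ.≤ᵇ v + a + b)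

T-∧⁻ : ∀ {a b} → T (a ∧ b) → T a × T b
T-∧⁻ {a} {b} = Equivalence.to (T-∧ {a} {b})

T-∧⁺ : ∀ {a b} → T a → T b → T (a ∧ b)
T-∧⁺ {a} {b} p q = Equivalence.from (T-∧ {a} {b}) (p , q)

module _ (q : ℤ) (v a bl b k u : ℕ) (base : q ℤ.+ + bl ≡ + (v + v)) where

  private
    Q = (+ v ℤ.+ + v) ℤ.- + bl

    q-eq : q ≡ Q
    q-eq = trans (lem q (+ bl)) (cong (ℤ._- + bl) base)
      where
      lem : ∀ q b → q ≡ q ℤ.+ b ℤ.- b
      lem = ℤ-Ring.solve-∀

    k-eq : ∀ n → k + b ≡ n → + k ≡ + n ℤ.- + b
    k-eq n e = trans (lem (+ k) (+ b)) (cong (λ z → + z ℤ.- + b) e)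
      where
      lem : ∀ q b → q ≡ q ℤ.+ b ℤ.- b
      lem = ℤ-Ring.solve-∀

    combine : ∀ {p r p′ r′ : ℤ} {s} → p ≡ p′ → r ≡ r′ → r′ ℤ.- p′ ≡ s → r ℤ.- p ≡ s
    combine refl refl e = e

    -- The bound on the height of a triangle follows from the bounds given by its two slanted sides,
    -- so three of the four inequalities suffice.
    four : ∀ {x y z w z′ w′} → z ≡ z′ → w ≡ w′ → (T x → T z′ → T w′ → T y) → x ∧ y ∧ z ∧ w ≡ x ∧ z′ ∧ w′
    four {true}  {true}  {true}  {true}  refl refl h = refl
    four {true}  {true}  {true}  {false} refl refl h = refl
    four {true}  {true}  {false} {w}     refl refl h = refl
    four {true}  {false} {true}  {true}  refl refl h = ⊥-elim (h tt tt tt)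
    four {true}  {false} {true}  {false} refl refl h = refl
    four {true}  {false} {false} {w}     refl refl h = refl
    four {false} refl refl h = refl

    span : v + b ≤ u + bl → u < v + a → b < bl + a
    span l m = ℕₚ.+-cancelˡ-≤ v _ _ (ℕₚ.≤-trans (ℕₚ.≤-reflexive (ℕₚ.+-suc v b)) (ℕₚ.≤-trans (s≤s l)
      (ℕₚ.≤-trans (ℕₚ.+-monoˡ-≤ bl m) (ℕₚ.≤-reflexive (perm v a bl)))))
      where
      perm : ∀ v a bl → v + a + bl ≡ v + (bl + a)
      perm = ℕ-Ring.solve-∀

  up-triangle-up : k + b ≡ suc (u + u) → inUpTriangle q a (+ bl) (+ k , + b) ≡ holeUp v a bl b u
  up-triangle-up e = four {bl ℕ.≤ᵇ b}
    (trans (≤ᵇ-ℤ (q ℤ.+ + 1 ℤ.+ (+ b ℤ.- + bl)) (+ k) (v + b + (v + b)) (u + bl + (u + bl)) (combine (cong (λ z → z ℤ.+ + 1 ℤ.+ (+ b ℤ.- + bl)) q-eq) (k-eq _ e) (low (+ u) (+ v) (+ b) (+ bl)))) (≤ᵇ-double (v + b) (u + bl)))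
    (trans (≤ᵇ-ℤ (+ k) (q ℤ.+ + (2 * a) ℤ.- + 1 ℤ.- (+ b ℤ.- + bl)) (suc u + suc u) (v + a + (v + a)) (combine (k-eq _ e) (cong (λ z → z ℤ.+ + (2 * a) ℤ.- + 1 ℤ.- (+ b ℤ.- + bl)) q-eq) (high (+ u) (+ v) (+ b) (+ bl) (+ a)))) (≤ᵇ-double (suc u) (v + a)))
    (λ _ l m → ℕₚ.≤⇒≤ᵇ (subst (_≤ bl + a) (ℕₚ.+-comm 1 b) (span (ℕₚ.≤ᵇ⇒≤ (v + b) (u + bl) l) (ℕₚ.≤ᵇ⇒≤ (suc u) (v + a) m))))
    where
    low : ∀ u v b bl → (+ 1 ℤ.+ (u ℤ.+ u)) ℤ.- b ℤ.- ((v ℤ.+ v ℤ.- bl) ℤ.+ + 1 ℤ.+ (b ℤ.- bl)) ≡ (u ℤ.+ bl ℤ.+ (u ℤ.+ bl)) ℤ.- (v ℤ.+ b ℤ.+ (v ℤ.+ b))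
    low = ℤ-Ring.solve-∀
    high : ∀ u v b bl a → (v ℤ.+ v ℤ.- bl) ℤ.+ (a ℤ.+ (a ℤ.+ + 0)) ℤ.- + 1 ℤ.- (b ℤ.- bl) ℤ.- ((+ 1 ℤ.+ (u ℤ.+ u)) ℤ.- b) ≡ (v ℤ.+ a ℤ.+ (v ℤ.+ a)) ℤ.- ((+ 1 ℤ.+ u) ℤ.+ (+ 1 ℤ.+ u))
    high = ℤ-Ring.solve-∀

  up-triangle-down : bl ≤ b → k + b ≡ u + u → inUpTriangle q a (+ bl) (+ k , + b) ≡ holeUp v a bl (suc b) u
  up-triangle-down h e = trans (four {bl ℕ.≤ᵇ b}
    (trans (≤ᵇ-ℤ (q ℤ.+ + 1 ℤ.+ (+ b ℤ.- + bl)) (+ k) (v + suc b + (v + suc b)) (suc (u + bl + (u + bl))) (combine (cong (λ z → z ℤ.+ + 1 ℤ.+ (+ b ℤ.- + bl)) q-eq) (k-eq _ e) (low (+ u) (+ v) (+ b) (+ bl)))) (≤ᵇ-double-suc (v + suc b) (u + bl)))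
    (trans (≤ᵇ-ℤ (+ k) (q ℤ.+ + (2 * a) ℤ.- + 1 ℤ.- (+ b ℤ.- + bl)) (suc (u + u)) (v + a + (v + a)) (combine (k-eq _ e) (cong (λ z → z ℤ.+ + (2 * a) ℤ.- + 1 ℤ.- (+ b ℤ.- + bl)) q-eq) (high (+ u) (+ v) (+ b) (+ bl) (+ a)))) (≤ᵇ-suc-double u (v + a)))
    (λ _ l m → ℕₚ.≤⇒≤ᵇ (subst (_≤ bl + a) (ℕₚ.+-comm 1 b) (span (ℕₚ.≤-trans (ℕₚ.+-monoʳ-≤ v (ℕₚ.n≤1+n b)) (ℕₚ.≤ᵇ⇒≤ (v + suc b) (u + bl) l)) (ℕₚ.≤ᵇ⇒≤ (suc u) (v + a) m)))))
    (cong (_∧ ((v + suc b ℕ.≤ᵇ u + bl) ∧ (suc u ℕ.≤ᵇ v + a))) (trans (T-true (ℕₚ.≤⇒≤ᵇ h)) (sym (T-true (ℕₚ.≤⇒≤ᵇ (ℕₚ.m≤n⇒m≤1+n h))))))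
    where
    low : ∀ u v b bl → (u ℤ.+ u) ℤ.- b ℤ.- ((v ℤ.+ v ℤ.- bl) ℤ.+ + 1 ℤ.+ (b ℤ.- bl)) ≡ + 1 ℤ.+ (u ℤ.+ bl ℤ.+ (u ℤ.+ bl)) ℤ.- (v ℤ.+ (+ 1 ℤ.+ b) ℤ.+ (v ℤ.+ (+ 1 ℤ.+ b)))
    low = ℤ-Ring.solve-∀
    high : ∀ u v b bl a → (v ℤ.+ v ℤ.- bl) ℤ.+ (a ℤ.+ (a ℤ.+ + 0)) ℤ.- + 1 ℤ.- (b ℤ.- bl) ℤ.- ((u ℤ.+ u) ℤ.- b) ≡ (v ℤ.+ a ℤ.+ (v ℤ.+ a)) ℤ.- (+ 1 ℤ.+ (u ℤ.+ u))
    high = ℤ-Ring.solve-∀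

  up-triangle-below : b < bl → inUpTriangle q a (+ bl) (+ k , + b) ≡ false
  up-triangle-below h with bl ℕ.≤ᵇ b in e
  ... | false = refl
  ... | true  = ⊥-elim (ℕₚ.<⇒≱ h (ℕₚ.≤ᵇ⇒≤ bl b (subst T (sym e) tt)))

  down-triangle-above : bl ≤ b → inDownTriangle q a (+ bl) (+ k , + b) ≡ false
  down-triangle-above h with (b + 1) ℕ.≤ᵇ bl in e
  ... | false = refl
  ... | true  = ⊥-elim (ℕₚ.<⇒≱ (subst (_≤ bl) (ℕₚ.+-comm b 1) (ℕₚ.≤ᵇ⇒≤ (b + 1) bl (subst T (sym e) tt))) h)

  private
    below : b < bl → ∀ {z} → ((b + 1) ℕ.≤ᵇ bl) ∧ z ≡ z
    below h = cong (_∧ _) (T-true (ℕₚ.≤⇒≤ᵇ (subst (_≤ bl) (ℕₚ.+-comm 1 b) h)))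

    span′ : v ≤ u → u + bl ≤ v + a + b → bl ≤ b + a
    span′ l m = ℕₚ.+-cancelˡ-≤ v _ _ (ℕₚ.≤-trans (ℕₚ.+-monoˡ-≤ bl l) (ℕₚ.≤-trans m (ℕₚ.≤-reflexive (perm v a b))))
      where
      perm : ∀ v a b → v + a + b ≡ v + (b + a)
      perm = ℕ-Ring.solve-∀

  down-triangle-up : b < bl → k + b ≡ suc (u + u) → inDownTriangle q a (+ bl) (+ k , + b) ≡ holeDown v a bl b u
  down-triangle-up h e = trans (below h) (four {true}
    (trans (≤ᵇ-ℤ (q ℤ.+ + 1 ℤ.+ (+ bl ℤ.- + 1 ℤ.- + b)) (+ k) (v + v) (suc (u + u)) (combine (cong (λ z → z ℤ.+ + 1 ℤ.+ (+ bl ℤ.- + 1 ℤ.- + b)) q-eq) (k-eq _ e) (low (+ u) (+ v) (+ b) (+ bl)))) (≤ᵇ-double-suc v u))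
    (trans (≤ᵇ-ℤ (+ k) (q ℤ.+ + (2 * a) ℤ.- + 1 ℤ.- (+ bl ℤ.- + 1 ℤ.- + b)) (suc (u + bl + (u + bl))) (v + a + b + (v + a + b)) (combine (k-eq _ e) (cong (λ z → z ℤ.+ + (2 * a) ℤ.- + 1 ℤ.- (+ bl ℤ.- + 1 ℤ.- + b)) q-eq) (high (+ u) (+ v) (+ b) (+ bl) (+ a)))) (≤ᵇ-suc-double (u + bl) (v + a + b)))
    (λ _ l m → ℕₚ.≤⇒≤ᵇ (span′ (ℕₚ.≤ᵇ⇒≤ v u l) (ℕₚ.<⇒≤ (ℕₚ.≤ᵇ⇒≤ (suc (u + bl)) (v + a + b) m)))))
    where
    low : ∀ u v b bl → (+ 1 ℤ.+ (u ℤ.+ u)) ℤ.- b ℤ.- ((v ℤ.+ v ℤ.- bl) ℤ.+ + 1 ℤ.+ (bl ℤ.- + 1 ℤ.- b)) ≡ + 1 ℤ.+ (u ℤ.+ u) ℤ.- (v ℤ.+ v)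
    low = ℤ-Ring.solve-∀
    high : ∀ u v b bl a → (v ℤ.+ v ℤ.- bl) ℤ.+ (a ℤ.+ (a ℤ.+ + 0)) ℤ.- + 1 ℤ.- (bl ℤ.- + 1 ℤ.- b) ℤ.- ((+ 1 ℤ.+ (u ℤ.+ u)) ℤ.- b) ≡ (v ℤ.+ a ℤ.+ b ℤ.+ (v ℤ.+ a ℤ.+ b)) ℤ.- (+ 1 ℤ.+ (u ℤ.+ bl ℤ.+ (u ℤ.+ bl)))
    high = ℤ-Ring.solve-∀

  down-triangle-down : b < bl → k + b ≡ u + u → inDownTriangle q a (+ bl) (+ k , + b) ≡ holeDown v a bl (suc b) u
  down-triangle-down h e = trans (below h) (four {true}
    (trans (≤ᵇ-ℤ (q ℤ.+ + 1 ℤ.+ (+ bl ℤ.- + 1 ℤ.- + b)) (+ k) (v + v) (u + u) (combine (cong (λ z → z ℤ.+ + 1 ℤ.+ (+ bl ℤ.- + 1 ℤ.- + b)) q-eq) (k-eq _ e) (low (+ u) (+ v) (+ b) (+ bl)))) (≤ᵇ-double v u))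
    (trans (≤ᵇ-ℤ (+ k) (q ℤ.+ + (2 * a) ℤ.- + 1 ℤ.- (+ bl ℤ.- + 1 ℤ.- + b)) (suc (u + bl) + suc (u + bl)) (v + a + suc b + (v + a + suc b)) (combine (k-eq _ e) (cong (λ z → z ℤ.+ + (2 * a) ℤ.- + 1 ℤ.- (+ bl ℤ.- + 1 ℤ.- + b)) q-eq) (high (+ u) (+ v) (+ b) (+ bl) (+ a)))) (≤ᵇ-double (suc (u + bl)) (v + a + suc b)))
    (λ _ l m → ℕₚ.≤⇒≤ᵇ (span′ (ℕₚ.≤ᵇ⇒≤ v u l) (ℕₚ.≤-pred (ℕₚ.≤-trans (ℕₚ.≤ᵇ⇒≤ (suc (u + bl)) (v + a + suc b) m) (ℕₚ.≤-reflexive (ℕₚ.+-suc (v + a) b)))))))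
    where
    low : ∀ u v b bl → (u ℤ.+ u) ℤ.- b ℤ.- ((v ℤ.+ v ℤ.- bl) ℤ.+ + 1 ℤ.+ (bl ℤ.- + 1 ℤ.- b)) ≡ (u ℤ.+ u) ℤ.- (v ℤ.+ v)
    low = ℤ-Ring.solve-∀
    high : ∀ u v b bl a → (v ℤ.+ v ℤ.- bl) ℤ.+ (a ℤ.+ (a ℤ.+ + 0)) ℤ.- + 1 ℤ.- (bl ℤ.- + 1 ℤ.- b) ℤ.- ((u ℤ.+ u) ℤ.- b) ≡ (v ℤ.+ a ℤ.+ (+ 1 ℤ.+ b) ℤ.+ (v ℤ.+ a ℤ.+ (+ 1 ℤ.+ b))) ℤ.- ((+ 1 ℤ.+ (u ℤ.+ bl)) ℤ.+ (+ 1 ℤ.+ (u ℤ.+ bl)))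
    high = ℤ-Ring.solve-∀

Runs : Set
Runs = List (ℕ × ℕ)

anyUp anyDown : Runs → ℕ → ℕ → ℕ → Bool
anyUp rs bl b u = any (λ r → holeUp (proj₁ r) (proj₂ r) bl b u) rs
anyDown rs bl b u = any (λ r → holeDown (proj₁ r) (proj₂ r) bl b u) rs

any-mono : ∀ {X : Set} {p q : X → Bool} {xs} → All (λ x → T (p x) → T (q x)) xs → T (any p xs) → T (any q xs)
any-mono {p = p} {q} {x ∷ xs} (h ∷ hs) t with Equivalence.to (T-∨ {p x}) t
... | inj₁ s = Equivalence.from (T-∨ {q x}) (inj₁ (h s))
... | inj₂ s = Equivalence.from (T-∨ {q x}) (inj₂ (any-mono hs s))

any-none : ∀ {X : Set} {p : X → Bool} {xs} → All (λ x → ¬ T (p x)) xs → any p xs ≡ false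
any-none []                  = refl
any-none {p = p} {x ∷ _} (h ∷ hs) with p x
... | true  = ⊥-elim (h tt)
... | false = any-none hs

true-T : ∀ {b} → b ≡ true → T b
true-T = Equivalence.from T-≡

fl-mono : ∀ n → fl n ≤ fl (suc n)
fl-mono n with par n
... | true  = ℕₚ.n≤1+n (fl n)
... | false = ℕₚ.≤-refl

fl-suc : ∀ n → fl (suc n) ≤ suc (fl n)
fl-suc n with par n
... | true  = ℕₚ.≤-refl
... | false = ℕₚ.n≤1+n (fl n)

fl-mono-≤ : ∀ {m n} → m ≤ n → fl m ≤ fl n
fl-mono-≤ {m} {n} l = subst (λ z → fl m ≤ fl z) (ℕₚ.m+[n∸m]≡n l) (go (n ∸ m))
  where
  go : ∀ d → fl m ≤ fl (m + d)
  go zero    = ℕₚ.≤-reflexive (cong fl (sym (ℕₚ.+-identityʳ m)))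
  go (suc d) = ℕₚ.≤-trans (go d) (subst (λ z → fl (m + d) ≤ fl z) (sym (ℕₚ.+-suc m d)) (fl-mono (m + d)))

fl-lipschitz : ∀ h {b b′} → b ≤ b′ → fl (h + b′) + b ≤ fl (h + b) + b′
fl-lipschitz h {b} {b′} l = subst (λ z → fl (h + z) + b ≤ fl (h + b) + z) (ℕₚ.m+[n∸m]≡n l) (go (b′ ∸ b))
  where
  go : ∀ d → fl (h + (b + d)) + b ≤ fl (h + b) + (b + d)
  go zero    rewrite ℕₚ.+-identityʳ b = ℕₚ.≤-refl
  go (suc d) rewrite ℕₚ.+-suc b d | ℕₚ.+-suc h (b + d) = ℕₚ.≤-trans (ℕₚ.+-monoˡ-≤ b (fl-suc (h + (b + d))))
    (ℕₚ.≤-trans (s≤s (go d)) (ℕₚ.≤-reflexive (sym (ℕₚ.+-suc (fl (h + b)) (b + d)))))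

erodes-applyUpTo : ∀ F G m → (∀ i → F i ≡ true → G i ≡ true × G (suc i) ≡ true) → Erodes (applyUpTo F m) (applyUpTo G (suc m))
erodes-applyUpTo F G zero    h = stop
erodes-applyUpTo F G (suc m) h = h 0 ◂ erodes-applyUpTo (F ∘ suc) (G ∘ suc) m (λ i → h (suc i))

none-applyUpTo : ∀ F m → (∀ i → F i ≡ false) → none (applyUpTo F m) ≡ true
none-applyUpTo F zero    h = refl
none-applyUpTo F (suc m) h rewrite h 0 = none-applyUpTo (F ∘ suc) m (λ i → h (suc i))

applyUpTo-++ : ∀ {X : Set} (f : ℕ → X) m n → applyUpTo f (m + n) ≡ applyUpTo f m ++ applyUpTo (λ i → f (m + i)) n
applyUpTo-++ f zero    n = refl
applyUpTo-++ f (suc m) n = cong (f 0 ∷_) (applyUpTo-++ (f ∘ suc) m n)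

applyUpTo-const : ∀ (f : ℕ → Bool) c n → (∀ i → i < n → f i ≡ c) → applyUpTo f n ≡ replicate n c
applyUpTo-const f c zero    h = refl
applyUpTo-const f c (suc n) h = cong₂ _∷_ (h 0 (s≤s z≤n)) (applyUpTo-const (f ∘ suc) c n (λ i l → h (suc i) (s≤s l)))

≤ᵇ-true : ∀ {m n} → m ≤ n → (m ℕ.≤ᵇ n) ≡ true
≤ᵇ-true l = T-true (ℕₚ.≤⇒≤ᵇ l)

≤ᵇ-false : ∀ {m n} → n < m → (m ℕ.≤ᵇ n) ≡ false
≤ᵇ-false {m} {n} l with m ℕ.≤ᵇ n in e
... | false = refl
... | true  = ⊥-elim (ℕₚ.<⇒≱ l (ℕₚ.≤ᵇ⇒≤ m n (true-T e)))

applyUpTo-limit : ∀ f m p (g : ℕ → Bool) → applyUpTo (λ i → (f + m ℕ.≤ᵇ f + i) ∨ g i) (m + p) ≡ applyUpTo g m ++ ones p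
applyUpTo-limit f m p g = trans (applyUpTo-++ _ m p) (cong₂ _++_
  (applyUpTo-cong m (λ i l → cong (_∨ g i) (≤ᵇ-false (ℕₚ.+-monoʳ-< f l))))
  (applyUpTo-const _ true p (λ i _ → cong (_∨ g (m + i)) (≤ᵇ-true (ℕₚ.+-monoʳ-≤ f (ℕₚ.m≤m+n m i))))))

rk-pos : ∀ n → par n ≡ true → ∃ λ r → rk n ≡ suc r
rk-pos (suc n) e with par n in p
... | false = rk n , refl

rk-≤ : ∀ n → rk n ≤ n
rk-≤ zero    = z≤n
rk-≤ (suc n) with par n
... | true  = ℕₚ.m≤n⇒m≤1+n (rk-≤ n)
... | false = s≤s (rk-≤ n)

par-gap : ∀ h n b → b + suc n ≡ h → par (h + b) ≡ not (par n)
par-gap h n b refl = trans (cong par (trans (cong (_+ b) (ℕₚ.+-comm b (suc n))) (ℕₚ.+-assoc (suc n) b b))) (par-+ (suc n) (b + b) (par-double b))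

fl-rk : ∀ n b h → b + n ≡ h → fl (h + b) + rk n ≡ h
fl-rk zero    b h e = trans (ℕₚ.+-identityʳ _) (trans (cong (λ z → fl (h + z)) (trans (sym (ℕₚ.+-identityʳ b)) e)) (dbl h))
  where
  dbl : ∀ h → fl (h + h) ≡ h
  dbl zero    = refl
  dbl (suc h) rewrite ℕₚ.+-suc h h | par-double h = cong suc (dbl h)
fl-rk (suc n) b h e with fl-rk n (suc b) h (trans (sym (ℕₚ.+-suc b n)) e)
... | ih rewrite ℕₚ.+-suc h b | par-gap h n b e with par n
...   | true  = ih
...   | false = trans (ℕₚ.+-suc _ _) ih

∸-gap : ∀ b n h → b + n ≡ h → h ∸ n ≡ b
∸-gap b n h e = trans (cong (_∸ n) (sym e)) (ℕₚ.m+n∸n≡m b n)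

-- The holes standing on the line bl, seen from the northern side. `fit` keeps their apexes inside
-- the region, and `left` keeps their bases from starting west of it.
module TopPattern (h bl L : ℕ) (rs : Runs) (fit : All (λ r → bl + proj₂ r ≤ h) rs) (left : All (λ r → fl (h + bl) ≤ proj₁ r) rs) where

  F : ℕ → ℕ → Bool
  F b i = anyUp rs bl b (fl (h + b) + i)

  holes : ℕ → List Bool
  holes n = applyUpTo (F (h ∸ n)) (L + rk n)

  start : none (holes 0) ≡ true
  start = none-applyUpTo (F h) (L + 0) (λ i → any-none (All.map (λ {r} l t → absurd r (fl (h + h) + i) l t) fit))
    where
    absurd : ∀ r u → bl + proj₂ r ≤ h → ¬ T (holeUp (proj₁ r) (proj₂ r) bl h u)
    absurd (v , a) u l t = ℕₚ.<⇒≱ (ℕₚ.≤ᵇ⇒≤ (suc u) (v + a) (proj₂ (T-∧⁻ {v + h ℕ.≤ᵇ u + bl} (proj₂ (T-∧⁻ {bl ℕ.≤ᵇ h} t)))))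
      (ℕₚ.+-cancelʳ-≤ bl _ _ (ℕₚ.≤-trans (ℕₚ.≤-reflexive (perm v a bl)) (ℕₚ.≤-trans (ℕₚ.+-monoʳ-≤ v l)
        (ℕₚ.≤ᵇ⇒≤ (v + h) (u + bl) (proj₁ (T-∧⁻ {v + h ℕ.≤ᵇ u + bl} (proj₂ (T-∧⁻ {bl ℕ.≤ᵇ h} t))))))))
      where
      perm : ∀ v a bl → v + a + bl ≡ v + (bl + a)
      perm = ℕ-Ring.solve-∀

  module _ (n b : ℕ) (e : b + suc n ≡ h) (l : bl ≤ b) where

    private
      f = fl (h + b)

      at : ∀ u → T (anyUp rs bl (suc b) (suc u)) → T (anyUp rs bl b u)
      at u = any-mono (All.universal (λ r t → T-∧⁺ (ℕₚ.≤⇒≤ᵇ l) (T-∧⁺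
        (ℕₚ.≤⇒≤ᵇ (ℕₚ.≤-pred (subst (_≤ suc u + bl) (ℕₚ.+-suc (proj₁ r) b) (low r t))))
        (ℕₚ.≤⇒≤ᵇ (ℕₚ.<⇒≤ (high r t))))) rs)
        where
        low : ∀ r → T (holeUp (proj₁ r) (proj₂ r) bl (suc b) (suc u)) → proj₁ r + suc b ≤ suc u + bl
        low r t = ℕₚ.≤ᵇ⇒≤ (proj₁ r + suc b) (suc u + bl) (proj₁ (T-∧⁻ {proj₁ r + suc b ℕ.≤ᵇ suc u + bl} (proj₂ (T-∧⁻ {bl ℕ.≤ᵇ suc b} t))))
        high : ∀ r → T (holeUp (proj₁ r) (proj₂ r) bl (suc b) (suc u)) → suc (suc u) ≤ proj₁ r + proj₂ r
        high r t = ℕₚ.≤ᵇ⇒≤ (suc (suc u)) (proj₁ r + proj₂ r) (proj₂ (T-∧⁻ {proj₁ r + suc b ℕ.≤ᵇ suc u + bl} (proj₂ (T-∧⁻ {bl ℕ.≤ᵇ suc b} t))))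

      at′ : ∀ u → T (anyUp rs bl (suc b) u) → T (anyUp rs bl b u)
      at′ u = any-mono (All.universal (λ r t → T-∧⁺ (ℕₚ.≤⇒≤ᵇ l) (T-∧⁺
        (ℕₚ.≤⇒≤ᵇ (ℕₚ.≤-trans (ℕₚ.+-monoʳ-≤ (proj₁ r) (ℕₚ.n≤1+n b)) (ℕₚ.≤ᵇ⇒≤ (proj₁ r + suc b) (u + bl) (proj₁ (T-∧⁻ {proj₁ r + suc b ℕ.≤ᵇ u + bl} (proj₂ (T-∧⁻ {bl ℕ.≤ᵇ suc b} t)))))))
        (proj₂ (T-∧⁻ {proj₁ r + suc b ℕ.≤ᵇ u + bl} (proj₂ (T-∧⁻ {bl ℕ.≤ᵇ suc b} t)))))) rs)

      -- Per line the left side of a hole advances by one segment number and the western side by at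
      -- most one; where the latter stands still, the hole has moved away from it.
      leftmost : anyUp rs bl (suc b) f ≡ false
      leftmost = any-none (All.map (λ {r} m t → ℕₚ.<⇒≱ (ℕₚ.≤-trans (ℕₚ.≤-reflexive (sym (ℕₚ.+-suc (proj₁ r) b)))
        (ℕₚ.≤ᵇ⇒≤ (proj₁ r + suc b) (f + bl) (proj₁ (T-∧⁻ {proj₁ r + suc b ℕ.≤ᵇ f + bl} (proj₂ (T-∧⁻ {bl ℕ.≤ᵇ suc b} t))))))
        (ℕₚ.≤-trans (fl-lipschitz h l) (ℕₚ.+-monoˡ-≤ b m))) left)

      both : ∀ i → anyUp rs bl (suc b) (suc f + i) ≡ true → F b i ≡ true × F b (suc i) ≡ true
      both i t = T-true (at (f + i) (true-T t)) , trans (cong (anyUp rs bl b) (ℕₚ.+-suc f i)) (T-true (at′ (suc f + i) (true-T t)))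

    erosion : ErodesAt (par n) (holes n) (holes (suc n))
    erosion rewrite ∸-gap (suc b) n h (trans (sym (ℕₚ.+-suc b n)) e) | ∸-gap b (suc n) h e | ℕₚ.+-suc h b | par-gap h n b e with par n in p
    ... | false rewrite ℕₚ.+-suc L (rk n) = erodes-applyUpTo (λ i → anyUp rs bl (suc b) (suc f + i)) (F b) (L + rk n) both
    ... | true with rk-pos n p
    ...   | r , q rewrite q | ℕₚ.+-suc L r = applyUpTo (G ∘ suc) (L + r) ,
      cong (_∷ applyUpTo (G ∘ suc) (L + r)) (trans (cong (anyUp rs bl (suc b)) (ℕₚ.+-identityʳ f)) leftmost) ,
      erodes-applyUpTo (G ∘ suc) (F b) (L + r) λ i t → both i (trans (cong (anyUp rs bl (suc b)) (sym (ℕₚ.+-suc f i))) t)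
      where
      G : ℕ → Bool
      G i = anyUp rs bl (suc b) (f + i)

module BottomPattern (h bl L : ℕ) (even : par h ≡ false) (rs : Runs) (fit : All (λ r → proj₂ r ≤ bl) rs) (left : All (λ r → fl (h + bl) ≤ proj₁ r) rs) where

  F : ℕ → ℕ → Bool
  F b i = anyDown rs bl b (fl (h + b) + i)

  holes : ℕ → List Bool
  holes b = applyUpTo (F b) (L + rk b)

  start : none (holes 0) ≡ true
  start = none-applyUpTo (F 0) (L + 0) (λ i → any-none (All.map (λ {r} l t → absurd r (fl (h + 0) + i) l t) fit))
    where
    absurd : ∀ r u → proj₂ r ≤ bl → ¬ T (holeDown (proj₁ r) (proj₂ r) bl 0 u)
    absurd (v , a) u l t = ℕₚ.<⇒≱ (ℕₚ.≤ᵇ⇒≤ (suc (u + bl)) (v + a + 0) (proj₂ (T-∧⁻ {v ℕ.≤ᵇ u} t)))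
      (ℕₚ.≤-trans (ℕₚ.≤-reflexive (ℕₚ.+-identityʳ (v + a))) (ℕₚ.+-mono-≤ (ℕₚ.≤ᵇ⇒≤ v u (proj₁ (T-∧⁻ {v ℕ.≤ᵇ u} t))) l))

  module _ (b : ℕ) (l : b < bl) where

    private
      f = fl (h + b)

      low : ∀ u r → T (holeDown (proj₁ r) (proj₂ r) bl b u) → proj₁ r ≤ u
      low u r t = ℕₚ.≤ᵇ⇒≤ (proj₁ r) u (proj₁ (T-∧⁻ {proj₁ r ℕ.≤ᵇ u} t))

      high : ∀ u r → T (holeDown (proj₁ r) (proj₂ r) bl b u) → suc (suc u + bl) ≤ proj₁ r + proj₂ r + suc b
      high u r t = ℕₚ.≤-trans (s≤s (ℕₚ.≤ᵇ⇒≤ (suc (u + bl)) (proj₁ r + proj₂ r + b) (proj₂ (T-∧⁻ {proj₁ r ℕ.≤ᵇ u} t)))) (ℕₚ.≤-reflexive (sym (ℕₚ.+-suc (proj₁ r + proj₂ r) b)))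

      both : ∀ u → anyDown rs bl b u ≡ true → anyDown rs bl (suc b) u ≡ true × anyDown rs bl (suc b) (suc u) ≡ true
      both u t = T-true (any-mono (All.universal (λ r s → T-∧⁺ (ℕₚ.≤⇒≤ᵇ (low u r s)) (ℕₚ.≤⇒≤ᵇ (ℕₚ.<⇒≤ (high u r s)))) rs) (true-T t)) ,
        T-true (any-mono (All.universal (λ r s → T-∧⁺ (ℕₚ.≤⇒≤ᵇ (ℕₚ.m≤n⇒m≤1+n (low u r s))) (ℕₚ.≤⇒≤ᵇ (high u r s))) rs) (true-T t))

      leftmost : fl (h + suc b) ≡ suc f → anyDown rs bl b f ≡ false
      leftmost e = any-none (All.map (λ {r} m t → ℕₚ.<⇒≱ (ℕₚ.≤-trans (ℕₚ.≤-reflexive (sym e)) (ℕₚ.≤-trans (fl-mono-≤ (ℕₚ.+-monoʳ-≤ h l)) m)) (low f r t)) left)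

      par-b : par (h + b) ≡ par b
      par-b = trans (cong par (ℕₚ.+-comm h b)) (par-+ b h even)

      next : fl (h + suc b) ≡ (if par b then suc f else f)
      next rewrite ℕₚ.+-suc h b | par-b = refl

    erosion : ErodesAt (par b) (holes b) (holes (suc b))
    erosion with par b in p
    ... | false rewrite ℕₚ.+-suc L (rk b) = erodes-applyUpTo (F b) (F (suc b)) (L + rk b)
      λ i t → trans (cong (λ z → anyDown rs bl (suc b) (z + i)) e) (proj₁ (both (f + i) t)) ,
              trans (cong (anyDown rs bl (suc b)) (trans (cong (_+ suc i) e) (ℕₚ.+-suc f i))) (proj₂ (both (f + i) t))
      where
      e : fl (h + suc b) ≡ f
      e = trans next (cong (λ z → if z then suc f else f) p)
    ... | true with rk-pos b p
    ...   | r , q rewrite q | ℕₚ.+-suc L r = applyUpTo (F b ∘ suc) (L + r) ,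
      cong (_∷ applyUpTo (F b ∘ suc) (L + r)) (trans (cong (anyDown rs bl b) (ℕₚ.+-identityʳ f)) (leftmost e)) ,
      erodes-applyUpTo (F b ∘ suc) (F (suc b)) (L + r) λ i t →
        trans (cong (anyDown rs bl (suc b)) (trans (cong (_+ i) e) (sym (ℕₚ.+-suc f i)))) (proj₁ (both (f + suc i) t)) ,
        trans (cong (anyDown rs bl (suc b)) (cong (_+ suc i) e)) (proj₂ (both (f + suc i) t))
      where
      e : fl (h + suc b) ≡ suc f
      e = trans next (cong (λ z → if z then suc f else f) p)

-- The regions counted by `Q'` and `K'`.

southRuns : ℕ → List ℕ → Runs
southRuns w []            = []
southRuns w (_ ∷ [])      = []
southRuns w (t₁ ∷ t₂ ∷ ts) = (w + t₁ , t₂) ∷ southRuns (w + (t₁ + t₂)) ts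

bits : List ℕ → List Bool
bits []             = []
bits (t₁ ∷ [])      = zeros t₁
bits (t₁ ∷ t₂ ∷ ts) = zeros t₁ ++ ones t₂ ++ bits ts

shift-base : ∀ p w t → p ≡ + (w + w) → p ℤ.+ + (2 * t) ≡ + ((w + t) + (w + t))
shift-base p w t refl = cong +_ (perm w t)
  where
  perm : ∀ w t → w + w + 2 * t ≡ (w + t) + (w + t)
  perm = ℕ-Ring.solve-∀

southHoles-up : ∀ t p w k b u → p ≡ + (w + w) → k + b ≡ suc (u + u) → southHoles p t (+ k , + b) ≡ anyUp (southRuns w t) 0 b u
southHoles-up []             p w k b u e c = refl
southHoles-up (_ ∷ [])       p w k b u e c = refl
southHoles-up (t₁ ∷ t₂ ∷ ts) p w k b u e c = cong₂ _∨_
  (up-triangle-up (p ℤ.+ + (2 * t₁)) (w + t₁) t₂ 0 b k u (trans (ℤₚ.+-identityʳ _) (shift-base p w t₁ e)) c)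
  (southHoles-up ts _ (w + (t₁ + t₂)) k b u (shift-base p w (t₁ + t₂) e) c)

southHoles-down : ∀ t p w k b u → p ≡ + (w + w) → k + b ≡ u + u → southHoles p t (+ k , + b) ≡ anyUp (southRuns w t) 0 (suc b) u
southHoles-down []             p w k b u e c = refl
southHoles-down (_ ∷ [])       p w k b u e c = refl
southHoles-down (t₁ ∷ t₂ ∷ ts) p w k b u e c = cong₂ _∨_
  (up-triangle-down (p ℤ.+ + (2 * t₁)) (w + t₁) t₂ 0 b k u (trans (ℤₚ.+-identityʳ _) (shift-base p w t₁ e)) z≤n c)
  (southHoles-down ts _ (w + (t₁ + t₂)) k b u (shift-base p w (t₁ + t₂) e) c)

south-left : ∀ w t → All (λ r → w ≤ proj₁ r) (southRuns w t)
south-left w []             = []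
south-left w (_ ∷ [])       = []
south-left w (t₁ ∷ t₂ ∷ ts) = ℕₚ.m≤m+n w t₁ ∷ All.map (ℕₚ.≤-trans (ℕₚ.m≤m+n w _)) (south-left (w + (t₁ + t₂)) ts)

south-fit : ∀ w t → All (λ r → proj₂ r ≤ evenSum t) (southRuns w t)
south-fit w []             = []
south-fit w (_ ∷ [])       = []
south-fit w (t₁ ∷ t₂ ∷ ts) = ℕₚ.m≤m+n t₂ _ ∷ All.map (λ l → ℕₚ.≤-trans l (ℕₚ.m≤n+m _ t₂)) (south-fit (w + (t₁ + t₂)) ts)

inRun : ∀ {v a u} → v ≤ u → u < v + a → holeUp v a 0 0 u ≡ true
inRun {v} {a} {u} l m = cong₂ _∧_ (≤ᵇ-true (subst₂′ l)) (≤ᵇ-true m)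
  where
  subst₂′ : v ≤ u → v + 0 ≤ u + 0
  subst₂′ = ℕₚ.+-monoˡ-≤ 0

beforeRun : ∀ {v a u} → u < v → holeUp v a 0 0 u ≡ false
beforeRun {v} {a} {u} l = cong (_∧ (suc u ℕ.≤ᵇ v + a)) (≤ᵇ-false (ℕₚ.+-monoˡ-< 0 l))

afterRun : ∀ {v a u} → v + a ≤ u → holeUp v a 0 0 u ≡ false
afterRun {v} {a} {u} l = trans (cong ((v + 0 ℕ.≤ᵇ u + 0) ∧_) (≤ᵇ-false (s≤s l))) (∧-zeroʳ _)

before-any : ∀ {rs u w} → u < w → All (λ r → w ≤ proj₁ r) rs → anyUp rs 0 0 u ≡ false
before-any l []       = refl
before-any {(v , a) ∷ _} l (m ∷ ms) = trans (cong₂ _∨_ (beforeRun {v} {a} (ℕₚ.≤-trans l m)) (before-any l ms)) refl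

south-bits : ∀ w t → applyUpTo (λ i → anyUp (southRuns w t) 0 0 (w + i)) (oddSum t + evenSum t) ≡ bits t
south-bits w []       = refl
south-bits w (t ∷ []) = trans (applyUpTo-const _ false (t + 0 + 0) (λ _ _ → refl)) (cong zeros (trans (ℕₚ.+-identityʳ _) (ℕₚ.+-identityʳ t)))
south-bits w (t₁ ∷ t₂ ∷ ts) = trans (cong (applyUpTo G) (perm t₁ (oddSum ts) t₂ (evenSum ts)))
  (trans (applyUpTo-++ G t₁ (t₂ + (oddSum ts + evenSum ts))) (cong₂ _++_
    (applyUpTo-const _ false t₁ (λ i l → before-any (ℕₚ.+-monoʳ-< w l)
      (ℕₚ.≤-refl ∷ All.map (ℕₚ.≤-trans (ℕₚ.+-monoʳ-≤ w (ℕₚ.m≤m+n t₁ t₂))) (south-left (w + (t₁ + t₂)) ts))))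
    (trans (applyUpTo-++ (λ i → G (t₁ + i)) t₂ (oddSum ts + evenSum ts)) (cong₂ _++_
      (applyUpTo-const _ true t₂ (λ i l → cong (_∨ anyUp (southRuns (w + (t₁ + t₂)) ts) 0 0 (w + (t₁ + i)))
        (inRun {w + t₁} {t₂} (ℕₚ.+-monoʳ-≤ w (ℕₚ.m≤m+n t₁ i)) (subst (_< w + t₁ + t₂) (ℕₚ.+-assoc w t₁ i) (ℕₚ.+-monoʳ-< (w + t₁) l)))))
      (trans (applyUpTo-cong (oddSum ts + evenSum ts) (λ i l → trans
        (cong (_∨ anyUp (southRuns (w + (t₁ + t₂)) ts) 0 0 (w + (t₁ + (t₂ + i))))
          (afterRun {w + t₁} {t₂} (subst (w + t₁ + t₂ ≤_) (assoc₄ w t₁ t₂ i) (ℕₚ.m≤m+n (w + t₁ + t₂) i))))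
        (cong (anyUp (southRuns (w + (t₁ + t₂)) ts) 0 0) (trans (sym (assoc₄ w t₁ t₂ i)) (assoc₄′ w t₁ t₂ i)))))
        (south-bits (w + (t₁ + t₂)) ts))))))
  where
  G : ℕ → Bool
  G i = anyUp (southRuns w (t₁ ∷ t₂ ∷ ts)) 0 0 (w + i)
  perm : ∀ a b c d → a + b + (c + d) ≡ a + (c + (b + d))
  perm = ℕ-Ring.solve-∀
  assoc₄ : ∀ w a b i → w + a + b + i ≡ w + (a + (b + i))
  assoc₄ = ℕ-Ring.solve-∀
  assoc₄′ : ∀ w a b i → w + a + b + i ≡ w + (a + b) + i
  assoc₄′ = ℕ-Ring.solve-∀

even-part : ∀ h → h ∸ h % 2 ≡ fl h + fl h
even-part h with par h in p
... | false = trans (cong (h ∸_) (mod2 h p)) (fl-even h p)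
  where
  mod2 : ∀ h → par h ≡ false → h % 2 ≡ 0
  mod2 zero          p = refl
  mod2 (suc (suc h)) p = mod2 h (trans (sym (not-involutive _)) p)
... | true  = trans (cong (h ∸_) (mod2 h p)) (cong (_∸ 1) (fl-odd h p))
  where
  mod2 : ∀ h → par h ≡ true → h % 2 ≡ 1
  mod2 (suc zero)    p = refl
  mod2 (suc (suc h)) p = mod2 h (trans (sym (not-involutive _)) p)

≤ᵇ-+ʳ : ∀ m n b → (m ℕ.≤ᵇ n) ≡ (m + b ℕ.≤ᵇ n + b)
≤ᵇ-+ʳ m n b = T-ext (λ t → ℕₚ.≤⇒≤ᵇ (ℕₚ.+-monoˡ-≤ b (ℕₚ.≤ᵇ⇒≤ m n t))) (λ t → ℕₚ.≤⇒≤ᵇ (ℕₚ.+-cancelʳ-≤ b m n (ℕₚ.≤ᵇ⇒≤ _ _ t)))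

orl-zeros : ∀ H → orl (zeros (length H)) H ≡ H
orl-zeros H = length-zeros-orl (length H) H refl

zeros-+ : ∀ m n → zeros (m + n) ≡ zeros m ++ zeros n
zeros-+ zero    n = refl
zeros-+ (suc m) n = cong (false ∷_) (zeros-+ m n)

limit-list : ∀ (lim f m wd : ℕ) (g : ℕ → Bool) → lim ≡ f + m → m ≤ wd →
  applyUpTo (λ i → (lim ℕ.≤ᵇ f + i) ∨ g i) wd ≡ applyUpTo g m ++ ones (wd ∸ m)
limit-list lim f m wd g refl l = trans (cong (applyUpTo _) (sym (ℕₚ.m+[n∸m]≡n l))) (applyUpTo-limit f m (wd ∸ m) g)

-- The whole region is the upper part for a cut along its southern side.
QK-Tr : ∀ t h → rk h ≡ evenSum t → M' h (QKregion h t) ≡ Tr (oddSum t) h (bits t)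
QK-Tr t h e = begin
  M W (zigRegion h right hole)        ≡⟨ cong (M W) C.region-strips ⟩
  M W (strips 0 h)                    ≡⟨ C.M-crossing ⟩
  C.crossing h 0 (zeros wd)           ≡⟨ cong (C.crossing h 0) (trans (cong zeros (sym (padded h ℕₚ.≤-refl))) (zeros-+ (length (holes h)) (pad h))) ⟩
  C.crossing h 0 (zeros (length (holes h)) ++ zeros (pad h))
    ≡⟨ Hv.crossing-Tr (λ n b l m → list b n m) (λ n b l m → list b n m) h 0 ℕₚ.≤-refl refl (zeros (length (holes h))) (length-replicate _) ⟩
  Tr L h (orl (zeros (length (holes h))) (holes h)) ≡⟨ cong (Tr L h) (trans (orl-zeros (holes h)) bottom) ⟩
  Tr L h (bits t) ∎
  where
  open ≡-Reasoning
  L = oddSum t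
  W = westernWeight h
  -- No line has more than L + h segments; the surplus is padding.
  wd = L + h
  right : ℤ → ℤ
  right b = + h ℤ.+ + (2 * L) ℤ.+ + h ℤ.- b ℤ.- + 1
  hole = southHoles (+ (h ∸ h % 2)) t
  rs = southRuns (fl h) t
  α : ℕ → ℕ → Bool
  α b u = (h + L ℕ.≤ᵇ u) ∨ anyUp rs 0 b u
  c : ℕ → ℕ
  c b = L + L + (h ∸ b)
  gap-eq : ∀ b → b < h → b + (h ∸ b) ≡ h
  gap-eq b l = ℕₚ.m+[n∸m]≡n (ℕₚ.<⇒≤ l)
  ends : ∀ b → b < h → right (+ b) ℤ.+ + 1 ≡ + (h + c b)
  ends b l = trans (cong (λ z → + h ℤ.+ + (2 * L) ℤ.+ + z ℤ.- + b ℤ.- + 1 ℤ.+ + 1) (sym (gap-eq b l))) (lem (+ h) (+ L) (+ b) (+ (h ∸ b)))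
    where
    lem : ∀ h L b d → h ℤ.+ (L ℤ.+ (L ℤ.+ + 0)) ℤ.+ (b ℤ.+ d) ℤ.- b ℤ.- + 1 ℤ.+ + 1 ≡ h ℤ.+ (L ℤ.+ L ℤ.+ d)
    lem = ℤ-Ring.solve-∀
  wide : ∀ b → b < h → c b ≤ wd + wd
  wide b l = ℕₚ.≤-trans (ℕₚ.+-monoʳ-≤ (L + L) (ℕₚ.≤-trans (ℕₚ.m∸n≤m h b) (ℕₚ.m≤m+n h h))) (ℕₚ.≤-reflexive (perm L h))
    where
    perm : ∀ L h → L + L + (h + h) ≡ L + h + (L + h)
    perm = ℕ-Ring.solve-∀
  total-eq : ∀ b → b < h → h + c b + b ≡ h + L + (h + L)
  total-eq b l = trans (perm h L b (h ∸ b)) (trans (cong (λ z → h + (L + L) + z) (gap-eq b l)) (perm′ h L))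
    where
    perm : ∀ h L b d → h + (L + L + d) + b ≡ h + (L + L) + (b + d)
    perm = ℕ-Ring.solve-∀
    perm′ : ∀ h L → h + (L + L) + h ≡ h + L + (h + L)
    perm′ = ℕ-Ring.solve-∀
  up-cells : ∀ b u k → b < h → h ≤ k → k + b ≡ suc (u + u) → α b u ≡ (h + c b ℕ.≤ᵇ k) ∨ hole (+ k , + b)
  up-cells b u k l _ q = sym (cong₂ _∨_
    (trans (≤ᵇ-+ʳ (h + c b) k b) (trans (cong₂ ℕ._≤ᵇ_ (total-eq b l) q) (≤ᵇ-double-suc (h + L) u)))
    (southHoles-up t _ (fl h) k b u (cong +_ (even-part h)) q))
  down-cells : ∀ b u k → b < h → h ≤ k → k + b ≡ u + u → α (suc b) u ≡ (h + c b ℕ.≤ᵇ k) ∨ hole (+ k , + b)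
  down-cells b u k l _ q = sym (cong₂ _∨_
    (trans (≤ᵇ-+ʳ (h + c b) k b) (trans (cong₂ ℕ._≤ᵇ_ (total-eq b l) q) (≤ᵇ-double (h + L) u)))
    (southHoles-down t _ (fl h) k b u (cong +_ (even-part h)) q))
  module C = Columns h wd right hole α α c ends wide up-cells down-cells
  open Strips h wd C.A C.B C.lengthA C.lengthB using (strips)
  module TP = TopPattern h 0 L rs (All.map (λ l → ℕₚ.≤-trans l (subst (_≤ h) e (rk-≤ h))) (south-fit (fl h) t))
    (subst (λ z → All (λ r → fl z ≤ proj₁ r) rs) (sym (ℕₚ.+-identityʳ h)) (south-left (fl h) t))
  open TP using (holes)
  pad : ℕ → ℕ
  pad n = wd ∸ (L + rk n)
  short : ∀ n → n ≤ h → L + rk n ≤ wd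
  short n l = ℕₚ.+-monoʳ-≤ L (ℕₚ.≤-trans (rk-≤ n) l)
  padded : ∀ n → n ≤ h → length (holes n) + pad n ≡ wd
  padded n l = trans (cong (_+ pad n) (length-applyUpTo _ (L + rk n))) (ℕₚ.m+[n∸m]≡n (short n l))
  module Hv = C.Halves L h holes pad (λ n _ → length-applyUpTo _ (L + rk n)) padded TP.start
    (λ n l → TP.erosion n (h ∸ suc n) (ℕₚ.m∸n+n≡m l) z≤n)
  list : ∀ b n → b + n ≡ h → C.A b ≡ holes n ++ ones (pad n)
  list b n m = trans (limit-list (h + L) (fl (h + b)) (L + rk n) wd (λ i → anyUp rs 0 b (fl (h + b) + i)) lim (short n (subst (n ≤_) m (ℕₚ.m≤n+m n b))))
    (cong (λ z → applyUpTo (TP.F z) (L + rk n) ++ ones (pad n)) (sym (∸-gap b n h m)))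
    where
    lim : h + L ≡ fl (h + b) + (L + rk n)
    lim = trans (cong (_+ L) (sym (fl-rk n b h m))) (perm (fl (h + b)) (rk n) L)
      where
      perm : ∀ f r L → f + r + L ≡ f + (L + r)
      perm = ℕ-Ring.solve-∀
  bottom : holes h ≡ bits t
  bottom = trans (cong₂ (λ x y → applyUpTo (TP.F x) (L + y)) (ℕₚ.n∸n≡0 h) e)
    (trans (applyUpTo-cong (L + evenSum t) (λ i _ → cong (λ z → anyUp rs 0 0 (fl z + i)) (ℕₚ.+-identityʳ h))) (south-bits (fl h) t))

-- The segments along ℓ that are bases of up-pointing triangles (for the
-- initial flag true) or top sides of down-pointing ones (for false), where
-- w is the right end of the first segment.
lineRuns : ℕ → Bool → List ℕ → Runs
lineRuns w s []       = []
lineRuns w s (a ∷ as) = if s then (w ∸ a , a) ∷ lineRuns (w ∸ a) (not s) as else lineRuns (w ∸ a) (not s) as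

total-length : List ℕ → ℕ
total-length []       = 0
total-length (a ∷ as) = a + total-length as

total-odd-even : ∀ a → total-length a ≡ oddSum a + evenSum a
total-odd-even []       = refl
total-odd-even (x ∷ xs) = trans (cong (ℕ._+_ x) (trans (total-odd-even xs) (ℕₚ.+-comm (oddSum xs) (evenSum xs)))) (sym (ℕₚ.+-assoc x (evenSum xs) (oddSum xs)))

module _ (bl b k u : ℕ) where

  base-left : ∀ X w a → X ℤ.+ + bl ≡ + (w + w) → a ≤ w → (X ℤ.- + (2 * a)) ℤ.+ + bl ≡ + ((w ∸ a) + (w ∸ a))
  base-left X w a e l = trans (move X (+ (2 * a)) (+ bl)) (trans (cong (ℤ._- + (2 * a)) (trans e (cong (λ z → + (z + z)) (sym (ℕₚ.m∸n+n≡m l))))) (cancel (+ (w ∸ a)) (+ a)))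
    where
    move : ∀ X t b → X ℤ.- t ℤ.+ b ≡ X ℤ.+ b ℤ.- t
    move = ℤ-Ring.solve-∀
    cancel : ∀ d a → d ℤ.+ a ℤ.+ (d ℤ.+ a) ℤ.- (a ℤ.+ (a ℤ.+ + 0)) ≡ d ℤ.+ d
    cancel = ℤ-Ring.solve-∀

  -- Above ℓ only the up-pointing holes are seen and below ℓ only the down-pointing ones. With both
  -- descriptions as parameters, one induction serves the four combinations of side and orientation.
  lineHoles-any : ∀ (up : ℕ → ℕ → Bool) (dn : ℕ → ℕ → Bool) →
    (∀ q v a → q ℤ.+ + bl ≡ + (v + v) → inUpTriangle q a (+ bl) (+ k , + b) ≡ up v a) →
    (∀ q v a → q ℤ.+ + bl ≡ + (v + v) → inDownTriangle q a (+ bl) (+ k , + b) ≡ dn v a) →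
    ∀ as s X w → X ℤ.+ + bl ≡ + (w + w) → total-length as ≤ w →
    lineHoles X (+ bl) s as (+ k , + b) ≡ any (λ r → up (proj₁ r) (proj₂ r)) (lineRuns w s as) ∨ any (λ r → dn (proj₁ r) (proj₂ r)) (lineRuns w (not s) as)
  lineHoles-any up dn hu hd []       s X w e l = refl
  lineHoles-any up dn hu hd (a ∷ as) s X w e l with lineHoles-any up dn hu hd as (not s) (X ℤ.- + (2 * a)) (w ∸ a)
      (base-left X w a e (ℕₚ.m+n≤o⇒m≤o a l)) (ℕₚ.m+n≤o⇒m≤o∸n (total-length as) (subst (_≤ w) (ℕₚ.+-comm a (total-length as)) l))
  lineHoles-any up dn hu hd (a ∷ as) true X w e l | ih = trans (cong₂ _∨_ (hu (X ℤ.- + (2 * a)) (w ∸ a) a (base-left X w a e (ℕₚ.m+n≤o⇒m≤o a l))) ih) (sym (∨-assoc (up (w ∸ a) a) _ _))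
  lineHoles-any up dn hu hd (a ∷ as) false X w e l | ih = trans (cong₂ _∨_ (hd (X ℤ.- + (2 * a)) (w ∸ a) a (base-left X w a e (ℕₚ.m+n≤o⇒m≤o a l))) ih)
    (rotate (dn (w ∸ a) a) (any (λ r → up (proj₁ r) (proj₂ r)) (lineRuns (w ∸ a) true as)) (any (λ r → dn (proj₁ r) (proj₂ r)) (lineRuns (w ∸ a) false as)))
    where
    rotate : ∀ d x y → d ∨ (x ∨ y) ≡ x ∨ (d ∨ y)
    rotate d x y = trans (sym (∨-assoc d x y)) (trans (cong (_∨ y) (∨-comm d x)) (∨-assoc x d y))

  private
    any-false₂ : ∀ (rs : Runs) → any (λ _ → false) rs ≡ false
    any-false₂ rs = any-false (λ _ → false) rs (λ _ → refl)

  module _ (as : List ℕ) (X : ℤ) (w : ℕ) (e : X ℤ.+ + bl ≡ + (w + w)) (l : total-length as ≤ w) where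

    lineHoles-up-above : bl ≤ b → k + b ≡ suc (u + u) → lineHoles X (+ bl) true as (+ k , + b) ≡ anyUp (lineRuns w true as) bl b u
    lineHoles-up-above m q = trans (lineHoles-any (λ v a → holeUp v a bl b u) (λ _ _ → false)
      (λ p v a c → up-triangle-up p v a bl b k u c q) (λ p v a c → down-triangle-above p v a bl b k u c m) as true X w e l)
      (trans (cong (anyUp (lineRuns w true as) bl b u ∨_) (any-false₂ (lineRuns w false as))) (∨-identityʳ _))

    lineHoles-down-above : bl ≤ b → k + b ≡ u + u → lineHoles X (+ bl) true as (+ k , + b) ≡ anyUp (lineRuns w true as) bl (suc b) u
    lineHoles-down-above m q = trans (lineHoles-any (λ v a → holeUp v a bl (suc b) u) (λ _ _ → false)
      (λ p v a c → up-triangle-down p v a bl b k u c m q) (λ p v a c → down-triangle-above p v a bl b k u c m) as true X w e l)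
      (trans (cong (anyUp (lineRuns w true as) bl (suc b) u ∨_) (any-false₂ (lineRuns w false as))) (∨-identityʳ _))

    lineHoles-up-below : b < bl → k + b ≡ suc (u + u) → lineHoles X (+ bl) true as (+ k , + b) ≡ anyDown (lineRuns w false as) bl b u
    lineHoles-up-below m q = trans (lineHoles-any (λ _ _ → false) (λ v a → holeDown v a bl b u)
      (λ p v a c → up-triangle-below p v a bl b k u c m) (λ p v a c → down-triangle-up p v a bl b k u c m q) as true X w e l)
      (cong (_∨ anyDown (lineRuns w false as) bl b u) (any-false₂ (lineRuns w true as)))

    lineHoles-down-below : b < bl → k + b ≡ u + u → lineHoles X (+ bl) true as (+ k , + b) ≡ anyDown (lineRuns w false as) bl (suc b) u
    lineHoles-down-below m q = trans (lineHoles-any (λ _ _ → false) (λ v a → holeDown v a bl (suc b) u)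
      (λ p v a c → up-triangle-below p v a bl b k u c m) (λ p v a c → down-triangle-down p v a bl b k u c m q) as true X w e l)
      (cong (_∨ anyDown (lineRuns w false as) bl (suc b) u) (any-false₂ (lineRuns w true as)))

-- The segments along ℓ from left to right; true marks the segments with
-- the parity of the initial flag.
segments : Bool → List ℕ → List Bool
segments s []       = []
segments s (a ∷ as) = segments (not s) as ++ replicate a s

inside : ℕ → ℕ × ℕ → Bool
inside u (v , a) = (v ℕ.≤ᵇ u) ∧ (suc u ℕ.≤ᵇ v + a)

anyUp-inside : ∀ rs b u → anyUp rs b b u ≡ any (inside u) rs
anyUp-inside []             b u = refl
anyUp-inside ((v , a) ∷ rs) b u = cong₂ _∨_ (cong₂ (λ p q → p ∧ q ∧ (suc u ℕ.≤ᵇ v + a)) (≤ᵇ-true (ℕₚ.≤-refl {b})) (sym (≤ᵇ-+ʳ v u b))) (anyUp-inside rs b u)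

anyDown-inside : ∀ rs b u → anyDown rs b b u ≡ any (inside u) rs
anyDown-inside []             b u = refl
anyDown-inside ((v , a) ∷ rs) b u = cong₂ _∨_ (cong ((v ℕ.≤ᵇ u) ∧_) (sym (≤ᵇ-+ʳ (suc u) (v + a) b))) (anyDown-inside rs b u)

inside-true : ∀ {u v a} → v ≤ u → u < v + a → inside u (v , a) ≡ true
inside-true l m = cong₂ _∧_ (≤ᵇ-true l) (≤ᵇ-true m)

inside-before : ∀ {u v a} → u < v → inside u (v , a) ≡ false
inside-before {u} {v} {a} l = cong (_∧ (suc u ℕ.≤ᵇ v + a)) (≤ᵇ-false l)

lineRuns-right : ∀ as s w → total-length as ≤ w → All (λ r → proj₁ r + proj₂ r ≤ w) (lineRuns w s as)
lineRuns-right []       s w l = []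
lineRuns-right (a ∷ as) s w l = go s
  where
  rest : ∀ s → All (λ r → proj₁ r + proj₂ r ≤ w) (lineRuns (w ∸ a) s as)
  rest s = All.map (λ m → ℕₚ.≤-trans m (ℕₚ.m∸n≤m w a)) (lineRuns-right as s (w ∸ a) (ℕₚ.m+n≤o⇒m≤o∸n (total-length as) (subst (_≤ w) (ℕₚ.+-comm a (total-length as)) l)))
  go : ∀ s → All (λ r → proj₁ r + proj₂ r ≤ w) (lineRuns w s (a ∷ as))
  go true  = ℕₚ.≤-reflexive (ℕₚ.m∸n+n≡m (ℕₚ.m+n≤o⇒m≤o a l)) ∷ rest false
  go false = rest true

lineRuns-left : ∀ as s f w → f + total-length as ≤ w → All (λ r → f ≤ proj₁ r) (lineRuns w s as)
lineRuns-left []       s f w l = []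
lineRuns-left (a ∷ as) s f w l = go s
  where
  l′ : f + total-length as ≤ w ∸ a
  l′ = ℕₚ.m+n≤o⇒m≤o∸n (f + total-length as) (subst (_≤ w) (perm f a (total-length as)) l)
    where
    perm : ∀ f a t → f + (a + t) ≡ f + t + a
    perm = ℕ-Ring.solve-∀
  go : ∀ s → All (λ r → f ≤ proj₁ r) (lineRuns w s (a ∷ as))
  go true  = ℕₚ.≤-trans (ℕₚ.m≤m+n f _) l′ ∷ lineRuns-left as false f (w ∸ a) l′
  go false = lineRuns-left as true f (w ∸ a) l′

line-bits : ∀ as s f k w → w ≡ f + (k + total-length as) →
  applyUpTo (λ i → any (inside (f + i)) (lineRuns w s as)) (k + total-length as) ≡ zeros k ++ segments s as
line-bits []       s f k w refl = trans (applyUpTo-const _ false (k + 0) (λ _ _ → refl)) (trans (cong zeros (ℕₚ.+-identityʳ k)) (sym (++-identityʳ _)))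
line-bits (a ∷ as) s f k w refl = trans (cong (applyUpTo (G s)) (perm k a t)) (trans (applyUpTo-++ (G s) (k + t) a)
  (trans (cong₂ _++_ (trans (applyUpTo-cong (k + t) (left s)) (line-bits as (not s) f k w′ w′-eq)) (applyUpTo-const _ s a (right s)))
         (++-assoc (zeros k) (segments (not s) as) (replicate a s))))
  where
  t = total-length as
  w′ = w ∸ a
  perm : ∀ k a t → k + (a + t) ≡ k + t + a
  perm = ℕ-Ring.solve-∀
  w′-eq : w′ ≡ f + (k + t)
  w′-eq = trans (cong (_∸ a) (trans (cong (ℕ._+_ f) (perm k a t)) (sym (ℕₚ.+-assoc f (k + t) a)))) (ℕₚ.m+n∸n≡m (f + (k + t)) a)
  G : Bool → ℕ → Bool
  G s i = any (inside (f + i)) (lineRuns w s (a ∷ as))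
  bound : t ≤ w′
  bound = subst (t ≤_) (sym w′-eq) (ℕₚ.≤-trans (ℕₚ.m≤n+m t k) (ℕₚ.m≤n+m (k + t) f))
  left : ∀ s i → i < k + t → G s i ≡ any (inside (f + i)) (lineRuns w′ (not s) as)
  left true  i l = cong (_∨ any (inside (f + i)) (lineRuns w′ false as)) (inside-before {f + i} {w′} {a} (subst (f + i <_) (sym w′-eq) (ℕₚ.+-monoʳ-< f l)))
  left false i l = refl
  far : ∀ s i → any (inside (f + (k + t + i))) (lineRuns w′ s as) ≡ false
  far s i = any-none (All.map (λ {r} m q → ℕₚ.<⇒≱ (ℕₚ.≤ᵇ⇒≤ _ _ (proj₂ (T-∧⁻ {proj₁ r ℕ.≤ᵇ f + (k + t + i)} q)))
    (ℕₚ.≤-trans m (subst (_≤ f + (k + t + i)) (sym w′-eq) (ℕₚ.+-monoʳ-≤ f (ℕₚ.m≤m+n (k + t) i))))) (lineRuns-right as s w′ bound))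
  right : ∀ s i → i < a → G s (k + t + i) ≡ s
  right true  i l = cong (_∨ any (inside (f + (k + t + i))) (lineRuns w′ false as)) (inside-true {f + (k + t + i)} {w′} {a}
    (subst (_≤ f + (k + t + i)) (sym w′-eq) (ℕₚ.+-monoʳ-≤ f (ℕₚ.m≤m+n (k + t) i)))
    (subst (λ z → f + (k + t + i) < z + a) (sym w′-eq) (subst (f + (k + t + i) <_) (sym (ℕₚ.+-assoc f (k + t) a)) (ℕₚ.+-monoʳ-< f (ℕₚ.+-monoʳ-< (k + t) l)))))
  right false i l = far true i

segments-not : ∀ s as → segments (not s) as ≡ map not (segments s as)
segments-not s []       = refl
segments-not s (a ∷ as) = trans (cong₂ _++_ (segments-not (not s) as) (sym (map-replicate not a s))) (sym (map-++ not (segments (not s) as) (replicate a s)))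

length-segments : ∀ s as → length (segments s as) ≡ total-length as
length-segments s []       = refl
length-segments s (a ∷ as) = trans (length-++ (segments (not s) as)) (trans (cong₂ _+_ (length-segments (not s) as) (length-replicate a)) (ℕₚ.+-comm (total-length as) a))

fl-rk-suc : ∀ n → rk n ≡ fl (suc n)
fl-rk-suc zero    = refl
fl-rk-suc (suc n) with par n | fl-rk-suc n
... | true  | e = e
... | false | e = cong suc e

fl-+-double : ∀ n m → fl (n + (m + m)) ≡ fl n + m
fl-+-double n zero    = trans (cong fl (ℕₚ.+-identityʳ n)) (sym (ℕₚ.+-identityʳ (fl n)))
fl-+-double n (suc m) = trans (cong fl (trans (cong (ℕ._+_ n) (cong suc (ℕₚ.+-suc m m))) (trans (ℕₚ.+-suc n _) (cong suc (ℕₚ.+-suc n (m + m))))))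
  (trans (two (n + (m + m))) (trans (cong suc (fl-+-double n m)) (sym (ℕₚ.+-suc (fl n) m))))
  where
  two : ∀ k → fl (suc (suc k)) ≡ suc (fl k)
  two k with par k
  ... | true  = refl
  ... | false = refl

twice-≤ : ∀ m n → m + m ≤ suc n → m ≤ n
twice-≤ zero    n l       = z≤n
twice-≤ (suc m) n (s≤s l) = ℕₚ.≤-trans (ℕₚ.m≤n+m (suc m) m) l

runs-odd  : ∀ w a → All (λ r → proj₂ r ≤ oddSum a) (lineRuns w true a)
runs-even : ∀ w a → All (λ r → proj₂ r ≤ evenSum a) (lineRuns w false a)
runs-odd w []       = []
runs-odd w (a ∷ as) = ℕₚ.m≤m+n a _ ∷ All.map (λ l → ℕₚ.≤-trans l (ℕₚ.m≤n+m _ a)) (runs-even (w ∸ a) as)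
runs-even w []       = []
runs-even w (a ∷ as) = runs-odd (w ∸ a) as

-- The first hole fits below the northern side by the hypothesis on a_1. The side of any other hole
-- above ℓ, increased by a_1 ≥ 1, is at most O, hence at most N + 1.
runs-odd-< : ∀ N y w a → All (1 ≤_) a → aAt a 1 ≤ N → suc N ≡ y + 2 * oddSum a → All (λ r → proj₂ r ≤ N) (lineRuns w true a)
runs-odd-< N y w []       p l e = []
runs-odd-< N y w (a ∷ as) (p ∷ ps) l e = l ∷ All.map (λ {r} m → ℕₚ.≤-pred (ℕₚ.≤-trans (ℕₚ.+-mono-≤ p m)
  (subst (a + evenSum as ≤_) (sym e) (ℕₚ.≤-trans (ℕₚ.m≤m+n (a + evenSum as) _) (ℕₚ.m≤n+m _ y))))) (runs-even (w ∸ a) as)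

-- Each marked segment of ℓ has a hole above or below it and cannot be crossed, and neither can the
-- padding; crossings are left only on the first k segments.
cover : ∀ k X m (F : List Bool → ℚ) {wd} → k + m ≡ wd → length X ≤ m →
  sumB wd (λ R → ind (free R (zeros k ++ map not X ++ ones (m ∸ length X)) (zeros k ++ X ++ ones (m ∸ length X))) (F R)) ≡ sumB k (λ S → F (S ++ zeros m))
cover zero    X m F refl l = go X m F l
  where
  go : ∀ X m (F : List Bool → ℚ) → length X ≤ m → sumB m (λ R → ind (free R (map not X ++ ones (m ∸ length X)) (X ++ ones (m ∸ length X))) (F R)) ≡ F (zeros m)
  go []      m       F l       = sumB-full m F
  go (x ∷ X) (suc m) F (s≤s l) = trans (cong₂ _⊕_ (go X m (F ∘ (false ∷_)) l) (sumB-0 m (λ R _ → blocked x R))) (⊕-identityʳ _)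
    where
    blocked : ∀ x R → ind (free (true ∷ R) (not x ∷ map not X ++ ones (m ∸ length X)) (x ∷ X ++ ones (m ∸ length X))) (F (true ∷ R)) ≡ 0ℚ
    blocked true  R = refl
    blocked false R = refl
cover (suc k) X m F refl l = cong₂ _⊕_ (cover k X m (F ∘ (false ∷_)) refl l) (cover k X m (F ∘ (true ∷_)) refl l)

∸-ℤ : ∀ m n d → m ≡ n + d → + m ℤ.- + n ≡ + d
∸-ℤ m n d refl = lem (+ n) (+ d)
  where
  lem : ∀ n d → n ℤ.+ d ℤ.- n ≡ d
  lem = ℤ-Ring.solve-∀

-- The region with holes along ℓ, cut along ℓ.

-- β is the height of V, N the number of rows above ℓ and q half the height of the region. The
-- equations for their successors replace truncated subtractions; the cases in which no such numbers
-- exist are treated separately.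
module RGeometry (x y z : ℕ) (a : List ℕ) (β N q : ℕ)
  (β-eq : suc β ≡ y + z + 2 * evenSum a) (N-eq : suc N ≡ y + 2 * oddSum a) (q-eq : suc q ≡ y + z + (oddSum a + evenSum a)) (fit : ∀ w → All (λ r → proj₂ r ≤ N) (lineRuns w true a)) where

  E O s h bl vT k wd : ℕ
  E = evenSum a
  O = oddSum a
  s = total-length a
  h = Rheight y z a
  bl = β + z
  vT = h + (x + E)
  k = x + fl y
  wd = (x + O) + (x + E) + h

  h-eq : h ≡ q + q
  h-eq = trans (cong (λ n → 2 * (n ∸ 1)) (sym q-eq)) (cong (ℕ._+_ q) (ℕₚ.+-identityʳ q))

  qE : q + E ≡ O + β
  qE = ℕₚ.suc-injective (trans (cong (_+ E) q-eq) (trans (perm y z O E) (trans (cong (ℕ._+_ O) (sym β-eq)) (ℕₚ.+-suc O β))))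
    where
    perm : ∀ y z O E → y + z + (O + E) + E ≡ O + (y + z + 2 * E)
    perm = ℕ-Ring.solve-∀

  h-split : bl + N ≡ h
  h-split = ℕₚ.suc-injective (ℕₚ.suc-injective (begin
    suc (suc (β + z + N))             ≡⟨ cong suc (sym (ℕₚ.+-suc (β + z) N)) ⟩
    suc β + z + suc N                 ≡⟨ cong₂ (λ m n → m + z + n) β-eq N-eq ⟩
    y + z + 2 * E + z + (y + 2 * O)   ≡⟨ perm y z O E ⟩
    y + z + (O + E) + (y + z + (O + E)) ≡⟨ cong₂ _+_ (sym q-eq) (sym q-eq) ⟩
    suc q + suc q                     ≡⟨ cong suc (ℕₚ.+-suc q q) ⟩
    suc (suc (q + q))                 ≡⟨ cong (suc ∘ suc) (sym h-eq) ⟩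
    suc (suc h) ∎))
    where
    open ≡-Reasoning
    perm : ∀ y z O E → y + z + 2 * E + z + (y + 2 * O) ≡ y + z + (O + E) + (y + z + (O + E))
    perm = ℕ-Ring.solve-∀

  bl≤h : bl ≤ h
  bl≤h = subst (bl ≤_) h-split (ℕₚ.m≤m+n bl N)

  h-even : par h ≡ false
  h-even = trans (cong par h-eq) (par-double q)

  rk-N : rk N ≡ fl y + O
  rk-N = trans (fl-rk-suc N) (trans (cong fl (trans N-eq (cong (λ n → y + (O + n)) (ℕₚ.+-identityʳ O)))) (fl-+-double y O))

  bl-suc : suc bl ≡ y + ((z + E) + (z + E))
  bl-suc = trans (cong (_+ z) β-eq) (perm y z E)
    where
    perm : ∀ y z E → y + z + 2 * E + z ≡ y + ((z + E) + (z + E))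
    perm = ℕ-Ring.solve-∀

  rk-bl : rk bl ≡ fl y + (z + E)
  rk-bl = trans (fl-rk-suc bl) (trans (cong fl bl-suc) (fl-+-double y (z + E)))

  f : ℕ
  f = fl (h + bl)

  vT-eq : vT ≡ f + (k + s)
  vT-eq = trans (cong (_+ (x + E)) (trans (sym (fl-rk N bl h h-split)) (cong (ℕ._+_ f) rk-N)))
    (trans (perm f (fl y) O x E) (cong (λ n → f + (k + n)) (sym (total-odd-even a))))
    where
    perm : ∀ f m O x E → f + (m + O) + (x + E) ≡ f + (x + m + (O + E))
    perm = ℕ-Ring.solve-∀

  s≤vT : s ≤ vT
  s≤vT = subst (s ≤_) (sym vT-eq) (ℕₚ.≤-trans (ℕₚ.m≤n+m s k) (ℕₚ.m≤n+m (k + s) f))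

  us ds : Runs
  us = lineRuns vT true a
  ds = (vT , z) ∷ lineRuns vT false a

  module TP = TopPattern h bl (x + E) us
    (All.map (λ {r} l → subst (bl + proj₂ r ≤_) h-split (ℕₚ.+-monoʳ-≤ bl l)) (fit vT))
    (lineRuns-left a true f vT (subst (f + s ≤_) (sym vT-eq) (ℕₚ.+-monoʳ-≤ f (ℕₚ.m≤n+m s k))))

  small : ∀ m → m ≤ z + E → m ≤ bl
  small m l = twice-≤ m bl (ℕₚ.≤-trans (ℕₚ.+-mono-≤ l l) (subst (z + E + (z + E) ≤_) (sym bl-suc) (ℕₚ.m≤n+m (z + E + (z + E)) y)))

  module BP = BottomPattern h bl (x + O) h-even ds
    (small z (ℕₚ.m≤m+n z E) ∷ All.map (λ {r} l → small (proj₂ r) (ℕₚ.≤-trans l (ℕₚ.m≤n+m E z))) (runs-even vT a))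
    (subst (f ≤_) (sym vT-eq) (ℕₚ.m≤m+n f (k + s)) ∷ lineRuns-left a false f vT (subst (f + s ≤_) (sym vT-eq) (ℕₚ.+-monoʳ-≤ f (ℕₚ.m≤n+m s k))))

  -- The first segment of the line b beyond the southeastern side, prolonged above V.
  lim : ℕ → ℕ
  lim b = q + (x + O) + b

  lim-bl : lim bl ≡ vT + z
  lim-bl = sym (trans (cong (λ n → n + (x + E) + z) h-eq) (trans (perm q x E z) (trans (cong (λ n → q + x + n + z) qE) (perm′ q x O β z))))
    where
    perm : ∀ q x E z → q + q + (x + E) + z ≡ q + x + (q + E) + z
    perm = ℕ-Ring.solve-∀
    perm′ : ∀ q x O β z → q + x + (O + β) + z ≡ q + (x + O) + (β + z)
    perm′ = ℕ-Ring.solve-∀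

  lim-shift : ∀ b → lim b + bl ≡ vT + z + b
  lim-shift b = trans (perm (q + (x + O)) b bl) (cong (_+ b) lim-bl)
    where
    perm : ∀ l b c → l + b + c ≡ l + c + b
    perm = ℕ-Ring.solve-∀

  lim-β : lim β ≡ vT
  lim-β = ℕₚ.+-cancelʳ-≡ bl _ _ (trans (lim-shift β) (trans (perm vT z β) refl))
    where
    perm : ∀ v z b → v + z + b ≡ v + (b + z)
    perm = ℕ-Ring.solve-∀

  top bottom : ℕ → ℕ → Bool
  top b u = (vT ℕ.≤ᵇ u) ∨ anyUp us bl b u
  bottom b u = (lim b ℕ.≤ᵇ u) ∨ anyDown ds bl b u

  -- From V upwards, the northeastern side cuts off what the prolonged southeastern side and the
  -- down-pointing triangle of side z to the right of P cut off together. This gives the lower part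
  -- a straight eastern side, at the price of one more hole.
  z-hole-beyond : ∀ b u X → β ≤ b → (vT ℕ.≤ᵇ u) ∨ X ≡ (lim b ℕ.≤ᵇ u) ∨ (holeDown vT z bl b u ∨ X)
  z-hole-beyond b u X l with ℕₚ.≤-<-connex (lim b) u
  ... | inj₁ m rewrite ≤ᵇ-true m | ≤ᵇ-true (ℕₚ.≤-trans (subst (_≤ lim b) lim-β (ℕₚ.+-monoʳ-≤ (q + (x + O)) l)) m) = refl
  ... | inj₂ m rewrite ≤ᵇ-false m | ≤ᵇ-true {suc (u + bl)} {vT + z + b} (subst (u + bl <_) (lim-shift b) (ℕₚ.+-monoˡ-< bl m)) | ∧-identityʳ (vT ℕ.≤ᵇ u) = refl

  -- Up to the height of V the additional triangle removes nothing inside the southeastern side.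
  z-hole-before : ∀ b u X → b ≤ β → (lim b ℕ.≤ᵇ u) ∨ X ≡ (lim b ℕ.≤ᵇ u) ∨ (holeDown vT z bl b u ∨ X)
  z-hole-before b u X l with ℕₚ.≤-<-connex (lim b) u
  ... | inj₁ m rewrite ≤ᵇ-true m = refl
  ... | inj₂ m rewrite ≤ᵇ-false m | ≤ᵇ-false {vT} {u} (ℕₚ.≤-trans m (subst (lim b ≤_) lim-β (ℕₚ.+-monoʳ-≤ (q + (x + O)) l))) = refl

  bV blℤ XP : ℤ
  bV = + (y + z + 2 * E) ℤ.- + 1
  blℤ = bV ℤ.+ + z
  XP = + h ℤ.+ + (2 * x + 2 * E) ℤ.+ + h ℤ.- blℤ

  Y : ℤ → ℤ → ℤ
  Y v b = if v ℤ.≤ᵇ b then + h ℤ.+ + (2 * x + 2 * E) ℤ.+ + h ℤ.- b else + h ℤ.+ + (2 * x + 2 * O) ℤ.+ b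

  right : ℤ → ℤ
  right b = Y bV b ℤ.⊓ Y bV (b ℤ.+ + 1)

  bV-eq : bV ≡ + β
  bV-eq = cong (λ n → + n ℤ.- + 1) (sym β-eq)

  blℤ-eq : blℤ ≡ + bl
  blℤ-eq = cong (ℤ._+ + z) bV-eq

  hole : Cell → Bool
  hole = lineHoles XP blℤ true a

  XP-eq : XP ℤ.+ blℤ ≡ + (vT + vT)
  XP-eq = lem (+ h) (+ x) (+ E) blℤ
    where
    lem : ∀ h x E b → h ℤ.+ (x ℤ.+ (x ℤ.+ + 0) ℤ.+ (E ℤ.+ (E ℤ.+ + 0))) ℤ.+ h ℤ.- b ℤ.+ b ≡ h ℤ.+ (x ℤ.+ E) ℤ.+ (h ℤ.+ (x ℤ.+ E))
    lem = ℤ-Ring.solve-∀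

  XP-eq′ : XP ℤ.+ + bl ≡ + (vT + vT)
  XP-eq′ = trans (cong (ℤ._+_ XP) (sym blℤ-eq)) XP-eq

  hole-eq : ∀ c → hole c ≡ lineHoles XP (+ bl) true a c
  hole-eq c = cong (λ b → lineHoles XP b true a c) blℤ-eq

  c : ℕ → ℕ
  c b = if β ℕ.≤ᵇ b then x + E + (x + E) + (h ∸ b) else x + O + (x + O) + suc b

  c-top : ∀ {b} → β ≤ b → c b ≡ x + E + (x + E) + (h ∸ b)
  c-top l rewrite ≤ᵇ-true l = refl

  c-bottom : ∀ {b} → b < β → c b ≡ x + O + (x + O) + suc b
  c-bottom l rewrite ≤ᵇ-false l = refl

  ends : ∀ b → b < h → right (+ b) ℤ.+ + 1 ≡ + (h + c b)
  ends b l with ℕₚ.≤-<-connex β b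
  ... | inj₁ m = trans (cong (λ v → Y v (+ b) ℤ.⊓ Y v (+ b ℤ.+ + 1) ℤ.+ + 1) bV-eq) (trans (cong₂ (λ p r → p ℤ.⊓ r ℤ.+ + 1) Y₀ Y₁)
      (trans (cong (ℤ._+ + 1) (ℤₚ.i≥j⇒i⊓j≡j (ℤ.+≤+ (ℕₚ.+-monoʳ-≤ (h + (2 * x + 2 * E)) (ℕₚ.n≤1+n d)))))
        (trans (cong +_ (perm h x E d)) (cong (λ n → + (h + n)) (trans (cong (ℕ._+_ (x + E + (x + E))) (sym d-eq)) (sym (c-top m)))))))
    where
    d = h ∸ suc b
    d-eq : h ∸ b ≡ suc d
    d-eq = trans (cong (_∸ b) (trans (sym (ℕₚ.m+[n∸m]≡n l)) (sym (ℕₚ.+-suc b d)))) (ℕₚ.m+n∸m≡n b (suc d))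
    h-b : h ≡ b + suc d
    h-b = trans (sym (ℕₚ.m+[n∸m]≡n l)) (sym (ℕₚ.+-suc b d))
    minus : ∀ p m n d → p ≡ p → m ≡ n + d → + p ℤ.+ + m ℤ.- + n ≡ + (p + d)
    minus p m n d _ e = trans (ℤₚ.+-assoc (+ p) (+ m) (ℤ.- + n)) (cong (ℤ._+_ (+ p)) (∸-ℤ m n d e))
    Y₀ : Y (+ β) (+ b) ≡ + (h + (2 * x + 2 * E) + suc d)
    Y₀ rewrite ≤ᵇ-true m = minus (h + (2 * x + 2 * E)) h b (suc d) refl h-b
    Y₁ : Y (+ β) (+ b ℤ.+ + 1) ≡ + (h + (2 * x + 2 * E) + d)
    Y₁ rewrite ≤ᵇ-true (ℕₚ.≤-trans m (ℕₚ.m≤m+n b 1)) = minus (h + (2 * x + 2 * E)) h (b + 1) d refl (trans h-b (trans (ℕₚ.+-suc b d) (cong (_+ d) (ℕₚ.+-comm 1 b))))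
    perm : ∀ h x E d → h + (2 * x + 2 * E) + d + 1 ≡ h + (x + E + (x + E) + suc d)
    perm = ℕ-Ring.solve-∀
  ... | inj₂ m = trans (cong (λ v → Y v (+ b) ℤ.⊓ Y v (+ b ℤ.+ + 1) ℤ.+ + 1) bV-eq) (trans (cong₂ (λ p r → p ℤ.⊓ r ℤ.+ + 1) Y₀ Y₁)
      (trans (cong (ℤ._+ + 1) (ℤₚ.i≤j⇒i⊓j≡i (ℤ.+≤+ (ℕₚ.+-monoʳ-≤ (h + (2 * x + 2 * O)) (ℕₚ.n≤1+n b)))))
        (trans (cong +_ (perm h x O b)) (cong (λ n → + (h + n)) (sym (c-bottom m))))))
    where
    Y₀ : Y (+ β) (+ b) ≡ + (h + (2 * x + 2 * O) + b)
    Y₀ rewrite ≤ᵇ-false m = refl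
    Y₁ : Y (+ β) (+ b ℤ.+ + 1) ≡ + (h + (2 * x + 2 * O) + suc b)
    Y₁ with ℕₚ.m≤n⇒m<n∨m≡n m
    ... | inj₁ n rewrite ≤ᵇ-false {β} {b + 1} (subst (_< β) (ℕₚ.+-comm 1 b) n) = cong (λ n → + (h + (2 * x + 2 * O) + n)) (ℕₚ.+-comm b 1)
    ... | inj₂ refl rewrite ≤ᵇ-true {suc b} {b + 1} (ℕₚ.≤-reflexive (ℕₚ.+-comm 1 b)) = trans (cong (λ n → + h ℤ.+ + (2 * x + 2 * E) ℤ.+ + h ℤ.- + n) (ℕₚ.+-comm b 1))
        (trans (cong (ℤ._- + suc b) (cong +_ corner)) (∸-ℤ _ (suc b) _ refl))
      where
      -- At V the formulas for the two eastern sides agree.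
      corner : h + (2 * x + 2 * E) + h ≡ suc b + (h + (2 * x + 2 * O) + suc b)
      corner = trans (cong (λ n → h + (2 * x + 2 * E) + n) h-eq) (trans (p₁ h x E q) (trans (cong (λ n → h + 2 * x + (n + n)) qE) (p₂ h x O (suc b))))
        where
        p₁ : ∀ h x E q → h + (2 * x + 2 * E) + (q + q) ≡ h + 2 * x + ((q + E) + (q + E))
        p₁ = ℕ-Ring.solve-∀
        p₂ : ∀ h x O b → h + 2 * x + ((O + b) + (O + b)) ≡ b + (h + (2 * x + 2 * O) + b)
        p₂ = ℕ-Ring.solve-∀
    perm : ∀ h x O b → h + (2 * x + 2 * O) + b + 1 ≡ h + (x + O + (x + O) + suc b)
    perm = ℕ-Ring.solve-∀

  -- On ℓ itself the up-pointing triangles belong to the upper part and the down-pointing ones to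
  -- the lower part, hence the two conventions at `bl`.
  α δ : ℕ → ℕ → Bool
  α b u = if bl ℕ.≤ᵇ b then top b u else bottom b u
  δ b u = if b ℕ.≤ᵇ bl then bottom b u else top b u

  α-top : ∀ {b} → bl ≤ b → ∀ u → α b u ≡ top b u
  α-top l u rewrite ≤ᵇ-true l = refl

  α-bottom : ∀ {b} → b < bl → ∀ u → α b u ≡ bottom b u
  α-bottom l u rewrite ≤ᵇ-false l = refl

  δ-top : ∀ {b} → bl < b → ∀ u → δ b u ≡ top b u
  δ-top l u rewrite ≤ᵇ-false l = refl

  δ-bottom : ∀ {b} → b ≤ bl → ∀ u → δ b u ≡ bottom b u
  δ-bottom l u rewrite ≤ᵇ-true l = refl

  total-top : ∀ b → b < h → β ≤ b → h + c b + b ≡ vT + vT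
  total-top b l m = trans (cong (λ n → h + n + b) (c-top m)) (trans (perm h x E (h ∸ b) b) (trans (cong (λ n → h + (x + E + (x + E)) + n) (ℕₚ.m∸n+n≡m (ℕₚ.<⇒≤ l))) (perm′ h x E)))
    where
    perm : ∀ h x E d b → h + (x + E + (x + E) + d) + b ≡ h + (x + E + (x + E)) + (d + b)
    perm = ℕ-Ring.solve-∀
    perm′ : ∀ h x E → h + (x + E + (x + E)) + h ≡ h + (x + E) + (h + (x + E))
    perm′ = ℕ-Ring.solve-∀

  total-bottom : ∀ b → b < β → h + c b + b ≡ suc (lim b + lim b)
  total-bottom b m = trans (cong₂ (λ n n′ → n′ + n + b) (c-bottom m) h-eq) (perm q x O b)
    where
    perm : ∀ q x O b → q + q + (x + O + (x + O) + suc b) + b ≡ suc (q + (x + O) + b + (q + (x + O) + b))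
    perm = ℕ-Ring.solve-∀

  suc-≤ᵇ : ∀ m n → (suc m ℕ.≤ᵇ suc n) ≡ (m ℕ.≤ᵇ n)
  suc-≤ᵇ m n = T-ext (λ t → ℕₚ.≤⇒≤ᵇ (ℕₚ.≤-pred (ℕₚ.≤ᵇ⇒≤ (suc m) (suc n) t))) (λ t → ℕₚ.≤⇒≤ᵇ (s≤s (ℕₚ.≤ᵇ⇒≤ m n t)))

  compare : ∀ b k {p r} → h + c b + b ≡ p → k + b ≡ r → (h + c b ℕ.≤ᵇ k) ≡ (p ℕ.≤ᵇ r)
  compare b k e e′ = trans (≤ᵇ-+ʳ (h + c b) k b) (cong₂ ℕ._≤ᵇ_ e e′)

  β≤bl : β ≤ bl
  β≤bl = ℕₚ.m≤m+n β z

  up-cells : ∀ b u k → b < h → h ≤ k → k + b ≡ suc (u + u) → α b u ≡ (h + c b ℕ.≤ᵇ k) ∨ hole (+ k , + b)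
  up-cells b u k l _ e with ℕₚ.≤-<-connex bl b | ℕₚ.≤-<-connex β b
  ... | inj₁ m | _ = trans (α-top m u) (sym (cong₂ _∨_
    (trans (compare b k (total-top b l (ℕₚ.≤-trans β≤bl m)) e) (≤ᵇ-double-suc vT u))
    (trans (hole-eq _) (lineHoles-up-above bl b k u a XP vT XP-eq′ s≤vT m e))))
  ... | inj₂ m | inj₁ n = trans (α-bottom m u) (trans (sym (z-hole-beyond b u _ n)) (sym (cong₂ _∨_
    (trans (compare b k (total-top b l n) e) (≤ᵇ-double-suc vT u))
    (trans (hole-eq _) (lineHoles-up-below bl b k u a XP vT XP-eq′ s≤vT m e)))))
  ... | inj₂ m | inj₂ n = trans (α-bottom m u) (trans (sym (z-hole-before b u _ (ℕₚ.<⇒≤ n))) (sym (cong₂ _∨_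
    (trans (compare b k (total-bottom b n) e) (trans (suc-≤ᵇ (lim b + lim b) (u + u)) (≤ᵇ-double (lim b) u)))
    (trans (hole-eq _) (lineHoles-up-below bl b k u a XP vT XP-eq′ s≤vT m e)))))

  down-cells : ∀ b u k → b < h → h ≤ k → k + b ≡ u + u → δ (suc b) u ≡ (h + c b ℕ.≤ᵇ k) ∨ hole (+ k , + b)
  down-cells b u k l _ e with ℕₚ.≤-<-connex bl b | ℕₚ.≤-<-connex β b
  ... | inj₁ m | _ = trans (δ-top (s≤s m) u) (sym (cong₂ _∨_
    (trans (compare b k (total-top b l (ℕₚ.≤-trans β≤bl m)) e) (≤ᵇ-double vT u))
    (trans (hole-eq _) (lineHoles-down-above bl b k u a XP vT XP-eq′ s≤vT m e))))
  ... | inj₂ m | inj₁ n = trans (δ-bottom m u) (trans (sym (z-hole-beyond (suc b) u _ (ℕₚ.m≤n⇒m≤1+n n))) (sym (cong₂ _∨_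
    (trans (compare b k (total-top b l n) e) (≤ᵇ-double vT u))
    (trans (hole-eq _) (lineHoles-down-below bl b k u a XP vT XP-eq′ s≤vT m e)))))
  ... | inj₂ m | inj₂ n = trans (δ-bottom m u) (trans (sym (z-hole-before (suc b) u _ n)) (sym (cong₂ _∨_
    (trans (compare b k (total-bottom b n) e) (trans (≤ᵇ-suc-double (lim b) u) (cong (ℕ._≤ᵇ u) (sym (ℕₚ.+-suc (q + (x + O)) b)))))
    (trans (hole-eq _) (lineHoles-down-below bl b k u a XP vT XP-eq′ s≤vT m e)))))

  wide : ∀ b → b < h → c b ≤ wd + wd
  wide b l with ℕₚ.≤-<-connex β b
  ... | inj₁ m = subst (_≤ wd + wd) (sym (c-top m)) (ℕₚ.≤-trans (ℕₚ.+-monoʳ-≤ (x + E + (x + E)) (ℕₚ.m∸n≤m h b))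
    (subst (x + E + (x + E) + h ≤_) (perm (x + O) (x + E) h) (ℕₚ.m≤m+n _ _)))
    where
    perm : ∀ p r h → r + r + h + (p + p + h) ≡ p + r + h + (p + r + h)
    perm = ℕ-Ring.solve-∀
  ... | inj₂ m = subst (_≤ wd + wd) (sym (c-bottom m)) (ℕₚ.≤-trans (ℕₚ.+-monoʳ-≤ (x + O + (x + O)) l)
    (subst (x + O + (x + O) + h ≤_) (perm (x + O) (x + E) h) (ℕₚ.m≤m+n _ _)))
    where
    perm : ∀ p r h → p + p + h + (r + r + h) ≡ p + r + h + (p + r + h)
    perm = ℕ-Ring.solve-∀

  module C = Columns h wd right hole α δ c ends wide up-cells down-cells
  open Strips h wd C.A C.B C.lengthA C.lengthB using (strips)

  padT padB : ℕ → ℕ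
  padT n = wd ∸ (x + E + rk n)
  padB b = wd ∸ (x + O + rk b)

  shortT : ∀ n → n ≤ h → x + E + rk n ≤ wd
  shortT n l = ℕₚ.+-mono-≤ (ℕₚ.m≤n+m (x + E) (x + O)) (ℕₚ.≤-trans (rk-≤ n) l)

  shortB : ∀ b → b ≤ h → x + O + rk b ≤ wd
  shortB b l = ℕₚ.+-mono-≤ (ℕₚ.m≤m+n (x + O) (x + E)) (ℕₚ.≤-trans (rk-≤ b) l)

  N≤h : N ≤ h
  N≤h = subst (N ≤_) h-split (ℕₚ.m≤n+m N bl)

  fl+rk : ∀ n → fl n + rk n ≡ n
  fl+rk zero    = refl
  fl+rk (suc n) with par n | fl+rk n
  ... | true  | e = cong suc e
  ... | false | e = trans (ℕₚ.+-suc (fl n) (rk n)) (cong suc e)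

  lim-T : ∀ n b → b + n ≡ h → vT ≡ fl (h + b) + (x + E + rk n)
  lim-T n b e = trans (cong (_+ (x + E)) (sym (fl-rk n b h e))) (perm (fl (h + b)) (rk n) (x + E))
    where
    perm : ∀ f r L → f + r + L ≡ f + (L + r)
    perm = ℕ-Ring.solve-∀

  lim-B : ∀ b → lim b ≡ fl (h + b) + (x + O + rk b)
  lim-B b = trans (cong (ℕ._+_ (q + (x + O))) (sym (fl+rk b))) (trans (perm q (x + O) (fl b) (rk b))
    (cong (_+ (x + O + rk b)) (sym (trans (cong fl (trans (ℕₚ.+-comm h b) (cong (ℕ._+_ b) h-eq))) (fl-+-double b q)))))
    where
    perm : ∀ q L f r → q + L + (f + r) ≡ f + q + (L + r)
    perm = ℕ-Ring.solve-∀

  listT : ∀ n b (g : ℕ → Bool) → b + n ≡ h → (∀ u → g u ≡ top b u) → applyUpTo (λ i → g (fl (h + b) + i)) wd ≡ TP.holes n ++ ones (padT n)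
  listT n b g e r = trans (applyUpTo-cong wd (λ i _ → r _)) (trans (limit-list vT (fl (h + b)) (x + E + rk n) wd (λ i → anyUp us bl b (fl (h + b) + i)) (lim-T n b e) (shortT n (subst (n ≤_) e (ℕₚ.m≤n+m n b))))
    (cong (λ z → applyUpTo (TP.F z) (x + E + rk n) ++ ones (padT n)) (sym (∸-gap b n h e))))

  listB : ∀ b (g : ℕ → Bool) → b ≤ h → (∀ u → g u ≡ bottom b u) → applyUpTo (λ i → g (fl (h + b) + i)) wd ≡ BP.holes b ++ ones (padB b)
  listB b g l r = trans (applyUpTo-cong wd (λ i _ → r _)) (limit-list (lim b) (fl (h + b)) (x + O + rk b) wd (λ i → anyDown ds bl b (fl (h + b) + i)) (lim-B b) (shortB b l))

  lengthT : ∀ n → length (TP.holes n) ≡ x + E + rk n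
  lengthT n = length-applyUpTo _ (x + E + rk n)

  lengthB : ∀ b → length (BP.holes b) ≡ x + O + rk b
  lengthB b = length-applyUpTo _ (x + O + rk b)

  past : ∀ n → n < N → bl ≤ h ∸ suc n
  past n l = ℕₚ.m+n≤o⇒m≤o∸n bl (subst (bl + suc n ≤_) h-split (ℕₚ.+-monoʳ-≤ bl l))

  module HT = C.Halves (x + E) N TP.holes padT (λ n _ → lengthT n)
    (λ n l → trans (cong (_+ padT n) (lengthT n)) (ℕₚ.m+[n∸m]≡n (shortT n (ℕₚ.≤-trans l N≤h)))) TP.start
    (λ n l → TP.erosion n (h ∸ suc n) (ℕₚ.m∸n+n≡m (ℕₚ.≤-trans l N≤h)) (past n l))

  module HB = C.Halves (x + O) bl BP.holes padB (λ b _ → lengthB b)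
    (λ b l → trans (cong (_+ padB b) (lengthB b)) (ℕₚ.m+[n∸m]≡n (shortB b (ℕₚ.≤-trans l bl≤h)))) BP.start BP.erosion

  bl≤ : ∀ {n b} → n ≤ N → b + n ≡ h → bl ≤ b
  bl≤ {n} {b} l e = ℕₚ.+-cancelʳ-≤ n bl b (subst (bl + n ≤_) (trans h-split (sym e)) (ℕₚ.+-monoʳ-≤ bl l))

  bl< : ∀ {n b} → n < N → b + n ≡ h → bl < b
  bl< {n} {b} l e = ℕₚ.+-cancelʳ-< n bl b (subst (bl + n <_) (trans h-split (sym e)) (ℕₚ.+-monoʳ-< bl l))

  crossing-top : ∀ Q → length Q ≡ length (TP.holes N) → C.crossing N bl (Q ++ zeros (padT N)) ≡ Tr (x + E) N (orl Q (TP.holes N))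
  crossing-top = HT.crossing-Tr (λ n b l e → listT n b (α b) e (α-top (bl≤ l e))) (λ n b l e → listT n b (δ b) e (δ-top (bl< l e))) N bl ℕₚ.≤-refl h-split

  forward-bottom : ∀ Q → length Q ≡ length (BP.holes bl) → C.forward bl (Q ++ zeros (padB bl)) ≡ Tr (x + O) bl (orl Q (BP.holes bl))
  forward-bottom = HB.forward-Tr h-even (λ b l → listB b (δ b) (ℕₚ.≤-trans l bl≤h) (δ-bottom l)) (λ b l → listB b (α b) (ℕₚ.<⇒≤ (ℕₚ.<-≤-trans l bl≤h)) (α-bottom l)) bl ℕₚ.≤-refl

  U D : List Bool
  U = segments true a
  D = segments false a

  rowT : x + E + rk N ≡ k + s
  rowT = trans (cong (ℕ._+_ (x + E)) rk-N) (trans (perm x E (fl y) O) (cong (ℕ._+_ k) (sym (total-odd-even a))))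
    where
    perm : ∀ x E m O → x + E + (m + O) ≡ x + m + (O + E)
    perm = ℕ-Ring.solve-∀

  rowB : x + O + rk bl ≡ k + s + z
  rowB = trans (cong (ℕ._+_ (x + O)) rk-bl) (trans (perm x E (fl y) O z) (cong (λ n → k + n + z) (sym (total-odd-even a))))
    where
    perm : ∀ x E m O z → x + O + (m + (z + E)) ≡ x + m + (O + E) + z
    perm = ℕ-Ring.solve-∀

  holesT : TP.holes N ≡ zeros k ++ U
  holesT = trans (cong₂ (λ b n → applyUpTo (TP.F b) n) (∸-gap bl N h h-split) rowT)
    (trans (applyUpTo-cong (k + s) (λ i _ → anyUp-inside us bl (f + i))) (line-bits a true f k vT vT-eq))

  holesB : BP.holes bl ≡ zeros k ++ D ++ ones z
  holesB = trans (cong (applyUpTo (BP.F bl)) rowB) (trans (applyUpTo-++ (BP.F bl) (k + s) z)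
    (trans (cong₂ _++_
      (trans (applyUpTo-cong (k + s) (λ i l → trans (anyDown-inside ds bl (f + i)) (cong (_∨ any (inside (f + i)) (lineRuns vT false a)) (inside-before {f + i} {vT} {z} (subst (f + i <_) (sym vT-eq) (ℕₚ.+-monoʳ-< f l))))))
        (line-bits a false f k vT vT-eq))
      (applyUpTo-const _ true z (λ i l → trans (anyDown-inside ds bl (f + (k + s + i))) (cong (_∨ any (inside (f + (k + s + i))) (lineRuns vT false a))
        (inside-true {f + (k + s + i)} {vT} {z} (subst (vT ≤_) (assoc i) (ℕₚ.m≤m+n vT i)) (subst (_< vT + z) (assoc i) (ℕₚ.+-monoʳ-< vT l)))))))
      (++-assoc (zeros k) D (ones z))))
    where
    assoc : ∀ i → vT + i ≡ f + (k + s + i)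
    assoc i = trans (cong (_+ i) vT-eq) (ℕₚ.+-assoc f (k + s) i)

  orl-++ : ∀ j S X → length X ≡ j → ∀ k → length S ≡ k → orl (S ++ zeros j) (zeros k ++ X) ≡ S ++ X
  orl-++ j []      X e zero    l = length-zeros-orl j X e
  orl-++ j (b ∷ S) X e (suc k) l = cong₂ _∷_ (∨-identityʳ b) (orl-++ j S X e k (ℕₚ.suc-injective l))

  p m : ℕ
  p = wd ∸ (k + s)
  m = s + p

  k+m : k + m ≡ wd
  k+m = trans (sym (ℕₚ.+-assoc k s p)) (ℕₚ.m+[n∸m]≡n (subst (_≤ wd) rowT (shortT N N≤h)))

  p-split : p ≡ z + padB bl
  p-split = ℕₚ.+-cancelˡ-≡ (k + s) p (z + padB bl) (trans (trans (ℕₚ.+-assoc k s p) k+m)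
    (sym (trans (sym (ℕₚ.+-assoc (k + s) z (padB bl))) (trans (cong (_+ padB bl) (sym rowB)) (ℕₚ.m+[n∸m]≡n (shortB bl bl≤h))))))

  p-T : padT N ≡ p
  p-T = cong (wd ∸_) rowT

  A-bl : C.A bl ≡ zeros k ++ U ++ ones p
  A-bl = trans (listT N bl (α bl) h-split (α-top ℕₚ.≤-refl)) (trans (cong₂ (λ X n → X ++ ones n) holesT p-T) (++-assoc (zeros k) U (ones p)))

  ones-+ : ∀ i j → ones (i + j) ≡ ones i ++ ones j
  ones-+ zero    j = refl
  ones-+ (suc i) j = cong (true ∷_) (ones-+ i j)

  B-bl : C.B bl ≡ zeros k ++ map not U ++ ones p
  B-bl = trans (listB bl (δ bl) bl≤h (δ-bottom ℕₚ.≤-refl)) (trans (cong (_++ ones (padB bl)) holesB) (trans (++-assoc (zeros k) (D ++ ones z) (ones (padB bl)))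
    (cong (zeros k ++_) (trans (++-assoc D (ones z) (ones (padB bl))) (cong₂ _++_ (segments-not true a) (trans (sym (ones-+ z (padB bl))) (cong ones (sym p-split))))))))

  -- A western lozenge that crosses ℓ belongs to neither part, so its weight is a factor of its own.
  summand : List Bool → ℚ
  summand S = wt (not (par y)) S ⊗ (Tr (x + O) bl (S ++ D ++ ones z) ⊗ Tr (x + E) N (S ++ U))

  par-bl : par (h + bl) ≡ not (par y)
  par-bl = trans (cong par (ℕₚ.+-comm h bl)) (trans (par-+ bl h h-even) (trans (sym (not-involutive (par bl)))
    (cong not (trans (cong par bl-suc) (par-+ y _ (par-double (z + E)))))))

  at-S : ∀ S → length S ≡ k → wt (par (h + bl)) (S ++ zeros m) ⊗ (C.forward bl (S ++ zeros m) ⊗ C.crossing N bl (S ++ zeros m)) ≡ summand S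
  at-S S l = cong₂ _⊗_ (trans (cong (λ b → wt b (S ++ zeros m)) par-bl) (wt-pad (not (par y)) S m)) (cong₂ _⊗_
    (trans (cong (C.forward bl) (split (s + z) (padB bl) (trans (cong (ℕ._+_ s) p-split) (sym (ℕₚ.+-assoc s z (padB bl))))))
      (trans (forward-bottom (S ++ zeros (s + z)) (trans (len (s + z)) (trans (sym (ℕₚ.+-assoc k s z)) (trans (sym rowB) (sym (lengthB bl))))))
        (cong (Tr (x + O) bl) (trans (cong (orl (S ++ zeros (s + z))) holesB) (orl-++ (s + z) S (D ++ ones z) (trans (length-++ D) (cong₂ _+_ (length-segments false a) (length-replicate z))) k l)))))
    (trans (cong (C.crossing N bl) (split s (padT N) (cong (ℕ._+_ s) (sym p-T))))
      (trans (crossing-top (S ++ zeros s) (trans (len s) (trans (sym rowT) (sym (lengthT N)))))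
        (cong (Tr (x + E) N) (trans (cong (orl (S ++ zeros s)) holesT) (orl-++ s S U (length-segments true a) k l))))))
    where
    split : ∀ i j → m ≡ i + j → S ++ zeros m ≡ (S ++ zeros i) ++ zeros j
    split i j e = trans (cong (λ n → S ++ zeros n) e) (trans (cong (S ++_) (zeros-+ i j)) (sym (++-assoc S (zeros i) (zeros j))))
    len : ∀ i → length (S ++ zeros i) ≡ k + i
    len i = trans (length-++ S) (cong₂ _+_ l (length-replicate i))

  R′-sum : R' x y z a ≡ sumB k summand
  R′-sum = begin
    M (westernWeight h) (zigRegion h right hole)  ≡⟨ cong (M (westernWeight h)) C.region-strips ⟩
    M (westernWeight h) (strips 0 h)              ≡⟨ C.M-split N bl h-split ⟩
    sumB wd (λ R → ind (free R (C.B bl) (C.A bl)) (F R))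
      ≡⟨ cong₂ (λ X X′ → sumB wd (λ R → ind (free R X X′) (F R))) (trans B-bl (cong (λ n → zeros k ++ map not U ++ ones n) p-m)) (trans A-bl (cong (λ n → zeros k ++ U ++ ones n) p-m)) ⟩
    sumB wd (λ R → ind (free R (zeros k ++ map not U ++ ones (m ∸ length U)) (zeros k ++ U ++ ones (m ∸ length U))) (F R))
      ≡⟨ cover k U m F k+m (subst (_≤ m) (sym (length-segments true a)) (ℕₚ.m≤m+n s p)) ⟩
    sumB k (λ S → F (S ++ zeros m))               ≡⟨ sumB-cong k at-S ⟩
    sumB k summand ∎
    where
    open ≡-Reasoning
    F : List Bool → ℚ
    F R = wt (par (h + bl)) R ⊗ (C.forward bl R ⊗ C.crossing N bl R)
    p-m : p ≡ m ∸ length U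
    p-m = sym (trans (cong (m ∸_) (length-segments true a)) (ℕₚ.m+n∸m≡n s p))

-- Products over the positions

crosses : Bool → ℕ → List Bool → List Bool → ℕ
crosses s x []          X = 1
crosses s x (false ∷ S) X = crosses s (suc x) S X
crosses s x (true ∷ S)  X = cross s x (length S) X * crosses s (suc x) S X

cross-++ : ∀ s x d S X → cross s x d (S ++ X) ≡ cross s x d S * cross s x (d + length S) X
cross-++ s x d []          X = trans (cong (λ e → cross s x e X) (sym (ℕₚ.+-identityʳ d))) (sym (ℕₚ.*-identityˡ _))
cross-++ s x d (false ∷ S) X = trans (cross-++ s x (suc d) S X) (cong (λ e → cross s x (suc d) S * cross s x e X) (sym (ℕₚ.+-suc d (length S))))
cross-++ s x d (true ∷ S)  X = trans (cong (ℕ._*_ (gap s x d)) (trans (cross-++ s x (suc d) S X) (cong (λ e → cross s x (suc d) S * cross s x e X) (sym (ℕₚ.+-suc d (length S))))))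
  (sym (ℕₚ.*-assoc (gap s x d) _ _))

Vdm-++ : ∀ s x S X → Vdm s x (S ++ X) ≡ Vdm s x S * (crosses s x S X * Vdm s (x + length S) X)
Vdm-++ s x []          X = trans (cong (λ y → Vdm s y X) (sym (ℕₚ.+-identityʳ x))) (sym (trans (ℕₚ.*-identityˡ _) (ℕₚ.*-identityˡ _)))
Vdm-++ s x (false ∷ S) X = trans (Vdm-++ s (suc x) S X) (cong (λ y → Vdm s (suc x) S * (crosses s (suc x) S X * Vdm s y X)) (sym (ℕₚ.+-suc x (length S))))
Vdm-++ s x (true ∷ S)  X = trans (cong₂ (λ p r → weight s x * (p * r)) (cross-++ s x 0 S X)
    (trans (Vdm-++ s (suc x) S X) (cong (λ y → Vdm s (suc x) S * (crosses s (suc x) S X * Vdm s y X)) (sym (ℕₚ.+-suc x (length S))))))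
  (perm (weight s x) (cross s x 0 S) (cross s x (length S) X) (Vdm s (suc x) S) (crosses s (suc x) S X) _)
  where
  perm : ∀ w a b c d e → w * (a * b * (c * (d * e))) ≡ w * (a * c) * (b * d * e)
  perm = ℕ-Ring.solve-∀

cross-complement : ∀ s x d X → cross s x d X * cross s x d (map not X) ≡ cross s x d (ones (length X))
cross-complement s x d []          = refl
cross-complement s x d (true ∷ X)  = trans (ℕₚ.*-assoc (gap s x d) _ _) (cong (ℕ._*_ (gap s x d)) (cross-complement s x (suc d) X))
cross-complement s x d (false ∷ X) = trans (swap (cross s x (suc d) X) (gap s x d) _) (cong (ℕ._*_ (gap s x d)) (cross-complement s x (suc d) X))
  where
  swap : ∀ a g b → a * (g * b) ≡ g * (a * b)
  swap = ℕ-Ring.solve-∀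

crosses-complement : ∀ s x S X → crosses s x S X * crosses s x S (map not X) ≡ crosses s x S (ones (length X))
crosses-complement s x []          X = refl
crosses-complement s x (false ∷ S) X = crosses-complement s (suc x) S X
crosses-complement s x (true ∷ S)  X = trans (perm (cross s x (length S) X) _ _ _) (cong₂ _*_ (cross-complement s x (length S) X) (crosses-complement s (suc x) S X))
  where
  perm : ∀ a b c d → a * b * (c * d) ≡ a * c * (b * d)
  perm = ℕ-Ring.solve-∀

-- The cross terms between S and the two complementary sets X and map not X
-- combine to those between S and all positions of X.
Vdm-complement : ∀ s x S X → let k = x + length S in
  Vdm s x (S ++ map not X) * Vdm s x (S ++ X) * Vdm s k (ones (length X)) ≡
  (Vdm s k (map not X) * Vdm s k X) * (Vdm s x (S ++ ones (length X)) * Vdm s x S)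
Vdm-complement s x S X rewrite Vdm-++ s x S X | Vdm-++ s x S (map not X) | Vdm-++ s x S (ones (length X)) | sym (crosses-complement s x S X) =
  perm (Vdm s x S) (crosses s x S (map not X)) (Vdm s (x + length S) (map not X)) (crosses s x S X) (Vdm s (x + length S) X) (Vdm s (x + length S) (ones (length X)))
  where
  perm : ∀ v c n c′ p o → v * (c * n) * (v * (c′ * p)) * o ≡ n * p * (v * (c′ * c * o) * v)
  perm = ℕ-Ring.solve-∀

cross-zeros : ∀ s x d n → cross s x d (zeros n) ≡ 1
cross-zeros s x d zero    = refl
cross-zeros s x d (suc n) = cross-zeros s x (suc d) n

Vdm-zeros : ∀ s x n → Vdm s x (zeros n) ≡ 1
Vdm-zeros s x zero    = refl
Vdm-zeros s x (suc n) = Vdm-zeros s (suc x) n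

crosses-zeros : ∀ s x S n → crosses s x S (zeros n) ≡ 1
crosses-zeros s x []          n = refl
crosses-zeros s x (false ∷ S) n = crosses-zeros s (suc x) S n
crosses-zeros s x (true ∷ S)  n rewrite cross-zeros s x (length S) n | crosses-zeros s (suc x) S n = refl

Vdm-trailing : ∀ s x S n → Vdm s x (S ++ zeros n) ≡ Vdm s x S
Vdm-trailing s x S n rewrite Vdm-++ s x S (zeros n) | crosses-zeros s x S n | Vdm-zeros s (x + length S) n = ℕₚ.*-identityʳ _

Vdm-leading : ∀ s x k X → Vdm s x (zeros k ++ X) ≡ Vdm s (x + k) X
Vdm-leading s x zero    X = cong (λ y → Vdm s y X) (sym (ℕₚ.+-identityʳ x))
Vdm-leading s x (suc k) X = trans (Vdm-leading s (suc x) k X) (cong (λ y → Vdm s y X) (sym (ℕₚ.+-suc x k)))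

poch-+ : ∀ u m n → poch u (m + n) ≡ poch u m * poch (u + m) n
poch-+ u zero    n = trans (cong (λ v → poch v n) (sym (ℕₚ.+-identityʳ u))) (sym (ℕₚ.*-identityˡ _))
poch-+ u (suc m) n = trans (cong (ℕ._*_ u) (trans (poch-+ (suc u) m n) (cong (λ v → poch (suc u) m * poch v n) (sym (ℕₚ.+-suc u m))))) (sym (ℕₚ.*-assoc u _ _))

poch-1 : ∀ n → poch 1 n ≡ n !
poch-1 zero    = refl
poch-1 (suc n) = trans (cong (poch 1) (ℕₚ.+-comm 1 n)) (trans (poch-+ 1 n 1) (trans (cong₂ _*_ (poch-1 n) (ℕₚ.*-identityʳ (suc n))) (ℕₚ.*-comm (n !) (suc n))))

cross-ones : ∀ s x d n → cross s x d (ones n) ≡ poch (suc d) n * poch (x + x + suc d + bit s) n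
cross-ones s x d zero    = refl
cross-ones s x d (suc n) = trans (cong (ℕ._*_ (gap s x d)) (trans (cross-ones s x (suc d) n)
    (cong (λ v → poch (suc (suc d)) n * poch (v + bit s) n) (ℕₚ.+-suc (x + x) (suc d)))))
  (perm (suc d) (x + x + suc d + bit s) (poch (suc (suc d)) n) (poch (suc (x + x + suc d + bit s)) n))
  where
  perm : ∀ a b c e → a * b * (c * e) ≡ a * c * (b * e)
  perm = ℕ-Ring.solve-∀

-- pairSums n x is the product of p + p′ over x ≤ p < p′ < x + n.
pairSums : ℕ → ℕ → ℕ
pairSums zero    x = 1
pairSums (suc n) x = poch (suc (x + x)) n * pairSums n (suc x)

-- In p′² - p² = (p′ - p)(p′ + p) the differences over an interval multiply to H n.
Vdm-ones-e : ∀ n x → Vdm true x (ones n) ≡ H n * pairSums n x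
Vdm-ones-e zero    x = refl
Vdm-ones-e (suc n) x = trans (ℕₚ.*-identityˡ _) (trans (cong₂ _*_
    (trans (cross-ones true x 0 n) (cong₂ _*_ (poch-1 n) (cong (λ v → poch v n) (trans (ℕₚ.+-identityʳ _) (ℕₚ.+-comm (x + x) 1)))))
    (Vdm-ones-e n (suc x)))
  (perm (n !) (poch (suc (x + x)) n) (H n) (pairSums n (suc x))))
  where
  perm : ∀ f p h w → f * p * (h * w) ≡ h * f * (p * w)
  perm = ℕ-Ring.solve-∀

-- The factors p + p′ + 1 of the pairs and the weights 2p + 1 are together the sums p + p″ with p <
-- p″ = p′ + 1, that is, those of an interval with one more position.
Vdm-ones-o : ∀ n x → Vdm false x (ones n) ≡ H n * pairSums (suc n) x
Vdm-ones-o zero    x = refl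
Vdm-ones-o (suc n) x = trans (cong₂ (λ a b → (x + suc x) * (a * b))
    (trans (cross-ones false x 0 n) (cong₂ _*_ (poch-1 n) (cong (λ v → poch v n) (shift x))))
    (Vdm-ones-o n (suc x)))
  (trans (cong (λ v → v * (n ! * poch (suc (suc (x + x))) n * (H n * pairSums (suc n) (suc x)))) (ℕₚ.+-suc x x))
    (perm (suc (x + x)) (n !) (poch (suc (suc (x + x))) n) (H n) (pairSums (suc n) (suc x))))
  where
  shift : ∀ x → x + x + 1 + 1 ≡ suc (suc (x + x))
  shift = ℕ-Ring.solve-∀
  perm : ∀ a f p h w → a * (f * p * (h * w)) ≡ h * f * (a * p * w)
  perm = ℕ-Ring.solve-∀

pairSums-last : ∀ n y → pairSums (suc n) y ≡ pairSums n y * poch (y + y + n) n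
pairSums-last zero    y = refl
pairSums-last (suc n) y = begin
  poch u (suc n) * pairSums (suc n) (suc y)
    ≡⟨ cong₂ _*_ (trans (cong (poch u) (ℕₚ.+-comm 1 n)) (poch-+ u n 1)) (pairSums-last n (suc y)) ⟩
  poch u n * ((u + n) * 1) * (pairSums n (suc y) * poch (suc y + suc y + n) n)
    ≡⟨ cong (λ v → poch u n * ((u + n) * 1) * (pairSums n (suc y) * poch v n)) (s₁ y n) ⟩
  poch u n * ((u + n) * 1) * (pairSums n (suc y) * poch (suc (u + n)) n)
    ≡⟨ s₂ (poch u n) (u + n) (pairSums n (suc y)) (poch (suc (u + n)) n) ⟩
  poch u n * pairSums n (suc y) * poch (u + n) (suc n)
    ≡⟨ cong (λ v → poch u n * pairSums n (suc y) * poch v (suc n)) (sym (ℕₚ.+-suc (y + y) n)) ⟩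
  poch u n * pairSums n (suc y) * poch (y + y + suc n) (suc n) ∎
  where
  open ≡-Reasoning
  u = suc (y + y)
  s₁ : ∀ y n → suc y + suc y + n ≡ suc (suc (y + y) + n)
  s₁ = ℕ-Ring.solve-∀
  s₂ : ∀ p v w r → p * (v * 1) * (w * r) ≡ p * w * (v * r)
  s₂ = ℕ-Ring.solve-∀

-- The sums with the first position and those of the last one with the inner positions are
-- consecutive numbers and join to a single Pochhammer symbol.
pairSums-strip : ∀ n x → pairSums (2 + n) x ≡ poch (suc (x + x)) (n + suc n) * pairSums n (suc x)
pairSums-strip n x = begin
  poch u (suc n) * pairSums (suc n) (suc x)
    ≡⟨ cong (ℕ._*_ (poch u (suc n))) (pairSums-last n (suc x)) ⟩
  poch u (suc n) * (pairSums n (suc x) * poch (suc x + suc x + n) n)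
    ≡⟨ cong (λ v → poch u (suc n) * (pairSums n (suc x) * poch v n)) (s₁ x n) ⟩
  poch u (suc n) * (pairSums n (suc x) * poch (u + suc n) n)
    ≡⟨ s₂ (poch u (suc n)) (pairSums n (suc x)) (poch (u + suc n) n) ⟩
  poch u (suc n) * poch (u + suc n) n * pairSums n (suc x)
    ≡⟨ cong (_* pairSums n (suc x)) (trans (sym (poch-+ u (suc n) n)) (cong (poch u) (ℕₚ.+-comm (suc n) n))) ⟩
  poch u (n + suc n) * pairSums n (suc x) ∎
  where
  open ≡-Reasoning
  u = suc (x + x)
  s₁ : ∀ x n → suc x + suc x + n ≡ suc (x + x) + suc n
  s₁ = ℕ-Ring.solve-∀
  s₂ : ∀ a b c → a * (b * c) ≡ a * c * b
  s₂ = ℕ-Ring.solve-∀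

-- Each factor of the product removes the two outermost positions.
pairSums-product : ∀ m n x K → K ≡ 2 * (m + m + n) + 1 →
  pairSums (m + m + n) x ≡ prod1 m (λ i → poch (2 * x + 2 * i ∸ 1) (K ∸ 4 * i)) * pairSums n (x + m)
pairSums-product zero    n x K e = trans (cong (pairSums n) (sym (ℕₚ.+-identityʳ x))) (sym (ℕₚ.*-identityˡ _))
pairSums-product (suc m) n x K e = begin
  pairSums (suc m + suc m + n) x
    ≡⟨ cong (λ N → pairSums N x) (s₁ m n) ⟩
  pairSums (m + m + (2 + n)) x
    ≡⟨ pairSums-product m (2 + n) x K (trans e (cong (λ N → 2 * N + 1) (s₁ m n))) ⟩
  P * pairSums (2 + n) (x + m)
    ≡⟨ cong (ℕ._*_ P) (pairSums-strip n (x + m)) ⟩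
  P * (poch (suc (x + m + (x + m))) (n + suc n) * pairSums n (suc (x + m)))
    ≡⟨ sym (ℕₚ.*-assoc P _ _) ⟩
  P * poch (suc (x + m + (x + m))) (n + suc n) * pairSums n (suc (x + m))
    ≡⟨ cong₂ (λ a b → P * a * pairSums n b) (cong₂ poch first second) (sym (ℕₚ.+-suc x m)) ⟩
  P * poch (2 * x + 2 * suc m ∸ 1) (K ∸ 4 * suc m) * pairSums n (x + suc m) ∎
  where
  open ≡-Reasoning
  P = prod1 m (λ i → poch (2 * x + 2 * i ∸ 1) (K ∸ 4 * i))
  s₁ : ∀ m n → suc m + suc m + n ≡ m + m + (2 + n)
  s₁ = ℕ-Ring.solve-∀
  first : suc (x + m + (x + m)) ≡ 2 * x + 2 * suc m ∸ 1
  first = sym (trans (cong (_∸ 1) (lem x m)) refl)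
    where
    lem : ∀ x m → 2 * x + 2 * suc m ≡ suc (suc (x + m + (x + m)))
    lem = ℕ-Ring.solve-∀
  second : n + suc n ≡ K ∸ 4 * suc m
  second = sym (trans (cong (_∸ 4 * suc m) (trans e (lem m n))) (ℕₚ.m+n∸n≡m (n + suc n) (4 * suc m)))
    where
    lem : ∀ m n → 2 * (suc m + suc m + n) + 1 ≡ n + suc n + 4 * suc m
    lem = ℕ-Ring.solve-∀

-- Closed forms for `Q'` and `K'`.

count-++ : ∀ X Y → count (X ++ Y) ≡ count X + count Y
count-++ []          Y = refl
count-++ (true ∷ X)  Y = cong suc (count-++ X Y)
count-++ (false ∷ X) Y = count-++ X Y

count-zeros : ∀ n → count (zeros n) ≡ 0
count-zeros zero    = refl
count-zeros (suc n) = count-zeros n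

count-ones : ∀ n → count (ones n) ≡ n
count-ones zero    = refl
count-ones (suc n) = cong suc (count-ones n)

count-segments : ∀ s as → count (segments s as) ≡ (if s then oddSum as else evenSum as)
count-segments true  []       = refl
count-segments false []       = refl
count-segments true  (a ∷ as) = trans (count-++ (segments false as) (ones a)) (trans (cong₂ _+_ (count-segments false as) (count-ones a)) (ℕₚ.+-comm (evenSum as) a))
count-segments false (a ∷ as) = trans (count-++ (segments true as) (zeros a)) (trans (cong₂ _+_ (count-segments true as) (count-zeros a)) (ℕₚ.+-identityʳ (oddSum as)))

cross-pos : ∀ s x d X → 1 ≤ cross s x d X
cross-pos s x d []          = ℕₚ.≤-refl
cross-pos s x d (false ∷ X) = cross-pos s x (suc d) X
cross-pos s x d (true ∷ X)  = ℕₚ.*-mono-≤ {1} (ℕₚ.*-mono-≤ {1} {suc d} (s≤s z≤n) (ℕₚ.≤-trans (s≤s z≤n) (ℕₚ.≤-trans (ℕₚ.m≤n+m (suc d) (x + x)) (ℕₚ.m≤m+n _ (bit s))))) (cross-pos s x (suc d) X)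

Vdm-pos : ∀ s x X → 1 ≤ Vdm s x X
Vdm-pos s x []          = ℕₚ.≤-refl
Vdm-pos s x (false ∷ X) = Vdm-pos s (suc x) X
Vdm-pos s x (true ∷ X)  = ℕₚ.*-mono-≤ {1} (w s) (ℕₚ.*-mono-≤ {1} (cross-pos s x 0 X) (Vdm-pos s (suc x) X))
  where
  w : ∀ s → 1 ≤ weight s x
  w true  = ℕₚ.≤-refl
  w false = ℕₚ.≤-trans (s≤s z≤n) (ℕₚ.m≤n+m (suc x) x)

evenSum-rk : ∀ E → rk (E + E) ≡ E
evenSum-rk zero    = refl
evenSum-rk (suc E) rewrite ℕₚ.+-suc E E | par-double E = cong suc (evenSum-rk E)

count-bits : ∀ t → count (bits t) ≡ evenSum t
count-bits []             = refl
count-bits (t ∷ [])       = count-zeros t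
count-bits (t₁ ∷ t₂ ∷ ts) = trans (count-++ (zeros t₁) _) (cong₂ _+_ (count-zeros t₁) (trans (count-++ (ones t₂) (bits ts)) (cong₂ _+_ (count-ones t₂) (count-bits ts))))

length-bits : ∀ t → length (bits t) ≡ oddSum t + evenSum t
length-bits []             = refl
length-bits (t ∷ [])       = trans (length-replicate t) (sym (trans (ℕₚ.+-identityʳ _) (ℕₚ.+-identityʳ t)))
length-bits (t₁ ∷ t₂ ∷ ts) = trans (length-++ (zeros t₁)) (trans (cong₂ _+_ (length-replicate t₁) (trans (length-++ (ones t₂)) (cong₂ _+_ (length-replicate t₂) (length-bits ts)))) (perm t₁ t₂ (oddSum ts) (evenSum ts)))
  where
  perm : ∀ a b c d → a + (b + (c + d)) ≡ a + c + (b + d)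
  perm = ℕ-Ring.solve-∀

Vdm-empty : ∀ s x P → count P ≡ 0 → Vdm s x P ≡ 1
Vdm-empty s x []          e = refl
Vdm-empty s x (false ∷ P) e = Vdm-empty s (suc x) P e

QK-formula : ∀ t h → rk h ≡ evenSum t → M' h (QKregion h t) ≡ inv (den h) ⊗ ι (Vdm (par h) 0 (bits t))
QK-formula t h e = trans (QK-Tr t h e) (trans (Tr-formula (oddSum t) h (bits t) (trans (length-bits t) (cong (ℕ._+_ (oddSum t)) (sym e))))
  (cong (λ z → inv (den h) ⊗ ind z (ι (Vdm (par h) 0 (bits t)))) (trans (cong₂ ℕ._≡ᵇ_ (count-bits t) e) (≡ᵇ-refl (evenSum t)))))

Q-formula : ∀ t → Q' t ≡ inv (2 ^ evenSum t * H₂ (2 * evenSum t + 1)) ⊗ ι (Vdm false 0 (bits t))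
Q-formula t = trans (QK-formula t (2 * E) (trans (cong rk dbl) (evenSum-rk E)))
  (cong₂ (λ b n → inv n ⊗ ι (Vdm b 0 (bits t))) even (trans (cong₂ (λ b n → (if b then 1 else 2 ^ n) * H₂ (suc (2 * E))) even (trans (cong rk dbl) (evenSum-rk E))) (cong (λ n → 2 ^ E * H₂ n) (ℕₚ.+-comm 1 (2 * E)))))
  where
  E = evenSum t
  dbl : 2 * E ≡ E + E
  dbl = cong (ℕ._+_ E) (ℕₚ.+-identityʳ E)
  even : par (2 * E) ≡ false
  even = trans (cong par dbl) (par-double E)

K-formula : ∀ t → K' t ≡ inv (H₂ (2 * evenSum t)) ⊗ ι (Vdm true 0 (bits t))
K-formula t = lem (evenSum t) refl
  where
  lem : ∀ E → evenSum t ≡ E → M' (2 * E ∸ 1) (QKregion (2 * E ∸ 1) t) ≡ inv (H₂ (2 * E)) ⊗ ι (Vdm true 0 (bits t))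
  -- For E = 0 the truncated height is 0, of the wrong parity; but nothing is removed, and both
  -- Vandermonde products are 1.
  lem zero    e = trans (QK-formula t 0 (sym e)) (cong (λ n → inv 1 ⊗ ι n) (trans (Vdm-empty false 0 (bits t) (trans (count-bits t) e)) (sym (Vdm-empty true 0 (bits t) (trans (count-bits t) e)))))
  lem (suc E) e = trans (QK-formula t h (trans rk-h (sym e))) (cong₂ (λ b n → inv n ⊗ ι (Vdm b 0 (bits t))) odd
      (trans (cong (λ b → (if b then 1 else 2 ^ rk h) * H₂ (suc h)) odd) (ℕₚ.*-identityˡ _)))
    where
    h = 2 * suc E ∸ 1
    h-eq : h ≡ suc (E + E)
    h-eq = trans (cong (ℕ._+_ E) (ℕₚ.+-identityʳ (suc E))) (ℕₚ.+-suc E E)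
    odd : par h ≡ true
    odd = trans (cong par h-eq) (cong not (par-double E))
    rk-h : rk h ≡ suc E
    rk-h = trans (cong rk h-eq) (lem′ E)
      where
      lem′ : ∀ E → rk (suc (E + E)) ≡ suc E
      lem′ E rewrite par-double E = cong suc (evenSum-rk E)

-- The arguments of `Q'` and `K'` in the theorem as markings of ℓ.

alternate : Bool → List ℕ → List Bool
alternate s []       = []
alternate s (t ∷ ts) = replicate t s ++ alternate (not s) ts

bits-alternate : ∀ t → bits t ≡ alternate false t
bits-alternate []             = refl
bits-alternate (t ∷ [])       = sym (++-identityʳ (zeros t))
bits-alternate (t₁ ∷ t₂ ∷ ts) = cong (λ X → zeros t₁ ++ ones t₂ ++ X) (bits-alternate ts)

flip : Bool → Bool → Bool
flip true  s = s
flip false s = not s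

alternate-snoc : ∀ s xs x → alternate s (xs ++ [ x ]) ≡ alternate s xs ++ replicate x (flip (not (par (length xs))) s)
alternate-snoc s []       x = ++-identityʳ (replicate x s)
alternate-snoc s (y ∷ ys) x = trans (cong (replicate y s ++_) (trans (alternate-snoc (not s) ys x) (cong (λ b → alternate (not s) ys ++ replicate x b) (lem (par (length ys)) s))))
  (sym (++-assoc (replicate y s) (alternate (not s) ys) _))
  where
  lem : ∀ p s → flip (not p) (not s) ≡ flip (not (not p)) s
  lem true  s = not-involutive s
  lem false s = refl

-- From left to right the marked segments have the lengths a_n, ..., a_1, so the kind of the first
-- one depends on the parity of n.
segments-alternate : ∀ s as → segments s as ≡ alternate (flip (par (length as)) s) (reverse as)
segments-alternate s []       = refl
segments-alternate s (a ∷ as) = begin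
  segments (not s) as ++ replicate a s
    ≡⟨ cong (_++ replicate a s) (segments-alternate (not s) as) ⟩
  alternate (flip p (not s)) (reverse as) ++ replicate a s
    ≡⟨ cong (λ b → alternate (flip p (not s)) (reverse as) ++ replicate a b) (sym (lem p s)) ⟩
  alternate (flip p (not s)) (reverse as) ++ replicate a (flip (not p) (flip p (not s)))
    ≡⟨ cong (λ n → alternate (flip p (not s)) (reverse as) ++ replicate a (flip (not (par n)) (flip p (not s)))) (sym (length-reverse as)) ⟩
  alternate (flip p (not s)) (reverse as) ++ replicate a (flip (not (par (length (reverse as)))) (flip p (not s)))
    ≡⟨ sym (alternate-snoc (flip p (not s)) (reverse as) a) ⟩
  alternate (flip p (not s)) (reverse as ++ [ a ])
    ≡⟨ cong₂ alternate (lem′ p s) (sym (unfold-reverse a as)) ⟩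
  alternate (flip (not p) s) (reverse (a ∷ as)) ∎
  where
  open ≡-Reasoning
  p = par (length as)
  lem : ∀ p s → flip (not p) (flip p (not s)) ≡ s
  lem true  s = not-involutive s
  lem false s = not-involutive s
  lem′ : ∀ p s → flip p (not s) ≡ flip (not p) s
  lem′ true  s = refl
  lem′ false s = not-involutive s

upTo-nth : ∀ a → map (nth a) (upTo (length a)) ≡ a
upTo-nth a = trans (map-upTo (nth a) (length a)) (lem a)
  where
  lem : ∀ a → applyUpTo (nth a) (length a) ≡ a
  lem []       = refl
  lem (x ∷ xs) = cong (x ∷_) (lem xs)

nth-end : ∀ a → nth a (length a) ≡ 0
nth-end []       = refl
nth-end (x ∷ xs) = nth-end xs

map-desc : ∀ a m → map (aAt a) (desc (suc m)) ≡ reverse (map (nth a) (upTo m))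
map-desc a m = trans (reverse-map (aAt a) (map suc (upTo m))) (cong reverse (sym (map-∘ (upTo m))))

reversed : ∀ a m → aAt a (suc m) ∷ map (aAt a) (desc (suc m)) ≡ reverse (map (nth a) (upTo (suc m)))
reversed a m = trans (cong (nth a m ∷_) (map-desc a m)) (sym (trans (cong reverse (trans (cong (map (nth a)) (sym (upTo-∷ʳ m))) (map-++ (nth a) (upTo m) [ m ]))) (reverse-++ (map (nth a) (upTo m)) [ nth a m ])))

alternate-head : ∀ s k t ts → alternate s ((k + t) ∷ ts) ≡ replicate k s ++ alternate s (t ∷ ts)
alternate-head s k t ts = trans (cong (_++ alternate (not s) ts) (lem k)) (++-assoc (replicate k s) (replicate t s) _)
  where
  lem : ∀ k → replicate (k + t) s ≡ replicate k s ++ replicate t s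
  lem zero    = refl
  lem (suc k) = cong (s ∷_) (lem k)

half-double : ∀ n → 2 * (n / 2) ≡ fl n + fl n
half-double n = trans (ℕₚ.*-comm 2 (n / 2)) (trans (sym (ℕₚ.m+n∸m≡n (n % 2) (n / 2 * 2))) (trans (cong (_∸ n % 2) (sym (DM.m≡m%n+[m/n]*n n 2))) (even-part n)))

half-fl : ∀ n → n / 2 ≡ fl n
half-fl n = ℕₚ.*-cancelˡ-≡ (n / 2) (fl n) 2 (trans (half-double n) (cong (ℕ._+_ (fl n)) (sym (ℕₚ.+-identityʳ (fl n)))))

reversed-all : ∀ a m → length a ≡ suc m → aAt a (suc m) ∷ map (aAt a) (desc (suc m)) ≡ reverse a
reversed-all a m e = trans (reversed a m) (cong reverse (trans (cong (map (nth a) ∘ upTo) (sym e)) (upTo-nth a)))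

-- Both arguments list a (padded by 0 on the left if necessary) in reverse.
bits-first : ∀ k a → bits (firstArg k a) ≡ zeros k ++ segments true a
bits-first k a = trans (bits-alternate (firstArg k a)) (lem (par (length a)) refl)
  where
  n = length a
  arg : ∀ m → 2 * ((n + 1) / 2) ≡ m → firstArg k a ≡ (k + aAt a m) ∷ map (aAt a) (desc m)
  arg m e = cong (λ m → (k + aAt a m) ∷ map (aAt a) (desc m)) e
  shift : ∀ {t ts us} → t ∷ ts ≡ us → alternate false ((k + t) ∷ ts) ≡ zeros k ++ alternate false us
  shift {t} {ts} refl = alternate-head false k t ts
  twice : 2 * ((n + 1) / 2) ≡ fl (suc n) + fl (suc n)
  twice = trans (half-double (n + 1)) (cong (λ m → fl m + fl m) (ℕₚ.+-comm n 1))
  lem : ∀ p → par n ≡ p → alternate false (firstArg k a) ≡ zeros k ++ segments true a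
  lem true  p = trans (cong (alternate false) (arg (suc n) (trans twice (sym (fl-even (suc n) (cong not p))))))
    (trans (shift (padded-reverse n refl)) (cong (zeros k ++_) (sym (trans (segments-alternate true a) (cong (λ b → alternate (flip b true) (reverse a)) p)))))
    where
    padded-reverse : ∀ m → n ≡ m → aAt a (suc m) ∷ map (aAt a) (desc (suc m)) ≡ 0 ∷ reverse a
    padded-reverse m refl = cong₂ _∷_ (nth-end a) (trans (map-desc a n) (cong reverse (upTo-nth a)))
  lem false p = trans (cong (alternate false) (arg n (trans twice (trans (cong (λ b → (if b then suc (fl n) else fl n) + (if b then suc (fl n) else fl n)) p) (sym (fl-even n p))))))
    (nonempty n refl)
    where
    nonempty : ∀ m → n ≡ m → alternate false ((k + aAt a m) ∷ map (aAt a) (desc m)) ≡ zeros k ++ segments true a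
    nonempty zero    e = empty a e
      where
      empty : ∀ a → length a ≡ 0 → alternate false ((k + aAt a 0) ∷ map (aAt a) (desc 0)) ≡ zeros k ++ segments true a
      empty [] e = trans (++-identityʳ _) (trans (cong zeros (ℕₚ.+-identityʳ k)) (sym (++-identityʳ _)))
    nonempty (suc m) e = trans (shift (reversed-all a m e)) (cong (zeros k ++_) (sym (trans (segments-alternate true a) (cong (λ b → alternate (flip b true) (reverse a)) p))))

bits-second : ∀ k a z → bits (secondArg k a z) ≡ zeros k ++ segments false a ++ ones z
bits-second k a z = trans (bits-alternate (secondArg k a z)) (lem (par (length a)) refl)
  where
  n = length a
  arg : ∀ m → 2 * (n / 2) + 1 ≡ m → secondArg k a z ≡ (k + aAt a m) ∷ (map (aAt a) (desc m) ++ [ z ])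
  arg m e = cong (λ m → (k + aAt a m) ∷ (map (aAt a) (desc m) ++ [ z ])) e
  shift : ∀ {t ts us} → t ∷ ts ≡ us → alternate false ((k + t) ∷ (ts ++ [ z ])) ≡ zeros k ++ alternate false (us ++ [ z ])
  shift {t} {ts} refl = alternate-head false k t (ts ++ [ z ])
  twice : 2 * (n / 2) + 1 ≡ suc (fl n + fl n)
  twice = trans (ℕₚ.+-comm (2 * (n / 2)) 1) (cong suc (half-double n))
  ending : ∀ s b → par n ≡ b → flip (not b) s ≡ true → s ≡ flip b false → alternate s (reverse a ++ [ z ]) ≡ segments false a ++ ones z
  ending s b p e e′ = trans (alternate-snoc s (reverse a) z) (cong₂ _++_ (trans (cong (λ c → alternate c (reverse a)) (trans e′ (cong (λ c → flip c false) (sym p)))) (sym (segments-alternate false a)))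
    (cong (replicate z) (trans (cong (λ c → flip (not c) s) (trans (cong par (length-reverse a)) p)) e)))
  lem : ∀ b → par n ≡ b → alternate false (secondArg k a z) ≡ zeros k ++ segments false a ++ ones z
  lem false p = trans (cong (alternate false) (arg (suc n) (trans twice (cong suc (sym (fl-even n p))))))
    (trans (shift (cong₂ _∷_ (nth-end a) (trans (map-desc a n) (cong reverse (upTo-nth a))))) (cong (zeros k ++_) (ending true false p refl refl)))
  lem true p = trans (cong (alternate false) (arg n (trans twice (sym (fl-odd n p))))) (nonempty n refl)
    where
    nonempty : ∀ m → n ≡ m → alternate false ((k + aAt a m) ∷ (map (aAt a) (desc m) ++ [ z ])) ≡ zeros k ++ segments false a ++ ones z
    nonempty zero    e with trans (sym p) (cong par e)
    ... | ()
    nonempty (suc m) e = trans (shift (reversed-all a m e)) (cong (zeros k ++_) (ending false true p refl refl))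

-- The sum over the crossings of ℓ.

-- The sum of V(S) V(S ∪ A), with weights, over the sets S of μ positions among the first k, where A
-- consists of the t positions after these.
pairing : Bool → ℕ → ℕ → ℕ → ℚ
pairing σ k t μ = sumB k (λ S → wt σ S ⊗ ind (count S ℕ.≡ᵇ μ) (ι (Vdm σ 0 (S ++ ones t) * Vdm σ 0 S)))

≡ᵇ-+ʳ : ∀ m n p → (m + p ℕ.≡ᵇ n + p) ≡ (m ℕ.≡ᵇ n)
≡ᵇ-+ʳ m n p = T-ext (λ t → ℕₚ.≡⇒≡ᵇ m n (ℕₚ.+-cancelʳ-≡ p m n (ℕₚ.≡ᵇ⇒≡ (m + p) (n + p) t))) (λ t → ℕₚ.≡⇒≡ᵇ (m + p) (n + p) (cong (_+ p) (ℕₚ.≡ᵇ⇒≡ m n t)))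

module RSum (x y z : ℕ) (a : List ℕ) (β N q : ℕ)
  (β-eq : suc β ≡ y + z + 2 * evenSum a) (N-eq : suc N ≡ y + 2 * oddSum a) (q-eq : suc q ≡ y + z + (oddSum a + evenSum a))
  (fit : ∀ w → All (λ r → proj₂ r ≤ N) (lineRuns w true a)) where

  open RGeometry x y z a β N q β-eq N-eq q-eq fit

  σ : Bool
  σ = not (par y)

  par-N : par N ≡ σ
  par-N = trans (sym (not-involutive (par N))) (cong not (trans (cong par (trans N-eq (cong (λ n → y + (O + n)) (ℕₚ.+-identityʳ O)))) (par-+ y (O + O) (par-double O))))

  par-bl′ : par bl ≡ σ
  par-bl′ = trans (sym (not-involutive (par bl))) (cong not (trans (cong par bl-suc) (par-+ y _ (par-double (z + E)))))

  Tr-σ : ∀ L n P → length P ≡ L + rk n → par n ≡ σ → ∀ {b} → (count P ℕ.≡ᵇ rk n) ≡ b → Tr L n P ≡ inv (den n) ⊗ ind b (ι (Vdm σ 0 P))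
  Tr-σ L n P e p refl = trans (Tr-formula L n P e) (cong (λ c → inv (den n) ⊗ ind (count P ℕ.≡ᵇ rk n) (ι (Vdm c 0 P))) p)

  -- U with z unmarked positions beyond P, so that its complement is the set removed below ℓ.
  X : List Bool
  X = U ++ zeros z

  not-X : map not X ≡ D ++ ones z
  not-X = trans (map-++ not U (zeros z)) (cong₂ _++_ (sym (segments-not true a)) (map-replicate not z false))

  length-X : length X ≡ s + z
  length-X = trans (length-++ U) (cong₂ _+_ (length-segments true a) (length-replicate z))

  complement : ∀ S → length S ≡ k →
    Vdm σ 0 (S ++ D ++ ones z) * Vdm σ 0 (S ++ U) * Vdm σ k (ones (s + z)) ≡
    (Vdm σ k (D ++ ones z) * Vdm σ k U) * (Vdm σ 0 (S ++ ones (s + z)) * Vdm σ 0 S)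
  complement S l = begin
    Vdm σ 0 (S ++ D ++ ones z) * Vdm σ 0 (S ++ U) * Vdm σ k (ones (s + z))
      ≡⟨ cong₂ (λ P Q → Vdm σ 0 (S ++ P) * Q * Vdm σ k (ones (s + z))) (sym not-X) (trans (sym (Vdm-trailing σ 0 (S ++ U) z)) (cong (Vdm σ 0) (++-assoc S U (zeros z)))) ⟩
    Vdm σ 0 (S ++ map not X) * Vdm σ 0 (S ++ X) * Vdm σ k (ones (s + z))
      ≡⟨ cong₂ (λ n m → Vdm σ 0 (S ++ map not X) * Vdm σ 0 (S ++ X) * Vdm σ n (ones m)) (sym l) (sym length-X) ⟩
    Vdm σ 0 (S ++ map not X) * Vdm σ 0 (S ++ X) * Vdm σ (length S) (ones (length X))
      ≡⟨ Vdm-complement σ 0 S X ⟩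
    (Vdm σ (length S) (map not X) * Vdm σ (length S) X) * (Vdm σ 0 (S ++ ones (length X)) * Vdm σ 0 S)
      ≡⟨ cong₂ (λ n m → (Vdm σ n (map not X) * Vdm σ n X) * (Vdm σ 0 (S ++ ones m) * Vdm σ 0 S)) l length-X ⟩
    (Vdm σ k (map not X) * Vdm σ k X) * (Vdm σ 0 (S ++ ones (s + z)) * Vdm σ 0 S)
      ≡⟨ cong₂ (λ P Q → (Vdm σ k P * Q) * (Vdm σ 0 (S ++ ones (s + z)) * Vdm σ 0 S)) not-X (Vdm-trailing σ k U z) ⟩
    (Vdm σ k (D ++ ones z) * Vdm σ k U) * (Vdm σ 0 (S ++ ones (s + z)) * Vdm σ 0 S) ∎
    where open ≡-Reasoning

  -- The factor V(A) stands on the left so that `complement` acts on each term within ℕ. The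
  -- conditions on the sizes in the two parts agree: each says that S has ⌊y/2⌋ elements.
  R′-pairing : ι (Vdm σ k (ones (s + z))) ⊗ R' x y z a ≡
    (inv (den bl) ⊗ inv (den N)) ⊗ (ι (Vdm σ k (D ++ ones z) * Vdm σ k U) ⊗ pairing σ k (s + z) (fl y))
  R′-pairing = begin
    ι Vt ⊗ R' x y z a                          ≡⟨ cong (ι Vt ⊗_) R′-sum ⟩
    ι Vt ⊗ sumB k summand                      ≡⟨ sym (sumB-⊗ k (ι Vt) summand) ⟩
    sumB k (λ S → ι Vt ⊗ summand S)            ≡⟨ sumB-cong k term ⟩
    sumB k (λ S → (inv (den bl) ⊗ inv (den N)) ⊗ (ι VV ⊗ g S)) ≡⟨ sumB-⊗ k _ _ ⟩
    (inv (den bl) ⊗ inv (den N)) ⊗ sumB k (λ S → ι VV ⊗ g S) ≡⟨ cong ((inv (den bl) ⊗ inv (den N)) ⊗_) (sumB-⊗ k (ι VV) g) ⟩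
    (inv (den bl) ⊗ inv (den N)) ⊗ (ι VV ⊗ sumB k g) ∎
    where
    open ≡-Reasoning
    Vt = Vdm σ k (ones (s + z))
    VV = Vdm σ k (D ++ ones z) * Vdm σ k U
    g : List Bool → ℚ
    g S = wt σ S ⊗ ind (count S ℕ.≡ᵇ fl y) (ι (Vdm σ 0 (S ++ ones (s + z)) * Vdm σ 0 S))
    countB : ∀ S → (count (S ++ D ++ ones z) ℕ.≡ᵇ rk bl) ≡ (count S ℕ.≡ᵇ fl y)
    countB S = trans (cong₂ ℕ._≡ᵇ_ (trans (count-++ S (D ++ ones z)) (cong (ℕ._+_ (count S)) (trans (count-++ D (ones z)) (trans (cong₂ _+_ (count-segments false a) (count-ones z)) (ℕₚ.+-comm E z))))) rk-bl)
      (≡ᵇ-+ʳ (count S) (fl y) (z + E))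
    countT : ∀ S → (count (S ++ U) ℕ.≡ᵇ rk N) ≡ (count S ℕ.≡ᵇ fl y)
    countT S = trans (cong₂ ℕ._≡ᵇ_ (trans (count-++ S U) (cong (ℕ._+_ (count S)) (count-segments true a))) rk-N) (≡ᵇ-+ʳ (count S) (fl y) O)
    zeroes : ∀ v w i j c d → v ⊗ (w ⊗ ((i ⊗ 0ℚ) ⊗ (j ⊗ 0ℚ))) ≡ c ⊗ (d ⊗ (w ⊗ 0ℚ))
    zeroes v w i j c d = trans (cong (v ⊗_) (trans (cong (w ⊗_) (trans (cong (_⊗ (j ⊗ 0ℚ)) (⊗-zeroʳ i)) (⊗-zeroˡ _))) (⊗-zeroʳ w))) (trans (⊗-zeroʳ v)
      (sym (trans (cong (c ⊗_) (trans (cong (d ⊗_) (⊗-zeroʳ w)) (⊗-zeroʳ d))) (⊗-zeroʳ c))))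
    opaque
      unfolding _⊕_ isZero
      gather : ∀ v w i p j r → v ⊗ (w ⊗ ((i ⊗ p) ⊗ (j ⊗ r))) ≡ (i ⊗ j) ⊗ (w ⊗ (p ⊗ r ⊗ v))
      gather = solve-∀ ℚ-ring
    term : ∀ S → length S ≡ k → ι Vt ⊗ summand S ≡ (inv (den bl) ⊗ inv (den N)) ⊗ (ι VV ⊗ g S)
    term S l = trans (cong₂ (λ P Q → ι Vt ⊗ (wt σ S ⊗ (P ⊗ Q)))
        (Tr-σ (x + O) bl (S ++ D ++ ones z) (trans (length-++ S) (trans (cong₂ _+_ l (trans (length-++ D) (cong₂ _+_ (length-segments false a) (length-replicate z)))) (trans (sym (ℕₚ.+-assoc k s z)) (sym rowB)))) par-bl′ (countB S))
        (Tr-σ (x + E) N (S ++ U) (trans (length-++ S) (trans (cong₂ _+_ l (length-segments true a)) (sym rowT))) par-N (countT S)))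
      (lem (count S ℕ.≡ᵇ fl y))
      where
      V₁ = Vdm σ 0 (S ++ D ++ ones z)
      V₂ = Vdm σ 0 (S ++ U)
      V₃ = Vdm σ 0 (S ++ ones (s + z)) * Vdm σ 0 S
      lem : ∀ c → ι Vt ⊗ (wt σ S ⊗ ((inv (den bl) ⊗ ind c (ι V₁)) ⊗ (inv (den N) ⊗ ind c (ι V₂)))) ≡ (inv (den bl) ⊗ inv (den N)) ⊗ (ι VV ⊗ (wt σ S ⊗ ind c (ι V₃)))
      lem false = zeroes _ _ _ _ _ _
      lem true  = trans (gather _ _ _ _ _ _) (cong ((inv (den bl) ⊗ inv (den N)) ⊗_)
        (trans (cong (wt σ S ⊗_) (trans (cong (_⊗ ι Vt) (sym (ι-* V₁ V₂))) (trans (sym (ι-* (V₁ * V₂) Vt)) (trans (cong ι (complement S l)) (ι-* VV V₃)))))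
          (⊗-swap _ _ _)))

Vdm-nonZero : ∀ σ x X → NonZero (Vdm σ x X)
Vdm-nonZero σ x X = ℕ.>-nonZero (Vdm-pos σ x X)

cancel-ι : ∀ n → .{{NonZero n}} → ∀ {a b} → ι n ⊗ a ≡ ι n ⊗ b → a ≡ b
cancel-ι n {a} {b} e = trans (divide n a e) (sym (divide n b refl))

fit-[] : ∀ N w → All (λ r → proj₂ r ≤ N) (lineRuns w true [])
fit-[] N w = []

-- Without holes, y and z separately only fix the position of ℓ.
no-holes : ∀ x y z y′ z′ → y + z ≡ y′ + z′ → R' x y z [] ≡ R' x y′ z′ []
no-holes x y z y′ z′ e = cong G e
  where
  G : ℕ → ℚ
  G n = M' h (zigRegion h right (λ _ → false))
    where
    h = 2 * (n + 0 ∸ 1)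
    bV : ℤ
    bV = + (n + 0) ℤ.- + 1
    Y : ℤ → ℤ
    Y b = if bV ℤ.≤ᵇ b then + h ℤ.+ + (2 * x + 0) ℤ.+ + h ℤ.- b else + h ℤ.+ + (2 * x + 0) ℤ.+ b
    right : ℤ → ℤ
    right b = Y b ℤ.⊓ Y (b ℤ.+ + 1)

Tr-ones : ∀ x q → Tr x (q + q) (zeros x ++ ones q) ≡ inv (2 ^ q * H₂ (suc (q + q))) ⊗ ι (H q * pairSums (suc q) x)
Tr-ones x q = trans (Tr-formula x (q + q) (zeros x ++ ones q) (trans (length-++ (zeros x)) (cong₂ _+_ (length-replicate x) (trans (length-replicate q) (sym (evenSum-rk q))))))
  (cong₂ _⊗_ (cong inv (cong₂ (λ b n → (if b then 1 else 2 ^ n) * H₂ (suc (q + q))) (par-double q) (evenSum-rk q)))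
    (trans (cong₂ ind (trans (cong₂ ℕ._≡ᵇ_ (trans (count-++ (zeros x) (ones q)) (cong₂ _+_ (count-zeros x) (count-ones q))) (evenSum-rk q)) (≡ᵇ-refl q))
      (cong ι (trans (cong (λ b → Vdm b 0 (zeros x ++ ones q)) (par-double q)) (trans (Vdm-leading false 0 x (ones q)) (Vdm-ones-o q x))))) refl))

-- If ℓ is the southern side, no vertical lozenge crosses it.
R′-bottom : ∀ x a q N (q-eq : q ≡ oddSum a) (N-eq : suc N ≡ 1 + 2 * oddSum a) → evenSum a ≡ 0 → (∀ w → All (λ r → proj₂ r ≤ N) (lineRuns w true a)) →
  R' x 1 0 a ≡ Tr x (q + q) (zeros x ++ segments true a)
R′-bottom x a q N refl N-eq e fit = begin
  R' x 1 0 a ≡⟨ R′-sum ⟩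
  sumB k summand ≡⟨ sumB-single k summand vanish ⟩
  1ℚ ⊗ (Tr (x + O) bl (zeros k ++ D ++ []) ⊗ Tr (x + E) N (zeros k ++ U))
    ≡⟨ trans (⊗-identityˡ _) (trans (cong (_⊗ Tr (x + E) N (zeros k ++ U)) (cong (λ b → ind b 1ℚ) clear)) (⊗-identityˡ _)) ⟩
  Tr (x + E) N (zeros k ++ U)
    ≡⟨ cong₂ (λ l n → Tr l n (zeros k ++ U)) (trans (cong (ℕ._+_ x) e) (ℕₚ.+-identityʳ x)) (trans (ℕₚ.suc-injective N-eq) (cong (ℕ._+_ O) (ℕₚ.+-identityʳ O))) ⟩
  Tr x (O + O) (zeros k ++ U) ≡⟨ cong (λ l → Tr x (O + O) (zeros l ++ U)) (ℕₚ.+-identityʳ x) ⟩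
  Tr x (O + O) (zeros x ++ U) ∎
  where
  open ≡-Reasoning
  open RGeometry x 1 0 a 0 N (oddSum a) (cong (λ n → 1 + (n + (n + 0))) (sym e)) N-eq (cong suc (sym (trans (cong (ℕ._+_ (oddSum a)) e) (ℕₚ.+-identityʳ _)))) fit
  none-++ : ∀ A B → none (A ++ B) ≡ none A ∧ none B
  none-++ []          B = refl
  none-++ (true ∷ A)  B = refl
  none-++ (false ∷ A) B = none-++ A B
  vanish : ∀ S → none S ≡ false → summand S ≡ 0ℚ
  vanish S h = trans (cong (wt false S ⊗_) (trans (cong (λ b → ind b 1ℚ ⊗ Tr (x + E) N (S ++ U)) (trans (none-++ S (D ++ [])) (cong (_∧ none (D ++ [])) h))) (⊗-zeroˡ _))) (⊗-zeroʳ _)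
  empty : ∀ P → count P ≡ 0 → none P ≡ true
  empty []          e = refl
  empty (false ∷ P) e = empty P e
  clear : none (zeros k ++ D ++ []) ≡ true
  clear = empty (zeros k ++ D ++ []) (trans (count-++ (zeros k) (D ++ [])) (cong₂ _+_ (count-zeros k) (trans (count-++ D []) (trans (ℕₚ.+-identityʳ _) (trans (count-segments false a) e)))))

-- With y = 1 and no holes there is no row above ℓ. The lower part is the whole region, and the
-- segments removed from its side along ℓ are those of the forced triangle of side q.
R′-top : ∀ x q → R' x 1 q [] ≡ Tr x (q + q) (zeros x ++ ones q)
R′-top x q = begin
  R' x 1 q [] ≡⟨ R′-sum ⟩
  sumB k summand ≡⟨ sumB-single k summand vanish ⟩
  1ℚ ⊗ (Tr (x + 0) (q + q) (zeros k ++ ones q) ⊗ Tr (x + 0) 0 (zeros k ++ []))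
    ≡⟨ trans (⊗-identityˡ _) (trans (cong (Tr (x + 0) (q + q) (zeros k ++ ones q) ⊗_) (cong (λ b → ind b 1ℚ) (trans (cong none (++-identityʳ (zeros k))) (none-zeros k)))) (⊗-identityʳ _)) ⟩
  Tr (x + 0) (q + q) (zeros (x + 0) ++ ones q) ≡⟨ cong (λ l → Tr l (q + q) (zeros l ++ ones q)) (ℕₚ.+-identityʳ x) ⟩
  Tr x (q + q) (zeros x ++ ones q) ∎
  where
  open ≡-Reasoning
  open RGeometry x 1 q [] q 0 q (cong suc (sym (ℕₚ.+-identityʳ q))) refl (cong suc (sym (ℕₚ.+-identityʳ q))) (fit-[] 0)
  vanish : ∀ S → none S ≡ false → summand S ≡ 0ℚ
  vanish S h = trans (cong (wt false S ⊗_) (trans (cong (λ P → Tr (x + 0) bl (S ++ ones q) ⊗ ind (none P) 1ℚ) (++-identityʳ S))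
    (trans (cong (λ b → Tr (x + 0) bl (S ++ ones q) ⊗ ind b 1ℚ) h) (⊗-zeroʳ _)))) (⊗-zeroʳ _)

-- Obtained by comparing two positions of ℓ in the region without holes.
pairing-formula : ∀ x y t q → suc q ≡ suc y + t → let σ = not (par (suc y)) in
  pairing σ (x + fl (suc y)) t (fl (suc y)) ≡
  ι (den (y + t + t) * den y) ⊗ (inv (2 ^ q * H₂ (suc (q + q))) ⊗ ι (H q * pairSums (suc q) x))
pairing-formula x y t q e = begin
  Pr ≡⟨ sym (⊗-identityˡ Pr) ⟩
  1ℚ ⊗ Pr ≡⟨ cong (_⊗ Pr) (sym (trans (cong (ι (dB * dN) ⊗_) (sym (inv-* dB dN))) (ι-inv (dB * dN) {{ℕₚ.m*n≢0 dB dN {{den-nonZero (y + t + t)}} {{den-nonZero y}}}}))) ⟩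
  ι (dB * dN) ⊗ (inv dB ⊗ inv dN) ⊗ Pr ≡⟨ ⊗-assoc _ _ _ ⟩
  ι (dB * dN) ⊗ ((inv dB ⊗ inv dN) ⊗ Pr) ≡⟨ cong (ι (dB * dN) ⊗_) (sym R-value) ⟩
  -- Only the sum of y and z matters without holes, so ℓ may be moved to the northern side, where S
  -- is empty.
  ι (dB * dN) ⊗ R' x (suc y) t [] ≡⟨ cong (ι (dB * dN) ⊗_) (trans (no-holes x (suc y) t 1 q (sym e)) (trans (R′-top x q) (Tr-ones x q))) ⟩
  ι (dB * dN) ⊗ (inv (2 ^ q * H₂ (suc (q + q))) ⊗ ι (H q * pairSums (suc q) x)) ∎
  where
  open ≡-Reasoning
  den-nonZero : ∀ n → NonZero (den n)
  den-nonZero n = ℕₚ.m*n≢0 _ (H₂ (suc n)) {{front (par n)}} {{H₂-nonZero (suc n)}}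
    where
    front : ∀ b → NonZero (if b then 1 else 2 ^ rk n)
    front true  = _
    front false = ℕₚ.m^n≢0 2 (rk n)
  dB = den (y + t + t)
  dN = den y
  module S = RSum x (suc y) t [] (y + t) y q (cong suc (sym (ℕₚ.+-identityʳ (y + t)))) (cong suc (sym (ℕₚ.+-identityʳ y))) (trans e (sym (ℕₚ.+-identityʳ _))) (fit-[] y)
  σ = not (par (suc y))
  k = x + fl (suc y)
  Pr = pairing σ k t (fl (suc y))
  Vt = Vdm σ k (ones t)
  R-value : R' x (suc y) t [] ≡ (inv dB ⊗ inv dN) ⊗ Pr
  R-value = cancel-ι Vt {{Vdm-nonZero σ k (ones t)}} (trans S.R′-pairing (trans (cong (λ n → (inv dB ⊗ inv dN) ⊗ (ι n ⊗ Pr)) (ℕₚ.*-identityʳ Vt)) (⊗-swap _ _ _)))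

sumB-count-0 : ∀ n (F : List Bool → ℚ) → sumB n (λ S → ind (count S ℕ.≡ᵇ 0) (F S)) ≡ F (zeros n)
sumB-count-0 zero    F = refl
sumB-count-0 (suc n) F = trans (cong₂ _⊕_ (sumB-count-0 n (F ∘ (false ∷_))) (sumB-0 n (λ _ _ → refl))) (⊕-identityʳ _)

pairing-0 : ∀ σ k t → pairing σ k t 0 ≡ ι (Vdm σ k (ones t))
pairing-0 σ k t = trans (sumB-cong k (λ S _ → ind-⊗ (count S ℕ.≡ᵇ 0) (wt σ S) _)) (trans (sumB-count-0 k _)
  (trans (cong₂ _⊗_ (wt-zeros σ k) (cong ι (trans (cong₂ _*_ (Vdm-leading σ 0 k (ones t)) (Vdm-zeros σ 0 k)) (ℕₚ.*-identityʳ _)))) (⊗-identityˡ _)))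

ι-ratio : ∀ A B C D → .{{NonZero D}} → A * D ≡ B * C → ι A ≡ ι B ⊗ (inv D ⊗ ι C)
ι-ratio A B C D e = trans (sym (⊗-identityʳ (ι A))) (trans (cong (ι A ⊗_) (sym (ι-inv D))) (trans (sym (⊗-assoc _ _ _))
  (trans (cong (_⊗ inv D) (trans (sym (ι-* A D)) (trans (cong ι e) (ι-* B C)))) (trans (⊗-assoc _ _ _) (cong (ι B ⊗_) (⊗-comm _ _))))))

H-nonZero : ∀ n → NonZero (H n)
H-nonZero zero    = _
H-nonZero (suc n) = ℕₚ.m*n≢0 (H n) (n !) {{H-nonZero n}} {{factorial-nonZero n}}

-- The weighted number of tilings of the region without holes for y + z = q + 1.
ratio : ℕ → ℕ → ℚ
ratio q x = inv (2 ^ q * H₂ (suc (q + q))) ⊗ ι (H q * pairSums (suc q) x)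

den-par-true : ∀ n → par n ≡ true → den n ≡ H₂ (suc n)
den-par-true n p = trans (cong (λ b → (if b then 1 else 2 ^ rk n) * H₂ (suc n)) p) (ℕₚ.*-identityˡ _)

den-par-false : ∀ n → par n ≡ false → den n ≡ 2 ^ rk n * H₂ (suc n)
den-par-false n p = cong (λ b → (if b then 1 else 2 ^ rk n) * H₂ (suc n)) p

pairing-even : ∀ x y t q → par y ≡ false → suc q ≡ y + t →
  pairing true (x + fl y) t (fl y) ≡ ι (H₂ (y + (t + t)) * H₂ y) ⊗ ratio q x
pairing-even x zero (suc q) .q p refl = trans (pairing-0 true (x + 0) (suc q)) (trans (cong ι (trans (Vdm-ones-e (suc q) (x + 0)) (cong (λ v → H (suc q) * pairSums (suc q) v) (ℕₚ.+-identityʳ x))))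
  (ι-ratio _ _ _ _ {{ℕₚ.m*n≢0 (2 ^ q) _ {{ℕₚ.m^n≢0 2 q}} {{H₂-nonZero (suc (q + q))}}}}
    (trans (perm (H q) (q !) (pairSums (suc q) x) (2 ^ q) (H₂ (suc (q + q))))
      (cong (λ n → n * 1 * (H q * pairSums (suc q) x)) (sym (trans (cong H₂ (cong suc (ℕₚ.+-suc q q))) (H₂-ratio q)))))))
  where
  perm : ∀ h f w p g → h * f * w * (p * g) ≡ p * g * f * 1 * (h * w)
  perm = ℕ-Ring.solve-∀
pairing-even x (suc y) t q p e = trans (cong (λ σ → pairing σ (x + fl (suc y)) t (fl (suc y))) (sym (cong not p))) (trans (pairing-formula x y t q e)
  (cong (λ n → ι n ⊗ ratio q x) (cong₂ _*_ (trans (den-par-true (y + t + t) p₂) (cong (H₂ ∘ suc) (ℕₚ.+-assoc y t t))) (den-par-true y p₁))))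
  where
  p₁ : par y ≡ true
  p₁ = trans (sym (not-involutive _)) (cong not p)
  p₂ : par (y + t + t) ≡ true
  p₂ = trans (cong par (ℕₚ.+-assoc y t t)) (trans (par-+ y (t + t) (par-double t)) p₁)

pairing-odd : ∀ x y t q → par y ≡ false → suc q ≡ suc y + t →
  pairing false (x + fl (suc y)) t (fl (suc y)) ≡ ι (2 ^ (fl (suc y) + t) * H₂ (suc y + (t + t)) * (2 ^ fl (suc y) * H₂ (suc y))) ⊗ ratio q x
pairing-odd x y t q p e = trans (cong (λ σ → pairing σ (x + fl (suc y)) t (fl (suc y))) (sym (cong not (cong not p)))) (trans (pairing-formula x y t q e)
  (cong (λ n → ι n ⊗ ratio q x) (cong₂ _*_
    (trans (den-par-false (y + t + t) p₂) (cong₂ (λ r n → 2 ^ r * H₂ (suc n)) (trans (fl-rk-suc (y + t + t)) (trans (cong (fl ∘ suc) (ℕₚ.+-assoc y t t)) (fl-+-double (suc y) t))) (ℕₚ.+-assoc y t t)))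
    (trans (den-par-false y p) (cong (λ r → 2 ^ r * H₂ (suc y)) (fl-rk-suc y))))))
  where
  p₂ : par (y + t + t) ≡ false
  p₂ = trans (cong par (ℕₚ.+-assoc y t t)) (trans (par-+ y (t + t) (par-double t)) p)

-- Comparison with the products in the theorem.

private opaque
  unfolding _⊕_ isZero
  collect : ∀ b n w u n₁ i h → (b ⊗ n) ⊗ ((w ⊗ u) ⊗ (n₁ ⊗ (i ⊗ h))) ≡ ((n₁ ⊗ h) ⊗ (b ⊗ (n ⊗ i))) ⊗ (w ⊗ u)
  collect = solve-∀ ℚ-ring
  distribute : ∀ v p n d a u b w → v ⊗ (p ⊗ (n ⊗ d) ⊗ (a ⊗ u) ⊗ (b ⊗ w)) ≡ ((p ⊗ (n ⊗ v)) ⊗ (d ⊗ (a ⊗ b))) ⊗ (w ⊗ u)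
  distribute = solve-∀ ℚ-ring

cross-multiply : ∀ A B C D → .{{NonZero B}} → .{{NonZero D}} → A * D ≡ C * B → ι A ⊗ inv B ≡ ι C ⊗ inv D
cross-multiply A B C D e = trans (cong (_⊗ inv B) (ι-ratio A C B D e)) (trans (⊗-assoc _ _ _) (cong (ι C ⊗_) (trans (⊗-assoc _ _ _) (trans (cong (inv D ⊗_) (ι-inv B)) (⊗-identityʳ _)))))

-- The Vandermonde products v₁ and v₂ of the two regions occur on both sides; what is left is an
-- equation between fractions, and the last hypothesis is its cross-multiplied form in ℕ.
compare-products : ∀ R Vt dB dN v₂ v₁ n₁ d₁ h₁ P num dd a b → .{{NonZero Vt}} → .{{NonZero (dB * (dN * d₁))}} → .{{NonZero (dd * (a * b))}} →
  ι Vt ⊗ R ≡ (inv dB ⊗ inv dN) ⊗ (ι (v₂ * v₁) ⊗ (ι n₁ ⊗ (inv d₁ ⊗ ι h₁))) →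
  (n₁ * h₁) * (dd * (a * b)) ≡ (P * (num * Vt)) * (dB * (dN * d₁)) →
  R ≡ toℚ P ℚ.* frac num dd ℚ.* (inv a ⊗ ι v₁) ℚ.* (inv b ⊗ ι v₂)
compare-products R Vt dB dN v₂ v₁ n₁ d₁ h₁ P num dd a b e f = trans (cancel-ι Vt (begin
  ι Vt ⊗ R                                  ≡⟨ e ⟩
  (inv dB ⊗ inv dN) ⊗ (ι (v₂ * v₁) ⊗ (ι n₁ ⊗ (inv d₁ ⊗ ι h₁))) ≡⟨ cong (λ w → (inv dB ⊗ inv dN) ⊗ (w ⊗ (ι n₁ ⊗ (inv d₁ ⊗ ι h₁)))) (ι-* v₂ v₁) ⟩
  (inv dB ⊗ inv dN) ⊗ ((ι v₂ ⊗ ι v₁) ⊗ (ι n₁ ⊗ (inv d₁ ⊗ ι h₁))) ≡⟨ collect (inv dB) (inv dN) (ι v₂) (ι v₁) (ι n₁) (inv d₁) (ι h₁) ⟩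
  ((ι n₁ ⊗ ι h₁) ⊗ (inv dB ⊗ (inv dN ⊗ inv d₁))) ⊗ (ι v₂ ⊗ ι v₁)
    ≡⟨ cong (_⊗ (ι v₂ ⊗ ι v₁)) (trans (cong₂ _⊗_ (sym (ι-* n₁ h₁)) (sym (trans (inv-* dB (dN * d₁)) (cong (inv dB ⊗_) (inv-* dN d₁)))))
         (trans (cross-multiply (n₁ * h₁) (dB * (dN * d₁)) (P * (num * Vt)) (dd * (a * b)) f)
           (cong₂ _⊗_ (trans (ι-* P (num * Vt)) (cong (ι P ⊗_) (ι-* num Vt))) (trans (inv-* dd (a * b)) (cong (inv dd ⊗_) (inv-* a b)))))) ⟩
  ((ι P ⊗ (ι num ⊗ ι Vt)) ⊗ (inv dd ⊗ (inv a ⊗ inv b))) ⊗ (ι v₂ ⊗ ι v₁) ≡⟨ sym (distribute (ι Vt) (ι P) (ι num) (inv dd) (inv a) (ι v₁) (inv b) (ι v₂)) ⟩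
  ι Vt ⊗ (ι P ⊗ (ι num ⊗ inv dd) ⊗ (inv a ⊗ ι v₁) ⊗ (inv b ⊗ ι v₂)) ∎))
  (sym (trans (⊗-unfold _ _) (cong (_⊗ (inv b ⊗ ι v₂)) (trans (⊗-unfold _ _) (cong (_⊗ (inv a ⊗ ι v₁)) (trans (⊗-unfold _ _) (cong₂ _⊗_ (ι-unfold P) (frac-ι-inv num dd))))))))
  where open ≡-Reasoning

even-first : ∀ k a → evenSum (firstArg k a) ≡ oddSum a
even-first k a = trans (sym (count-bits (firstArg k a))) (trans (cong count (bits-first k a)) (trans (count-++ (zeros k) _) (cong₂ _+_ (count-zeros k) (count-segments true a))))

even-second : ∀ k a z → evenSum (secondArg k a z) ≡ evenSum a + z
even-second k a z = trans (sym (count-bits (secondArg k a z))) (trans (cong count (bits-second k a z)) (trans (count-++ (zeros k) _)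
  (cong₂ _+_ (count-zeros k) (trans (count-++ (segments false a) (ones z)) (cong₂ _+_ (count-segments false a) (count-ones z))))))

Q-first : ∀ k a → Q' (firstArg k a) ≡ inv (2 ^ oddSum a * H₂ (2 * oddSum a + 1)) ⊗ ι (Vdm false k (segments true a))
Q-first k a = trans (Q-formula (firstArg k a)) (cong₂ (λ E V → inv (2 ^ E * H₂ (2 * E + 1)) ⊗ ι V) (even-first k a) (trans (cong (Vdm false 0) (bits-first k a)) (Vdm-leading false 0 k _)))

Q-second : ∀ k a z → Q' (secondArg k a z) ≡ inv (2 ^ (evenSum a + z) * H₂ (2 * (evenSum a + z) + 1)) ⊗ ι (Vdm false k (segments false a ++ ones z))
Q-second k a z = trans (Q-formula (secondArg k a z)) (cong₂ (λ E V → inv (2 ^ E * H₂ (2 * E + 1)) ⊗ ι V) (even-second k a z) (trans (cong (Vdm false 0) (bits-second k a z)) (Vdm-leading false 0 k _)))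

K-first : ∀ k a → K' (firstArg k a) ≡ inv (H₂ (2 * oddSum a)) ⊗ ι (Vdm true k (segments true a))
K-first k a = trans (K-formula (firstArg k a)) (cong₂ (λ E V → inv (H₂ (2 * E)) ⊗ ι V) (even-first k a) (trans (cong (Vdm true 0) (bits-first k a)) (Vdm-leading true 0 k _)))

K-second : ∀ k a z → K' (secondArg k a z) ≡ inv (H₂ (2 * (evenSum a + z))) ⊗ ι (Vdm true k (segments false a ++ ones z))
K-second k a z = trans (K-formula (secondArg k a z)) (cong₂ (λ E V → inv (H₂ (2 * E)) ⊗ ι V) (even-second k a z) (trans (cong (Vdm true 0) (bits-second k a z)) (Vdm-leading true 0 k _)))

*-nonZero : ∀ m n → NonZero m → NonZero n → NonZero (m * n)
*-nonZero m n p q = ℕₚ.m*n≢0 m n {{p}} {{q}}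

2^-nonZero : ∀ n → NonZero (2 ^ n)
2^-nonZero n = ℕₚ.m^n≢0 2 n

-- R is left arbitrary so that the case with ℓ below the region, to which `R′-pairing` does not
-- extend, can be evaluated in the same way.
rhsEven-value : ∀ x y z a q R → par y ≡ false → let t = total-length a + z ; k = x + fl y in suc q ≡ y + t →
  ι (Vdm true k (ones t)) ⊗ R ≡ (inv (H₂ (2 * evenSum a + y + 2 * z)) ⊗ inv (H₂ (2 * oddSum a + y))) ⊗
    (ι (Vdm true k (segments false a ++ ones z) * Vdm true k (segments true a)) ⊗ pairing true k t (fl y)) →
  R ≡ rhsEven x y z a
rhsEven-value x y z a q R p e r = trans
  (compare-products R Vt E₁ F₁ v₂ v₁ (D₁ * A₁) (2 ^ q * G₁) (H q * pairSums (suc q) x) P num dd C₁ B₁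
    {{Vdm-nonZero true k (ones t)}} {{*-nonZero E₁ _ E₁≢0 (*-nonZero F₁ _ F₁≢0 (*-nonZero (2 ^ q) G₁ (2^-nonZero q) (H₂-nonZero (suc (q + q)))))}}
    {{*-nonZero dd _ (*-nonZero _ _ (*-nonZero _ F₁ (*-nonZero (H (s + z)) E₁ (H-nonZero (s + z)) E₁≢0) F₁≢0) (H₂-nonZero (2 * s + 2 * y + 2 * z))) (*-nonZero C₁ B₁ (H₂-nonZero (2 * O)) (H₂-nonZero (2 * (E + z))))}}
    (trans r (cong (λ n → (inv E₁ ⊗ inv F₁) ⊗ (ι (v₂ * v₁) ⊗ n)) (pairing-even x y t q p e))) identity)
  (cong₂ ℚ._*_ (cong (toℚ P ℚ.* frac num dd ℚ.*_) (trans (sym (K-first k a)) (cong (λ m → K' (firstArg (x + m) a)) (sym (half-fl y)))))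
    (trans (sym (K-second k a z)) (cong (λ m → K' (secondArg (x + m) a z)) (sym (half-fl y)))))
  where
  open ≡-Reasoning
  E = evenSum a
  O = oddSum a
  s = O + E
  t = total-length a + z
  k = x + fl y
  m = fl y
  Vt = Vdm true k (ones t)
  v₂ = Vdm true k (segments false a ++ ones z)
  v₁ = Vdm true k (segments true a)
  A₁ = H₂ y
  B₁ = H₂ (2 * (E + z))
  C₁ = H₂ (2 * O)
  D₁ = H₂ (y + (t + t))
  E₁ = H₂ (2 * E + y + 2 * z)
  F₁ = H₂ (2 * O + y)
  G₁ = H₂ (suc (q + q))
  E₁≢0 : NonZero E₁
  E₁≢0 = H₂-nonZero (2 * E + y + 2 * z)
  F₁≢0 : NonZero F₁
  F₁≢0 = H₂-nonZero (2 * O + y)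
  K = 2 * s + 2 * y + 2 * z + 1
  P = prod1 (y / 2) (λ i → poch (2 * x + 2 * i ∸ 1) (2 * s + 2 * y + 2 * z + 1 ∸ 4 * i))
  num = H (s + y + z) * H₂ y * H₂ (2 * E + 2 * z) * H₂ (2 * O) * H₂ (2 * s + y + 2 * z)
  dd = H (s + z) * H₂ (2 * E + y + 2 * z) * H₂ (2 * O + y) * H₂ (2 * s + 2 * y + 2 * z)
  W = pairSums t k
  t-eq : t ≡ s + z
  t-eq = cong (_+ z) (total-odd-even a)
  y-eq : y ≡ m + m
  y-eq = fl-even y p
  q-eq : suc q ≡ s + y + z
  q-eq = trans e (trans (cong (ℕ._+_ y) t-eq) (perm y s z))
    where
    perm : ∀ y s z → y + (s + z) ≡ s + y + z
    perm = ℕ-Ring.solve-∀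
  -- Of the q + 1 = 2m + t positions, m pairs of outermost ones give the product of Pochhammer
  -- symbols; the t inner ones start at k and belong to V(A).
  pairs : pairSums (suc q) x ≡ P * W
  pairs = trans (cong (λ n → pairSums n x) (trans e (cong (_+ t) y-eq))) (trans (pairSums-product m t x K (trans (perm s y z) (cong (λ n → 2 * n + 1) (trans (cong (ℕ._+_ y) (sym t-eq)) (cong (_+ t) y-eq)))))
    (cong (λ n → prod1 n (λ i → poch (2 * x + 2 * i ∸ 1) (K ∸ 4 * i)) * W) (sym (half-fl y))))
    where
    perm : ∀ s y z → 2 * s + 2 * y + 2 * z + 1 ≡ 2 * (y + (s + z)) + 1
    perm = ℕ-Ring.solve-∀
  num-eq : num ≡ (H q * (q !)) * A₁ * B₁ * C₁ * D₁
  num-eq = cong₂ _*_ (cong₂ (λ h b → h * A₁ * b * C₁) (cong H (sym q-eq)) (cong H₂ (sym (ℕₚ.*-distribˡ-+ 2 E z)))) (cong H₂ (trans (perm s y z) (cong (λ n → y + (n + n)) (sym t-eq))))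
    where
    perm : ∀ s y z → 2 * s + y + 2 * z ≡ y + (s + z + (s + z))
    perm = ℕ-Ring.solve-∀
  dd-eq : dd ≡ H t * E₁ * F₁ * (2 ^ q * G₁ * q !)
  dd-eq = cong₂ (λ h g → h * E₁ * F₁ * g) (cong H (sym t-eq)) (trans (cong H₂ (trans (perm s y z) (trans (cong₂ _+_ (sym q-eq) (sym q-eq)) (cong suc (ℕₚ.+-suc q q))))) (H₂-ratio q))
    where
    perm : ∀ s y z → 2 * s + 2 * y + 2 * z ≡ s + y + z + (s + y + z)
    perm = ℕ-Ring.solve-∀
  identity : (D₁ * A₁ * (H q * pairSums (suc q) x)) * (dd * (C₁ * B₁)) ≡ (P * (num * Vt)) * (E₁ * (F₁ * (2 ^ q * G₁)))
  identity = begin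
    (D₁ * A₁ * (H q * pairSums (suc q) x)) * (dd * (C₁ * B₁))
      ≡⟨ cong₂ (λ w d → (D₁ * A₁ * (H q * w)) * (d * (C₁ * B₁))) pairs dd-eq ⟩
    (D₁ * A₁ * (H q * (P * W))) * (H t * E₁ * F₁ * (2 ^ q * G₁ * q !) * (C₁ * B₁))
      ≡⟨ perm A₁ B₁ C₁ D₁ E₁ F₁ G₁ (H q) (H t) (2 ^ q) (q !) P W ⟩
    (P * ((H q * (q !)) * A₁ * B₁ * C₁ * D₁ * (H t * W))) * (E₁ * (F₁ * (2 ^ q * G₁)))
      ≡⟨ cong₂ (λ n v → (P * (n * v)) * (E₁ * (F₁ * (2 ^ q * G₁)))) (sym num-eq) (sym (Vdm-ones-e t k)) ⟩
    (P * (num * Vt)) * (E₁ * (F₁ * (2 ^ q * G₁))) ∎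
    where
    perm : ∀ A B C D E F G h t p f P W → (D * A * (h * (P * W))) * (t * E * F * (p * G * f) * (C * B)) ≡ (P * ((h * f) * A * B * C * D * (t * W))) * (E * (F * (p * G)))
    perm = ℕ-Ring.solve-∀

-- In contrast to the even case all heights are even and carry powers of 2. With q = 2m + t these
-- reduce to 2^t / 2^q = 1 / 2^(2m), the power in the theorem.
rhsOdd-value : ∀ x y z a q R → par y ≡ false → let t = total-length a + z ; m = fl (suc y) ; k = x + m in suc q ≡ suc y + t →
  ι (Vdm false k (ones t)) ⊗ R ≡ (inv (2 ^ (m + (z + evenSum a)) * H₂ (2 * evenSum a + suc y + 2 * z)) ⊗ inv (2 ^ (m + oddSum a) * H₂ (2 * oddSum a + suc y))) ⊗
    (ι (Vdm false k (segments false a ++ ones z) * Vdm false k (segments true a)) ⊗ pairing false k t m) →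
  R ≡ rhsOdd x (suc y) z a
rhsOdd-value x y z a q R p e r = trans
  (compare-products R Vt dB dN v₂ v₁ n₁ (2 ^ q * G₁) (H q * pairSums (suc q) x) P num dd (2 ^ O * C₁) (2 ^ (E + z) * B₁)
    {{Vdm-nonZero false k (ones t)}}
    {{*-nonZero dB _ (*-nonZero (2 ^ (m + (z + E))) E₁ (2^-nonZero (m + (z + E))) E₁≢0) (*-nonZero dN _ (*-nonZero (2 ^ (m + O)) F₁ (2^-nonZero (m + O)) F₁≢0) (*-nonZero (2 ^ q) G₁ (2^-nonZero q) (H₂-nonZero (suc (q + q)))))}}
    {{*-nonZero dd _ (*-nonZero (2 ^ y) _ (2^-nonZero y) (*-nonZero _ _ (*-nonZero _ F₁ (*-nonZero (H (s + z)) E₁ (H-nonZero (s + z)) E₁≢0) F₁≢0) (H₂-nonZero (2 * s + 2 * suc y + 2 * z ∸ 1))))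
      (*-nonZero _ _ (*-nonZero (2 ^ O) C₁ (2^-nonZero O) (H₂-nonZero (2 * O + 1))) (*-nonZero (2 ^ (E + z)) B₁ (2^-nonZero (E + z)) (H₂-nonZero (2 * (E + z) + 1))))}}
    (trans r (cong (λ n → (inv dB ⊗ inv dN) ⊗ (ι (v₂ * v₁) ⊗ n)) (pairing-odd x y t q p e))) identity)
  (cong₂ ℚ._*_ (cong (toℚ P ℚ.* frac num dd ℚ.*_) (trans (sym (Q-first k a)) (cong (λ m → Q' (firstArg (x + m) a)) (sym half))))
    (trans (sym (Q-second k a z)) (cong (λ m → Q' (secondArg (x + m) a z)) (sym half))))
  where
  open ≡-Reasoning
  E = evenSum a
  O = oddSum a
  s = O + E
  t = total-length a + z
  m = fl (suc y)
  k = x + m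
  Vt = Vdm false k (ones t)
  v₂ = Vdm false k (segments false a ++ ones z)
  v₁ = Vdm false k (segments true a)
  A₁ = H₂ (suc y)
  B₁ = H₂ (2 * (E + z) + 1)
  C₁ = H₂ (2 * O + 1)
  D₁ = H₂ (suc y + (t + t))
  E₁ = H₂ (2 * E + suc y + 2 * z)
  F₁ = H₂ (2 * O + suc y)
  G₁ = H₂ (suc (q + q))
  dB = 2 ^ (m + (z + E)) * E₁
  dN = 2 ^ (m + O) * F₁
  n₁ = 2 ^ (m + t) * D₁ * (2 ^ m * A₁)
  E₁≢0 : NonZero E₁
  E₁≢0 = H₂-nonZero (2 * E + suc y + 2 * z)
  F₁≢0 : NonZero F₁
  F₁≢0 = H₂-nonZero (2 * O + suc y)
  K = 2 * s + 2 * suc y + 2 * z + 1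
  P = prod1 (y / 2) (λ i → poch (2 * x + 2 * i ∸ 1) (2 * s + 2 * suc y + 2 * z + 1 ∸ 4 * i))
  num = H (s + suc y + z ∸ 1) * H₂ (suc y) * H₂ (2 * E + 2 * z + 1) * H₂ (2 * O + 1) * H₂ (2 * s + suc y + 2 * z)
  dd = 2 ^ y * (H (s + z) * H₂ (2 * E + suc y + 2 * z) * H₂ (2 * O + suc y) * H₂ (2 * s + 2 * suc y + 2 * z ∸ 1))
  W = pairSums (suc t) k
  m-eq : fl y ≡ m
  m-eq = sym (cong (λ b → if b then suc (fl y) else fl y) p)
  half : y / 2 ≡ m
  half = trans (half-fl y) m-eq
  t-eq : t ≡ s + z
  t-eq = cong (_+ z) (total-odd-even a)
  y-eq : y ≡ m + m
  y-eq = trans (fl-even y p) (cong₂ _+_ m-eq m-eq)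
  q-eq : suc q ≡ s + suc y + z
  q-eq = trans e (trans (cong (ℕ._+_ (suc y)) t-eq) (perm (suc y) s z))
    where
    perm : ∀ y s z → y + (s + z) ≡ s + y + z
    perm = ℕ-Ring.solve-∀
  sq-eq : suc q ≡ m + m + suc t
  sq-eq = trans e (trans (sym (ℕₚ.+-suc y t)) (cong (_+ suc t) y-eq))
  pairs : pairSums (suc q) x ≡ P * W
  pairs = trans (cong (λ n → pairSums n x) sq-eq) (trans (pairSums-product m (suc t) x K (trans (perm s (suc y) z) (cong (λ n → 2 * n + 1) (trans (sym q-eq) sq-eq))))
    (cong (λ n → prod1 n (λ i → poch (2 * x + 2 * i ∸ 1) (K ∸ 4 * i)) * W) (sym half)))
    where
    perm : ∀ s y z → 2 * s + 2 * y + 2 * z + 1 ≡ 2 * (s + y + z) + 1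
    perm = ℕ-Ring.solve-∀
  num-eq : num ≡ H q * A₁ * B₁ * C₁ * D₁
  num-eq = cong₂ _*_ (cong₂ (λ h b → h * A₁ * b * C₁) (cong (λ n → H (n ∸ 1)) (sym q-eq)) (cong (λ n → H₂ (n + 1)) (sym (ℕₚ.*-distribˡ-+ 2 E z))))
    (cong H₂ (trans (perm s (suc y) z) (cong (λ n → suc y + (n + n)) (sym t-eq))))
    where
    perm : ∀ s y z → 2 * s + y + 2 * z ≡ y + (s + z + (s + z))
    perm = ℕ-Ring.solve-∀
  pow = 2 ^ m
  dd-eq : dd ≡ pow * pow * (H t * E₁ * F₁ * G₁)
  dd-eq = cong₂ _*_ (trans (cong (2 ^_) y-eq) (ℕₚ.^-distribˡ-+-* 2 m m)) (cong₂ (λ h g → h * E₁ * F₁ * H₂ g) (cong H (sym t-eq))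
    (trans (cong (_∸ 1) (trans (perm s (suc y) z) (cong₂ _+_ (sym q-eq) (sym q-eq)))) (ℕₚ.+-suc q q)))
    where
    perm : ∀ s y z → 2 * s + 2 * y + 2 * z ≡ s + y + z + (s + y + z)
    perm = ℕ-Ring.solve-∀
  q-pow : 2 ^ q ≡ pow * pow * 2 ^ t
  q-pow = trans (cong (2 ^_) (ℕₚ.suc-injective (trans sq-eq (ℕₚ.+-suc (m + m) t)))) (trans (ℕₚ.^-distribˡ-+-* 2 (m + m) t) (cong (_* 2 ^ t) (ℕₚ.^-distribˡ-+-* 2 m m)))
  n₁-eq : n₁ ≡ pow * 2 ^ t * D₁ * (pow * A₁)
  n₁-eq = cong (λ w → w * D₁ * (pow * A₁)) (ℕₚ.^-distribˡ-+-* 2 m t)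
  dB-eq : dB ≡ pow * 2 ^ (E + z) * E₁
  dB-eq = cong (_* E₁) (trans (ℕₚ.^-distribˡ-+-* 2 m (z + E)) (cong (λ n → pow * 2 ^ n) (ℕₚ.+-comm z E)))
  dN-eq : dN ≡ pow * 2 ^ O * F₁
  dN-eq = cong (_* F₁) (ℕₚ.^-distribˡ-+-* 2 m O)
  identity : (n₁ * (H q * pairSums (suc q) x)) * (dd * (2 ^ O * C₁ * (2 ^ (E + z) * B₁))) ≡ (P * (num * Vt)) * (dB * (dN * (2 ^ q * G₁)))
  identity = begin
    (n₁ * (H q * pairSums (suc q) x)) * (dd * (2 ^ O * C₁ * (2 ^ (E + z) * B₁)))
      ≡⟨ cong₂ (λ w d → w * (d * (2 ^ O * C₁ * (2 ^ (E + z) * B₁)))) (cong₂ (λ n w → n * (H q * w)) n₁-eq pairs) dd-eq ⟩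
    (pow * 2 ^ t * D₁ * (pow * A₁) * (H q * (P * W))) * (pow * pow * (H t * E₁ * F₁ * G₁) * (2 ^ O * C₁ * (2 ^ (E + z) * B₁)))
      ≡⟨ perm₁ A₁ B₁ C₁ D₁ (H q) pow (2 ^ t) (2 ^ O) (2 ^ (E + z)) P W (H t) (E₁ * F₁ * G₁) (H t * E₁ * F₁ * G₁) (assoc (H t) E₁ F₁ G₁) ⟩
    (P * (H q * A₁ * B₁ * C₁ * D₁ * (H t * W))) * ((pow * 2 ^ (E + z)) * (pow * 2 ^ O) * (pow * pow * 2 ^ t) * (E₁ * F₁ * G₁))
      ≡⟨ cong (ℕ._*_ (P * (H q * A₁ * B₁ * C₁ * D₁ * (H t * W)))) (perm₂ (pow * 2 ^ (E + z)) (pow * 2 ^ O) (pow * pow * 2 ^ t) E₁ F₁ G₁) ⟩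
    (P * (H q * A₁ * B₁ * C₁ * D₁ * (H t * W))) * (pow * 2 ^ (E + z) * E₁ * (pow * 2 ^ O * F₁ * (pow * pow * 2 ^ t * G₁)))
      ≡⟨ cong₂ _*_ (cong₂ (λ n v → P * (n * v)) (sym num-eq) (sym (Vdm-ones-o t k))) (cong₂ _*_ (sym dB-eq) (cong₂ _*_ (sym dN-eq) (cong (_* G₁) (sym q-pow)))) ⟩
    (P * (num * Vt)) * (dB * (dN * (2 ^ q * G₁))) ∎
    where
    assoc : ∀ h e f g → h * e * f * g ≡ h * (e * f * g)
    assoc = ℕ-Ring.solve-∀
    perm₁ : ∀ A B C D h pow T o Z P W t e u → u ≡ t * e → (pow * T * D * (pow * A) * (h * (P * W))) * (pow * pow * u * (o * C * (Z * B))) ≡ (P * (h * A * B * C * D * (t * W))) * ((pow * Z) * (pow * o) * (pow * pow * T) * e)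
    perm₁ A B C D h pow T o Z P W t e _ refl = lem A B C D h pow T o Z P W t e
      where
      lem : ∀ A B C D h pow T o Z P W t e → (pow * T * D * (pow * A) * (h * (P * W))) * (pow * pow * (t * e) * (o * C * (Z * B))) ≡ (P * (h * A * B * C * D * (t * W))) * ((pow * Z) * (pow * o) * (pow * pow * T) * e)
      lem = ℕ-Ring.solve-∀
    perm₂ : ∀ a b c e f g → a * b * c * (e * f * g) ≡ a * e * (b * f * (c * g))
    perm₂ = ℕ-Ring.solve-∀

-- The line ℓ below the region, and the conclusion.

zigRegion-cong : ∀ h {right right′ : ℤ → ℤ} {hole hole′ : Cell → Bool} → (∀ b → right (+ b) ≡ right′ (+ b)) → (∀ k b → hole (k , + b) ≡ hole′ (k , + b)) →
  zigRegion h right hole ≡ zigRegion h right′ hole′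
zigRegion-cong h {right} {right′} {hole} {hole′} r p = go (upTo h)
  where
  row : ∀ b ks → filterᵇ (not ∘ hole) (map (λ k → (k , + b)) ks) ≡ filterᵇ (not ∘ hole′) (map (λ k → (k , + b)) ks)
  row b []       = refl
  row b (k ∷ ks) with hole (k , + b) | hole′ (k , + b) | p k b
  ... | true  | .true  | refl = row b ks
  ... | false | .false | refl = cong (_ ∷_) (row b ks)
  go : ∀ bs → filterᵇ (not ∘ hole) (concatMap (λ i → map (λ k → (k , + i)) (interval (+ h) (right (+ i)))) bs) ≡
    filterᵇ (not ∘ hole′) (concatMap (λ i → map (λ k → (k , + i)) (interval (+ h) (right′ (+ i)))) bs)
  go []       = refl
  go (b ∷ bs) = trans (filter-++ (T? ∘ not ∘ hole) (map (λ k → (k , + b)) (interval (+ h) (right (+ b)))) _)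
    (trans (cong₂ _++_ (trans (row b (interval (+ h) (right (+ b)))) (cong (λ n → filterᵇ (not ∘ hole′) (map (λ k → (k , + b)) (interval (+ h) n))) (r b))) (go bs))
      (sym (filter-++ (T? ∘ not ∘ hole′) (map (λ k → (k , + b)) (interval (+ h) (right′ (+ b)))) _)))

-- For y = z = 0 and a single hole of side q + 1 the line ℓ is one unit
-- below the region; the part of the hole inside is a triangle of side q.
R′-degenerate : ∀ x q → R' x 0 0 (suc q ∷ []) ≡ R' x 1 0 (q ∷ [])
R′-degenerate x q = cong (M' h) (zigRegion-cong h {right -[1+ 0 ] (suc q + 0)} {right (+ 0) (q + 0)} (λ b → refl) (λ k b → cong (_∨ false) (triangle k b)))
  where
  h = Rheight 1 0 (q ∷ [])
  c : ℤ
  c = + h ℤ.+ + (2 * x + 0) ℤ.+ + h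
  Y right : ℤ → ℕ → ℤ → ℤ
  Y v O b = if v ℤ.≤ᵇ b then c ℤ.- b else + h ℤ.+ + (2 * x + 2 * O) ℤ.+ b
  right v O b = Y v O b ℤ.⊓ Y v O (b ℤ.+ + 1)
  and₂ : ∀ {u v u′ v′ : Bool} {e f} → u ≡ u′ → v ≡ v′ → e ∧ f ∧ u ∧ v ≡ e ∧ f ∧ u′ ∧ v′
  and₂ refl refl = refl
  triangle : ∀ k b → inUpTriangle (c ℤ.- -[1+ 0 ] ℤ.- + (2 * suc q)) (suc q) -[1+ 0 ] (k , + b) ≡ inUpTriangle (c ℤ.- + 0 ℤ.- + (2 * q)) q (+ 0) (k , + b)
  triangle k b = and₂ {e = true} {f = (b + 1) ℕ.≤ᵇ q} (cong (ℤ._≤ᵇ k) (low c (+ q) (+ b))) (cong (k ℤ.≤ᵇ_) (high c (+ q) (+ b)))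
    where
    low : ∀ c q b → c ℤ.- -[1+ 0 ] ℤ.- ((+ 1 ℤ.+ q) ℤ.+ ((+ 1 ℤ.+ q) ℤ.+ + 0)) ℤ.+ + 1 ℤ.+ (b ℤ.- -[1+ 0 ]) ≡ c ℤ.- + 0 ℤ.- (q ℤ.+ (q ℤ.+ + 0)) ℤ.+ + 1 ℤ.+ (b ℤ.- + 0)
    low = ℤ-Ring.solve-∀
    high : ∀ c q b → c ℤ.- -[1+ 0 ] ℤ.- ((+ 1 ℤ.+ q) ℤ.+ ((+ 1 ℤ.+ q) ℤ.+ + 0)) ℤ.+ ((+ 1 ℤ.+ q) ℤ.+ ((+ 1 ℤ.+ q) ℤ.+ + 0)) ℤ.- + 1 ℤ.- (b ℤ.- -[1+ 0 ]) ≡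
      c ℤ.- + 0 ℤ.- (q ℤ.+ (q ℤ.+ + 0)) ℤ.+ (q ℤ.+ (q ℤ.+ + 0)) ℤ.- + 1 ℤ.- (b ℤ.- + 0)
    high = ℤ-Ring.solve-∀

-- After `R′-degenerate`, ℓ is the southern side and `R′-bottom` gives the value `ratio q x`; this
-- is related to `pairing` for y = 0 just as `rhsEven-value` requires.
theorem-degenerate : ∀ x q → R' x 0 0 (suc q ∷ []) ≡ rhsEven x 0 0 (suc q ∷ [])
theorem-degenerate x q = rhsEven-value x 0 0 (suc q ∷ []) q _ refl (sym (perm q)) (begin
  ι Vt ⊗ R                                   ≡⟨ cong (ι Vt ⊗_) value ⟩
  ι Vt ⊗ ratio q x                           ≡⟨ cong₂ _⊗_ (cong ι (sym (ℕₚ.*-identityˡ Vt))) (sym (trans (cong (_⊗ ratio q x) (trans (⊗-comm _ _) (ι-inv F₁ {{H₂-nonZero (2 * (suc q + 0) + 0)}}))) (⊗-identityˡ _))) ⟩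
  ι (1 * Vt) ⊗ ((inv F₁ ⊗ ι F₁) ⊗ ratio q x) ≡⟨ cong (ι (1 * Vt) ⊗_) (⊗-assoc _ _ _) ⟩
  ι (1 * Vt) ⊗ (inv F₁ ⊗ (ι F₁ ⊗ ratio q x)) ≡⟨ trans (⊗-swap _ _ _) (cong (_⊗ (ι (1 * Vt) ⊗ (ι F₁ ⊗ ratio q x))) (sym (trans (cong (_⊗ inv F₁) inv-1) (⊗-identityˡ _)))) ⟩
  (inv 1 ⊗ inv F₁) ⊗ (ι (1 * Vt) ⊗ (ι F₁ ⊗ ratio q x))
    ≡⟨ cong₂ (λ v p → (inv 1 ⊗ inv F₁) ⊗ (ι v ⊗ p)) (cong₂ _*_ (sym (trans (cong (Vdm true k) (++-identityʳ (zeros (suc q)))) (Vdm-zeros true k (suc q)))) (cong (λ n → Vdm true k (ones n)) (trans (ℕₚ.+-identityʳ _) (ℕₚ.+-identityʳ (suc q)))))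
        (sym (trans (pairing-even x 0 t q refl (sym (perm q))) (cong (λ n → ι n ⊗ ratio q x) (trans (ℕₚ.*-identityʳ _) (cong H₂ (F-eq q)))))) ⟩
  (inv 1 ⊗ inv F₁) ⊗ (ι (Vdm true k (zeros (suc q) ++ []) * Vdm true k (ones (suc q))) ⊗ pairing true k t 0) ∎)
  where
  open ≡-Reasoning
  R = R' x 0 0 (suc q ∷ [])
  k = x + 0
  t = suc q + 0 + 0
  F₁ = H₂ (2 * (suc q + 0) + 0)
  Vt = Vdm true k (ones t)
  perm : ∀ q → suc q + 0 + 0 ≡ suc q
  perm = ℕ-Ring.solve-∀
  F-eq : ∀ q → suc q + 0 + 0 + (suc q + 0 + 0) ≡ 2 * (suc q + 0) + 0
  F-eq = ℕ-Ring.solve-∀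
  value : R ≡ ratio q x
  value = trans (R′-degenerate x q) (trans (R′-bottom x (q ∷ []) q (2 * (q + 0)) (sym (ℕₚ.+-identityʳ q)) refl refl (λ w → ℕₚ.≤-trans (ℕₚ.m≤m+n q 0) (ℕₚ.m≤m+n (q + 0) _) ∷ []))
    (Tr-ones x q))

suc-witness : ∀ {n} → 1 ≤ n → ∃ λ m → suc m ≡ n
suc-witness (s≤s l) = _ , refl

module Regular (x y z : ℕ) (a : List ℕ) (β N q : ℕ)
  (β-eq : suc β ≡ y + z + 2 * evenSum a) (N-eq : suc N ≡ y + 2 * oddSum a) (q-eq : suc q ≡ y + z + (oddSum a + evenSum a))
  (fit : ∀ w → All (λ r → proj₂ r ≤ N) (lineRuns w true a)) where

  open RGeometry x y z a β N q β-eq N-eq q-eq fit using (bl; bl-suc; rk-bl; rk-N; s; k; E; O)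
  open RSum x y z a β N q β-eq N-eq q-eq fit

  pairing-at : ∀ τ → par y ≡ not τ → ι (Vdm τ k (ones (s + z))) ⊗ R' x y z a ≡
    (inv (den bl) ⊗ inv (den N)) ⊗ (ι (Vdm τ k (segments false a ++ ones z) * Vdm τ k (segments true a)) ⊗ pairing τ k (s + z) (fl y))
  pairing-at τ p = subst (λ τ → ι (Vdm τ k (ones (s + z))) ⊗ R' x y z a ≡
    (inv (den bl) ⊗ inv (den N)) ⊗ (ι (Vdm τ k (segments false a ++ ones z) * Vdm τ k (segments true a)) ⊗ pairing τ k (s + z) (fl y))) (trans (cong not p) (not-involutive τ)) R′-pairing

  q-eq′ : suc q ≡ y + (s + z)
  q-eq′ = trans q-eq (trans (perm y z (O + E)) (cong (λ n → y + (n + z)) (sym (total-odd-even a))))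
    where
    perm : ∀ y z n → y + z + n ≡ y + (n + z)
    perm = ℕ-Ring.solve-∀

  E-eq : suc bl ≡ 2 * E + y + 2 * z
  E-eq = trans bl-suc (perm y z E)
    where
    perm : ∀ y z E → y + ((z + E) + (z + E)) ≡ 2 * E + y + 2 * z
    perm = ℕ-Ring.solve-∀

  F-eq : suc N ≡ 2 * O + y
  F-eq = trans N-eq (ℕₚ.+-comm y (2 * O))

  even-y : par y ≡ false → R' x y z a ≡ rhsEven x y z a
  even-y p = rhsEven-value x y z a q _ p q-eq′ (trans (pairing-at true p)
    (cong₂ (λ m n → (inv m ⊗ inv n) ⊗ (ι (Vdm true k (segments false a ++ ones z) * Vdm true k (segments true a)) ⊗ pairing true k (s + z) (fl y)))
      (trans (den-par-true bl (trans par-bl′ (cong not p))) (cong H₂ E-eq)) (trans (den-par-true N (trans par-N (cong not p))) (cong H₂ F-eq))))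

  odd-y : ∀ y′ → y ≡ suc y′ → par y ≡ true → R' x y z a ≡ rhsOdd x y z a
  odd-y y′ refl p = rhsOdd-value x y′ z a q _ (trans (sym (not-involutive _)) (cong not p)) q-eq′ (trans (pairing-at false p)
    (cong₂ (λ m n → (inv m ⊗ inv n) ⊗ (ι (Vdm false k (segments false a ++ ones z) * Vdm false k (segments true a)) ⊗ pairing false k (s + z) (fl y)))
      (trans (den-par-false bl (trans par-bl′ (cong not p))) (cong₂ (λ r n → 2 ^ r * H₂ n) rk-bl E-eq)) (trans (den-par-false N (trans par-N (cong not p))) (cong₂ (λ r n → 2 ^ r * H₂ n) rk-N F-eq))))

theorem1p6 : (x y z : ℕ) (a : List ℕ) → All (λ aᵢ → 1 ≤ aᵢ) a →
    aAt a 1 + 1 ≤ y + 2 * oddSum a →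
    (y % 2 ≡ 1 → R' x y z a ≡ rhsOdd x y z a) ×
    (y % 2 ≡ 0 → R' x y z a ≡ rhsEven x y z a)
theorem1p6 x (suc y) z a pos l = (λ e → odd-y y refl (parity e)) , (λ e → even-y (parity e))
  where
  parity : ∀ {n} → suc y % 2 ≡ n → par (suc y) ≡ (n ℕ.≡ᵇ 1)
  parity e = trans (sym (%2-par (suc y))) (cong (ℕ._≡ᵇ 1) e)
  -- For positive y the predecessors β, N and q can be written down, and their equations hold by
  -- computation.
  open Regular x (suc y) z a (y + z + 2 * evenSum a) (y + 2 * oddSum a) (y + z + (oddSum a + evenSum a)) refl refl refl
    (λ w → runs-odd-< (y + 2 * oddSum a) (suc y) w a pos (ℕₚ.≤-pred (subst (_≤ suc y + 2 * oddSum a) (ℕₚ.+-comm (aAt a 1) 1) l)) refl)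
theorem1p6 x zero z a pos l = (λ ()) , λ _ → lem z a pos l
  where
  -- Here O ≥ 1, so that the number N of rows above ℓ is well defined.
  regular : ∀ z a → All (1 ≤_) a → aAt a 1 + 1 ≤ 2 * oddSum a → 1 ≤ z + 2 * evenSum a → R' x 0 z a ≡ rhsEven x 0 z a
  regular z a pos l m with suc-witness m | suc-witness (ℕₚ.≤-trans (ℕₚ.m≤n+m 1 (aAt a 1)) l)
  ... | β , β-eq | N , N-eq with suc-witness {z + (oddSum a + evenSum a)} (positive (oddSum a) (subst (1 ≤_) N-eq (s≤s z≤n)))
    where
    positive : ∀ o → 1 ≤ 2 * o → 1 ≤ z + (o + evenSum a)
    positive (suc o) _ = ℕₚ.≤-trans (s≤s z≤n) (ℕₚ.m≤n+m (suc o + evenSum a) z)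
  ...   | q , q-eq = Regular.even-y x 0 z a β N q β-eq N-eq q-eq
    (λ w → runs-odd-< N 0 w a pos (ℕₚ.≤-pred (subst (_≤ suc N) (ℕₚ.+-comm (aAt a 1) 1) (subst (aAt a 1 + 1 ≤_) (sym N-eq) l))) N-eq) refl
  -- For y = 0 there is no β exactly if z = 0 and E = 0. Then there is at most one hole, and the
  -- hypothesis on a_1 rules out that there is none.
  lem : ∀ z a → All (1 ≤_) a → aAt a 1 + 1 ≤ 2 * oddSum a → R' x 0 z a ≡ rhsEven x 0 z a
  lem (suc z) a              pos l = regular (suc z) a pos l (s≤s z≤n)
  lem zero    []             pos ()
  lem zero    (zero ∷ [])    (() ∷ _) l
  lem zero    (suc q ∷ [])   pos l = theorem-degenerate x q
  lem zero    (a ∷ zero ∷ as) (_ ∷ () ∷ _) l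
  lem zero    (a ∷ suc b ∷ as) pos l = regular zero (a ∷ suc b ∷ as) pos l (s≤s z≤n)
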